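{- Let $\tau>0$ be a fixed constant and let $d=O(n^{1/2-\tau})$ as $n\to\infty$ (with $nd$ even). Then for all graphs $G\in\mathcal{L}(n,d)$ except a set of size $o(|\mathcal{L}(n,d)|)$, Procedure A (run on the degree sequence $(d,d,\dots,d)$) generates $G$ with probability $(1\pm o(1))/|\mathcal{L}(n,d)|$. In other words, as $n\to\infty$ the output distribution of Procedure A converges to the uniform distribution on $\mathcal{L}(n,d)$ in total variation distance.
   Context: $\mathcal{L}(n,d)$ denotes the set of all labeled simple $d$-regular graphs on the vertex set $V=\{v_1,\dots,v_n\}$; such graphs have $m=nd/2$ edges. Procedure A, for a degree sequence $d_1,\dots,d_n$ with $\sum_i d_i=2m$: (1) set $E=\emptyset$, $\hat d=(d_1,\dots,d_n)$, $P=1$. (2) Among all pairs $\{i,j\}$ with $i\neq j$ and $(v_i,v_j)\notin E$, choose one with probability $p_{ij}$ proportional to $\hat d_i\hat d_j\bigl(1-\frac{d_id_j}{4m}\bigr)$ (for regular sequences this is proportional to $\hat d_i\hat d_j$); multiply $P$ by $p_{ij}$, add $(v_i,v_j)$ to $E$, and decrease $\hat d_i,\hat d_j$ by $1$. (3) Repeat (2) until no more edge can be added. (4) If $|E|<m$ report failure; otherwise output $G=(V,E)$. -}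

module Defs where

open import Data.Bool using (Bool; true; false; if_then_else_; not; _∧_; _∨_)
open import Data.Nat as ℕ using (ℕ; zero; suc; _∸_; _≡ᵇ_; _<ᵇ_)
open import Data.Fin using (Fin; toℕ)
open import Data.Product using (_×_; _,_; proj₁; proj₂)
open import Data.List as L using (List; []; _∷_; length; allFin; filterᵇ; cartesianProduct; foldr)
open import Data.Nat.ListAction using (sum)
open import Data.Bool.ListAction using (all)
open import Data.Vec as V using (Vec; []; _∷_; lookup; fromList; _[_]≔_)
open import Data.Integer using (+_)
open import Data.Rational as ℚ using (ℚ; 0ℚ; 1ℚ; _/_; ∣_∣; _≤ᵇ_; _-_)

pairList : (n : ℕ) → List (Fin n × Fin n)
pairList n = filterᵇ (λ p → toℕ (proj₁ p) <ᵇ toℕ (proj₂ p))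
                     (cartesianProduct (allFin n) (allFin n))

NP : ℕ → ℕ
NP n = length (pairList n)

pairs : (n : ℕ) → Vec (Fin n × Fin n) (NP n)
pairs n = fromList (pairList n)

-- A labeled simple graph on {v_1..v_n} = its edge set, a subset of the
-- unordered pairs, given by its characteristic vector.
EdgeSet : ℕ → Set
EdgeSet n = Vec Bool (NP n)

allVecs : (k : ℕ) → List (Vec Bool k)
allVecs zero = [] ∷ []
allVecs (suc k) = L.concatMap (λ v → (false ∷ v) ∷ (true ∷ v) ∷ []) (allVecs k)

eqVec : {k : ℕ} → Vec Bool k → Vec Bool k → Bool
eqVec [] [] = true
eqVec (true ∷ u) (true ∷ v) = eqVec u v
eqVec (false ∷ u) (false ∷ v) = eqVec u v
eqVec (_ ∷ _) (_ ∷ _) = false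

isV : {n : ℕ} → Fin n → Fin n → Bool
isV i j = toℕ i ≡ᵇ toℕ j

countᵇ : {k : ℕ} → (Fin k → Bool) → ℕ
countᵇ {k} p = length (filterᵇ p (allFin k))

deg : {n : ℕ} → EdgeSet n → Fin n → ℕ
deg {n} E v = countᵇ (λ q → lookup E q ∧
                  (isV (proj₁ (lookup (pairs n) q)) v ∨ isV (proj₂ (lookup (pairs n) q)) v))

isRegular : {n : ℕ} → ℕ → EdgeSet n → Bool
isRegular {n} d E = all (λ v → deg {n} E v ≡ᵇ d) (allFin n)

Lnd : (n d : ℕ) → List (EdgeSet n)
Lnd n d = filterᵇ (isRegular {n} d) (allVecs (NP n))

-- Procedure A on the degree sequence (d,…,d).
-- Residual degrees: d̂_v = d - deg_E v.  Weight of a pair {i,j} not in E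
-- is d̂_i d̂_j (the factor (1 - d²/4m) is constant for regular sequences).

qsum : List ℚ → ℚ
qsum = foldr ℚ._+_ 0ℚ

frac : ℕ → ℕ → ℚ
frac a zero = 0ℚ
frac a (suc b) = (+ a) / suc b

module _ (n d : ℕ) where

  resid : EdgeSet n → Fin n → ℕ
  resid E v = d ∸ deg {n} E v

  weight : EdgeSet n → Fin (NP n) → ℕ
  weight E q = if lookup E q then 0
               else resid E (proj₁ (lookup (pairs n) q)) ℕ.* resid E (proj₂ (lookup (pairs n) q))

  totalWeight : EdgeSet n → ℕ
  totalWeight E = sum (L.map (weight E) (allFin (NP n)))

  -- reach G fuel E: probability that Procedure A, currently holding the
  -- edge set E, terminates successfully (|E| = m = nd/2) with output G.
  -- Fuel NP n suffices: every step adds a new pair.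
  reach : EdgeSet n → ℕ → EdgeSet n → ℚ
  reach G fuel E with totalWeight E
  reach G fuel E | zero =
    if eqVec E G ∧ (countᵇ {NP n} (lookup E) ℕ.* 2 ≡ᵇ n ℕ.* d) then 1ℚ else 0ℚ
  reach G zero E | suc W = 0ℚ
  reach G (suc f) E | suc W =
    qsum (L.map (λ q → ℚ._*_ (frac (weight E q) (suc W)) (reach G f (E [ q ]≔ true)))
                (allFin (NP n)))

  probA : EdgeSet n → ℚ
  probA G = reach G (NP n) (V.replicate (NP n) false)

badCount : (n d : ℕ) → ℚ → ℕ
badCount n d ε = length (filterᵇ
  (λ G → not (∣ ℚ._*_ (probA n d G) ((+ length (Lnd n d)) / 1) - 1ℚ ∣ ≤ᵇ ε))
  (Lnd n d))

{-# OPTIONS --safe #-}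

-- Let 𝓗 E be the d-regular graphs containing the edge set E, N E their number, D the residual degrees, t = 2s their sum.
-- A uniformly random element of 𝓗 E, revealed edge by edge in random order, adds the pair q with probability
-- U_q = N(E + q) / (s N(E)); Procedure A adds it with probability A_q proportional to D_i D_j.  Put x_q = U_q / A_q and let
-- X_G be the expected sum of the x_q when the m edges of G are inserted in random order.  AM-GM along each order, with no
-- logarithms, gives R / c + c + X_G ≥ m + 2 for all c > 0, where R = N(∅) P(output G).  As the R average to at most 1, a
-- bound m + o(1) for the average of X_G forces R = 1 ± o(1) for all but o(N(∅)) graphs G.
--
-- The sum of U_q x_q over q is 1 plus a chi-square distance.  Double counting the switchings ij, kl → ik, jl gives
-- F_ij = #{G ∈ 𝓗 E : ij ∈ G ∖ E} ≈ D_i D_j N / t, with an error controlled by how far the number C_i of residual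
-- half-edges in the closed neighbourhood of i in G is from its mean μ.  These errors are averaged over the random subset E
-- of G: if fewer than S edges are left, a step is exact unless two of these edges conflict; for S ≤ s ≤ n eighth factorial
-- moments, and for s ≥ n variances, bound the s-th error by O(1/s² + d²/(n s)).  The total is
-- O(S⁴ d²/n + 1/S + d² log n / n), which is small since d² log n = o(n).
module Submission where

open import Defs

-- For one insertion order of the m edges of G, N(∅) times the probability that Procedure A follows
-- it is the product of the 1/x_q divided by m!. Hence R is the average over the orders of these
-- products, and such a product divided by c, the number c and the m ratios x_q are m + 2 numbers
-- with product 1: this is all that AM-GM needs. The free c later turns a one-sided inequality into
-- a two-sided statement about R. The main obstacle is that the switching identity for ij contains
-- counts correlated with ij ∈ G. They are controlled by reusing the edge bound it yields in states
-- with a few more edges, so every hypothesis on a state must survive the addition of edges. A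
-- second one is a mismatch of averages: a step is judged for fixed E, averaged over its completions
-- G, while concentration is available for fixed G and random E. The error terms are therefore
-- functions of the pair, and the two averages are exchanged. States whose neighbourhoods are too
-- large for a useful identity pay the trivial bound, multiplied by a statistic that is at least 1
-- on them.

module Development where
  import Algebra.Solver.Ring
  import Algebra.Solver.Ring.AlmostCommutativeRing as ACR
  import Data.Bool.ListAction
  import Data.Bool.Properties as Bₚ
  import Data.Fin.Properties as Fₚ
  import Data.Integer.Properties as ℤₚ
  import Data.List.Membership.Propositional.Properties as Mₚ
  import Data.List.Properties as Lₚ
  import Data.List.Relation.Unary.All as All
  import Data.List.Relation.Unary.Unique.Propositional.Properties as Uₚ
  import Data.Nat.Properties as ℕₚ
  import Data.Rational.Properties as ℚₚ
  import Data.Rational.Unnormalised as ℚᵘ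
  import Data.Rational.Unnormalised.Properties as ℚᵘₚ
  import Data.Vec.Properties as Vₚ
  open import Algebra.Bundles using (CommutativeRing; RawRing)
  open import Algebra.Structures using (IsCommutativeRing)
  open import Data.Bool using (Bool; true; false; not; _∧_; _∨_; if_then_else_; T)
  open import Data.Empty using (⊥; ⊥-elim)
  open import Data.Fin as F using (Fin; zero; suc; toℕ)
  open import Data.Integer as ℤ using (ℤ; -[1+_])
  open import Data.List as L using (List; []; _∷_; length; allFin; filterᵇ; map; concatMap)
  open import Data.List.Membership.Propositional using (_∈_)
  open import Data.List.Relation.Unary.AllPairs using (_∷_)
  open import Data.List.Relation.Unary.Any as Any using (here; there)
  open import Data.List.Relation.Unary.Unique.Propositional using (Unique)
  open import Data.Maybe using (Maybe; just; nothing)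
  open import Data.Nat as ℕ using (ℕ; zero; suc; z≤n; s≤s; _≡ᵇ_; _<ᵇ_)
  open import Data.Nat.DivMod using (m≡m%n+[m/n]*n; m%n<n; m/n*n≤m)
  open import Data.Nat.ListAction using (sum)
  open import Data.Nat.Tactic.RingSolver using (solve-∀)
  open import Data.Product using (Σ; _×_; _,_; proj₁; proj₂)
  open import Data.Rational as ℚ using (ℚ; 0ℚ; 1ℚ; _≤_; _<_)
  open import Data.Sum using (_⊎_; inj₁; inj₂)
  open import Data.Unit using (tt)
  open import Data.Vec as V using (Vec; []; _∷_; lookup; _[_]≔_; fromList)
  open import Function using (_∘_; id)
  open import Relation.Binary.Definitions using (tri<; tri≈; tri>)
  open import Relation.Binary.PropositionalEquality
  open import Relation.Nullary using (¬_; Dec; yes; no)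
  open import Relation.Nullary.Decidable using (T?)

  -- Rational arithmetic and a ring solver with integer coefficients

  infixl 6 _+_ _-_
  infixl 7 _*_
  infix  8 -_
  infixr 9 _^_

  -- Opaque, since conversion checking must never unfold rational arithmetic; inv 0 = 0.
  opaque
    _+_ _*_ : ℚ → ℚ → ℚ
    _+_ = ℚ._+_
    _*_ = ℚ._*_

    -_ : ℚ → ℚ
    -_ = ℚ.-_

    # : ℕ → ℚ
    # zero = 0ℚ
    # (suc n) = 1ℚ ℚ.+ # n

    inv : ℚ → ℚ
    inv x with x ℚₚ.≟ 0ℚ
    ... | yes _ = 0ℚ
    ... | no x≢0 = ℚ.1/_ x {{ℚ.≢-nonZero x≢0}}

  _-_ : ℚ → ℚ → ℚ
  x - y = x + - y

  _^_ : ℚ → ℕ → ℚ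
  x ^ zero = # 1
  x ^ suc k = x * x ^ k

  opaque
    unfolding _+_

    #0 : # 0 ≡ 0ℚ
    #0 = refl

    #1 : # 1 ≡ 1ℚ
    #1 = ℚₚ.+-identityʳ 1ℚ

    +≡ : ∀ x y → x + y ≡ x ℚ.+ y
    +≡ x y = refl

    *≡ : ∀ x y → x * y ≡ x ℚ.* y
    *≡ x y = refl

    -≡ : ∀ x → - x ≡ ℚ.- x
    -≡ x = refl

    isCommutativeRing : IsCommutativeRing _≡_ _+_ _*_ -_ (# 0) (# 1)
    isCommutativeRing = subst (IsCommutativeRing _≡_ ℚ._+_ ℚ._*_ ℚ.-_ 0ℚ) (sym #1) ℚₚ.+-*-isCommutativeRing

    #-suc : ∀ n → # (suc n) ≡ # 1 + # n
    #-suc n = cong (ℚ._+ # n) (sym #1)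

  ℚ-ring : CommutativeRing _ _
  ℚ-ring = record { isCommutativeRing = isCommutativeRing }

  module Rq = CommutativeRing ℚ-ring

  #-+ : ∀ m n → # (m ℕ.+ n) ≡ # m + # n
  #-+ zero n = sym (Rq.+-identityˡ (# n))
  #-+ (suc m) n = trans (#-suc (m ℕ.+ n)) (trans (cong (# 1 +_) (#-+ m n))
    (trans (sym (Rq.+-assoc (# 1) (# m) (# n))) (cong (_+ # n) (sym (#-suc m)))))

  #-* : ∀ m n → # (m ℕ.* n) ≡ # m * # n
  #-* zero n = sym (Rq.zeroˡ (# n))
  #-* (suc m) n = trans (#-+ n (m ℕ.* n)) (trans (cong₂ _+_ (sym (Rq.*-identityˡ (# n))) (#-* m n))
    (trans (sym (Rq.distribʳ (# n) (# 1) (# m))) (cong (_* # n) (sym (#-suc m)))))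

  private
    ⟦_⟧ℤ : ℤ → ℚ
    ⟦ ℤ.+ n ⟧ℤ = # n
    ⟦ -[1+ n ] ⟧ℤ = - # (suc n)

    neg-unique : ∀ {x y} → x + y ≡ # 0 → y ≡ - x
    neg-unique {x} {y} e = trans (sym (Rq.+-identityˡ y)) (trans (cong (_+ y) (sym (Rq.-‿inverseˡ x)))
      (trans (Rq.+-assoc (- x) x y) (trans (cong (- x +_) e) (Rq.+-identityʳ (- x)))))

    neg-neg : ∀ x → - - x ≡ x
    neg-neg x = sym (neg-unique (Rq.-‿inverseˡ x))

    neg-0 : - # 0 ≡ # 0
    neg-0 = sym (neg-unique (Rq.+-identityˡ (# 0)))

    swap-mid : ∀ a b c → a + (b + c) ≡ b + (a + c)
    swap-mid a b c = trans (sym (Rq.+-assoc a b c)) (trans (cong (_+ c) (Rq.+-comm a b)) (Rq.+-assoc b a c))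

    ⊖-homo : ∀ m n → ⟦ m ℤ.⊖ n ⟧ℤ ≡ # m + - # n
    ⊖-homo m zero = trans (sym (Rq.+-identityʳ (# m))) (cong (# m +_) (sym neg-0))
    ⊖-homo zero (suc n) = sym (Rq.+-identityˡ (- # (suc n)))
    ⊖-homo (suc m) (suc n) = trans (cong ⟦_⟧ℤ (ℤₚ.[1+m]⊖[1+n]≡m⊖n m n)) (trans (⊖-homo m n) (sym lem))
      where
      neg-+ : ∀ a b → - (a + b) ≡ - a + - b
      neg-+ a b = sym (neg-unique (trans (Rq.+-assoc a b (- a + - b)) (trans (cong (a +_) (swap-mid b (- a) (- b)))
        (trans (cong (λ z → a + (- a + z)) (Rq.-‿inverseʳ b)) (trans (cong (a +_) (Rq.+-identityʳ (- a))) (Rq.-‿inverseʳ a))))))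
      lem : # (suc m) + - # (suc n) ≡ # m + - # n
      lem = trans (cong₂ (λ u v → u + - v) (trans (#-suc m) (Rq.+-comm (# 1) (# m))) (#-suc n))
        (trans (cong (# m + # 1 +_) (neg-+ (# 1) (# n))) (trans (Rq.+-assoc (# m) (# 1) (- # 1 + - # n))
        (cong (# m +_) (trans (sym (Rq.+-assoc (# 1) (- # 1) (- # n))) (trans (cong (_+ - # n) (Rq.-‿inverseʳ (# 1))) (Rq.+-identityˡ (- # n)))))))

    neg-homo : ∀ i → ⟦ ℤ.- i ⟧ℤ ≡ - ⟦ i ⟧ℤ
    neg-homo (ℤ.+ zero) = sym neg-0
    neg-homo (ℤ.+ suc n) = refl
    neg-homo -[1+ n ] = sym (neg-neg (# (suc n)))

    +-homo : ∀ i j → ⟦ i ℤ.+ j ⟧ℤ ≡ ⟦ i ⟧ℤ + ⟦ j ⟧ℤ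
    +-homo (ℤ.+ m) (ℤ.+ n) = #-+ m n
    +-homo (ℤ.+ m) -[1+ n ] = ⊖-homo m (suc n)
    +-homo -[1+ m ] (ℤ.+ n) = trans (⊖-homo n (suc m)) (Rq.+-comm (# n) (- # (suc m)))
    +-homo -[1+ m ] -[1+ n ] = sym (neg-unique (trans (cong₂ _+_ (trans (cong # (sym (cong suc (ℕₚ.+-suc m n)))) (#-+ (suc m) (suc n))) refl)
      (trans (Rq.+-assoc (# (suc m)) (# (suc n)) (- # (suc m) + - # (suc n))) (trans (cong (# (suc m) +_) (swap-mid (# (suc n)) (- # (suc m)) (- # (suc n))))
      (trans (cong (λ z → # (suc m) + (- # (suc m) + z)) (Rq.-‿inverseʳ (# (suc n)))) (trans (cong (# (suc m) +_) (Rq.+-identityʳ (- # (suc m)))) (Rq.-‿inverseʳ (# (suc m)))))))))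

    open import Algebra.Properties.Ring Rq.ring using (-‿distribˡ-*; -‿distribʳ-*)

    *-homo⁺ : ∀ m n → ⟦ ℤ.+ m ℤ.* ℤ.+ n ⟧ℤ ≡ # m * # n
    *-homo⁺ m n = trans (cong ⟦_⟧ℤ (sym (ℤₚ.pos-* m n))) (#-* m n)

    *-homo : ∀ i j → ⟦ i ℤ.* j ⟧ℤ ≡ ⟦ i ⟧ℤ * ⟦ j ⟧ℤ
    *-homo (ℤ.+ m) (ℤ.+ n) = *-homo⁺ m n
    *-homo (ℤ.+ m) -[1+ n ] = trans (cong ⟦_⟧ℤ (sym (ℤₚ.neg-distribʳ-* (ℤ.+ m) (ℤ.+ suc n))))
      (trans (neg-homo (ℤ.+ m ℤ.* ℤ.+ suc n)) (trans (cong -_ (*-homo⁺ m (suc n))) (-‿distribʳ-* (# m) (# (suc n)))))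
    *-homo -[1+ m ] (ℤ.+ n) = trans (cong ⟦_⟧ℤ (sym (ℤₚ.neg-distribˡ-* (ℤ.+ suc m) (ℤ.+ n))))
      (trans (neg-homo (ℤ.+ suc m ℤ.* ℤ.+ n)) (trans (cong -_ (*-homo⁺ (suc m) n)) (-‿distribˡ-* (# (suc m)) (# n))))
    *-homo -[1+ m ] -[1+ n ] = trans (#-* (suc m) (suc n)) (trans (sym (neg-neg (# (suc m) * # (suc n))))
      (trans (cong -_ (-‿distribˡ-* (# (suc m)) (# (suc n)))) (-‿distribʳ-* (- # (suc m)) (# (suc n)))))

    ℤ-raw : RawRing _ _
    ℤ-raw = record { Carrier = ℤ ; _≈_ = _≡_ ; _+_ = ℤ._+_ ; _*_ = ℤ._*_ ; -_ = ℤ.-_ ; 0# = ℤ.+ 0 ; 1# = ℤ.+ 1 }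

    ℚ-acr : ACR.AlmostCommutativeRing _ _
    ℚ-acr = ACR.fromCommutativeRing ℚ-ring

    -- Solver coefficients are integers and not rationals: integer arithmetic computes, whereas the
    -- rational operations are opaque. A numeral `κ k` then denotes `# k`, the form in which all
    -- constants occur below.
    ℤ⟶ℚ : ℤ-raw ACR.-Raw-AlmostCommutative⟶ ℚ-acr
    ℤ⟶ℚ = record { ⟦_⟧ = ⟦_⟧ℤ ; +-homo = +-homo ; *-homo = *-homo ; -‿homo = neg-homo ; 0-homo = refl ; 1-homo = refl }

    coeff≟ : ∀ i j → Maybe (⟦ i ⟧ℤ ≡ ⟦ j ⟧ℤ)
    coeff≟ i j with i ℤ.≟ j
    ... | yes e = just (cong ⟦_⟧ℤ e)
    ... | no _ = nothing

  open Algebra.Solver.Ring ℤ-raw ℚ-acr ℤ⟶ℚ coeff≟ public using (Polynomial; con; solve; _:=_; _:+_; _:*_; _:-_; :-_)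

  κ : ∀ {n} → ℕ → Polynomial n
  κ k = con (ℤ.+ k)

  -- Order, inverses and absolute values

  opaque
    unfolding _+_

    ≤-total : ∀ x y → x ≤ y ⊎ y ≤ x
    ≤-total = ℚₚ.≤-total

    +-mono : ∀ {a b c d} → a ≤ b → c ≤ d → a + c ≤ b + d
    +-mono = ℚₚ.+-mono-≤

    0≤* : ∀ {a b} → # 0 ≤ a → # 0 ≤ b → # 0 ≤ a * b
    0≤* {a} {b} p q = subst (_≤ a ℚ.* b) (ℚₚ.*-zeroʳ a) (ℚₚ.*-monoˡ-≤-nonNeg a {{ℚ.nonNegative p}} q)

    0<* : ∀ {a b} → # 0 < a → # 0 < b → # 0 < a * b
    0<* {a} {b} p q = subst (ℚ._< a ℚ.* b) (ℚₚ.*-zeroʳ a) (ℚₚ.*-monoʳ-<-pos a {{ℚ.positive p}} q)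

    0<1 : # 0 < # 1
    0<1 = subst (0ℚ <_) (sym #1) (ℚ.*<* (ℤ.+<+ (s≤s z≤n)))

    inv-r : ∀ {x} → x ≢ # 0 → x * inv x ≡ # 1
    inv-r {x} x≢0 with x ℚₚ.≟ 0ℚ
    ... | yes e = ⊥-elim (x≢0 e)
    ... | no ne = trans (ℚₚ.*-inverseʳ x {{ℚ.≢-nonZero ne}}) (sym #1)

    inv-0 : inv (# 0) ≡ # 0
    inv-0 with 0ℚ ℚₚ.≟ 0ℚ
    ... | yes e = refl
    ... | no ne = ⊥-elim (ne refl)

    0<+ : ∀ {a b} → # 0 < a → # 0 ≤ b → # 0 < a + b
    0<+ {a} {b} p q = subst (ℚ._< a ℚ.+ b) (ℚₚ.+-identityʳ 0ℚ) (ℚₚ.+-mono-<-≤ p q)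

    mkPos : ∀ {a} → # 0 ≤ a → a ≢ # 0 → # 0 < a
    mkPos {a} p ne = ℚₚ.positive⁻¹ a {{ℚₚ.nonNeg∧nonZero⇒pos a {{ℚ.nonNegative p}} {{ℚ.≢-nonZero ne}}}}

    _≟0 : ∀ x → Dec (x ≡ # 0)
    x ≟0 = x ℚₚ.≟ 0ℚ

    ∣∣-spec : ∀ x → (ℚ.∣ x ∣ ≡ x × # 0 ≤ x) ⊎ (ℚ.∣ x ∣ ≡ - x × x ≤ # 0)
    ∣∣-spec x with ℚₚ.≤-total 0ℚ x
    ... | inj₁ p = inj₁ (ℚₚ.0≤p⇒∣p∣≡p p , p)
    ... | inj₂ p = inj₂ (trans (sym (ℚₚ.∣-p∣≡∣p∣ x)) (ℚₚ.0≤p⇒∣p∣≡p (ℚₚ.neg-antimono-≤ p)) , p)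

  open ℚₚ public using (≤-refl; ≤-trans; ≤-reflexive; ≤-antisym; <⇒≤; <-≤-trans; ≤-<-trans; ≰⇒>; <-irrefl; _≤?_)

  +-monoˡ : ∀ c {a b} → a ≤ b → a + c ≤ b + c
  +-monoˡ c p = +-mono p ≤-refl

  +-monoʳ : ∀ c {a b} → a ≤ b → c + a ≤ c + b
  +-monoʳ c p = +-mono (≤-refl {c}) p

  ≤⇒0≤- : ∀ {a b} → a ≤ b → # 0 ≤ b - a
  ≤⇒0≤- {a} {b} p = subst (_≤ b - a) (solve 1 (λ a → a :- a := κ 0) refl a) (+-monoˡ (- a) p)

  -- The form in which nonlinear inequalities are proved: the difference r is exhibited, and the equation is left to the ring solver.
  ≤-by : ∀ {a b} r → # 0 ≤ r → b - a ≡ r → a ≤ b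
  ≤-by {a} {b} r p e = subst₂ _≤_ (solve 1 (λ a → κ 0 :+ a := a) refl a)
    (solve 2 (λ a b → (b :- a) :+ a := b) refl a b) (+-monoˡ a (subst (# 0 ≤_) (sym e) p))

  0≤-⇒≤ : ∀ {a b} → # 0 ≤ b - a → a ≤ b
  0≤-⇒≤ {a} {b} p = ≤-by (b - a) p refl

  0≤+ : ∀ {a b} → # 0 ≤ a → # 0 ≤ b → # 0 ≤ a + b
  0≤+ {a} {b} p q = ≤-trans (≤-reflexive (solve 0 (κ 0 := κ 0 :+ κ 0) refl)) (+-mono p q)

  *-monoˡ : ∀ c {a b} → # 0 ≤ c → a ≤ b → c * a ≤ c * b
  *-monoˡ c {a} {b} p q = ≤-by (c * (b - a)) (0≤* p (≤⇒0≤- q)) (solve 3 (λ a b c → c :* b :- c :* a := c :* (b :- a)) refl a b c)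

  *-monoʳ : ∀ c {a b} → # 0 ≤ c → a ≤ b → a * c ≤ b * c
  *-monoʳ c {a} {b} p q = ≤-by (c * (b - a)) (0≤* p (≤⇒0≤- q)) (solve 3 (λ a b c → b :* c :- a :* c := c :* (b :- a)) refl a b c)

  *-mono : ∀ {a b c d} → # 0 ≤ a → # 0 ≤ d → a ≤ b → c ≤ d → a * c ≤ b * d
  *-mono {a} {b} {c} {d} p q r s = ≤-trans (*-monoˡ a p s) (*-monoʳ d q r)

  0≤sq : ∀ x → # 0 ≤ x * x
  0≤sq x with ≤-total (# 0) x
  ... | inj₁ p = 0≤* p p
  ... | inj₂ p = subst (# 0 ≤_) (solve 1 (λ x → (κ 0 :- x) :* (κ 0 :- x) := x :* x) refl x) (0≤* (≤⇒0≤- p) (≤⇒0≤- p))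

  0≤1 : # 0 ≤ # 1
  0≤1 = <⇒≤ 0<1

  0≤# : ∀ n → # 0 ≤ # n
  0≤# zero = ≤-refl
  0≤# (suc n) = subst (# 0 ≤_) (sym (#-suc n)) (0≤+ 0≤1 (0≤# n))

  #-mono : ∀ {m n} → m ℕ.≤ n → # m ≤ # n
  #-mono {m} {n} p = ≤-by (# (n ℕ.∸ m)) (0≤# (n ℕ.∸ m)) (trans (cong (_- # m) (trans (cong # (sym (ℕₚ.m+[n∸m]≡n p))) (#-+ m (n ℕ.∸ m))))
    (solve 2 (λ a b → (a :+ b) :- a := b) refl (# m) (# (n ℕ.∸ m))))

  0<#suc : ∀ n → # 0 < # (suc n)
  0<#suc n = subst (# 0 <_) (sym (#-suc n)) (0<+ 0<1 (0≤# n))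

  #-cancel-≤ : ∀ {m n} → # m ≤ # n → m ℕ.≤ n
  #-cancel-≤ {m} {n} p with m ℕ.≤? n
  ... | yes q = q
  ... | no q = ⊥-elim (<-irrefl refl (<-≤-trans (0<#suc (m ℕ.∸ suc n)) (≤-by (# n - # m) (≤⇒0≤- p)
     (trans (cong (λ z → # 0 - z) (trans (#-suc k) refl)) (trans (solve 3 (λ a b c → κ 0 :- (κ 1 :+ c) := a :- (κ 1 :+ (a :+ c))) refl (# n) (# m) (# k))
       (cong (λ z → # n - z) (sym (trans (cong # (sym (ℕₚ.m+[n∸m]≡n (ℕₚ.≰⇒> q)))) (trans (#-suc (n ℕ.+ k)) (cong (# 1 +_) (#-+ n k)))))))))))
     where k = m ℕ.∸ suc n

  #-injective : ∀ {m n} → # m ≡ # n → m ≡ n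
  #-injective e = ℕₚ.≤-antisym (#-cancel-≤ (≤-reflexive e)) (#-cancel-≤ (≤-reflexive (sym e)))

  pos⇒≢0 : ∀ {x} → # 0 < x → x ≢ # 0
  pos⇒≢0 p refl = <-irrefl refl p

  inv-pos-r : ∀ {x} → # 0 < x → x * inv x ≡ # 1
  inv-pos-r p = inv-r (pos⇒≢0 p)

  0≤inv : ∀ {x} → # 0 ≤ x → # 0 ≤ inv x
  0≤inv {x} p with x ≟0
  ... | yes refl = ≤-reflexive (sym inv-0)
  ... | no ne = subst (# 0 ≤_) e (0≤* p (0≤sq (inv x)))
    where
    e : x * (inv x * inv x) ≡ inv x
    e = trans (solve 2 (λ x y → x :* (y :* y) := (x :* y) :* y) refl x (inv x)) (trans (cong (_* inv x) (inv-r ne)) (Rq.*-identityˡ (inv x)))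

  0<inv : ∀ {x} → # 0 < x → # 0 < inv x
  0<inv {x} p = mkPos (0≤inv (<⇒≤ p)) λ e → pos⇒≢0 0<1 (trans (sym (inv-pos-r p)) (trans (cong (x *_) e) (Rq.zeroʳ x)))

  *-cancelˡ : ∀ c {a b} → # 0 < c → c * a ≤ c * b → a ≤ b
  *-cancelˡ c {a} {b} p q = subst₂ _≤_ (e a) (e b) (*-monoˡ (inv c) (0≤inv (<⇒≤ p)) q)
    where
    e : ∀ x → inv c * (c * x) ≡ x
    e x = trans (solve 3 (λ i c x → i :* (c :* x) := (c :* i) :* x) refl (inv c) c x) (trans (cong (_* x) (inv-pos-r p)) (Rq.*-identityˡ x))

  ∣_∣ : ℚ → ℚ
  ∣ x ∣ = ℚ.∣ x ∣

  ≤∣∣ : ∀ x → x ≤ ∣ x ∣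
  ≤∣∣ x with ∣∣-spec x
  ... | inj₁ (e , _) = ≤-reflexive (sym e)
  ... | inj₂ (e , p) = subst (x ≤_) (sym e) (≤-trans p (subst (# 0 ≤_) (solve 1 (λ x → κ 0 :- x := :- x) refl x) (≤⇒0≤- p)))

  -≤∣∣ : ∀ x → - x ≤ ∣ x ∣
  -≤∣∣ x with ∣∣-spec x
  ... | inj₂ (e , _) = ≤-reflexive (sym e)
  ... | inj₁ (e , p) = subst (- x ≤_) (sym e) (≤-trans (0≤-⇒≤ (subst (# 0 ≤_) (solve 1 (λ x → x := κ 0 :- (:- x)) refl x) p)) p)

  0≤∣∣ : ∀ x → # 0 ≤ ∣ x ∣
  0≤∣∣ x with ∣∣-spec x
  ... | inj₁ (e , p) = subst (# 0 ≤_) (sym e) p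
  ... | inj₂ (e , p) = subst (# 0 ≤_) (trans (solve 1 (λ x → κ 0 :- x := :- x) refl x) (sym e)) (≤⇒0≤- p)

  ∣∣-sq : ∀ x → ∣ x ∣ * ∣ x ∣ ≡ x * x
  ∣∣-sq x with ∣∣-spec x
  ... | inj₁ (e , _) = cong₂ _*_ e e
  ... | inj₂ (e , _) = trans (cong₂ _*_ e e) (solve 1 (λ x → (:- x) :* (:- x) := x :* x) refl x)

  -- Finite sums

  variable
    A B : Set

  ∑ : List A → (A → ℚ) → ℚ
  ∑ [] f = # 0
  ∑ (x ∷ xs) f = f x + ∑ xs f

  𝟙 : Bool → ℚ
  𝟙 true = # 1
  𝟙 false = # 0

  0≤𝟙 : ∀ b → # 0 ≤ 𝟙 b
  0≤𝟙 true = 0≤1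
  0≤𝟙 false = ≤-refl

  ∑-cong∈ : ∀ (xs : List A) {f g : A → ℚ} → (∀ {x} → x ∈ xs → f x ≡ g x) → ∑ xs f ≡ ∑ xs g
  ∑-cong∈ [] p = refl
  ∑-cong∈ (x ∷ xs) p = cong₂ _+_ (p (here refl)) (∑-cong∈ xs (λ m → p (there m)))

  ∑-cong : ∀ (xs : List A) {f g : A → ℚ} → (∀ x → f x ≡ g x) → ∑ xs f ≡ ∑ xs g
  ∑-cong xs p = ∑-cong∈ xs (λ {x} _ → p x)

  ∑-mono∈ : ∀ (xs : List A) {f g : A → ℚ} → (∀ {x} → x ∈ xs → f x ≤ g x) → ∑ xs f ≤ ∑ xs g
  ∑-mono∈ [] p = ≤-refl
  ∑-mono∈ (x ∷ xs) p = +-mono (p (here refl)) (∑-mono∈ xs (λ m → p (there m)))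

  ∑-mono : ∀ (xs : List A) {f g : A → ℚ} → (∀ x → f x ≤ g x) → ∑ xs f ≤ ∑ xs g
  ∑-mono xs p = ∑-mono∈ xs (λ {x} _ → p x)

  ∑-0 : ∀ (xs : List A) → ∑ xs (λ _ → # 0) ≡ # 0
  ∑-0 [] = refl
  ∑-0 (x ∷ xs) = trans (cong (# 0 +_) (∑-0 xs)) (Rq.+-identityˡ (# 0))

  ∑-nonneg∈ : ∀ (xs : List A) {f : A → ℚ} → (∀ {x} → x ∈ xs → # 0 ≤ f x) → # 0 ≤ ∑ xs f
  ∑-nonneg∈ xs p = subst (_≤ ∑ xs _) (∑-0 xs) (∑-mono∈ xs p)

  ∑-nonneg : ∀ (xs : List A) {f : A → ℚ} → (∀ x → # 0 ≤ f x) → # 0 ≤ ∑ xs f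
  ∑-nonneg xs p = ∑-nonneg∈ xs (λ {x} _ → p x)

  ∑-+ : ∀ (xs : List A) (f g : A → ℚ) → ∑ xs (λ x → f x + g x) ≡ ∑ xs f + ∑ xs g
  ∑-+ [] f g = sym (Rq.+-identityˡ (# 0))
  ∑-+ (x ∷ xs) f g = trans (cong (f x + g x +_) (∑-+ xs f g))
    (solve 4 (λ a b c d → a :+ b :+ (c :+ d) := a :+ c :+ (b :+ d)) refl (f x) (g x) (∑ xs f) (∑ xs g))

  ∑-*ˡ : ∀ c (xs : List A) (f : A → ℚ) → ∑ xs (λ x → c * f x) ≡ c * ∑ xs f
  ∑-*ˡ c [] f = sym (Rq.zeroʳ c)
  ∑-*ˡ c (x ∷ xs) f = trans (cong (c * f x +_) (∑-*ˡ c xs f)) (sym (Rq.distribˡ c (f x) (∑ xs f)))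

  ∑-*ʳ : ∀ c (xs : List A) (f : A → ℚ) → ∑ xs (λ x → f x * c) ≡ ∑ xs f * c
  ∑-*ʳ c xs f = trans (∑-cong xs (λ x → Rq.*-comm (f x) c)) (trans (∑-*ˡ c xs f) (Rq.*-comm c (∑ xs f)))

  ∑-- : ∀ (xs : List A) (f g : A → ℚ) → ∑ xs (λ x → f x - g x) ≡ ∑ xs f - ∑ xs g
  ∑-- [] f g = solve 0 (κ 0 := κ 0 :- κ 0) refl
  ∑-- (x ∷ xs) f g = trans (cong (f x - g x +_) (∑-- xs f g))
    (solve 4 (λ a b c d → a :- b :+ (c :- d) := a :+ c :- (b :+ d)) refl (f x) (g x) (∑ xs f) (∑ xs g))

  ∑-swap : ∀ (xs : List A) (ys : List B) (f : A → B → ℚ) →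
    ∑ xs (λ x → ∑ ys (λ y → f x y)) ≡ ∑ ys (λ y → ∑ xs (λ x → f x y))
  ∑-swap [] ys f = sym (∑-0 ys)
  ∑-swap (x ∷ xs) ys f = trans (cong (∑ ys (f x) +_) (∑-swap xs ys f)) (sym (∑-+ ys (f x) (λ y → ∑ xs (λ x → f x y))))

  ∑-const : ∀ (xs : List A) c → ∑ xs (λ _ → c) ≡ # (length xs) * c
  ∑-const [] c = sym (Rq.zeroˡ c)
  ∑-const (x ∷ xs) c = trans (cong (c +_) (∑-const xs c)) (trans (solve 2 (λ c n → c :+ n :* c := (κ 1 :+ n) :* c) refl c (# (length xs)))
    (cong (_* c) (sym (#-suc (length xs)))))

  ∑-filter : ∀ p (xs : List A) (f : A → ℚ) → ∑ (filterᵇ p xs) f ≡ ∑ xs (λ x → 𝟙 (p x) * f x)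
  ∑-filter p [] f = refl
  ∑-filter p (x ∷ xs) f with p x
  ... | true = cong₂ _+_ (sym (Rq.*-identityˡ (f x))) (∑-filter p xs f)
  ... | false = trans (∑-filter p xs f) (sym (trans (cong (_+ ∑ xs _) (Rq.zeroˡ (f x))) (Rq.+-identityˡ _)))

  ∑-map : ∀ (g : A → B) xs (f : B → ℚ) → ∑ (map g xs) f ≡ ∑ xs (λ x → f (g x))
  ∑-map g [] f = refl
  ∑-map g (x ∷ xs) f = cong (f (g x) +_) (∑-map g xs f)

  #-length : ∀ (xs : List A) → # (length xs) ≡ ∑ xs (λ _ → # 1)
  #-length xs = sym (trans (∑-const xs (# 1)) (Rq.*-identityʳ (# (length xs))))

  #-sum : ∀ (f : A → ℕ) xs → # (sum (map f xs)) ≡ ∑ xs (λ x → # (f x))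
  #-sum f [] = refl
  #-sum f (x ∷ xs) = trans (#-+ (f x) (sum (map f xs))) (cong (# (f x) +_) (#-sum f xs))

  term≤∑ : ∀ (xs : List A) {f : A → ℚ} → (∀ x → # 0 ≤ f x) → ∀ {x} → x ∈ xs → f x ≤ ∑ xs f
  term≤∑ (x ∷ xs) {f} p (here refl) = subst (_≤ f x + ∑ xs f) (Rq.+-identityʳ (f x)) (+-monoʳ (f x) (∑-nonneg xs p))
  term≤∑ (y ∷ xs) {f} p {x} (there m) = subst (_≤ f y + ∑ xs f) (Rq.+-identityˡ (f x)) (+-mono (p y) (term≤∑ xs p m))

  -- Lagrange's identity: twice the difference of the two sides is the double sum of `w x * w y`
  -- times the square of `φ x - φ y`.
  cauchy : ∀ (xs : List A) {w : A → ℚ} (φ : A → ℚ) → (∀ {x} → x ∈ xs → # 0 ≤ w x) →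
    ∑ xs (λ x → w x * φ x) * ∑ xs (λ x → w x * φ x) ≤ ∑ xs w * ∑ xs (λ x → w x * (φ x * φ x))
  cauchy xs {w} φ 0≤w = *-cancelˡ (# 2) (0<#suc 1) (≤-by (∑ xs λ x → ∑ xs λ y → w x * w y * ((φ x - φ y) * (φ x - φ y)))
    (∑-nonneg∈ xs λ {x} x∈ → ∑-nonneg∈ xs λ {y} y∈ → 0≤* (0≤* (0≤w x∈) (0≤w y∈)) (0≤sq (φ x - φ y))) (sym eq))
    where
    W = ∑ xs w
    S = ∑ xs (λ x → w x * φ x)
    Q = ∑ xs (λ x → w x * (φ x * φ x))
    inner : ∀ x → ∑ xs (λ y → w x * w y * ((φ x - φ y) * (φ x - φ y))) ≡ w x * (φ x * φ x) * W - # 2 * (w x * φ x) * S + w x * Q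
    inner x = trans (∑-cong xs (λ y → solve 4 (λ a b p q → a :* b :* ((p :- q) :* (p :- q))
        := a :* (p :* p) :* b :- κ 2 :* (a :* p) :* (b :* q) :+ a :* (b :* (q :* q))) refl (w x) (w y) (φ x) (φ y)))
      (trans (∑-+ xs _ _) (cong₂ _+_ (trans (∑-- xs _ _) (cong₂ _-_ (∑-*ˡ _ xs w) (∑-*ˡ _ xs _))) (∑-*ˡ (w x) xs _)))
    eq : ∑ xs (λ x → ∑ xs λ y → w x * w y * ((φ x - φ y) * (φ x - φ y))) ≡ # 2 * (W * Q) - # 2 * (S * S)
    eq = trans (∑-cong xs inner) (trans (∑-+ xs _ _) (trans (cong₂ _+_ (trans (∑-- xs _ _) (cong₂ _-_ (∑-*ʳ W xs _)
        (trans (∑-*ʳ S xs _) (cong (_* S) (∑-*ˡ (# 2) xs _))))) (∑-*ʳ Q xs w))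
      (solve 3 (λ W S Q → Q :* W :- κ 2 :* S :* S :+ W :* Q := κ 2 :* (W :* Q) :- κ 2 :* (S :* S)) refl W S Q)))

  ∑ꟳ : ∀ {n} → (Fin n → ℚ) → ℚ
  ∑ꟳ {n} = ∑ (allFin n)

  ∑ꟳ-suc : ∀ {n} (f : Fin (suc n) → ℚ) → ∑ꟳ f ≡ f zero + ∑ꟳ (λ i → f (suc i))
  ∑ꟳ-suc {n} f = cong (f zero +_) (trans (cong (λ l → ∑ l f) (sym (Lₚ.map-tabulate id suc))) (∑-map suc (allFin n) f))

  opaque
    δ : ∀ {n} → Fin n → Fin n → ℚ
    δ zero zero = # 1
    δ zero (suc j) = # 0
    δ (suc i) zero = # 0
    δ (suc i) (suc j) = δ i j

    δ-refl : ∀ {n} (i : Fin n) → δ i i ≡ # 1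
    δ-refl zero = refl
    δ-refl (suc i) = δ-refl i

    δ-≢ : ∀ {n} {i j : Fin n} → i ≢ j → δ i j ≡ # 0
    δ-≢ {i = zero} {zero} p = ⊥-elim (p refl)
    δ-≢ {i = zero} {suc j} p = refl
    δ-≢ {i = suc i} {zero} p = refl
    δ-≢ {i = suc i} {suc j} p = δ-≢ (λ e → p (cong suc e))

    δ-sym : ∀ {n} (i j : Fin n) → δ i j ≡ δ j i
    δ-sym zero zero = refl
    δ-sym zero (suc j) = refl
    δ-sym (suc i) zero = refl
    δ-sym (suc i) (suc j) = δ-sym i j

    0≤δ : ∀ {n} (i j : Fin n) → # 0 ≤ δ i j
    0≤δ zero zero = 0≤1
    0≤δ zero (suc j) = ≤-refl
    0≤δ (suc i) zero = ≤-refl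
    0≤δ (suc i) (suc j) = 0≤δ i j

    ∑-δ : ∀ {n} (i : Fin n) (f : Fin n → ℚ) → ∑ꟳ (λ j → δ i j * f j) ≡ f i
    ∑-δ {suc n} zero f = trans (∑ꟳ-suc {n} _) (trans (cong₂ _+_ (Rq.*-identityˡ (f zero))
      (trans (∑-cong (allFin n) (λ j → Rq.zeroˡ (f (suc j)))) (∑-0 (allFin n)))) (Rq.+-identityʳ (f zero)))
    ∑-δ {suc n} (suc i) f = trans (∑ꟳ-suc {n} _) (trans (cong₂ _+_ (Rq.zeroˡ (f zero)) (∑-δ i (λ j → f (suc j)))) (Rq.+-identityˡ (f (suc i))))

    ∑-δ1 : ∀ {n} (i : Fin n) → ∑ꟳ (δ i) ≡ # 1
    ∑-δ1 i = trans (∑-cong (allFin _) (λ j → sym (Rq.*-identityʳ (δ i j)))) (∑-δ i (λ _ → # 1))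

  ∈-allFin : ∀ {n} (i : Fin n) → i ∈ allFin n
  ∈-allFin i = Mₚ.∈-allFin i

  -- The inequality between arithmetic and geometric means

  ∏ : List ℚ → ℚ
  ∏ [] = # 1
  ∏ (x ∷ xs) = x * ∏ xs

  data Positives : List ℚ → Set where
    [] : Positives []
    _∷_ : ∀ {x xs} → # 0 < x → Positives xs → Positives (x ∷ xs)

  0≤^ : ∀ {x} k → # 0 ≤ x → # 0 ≤ x ^ k
  0≤^ zero p = 0≤1
  0≤^ (suc k) p = 0≤* p (0≤^ k p)

  -- The tangent at `c` to the convex function `y ^ suc k` lies below it. In the induction the gap
  -- is `y` times the previous gap plus `# (suc k) * c ^ k` times the square of `y - c`.
  young : ∀ k {y c} → # 0 ≤ y → # 0 ≤ c → # (suc k) * (y * c ^ k) ≤ y ^ suc k + # k * c ^ suc k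
  young zero {y} {c} p q = ≤-by (# 0) ≤-refl (solve 2 (λ y c → (y :* κ 1 :+ κ 0 :* (c :* κ 1)) :- κ 1 :* (y :* κ 1) := κ 0) refl y c)
  young (suc k) {y} {c} p q = ≤-by
    (y * (y ^ suc k + # k * c ^ suc k - # (suc k) * (y * c ^ k)) + # (suc k) * (c ^ k * ((y - c) * (y - c))))
    (0≤+ (0≤* p (≤⇒0≤- (young k p q))) (0≤* (0≤# (suc k)) (0≤* (0≤^ k q) (0≤sq (y - c)))))
    (subst₂ (λ a b → y * y ^ suc k + a * (c * (c * c ^ k)) - b * (y * (c * c ^ k))
       ≡ y * (y ^ suc k + # k * (c * c ^ k) - a * (y * c ^ k)) + a * (c ^ k * ((y - c) * (y - c)))) (sym (#-suc k)) (sym (trans (#-suc (suc k)) (cong (# 1 +_) (#-suc k))))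
     (solve 5 (λ y c C Y k → y :* Y :+ (κ 1 :+ k) :* (c :* (c :* C)) :- (κ 1 :+ (κ 1 :+ k)) :* (y :* (c :* C))
        := y :* (Y :+ k :* (c :* C) :- (κ 1 :+ k) :* (y :* C)) :+ (κ 1 :+ k) :* (C :* ((y :- c) :* (y :- c)))) refl y c (c ^ k) (y ^ suc k) (# k)))

  ∑id : List ℚ → ℚ
  ∑id xs = ∑ xs (λ x → x)

  0≤∑id : ∀ {xs} → Positives xs → # 0 ≤ ∑id xs
  0≤∑id [] = ≤-refl
  0≤∑id (p ∷ ps) = 0≤+ (<⇒≤ p) (0≤∑id ps)

  mean : ∀ x (xs : List ℚ) → ℚ
  mean x xs = inv (# (suc (length xs))) * (x + ∑id xs)

  mean-spec : ∀ x xs → # (suc (length xs)) * mean x xs ≡ x + ∑id xs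
  mean-spec x xs = trans (sym (Rq.*-assoc (# (suc (length xs))) _ _))
    (trans (cong (_* (x + ∑id xs)) (inv-pos-r (0<#suc (length xs)))) (Rq.*-identityˡ _))

  -- With `y` the mean of the whole list and `c` that of its tail of length k, the head equals (k +
  -- 1) y - k c, so that the head times c^k is at most y^(k+1) by `young`. Raising the mean to a
  -- power avoids roots.
  am-gm : ∀ x xs → Positives (x ∷ xs) → ∏ (x ∷ xs) ≤ mean x xs ^ suc (length xs)
  am-gm x [] (p ∷ ps) = ≤-reflexive (cong (_* # 1) (sym (trans (sym (Rq.*-identityˡ (mean x []))) (trans (mean-spec x []) (Rq.+-identityʳ x)))))
  am-gm x (x' ∷ xs) (p ∷ ps@(p' ∷ ps')) = ≤-trans (*-monoˡ x (<⇒≤ p) (am-gm x' xs ps)) (≤-by (y ^ suc k + # k * c ^ suc k - # (suc k) * (y * c ^ k)) (≤⇒0≤- (young k (0≤mean (p ∷ ps)) (0≤mean ps))) eq)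
    where
    k = suc (length xs)
    y = mean x (x' ∷ xs)
    c = mean x' xs
    0≤mean : ∀ {x xs} → Positives (x ∷ xs) → # 0 ≤ mean x xs
    0≤mean {x} {xs} ps = 0≤* (0≤inv (0≤# (suc (length xs)))) (0≤∑id ps)
    x≡ : x ≡ # (suc k) * y - # k * c
    x≡ = trans (solve 2 (λ x s → x := (x :+ s) :- s) refl x (x' + ∑id xs)) (cong₂ _-_ (sym (mean-spec x (x' ∷ xs))) (sym (mean-spec x' xs)))
    eq : y ^ suc k - x * c ^ k ≡ y ^ suc k + # k * c ^ suc k - # (suc k) * (y * c ^ k)
    eq = trans (cong (λ z → y ^ suc k - z * c ^ k) x≡) (solve 6 (λ Y y c C k k' → Y :- (k' :* y :- k :* c) :* C := Y :+ k :* (c :* C) :- k' :* (y :* C)) refl (y ^ suc k) y c (c ^ k) (# k) (# (suc k)))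

  pow<1 : ∀ k {x} → # 0 ≤ x → x < # 1 → x ^ suc k < # 1
  pow<1 zero {x} p q = subst (_< # 1) (sym (Rq.*-identityʳ x)) q
  pow<1 (suc k) {x} p q = ≤-<-trans (≤-trans (*-monoˡ x p (<⇒≤ (pow<1 k p q))) (≤-reflexive (Rq.*-identityʳ x))) q

  -- A mean below 1 would make its power, and by `am-gm` the product, less than 1.
  length≤∑ : ∀ x xs → Positives (x ∷ xs) → # 1 ≤ ∏ (x ∷ xs) → # (suc (length xs)) ≤ x + ∑id xs
  length≤∑ x xs ps h with # 1 ≤? mean x xs
  ... | yes q = subst₂ _≤_ (Rq.*-identityʳ _) (mean-spec x xs) (*-monoˡ (# (suc (length xs))) (0≤# (suc (length xs))) q)
  ... | no q = ⊥-elim (<-irrefl refl (≤-<-trans (≤-trans h (am-gm x xs ps)) (pow<1 (length xs) (0≤* (0≤inv (0≤# (suc (length xs)))) (0≤∑id ps)) (≰⇒> q))))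

  -- Unordered pairs of vertices as indices

  lookup-fromList-∈ : ∀ (xs : List A) q → lookup (fromList xs) q ∈ xs
  lookup-fromList-∈ (x ∷ xs) zero = here refl
  lookup-fromList-∈ (x ∷ xs) (suc q) = there (lookup-fromList-∈ xs q)

  lookup-fromList-injective : ∀ {xs : List A} → Unique xs → ∀ q q' → lookup (fromList xs) q ≡ lookup (fromList xs) q' → q ≡ q'
  lookup-fromList-injective {xs = x ∷ xs} (p ∷ u) zero zero e = refl
  lookup-fromList-injective {xs = x ∷ xs} (p ∷ u) zero (suc q) e = ⊥-elim (All.lookup p (lookup-fromList-∈ xs q) e)
  lookup-fromList-injective {xs = x ∷ xs} (p ∷ u) (suc q) zero e = ⊥-elim (All.lookup p (lookup-fromList-∈ xs q) (sym e))
  lookup-fromList-injective {xs = x ∷ xs} (p ∷ u) (suc q) (suc q') e = cong suc (lookup-fromList-injective u q q' e)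

  ∈⇒lookup-fromList : ∀ {xs : List A} {x} → x ∈ xs → Σ (Fin (length xs)) λ q → lookup (fromList xs) q ≡ x
  ∈⇒lookup-fromList (here refl) = zero , refl
  ∈⇒lookup-fromList (there m) with ∈⇒lookup-fromList m
  ... | q , e = suc q , e

  T⇒≡true : ∀ {b} → T b → b ≡ true
  T⇒≡true {true} _ = refl

  ≡true⇒T : ∀ {b} → b ≡ true → T b
  ≡true⇒T refl = tt

  𝟙-∧ : ∀ x y → 𝟙 (x ∧ y) ≡ 𝟙 x * 𝟙 y
  𝟙-∧ true y = sym (Rq.*-identityˡ (𝟙 y))
  𝟙-∧ false y = sym (Rq.zeroˡ (𝟙 y))

  opaque
    unfolding δ

    𝟙-isV : ∀ {n} (i j : Fin n) → 𝟙 (isV i j) ≡ δ i j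
    𝟙-isV zero zero = refl
    𝟙-isV zero (suc j) = refl
    𝟙-isV (suc i) zero = refl
    𝟙-isV (suc i) (suc j) = 𝟙-isV i j

  #-countᵇ : ∀ {k} (p : Fin k → Bool) → # (countᵇ p) ≡ ∑ꟳ (λ q → 𝟙 (p q))
  #-countᵇ p = trans (#-length (filterᵇ p (allFin _))) (trans (∑-filter p (allFin _) (λ _ → # 1)) (∑-cong (allFin _) (λ q → Rq.*-identityʳ (𝟙 (p q)))))

  module Pairs (n : ℕ) where

    P : Set
    P = Fin (NP n)

    Vs : List (Fin n)
    Vs = allFin n

    Ps : List P
    Ps = allFin (NP n)

    fst snd : P → Fin n
    fst q = proj₁ (lookup (pairs n) q)
    snd q = proj₂ (lookup (pairs n) q)

    fst<snd : ∀ q → toℕ (fst q) ℕ.< toℕ (snd q)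
    fst<snd q = ℕₚ.<ᵇ⇒< _ _ (proj₂ (Mₚ.∈-filter⁻ (T? ∘ _) {xs = L.cartesianProduct (allFin n) (allFin n)} (lookup-fromList-∈ (pairList n) q)))

    fst≢snd : ∀ q → fst q ≢ snd q
    fst≢snd q e = ℕₚ.<-irrefl (cong toℕ e) (fst<snd q)

    ends-injective : ∀ q q' → fst q ≡ fst q' → snd q ≡ snd q' → q ≡ q'
    ends-injective q q' e e' = lookup-fromList-injective
      (Uₚ.filter⁺ (T? ∘ _) (Uₚ.cartesianProduct⁺ (Uₚ.allFin⁺ n) (Uₚ.allFin⁺ n))) q q' (cong₂ _,_ e e')

    Joins : P → Fin n → Fin n → Set
    Joins q i j = (fst q ≡ i × snd q ≡ j) ⊎ (fst q ≡ j × snd q ≡ i)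

    pair< : ∀ i j → toℕ i ℕ.< toℕ j → Σ P λ q → fst q ≡ i × snd q ≡ j
    pair< i j p with ∈⇒lookup-fromList (Mₚ.∈-filter⁺ (T? ∘ (λ (x : Fin n × Fin n) → toℕ (proj₁ x) <ᵇ toℕ (proj₂ x)))
                        (Mₚ.∈-cartesianProduct⁺ (∈-allFin i) (∈-allFin j)) (ℕₚ.<⇒<ᵇ p))
    ... | q , e = q , cong proj₁ e , cong proj₂ e

    pair : ∀ i j → i ≢ j → Σ P λ q → Joins q i j
    pair i j ne with ℕₚ.<-cmp (toℕ i) (toℕ j)
    ... | tri< p _ _ = proj₁ (pair< i j p) , inj₁ (proj₂ (pair< i j p))
    ... | tri≈ _ e _ = ⊥-elim (ne (Fₚ.toℕ-injective e))
    ... | tri> _ _ p = proj₁ (pair< j i p) , inj₂ (proj₂ (pair< j i p))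

    ix : ∀ i j → i ≢ j → P
    ix i j ne = proj₁ (pair i j ne)

    ix-joins : ∀ i j ne → Joins (ix i j ne) i j
    ix-joins i j ne = proj₂ (pair i j ne)

    joins-sym : ∀ {q i j} → Joins q i j → Joins q j i
    joins-sym (inj₁ x) = inj₂ x
    joins-sym (inj₂ x) = inj₁ x

    joins-unique : ∀ {q q' i j} → Joins q i j → Joins q' i j → q ≡ q'
    joins-unique {q} {q'} (inj₁ (a , b)) (inj₁ (a' , b')) = ends-injective q q' (trans a (sym a')) (trans b (sym b'))
    joins-unique {q} {q'} (inj₂ (a , b)) (inj₂ (a' , b')) = ends-injective q q' (trans a (sym a')) (trans b (sym b'))
    joins-unique {q} {q'} (inj₁ (refl , refl)) (inj₂ (a' , b')) = ⊥-elim (ℕₚ.<-asym (fst<snd q) (subst₂ (λ x y → toℕ x ℕ.< toℕ y) a' b' (fst<snd q')))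
    joins-unique {q} {q'} (inj₂ (refl , refl)) (inj₁ (a' , b')) = ⊥-elim (ℕₚ.<-asym (fst<snd q) (subst₂ (λ x y → toℕ x ℕ.< toℕ y) a' b' (fst<snd q')))

    joins-≢ : ∀ {q i j} → Joins q i j → i ≢ j
    joins-≢ {q} (inj₁ (refl , refl)) e = fst≢snd q e
    joins-≢ {q} (inj₂ (refl , refl)) e = fst≢snd q (sym e)

    opaque
      -- Indicator that `q` joins `i` and `j`, written with deltas so that its row sums come from
      -- `∑-δ1`. Through `lift` it turns functions of unordered pairs into symmetric matrices with
      -- zero diagonal, whose indices range freely.
      link : P → Fin n → Fin n → ℚ
      link q i j = δ (fst q) i * δ (snd q) j + δ (fst q) j * δ (snd q) i

      inc : P → Fin n → ℚ
      inc q i = δ (fst q) i + δ (snd q) i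

      link-sym : ∀ q i j → link q i j ≡ link q j i
      link-sym q i j = Rq.+-comm _ _

      ∑-link : ∀ q i → ∑ꟳ (link q i) ≡ inc q i
      ∑-link q i = trans (∑-+ (allFin n) _ _) (cong₂ _+_
        (trans (∑-*ˡ (δ (fst q) i) (allFin n) _) (trans (cong (δ (fst q) i *_) (∑-δ1 (snd q))) (Rq.*-identityʳ _)))
        (trans (∑-*ʳ (δ (snd q) i) (allFin n) _) (trans (cong (_* δ (snd q) i) (∑-δ1 (fst q))) (Rq.*-identityˡ _))))

      link-joins : ∀ {q i j} → Joins q i j → link q i j ≡ # 1
      link-joins {q} (inj₁ (refl , refl)) = trans (cong₂ _+_ (cong₂ _*_ (δ-refl (fst q)) (δ-refl (snd q)))
        (cong₂ _*_ (δ-≢ (fst≢snd q)) (δ-≢ (λ e → fst≢snd q (sym e))))) (solve 0 (κ 1 :* κ 1 :+ κ 0 :* κ 0 := κ 1) refl)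
      link-joins {q} (inj₂ (refl , refl)) = trans (cong₂ _+_ (cong₂ _*_ (δ-≢ (fst≢snd q)) (δ-≢ (λ e → fst≢snd q (sym e))))
        (cong₂ _*_ (δ-refl (fst q)) (δ-refl (snd q)))) (solve 0 (κ 0 :* κ 0 :+ κ 1 :* κ 1 := κ 1) refl)

      δδ-0 : ∀ {i i' j j' : Fin n} → ¬ (i ≡ i' × j ≡ j') → δ i i' * δ j j' ≡ # 0
      δδ-0 {i} {i'} {j} {j'} p with i F.≟ i' | j F.≟ j'
      ... | yes e | yes e' = ⊥-elim (p (e , e'))
      ... | no ne | _ = trans (cong (_* δ j j') (δ-≢ ne)) (Rq.zeroˡ _)
      ... | yes _ | no ne = trans (cong (δ i i' *_) (δ-≢ ne)) (Rq.zeroʳ _)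

      link-¬joins : ∀ {q i j} → ¬ Joins q i j → link q i j ≡ # 0
      link-¬joins p = trans (cong₂ _+_ (δδ-0 (λ x → p (inj₁ x))) (δδ-0 (λ x → p (inj₂ x)))) (Rq.+-identityˡ (# 0))

    link-ix : ∀ i j ne q → link q i j ≡ δ (ix i j ne) q
    link-ix i j ne q with ix i j ne F.≟ q
    ... | yes refl = trans (link-joins (ix-joins i j ne)) (sym (δ-refl q))
    ... | no p = trans (link-¬joins (λ x → p (joins-unique (ix-joins i j ne) x))) (sym (δ-≢ p))

    lift : (P → ℚ) → Fin n → Fin n → ℚ
    lift g i j = ∑ꟳ (λ q → link q i j * g q)

    lift-sym : ∀ g i j → lift g i j ≡ lift g j i
    lift-sym g i j = ∑-cong (allFin _) (λ q → cong (_* g q) (link-sym q i j))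

    lift-ix : ∀ g i j ne → lift g i j ≡ g (ix i j ne)
    lift-ix g i j ne = trans (∑-cong (allFin _) (λ q → cong (_* g q) (link-ix i j ne q))) (∑-δ (ix i j ne) g)

    lift-joins : ∀ g {q i j} → Joins q i j → lift g i j ≡ g q
    lift-joins g {q} {i} {j} x = trans (lift-ix g i j (joins-≢ x)) (cong g (joins-unique (ix-joins i j (joins-≢ x)) x))

    lift-diag : ∀ g i → lift g i i ≡ # 0
    lift-diag g i = trans (∑-cong (allFin _) (λ q → trans (cong (_* g q) (link-¬joins (λ x → joins-≢ x refl))) (Rq.zeroˡ (g q)))) (∑-0 (allFin (NP n)))

    lift-row : ∀ g i → ∑ꟳ (lift g i) ≡ ∑ꟳ (λ q → inc q i * g q)
    lift-row g i = trans (∑-swap (allFin n) (allFin (NP n)) (λ j q → link q i j * g q)) (∑-cong (allFin (NP n)) (λ q → trans (∑-*ʳ (g q) (allFin n) _) (cong (_* g q) (∑-link q i))))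

    opaque
      unfolding inc

      #-deg : ∀ (G : EdgeSet n) i → # (deg {n} G i) ≡ ∑ꟳ (λ q → inc q i * 𝟙 (lookup G q))
      #-deg G i = trans (#-countᵇ {NP n} _) (∑-cong (allFin _) (λ q → trans (𝟙-∧ (lookup G q) _) (trans (cong (𝟙 (lookup G q) *_) (e q)) (Rq.*-comm _ _))))
        where
        e : ∀ q → 𝟙 (isV (fst q) i ∨ isV (snd q) i) ≡ inc q i
        e q with isV (fst q) i in e₁ | isV (snd q) i in e₂
        ... | false | b = trans (sym (Rq.+-identityˡ (𝟙 b))) (cong₂ _+_ (trans (sym (cong 𝟙 e₁)) (𝟙-isV (fst q) i)) (trans (sym (cong 𝟙 e₂)) (𝟙-isV (snd q) i)))
        ... | true | false = trans (sym (Rq.+-identityʳ (# 1))) (cong₂ _+_ (trans (sym (cong 𝟙 e₁)) (𝟙-isV (fst q) i)) (trans (sym (cong 𝟙 e₂)) (𝟙-isV (snd q) i)))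
        -- The disjunction in `deg` agrees with the sum of the two deltas because the ends of a pair
        -- are distinct.
        ... | true | true = ⊥-elim (fst≢snd q (trans (isV-≡ e₁) (sym (isV-≡ e₂))))
          where
          isV-≡ : ∀ {u} → isV u i ≡ true → u ≡ i
          isV-≡ {u} p = Fₚ.toℕ-injective (ℕₚ.≡ᵇ⇒≡ (toℕ u) (toℕ i) (≡true⇒T p))

  -- Sums over all edge sets

  ∑-allVecs-suc : ∀ k (f : Vec Bool (suc k) → ℚ) → ∑ (allVecs (suc k)) f ≡ ∑ (allVecs k) (λ v → f (false ∷ v) + f (true ∷ v))
  ∑-allVecs-suc k f = go (allVecs k)
    where
    go : ∀ vs → ∑ (concatMap (λ v → (false ∷ v) ∷ (true ∷ v) ∷ []) vs) f ≡ ∑ vs (λ v → f (false ∷ v) + f (true ∷ v))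
    go [] = refl
    go (v ∷ vs) = trans (cong (λ z → f (false ∷ v) + (f (true ∷ v) + z)) (go vs)) (sym (Rq.+-assoc _ _ _))

  -- Switching one coordinate of all 0-1 vectors permutes them.
  opaque
    flip : ∀ {k} → Fin k → Vec Bool k → Vec Bool k
    flip q v = v [ q ]≔ not (lookup v q)

    ∑-flip : ∀ {k} (q : Fin k) (f : Vec Bool k → ℚ) → ∑ (allVecs k) (λ v → f (flip q v)) ≡ ∑ (allVecs k) f
    ∑-flip {suc k} zero f = trans (∑-allVecs-suc k _) (trans (∑-cong (allVecs k) (λ v → Rq.+-comm _ _)) (sym (∑-allVecs-suc k f)))
    ∑-flip {suc k} (suc q) f = trans (∑-allVecs-suc k _) (trans (∑-flip q (λ v → f (false ∷ v) + f (true ∷ v))) (sym (∑-allVecs-suc k f)))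

    lookup-flip : ∀ {k} (q : Fin k) v → lookup (flip q v) q ≡ not (lookup v q)
    lookup-flip q v = Vₚ.lookup∘updateAt q v

    lookup-flip-≢ : ∀ {k} {q r : Fin k} → q ≢ r → ∀ v → lookup (flip q v) r ≡ lookup v r
    lookup-flip-≢ {q = q} {r} ne v = Vₚ.lookup∘updateAt′ r q (λ e → ne (sym e)) v

  ∑-eqVec : ∀ {k} (u : Vec Bool k) → ∑ (allVecs k) (λ v → 𝟙 (eqVec u v)) ≡ # 1
  ∑-eqVec [] = Rq.+-identityʳ (# 1)
  ∑-eqVec {suc k} (true ∷ u) = trans (∑-allVecs-suc k _) (trans (∑-cong (allVecs k) (λ v → Rq.+-identityˡ _)) (∑-eqVec u))
  ∑-eqVec {suc k} (false ∷ u) = trans (∑-allVecs-suc k _) (trans (∑-cong (allVecs k) (λ v → Rq.+-identityʳ _)) (∑-eqVec u))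

  ∈-allVecs : ∀ {k} (v : Vec Bool k) → v ∈ allVecs k
  ∈-allVecs [] = here refl
  ∈-allVecs {suc k} (b ∷ v) = Mₚ.∈-concatMap⁺ _ (Any.map (λ where refl → pick b) (∈-allVecs v))
    where
    pick : ∀ b → (b ∷ v) ∈ (false ∷ v) ∷ (true ∷ v) ∷ []
    pick false = here refl
    pick true = there (here refl)

  subᵇ : ∀ {k} → Vec Bool k → Vec Bool k → Bool
  subᵇ [] [] = true
  subᵇ (e ∷ E) (g ∷ G) = (not e ∨ g) ∧ subᵇ E G

  record _⊆_ {k} (E G : Vec Bool k) : Set where
    constructor mk⊆
    field
      at : ∀ q → lookup E q ≡ true → lookup G q ≡ true
  open _⊆_ public

  ∧-true : ∀ {a b} → a ∧ b ≡ true → a ≡ true × b ≡ true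
  ∧-true {true} {true} _ = refl , refl

  subᵇ⇒⊆ : ∀ {k} (E G : Vec Bool k) → subᵇ E G ≡ true → E ⊆ G
  subᵇ⇒⊆ E G p = mk⊆ (go E G p)
    where
    go : ∀ {k} (E G : Vec Bool k) → subᵇ E G ≡ true → ∀ q → lookup E q ≡ true → lookup G q ≡ true
    go (true ∷ E) (true ∷ G) p zero _ = refl
    go (e ∷ E) (g ∷ G) p (suc q) r = go E G (proj₂ (∧-true {not e ∨ g} p)) q r

  ⊆⇒subᵇ : ∀ {k} (E G : Vec Bool k) → E ⊆ G → subᵇ E G ≡ true
  ⊆⇒subᵇ [] [] p = refl
  ⊆⇒subᵇ (false ∷ E) (g ∷ G) p = ⊆⇒subᵇ E G (mk⊆ λ q → at p (suc q))
  ⊆⇒subᵇ (true ∷ E) (false ∷ G) p with () ← at p zero refl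
  ⊆⇒subᵇ (true ∷ E) (true ∷ G) p = ⊆⇒subᵇ E G (mk⊆ λ q → at p (suc q))

  subᵇ-add : ∀ {k} (E G : Vec Bool k) q → subᵇ (E [ q ]≔ true) G ≡ subᵇ E G ∧ lookup G q
  subᵇ-add (true ∷ E) (true ∷ G) zero = sym (Bₚ.∧-identityʳ _)
  subᵇ-add (true ∷ E) (false ∷ G) zero = refl
  subᵇ-add (false ∷ E) (true ∷ G) zero = sym (Bₚ.∧-identityʳ _)
  subᵇ-add (false ∷ E) (false ∷ G) zero = sym (Bₚ.∧-zeroʳ _)
  subᵇ-add (e ∷ E) (g ∷ G) (suc q) = trans (cong ((not e ∨ g) ∧_) (subᵇ-add E G q)) (sym (Bₚ.∧-assoc (not e ∨ g) (subᵇ E G) (lookup G q)))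

  opaque
    unfolding δ flip

    𝟙-add : ∀ {k} (E : Vec Bool k) q r → 𝟙 (lookup (E [ q ]≔ true) r) ≡ 𝟙 (lookup E r) + (# 1 - 𝟙 (lookup E q)) * δ q r
    𝟙-add (e ∷ E) zero zero = solve 1 (λ e → κ 1 := e :+ (κ 1 :- e) :* κ 1) refl (𝟙 e)
    𝟙-add (e ∷ E) zero (suc r) = solve 2 (λ e x → x := x :+ (κ 1 :- e) :* κ 0) refl (𝟙 e) (𝟙 (lookup E r))
    𝟙-add (e ∷ E) (suc q) zero = solve 2 (λ e x → e := e :+ (κ 1 :- x) :* κ 0) refl (𝟙 e) (𝟙 (lookup E q))
    𝟙-add (e ∷ E) (suc q) (suc r) = 𝟙-add E q r

    𝟙-flip : ∀ {k} (G : Vec Bool k) q r → 𝟙 (lookup (flip q G) r) ≡ 𝟙 (lookup G r) + (# 1 - # 2 * 𝟙 (lookup G q)) * δ q r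
    𝟙-flip (true ∷ G) zero zero = solve 0 (κ 0 := κ 1 :+ (κ 1 :- κ 2 :* κ 1) :* κ 1) refl
    𝟙-flip (false ∷ G) zero zero = solve 0 (κ 1 := κ 0 :+ (κ 1 :- κ 2 :* κ 0) :* κ 1) refl
    𝟙-flip (e ∷ E) zero (suc r) = solve 2 (λ e x → x := x :+ (κ 1 :- κ 2 :* e) :* κ 0) refl (𝟙 e) (𝟙 (lookup E r))
    𝟙-flip (e ∷ E) (suc q) zero = solve 2 (λ e x → e := e :+ (κ 1 :- κ 2 :* x) :* κ 0) refl (𝟙 e) (𝟙 (lookup E q))
    𝟙-flip (e ∷ E) (suc q) (suc r) = 𝟙-flip E q r

  all⇒ : ∀ (p : A → Bool) xs → Data.Bool.ListAction.all p xs ≡ true → ∀ {x} → x ∈ xs → p x ≡ true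
  all⇒ p (x ∷ xs) h (here refl) = proj₁ (∧-true h)
  all⇒ p (x ∷ xs) h (there m) = all⇒ p xs (proj₂ (∧-true {p x} h)) m

  ⇒all : ∀ (p : A → Bool) xs → (∀ x → p x ≡ true) → Data.Bool.ListAction.all p xs ≡ true
  ⇒all p [] h = refl
  ⇒all p (x ∷ xs) h = cong₂ _∧_ (h x) (⇒all p xs h)

  𝟙-mono : ∀ {a b} → (a ≡ true → b ≡ true) → 𝟙 a ≤ 𝟙 b
  𝟙-mono {false} {b} p = 0≤𝟙 b
  𝟙-mono {true} {b} p = ≤-reflexive (cong 𝟙 (sym (p refl)))

  not-true : ∀ {b} → not b ≡ true → b ≡ false
  not-true {false} _ = refl

  ¬true : ∀ {b} → b ≢ true → b ≡ false
  ¬true {true} p = ⊥-elim (p refl)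
  ¬true {false} _ = refl

  ∈-filterᵇ⁻ : ∀ (p : A → Bool) xs {x} → x ∈ filterᵇ p xs → x ∈ xs × p x ≡ true
  ∈-filterᵇ⁻ p xs m with Mₚ.∈-filter⁻ (T? ∘ p) {xs = xs} m
  ... | m' , t = m' , T⇒≡true t

  -- Squares, inverses and the fractions occurring in the definitions

  sq-≤ : ∀ {m b} → m ≤ b → - m ≤ b → m * m ≤ b * b
  sq-≤ {m} {b} p q = ≤-by ((b - m) * (b - - m)) (0≤* (≤⇒0≤- p) (≤⇒0≤- q)) (solve 2 (λ m b → b :* b :- m :* m := (b :- m) :* (b :- (:- m))) refl m b)

  sq-+₂ : ∀ a b → (a + b) * (a + b) ≤ # 2 * (a * a + b * b)
  sq-+₂ a b = ≤-by ((a - b) * (a - b)) (0≤sq (a - b)) (solve 2 (λ a b → κ 2 :* (a :* a :+ b :* b) :- (a :+ b) :* (a :+ b) := (a :- b) :* (a :- b)) refl a b)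

  sq-+₃ : ∀ a b c → (a + b + c) * (a + b + c) ≤ # 3 * (a * a + b * b + c * c)
  sq-+₃ a b c = ≤-by ((a - b) * (a - b) + (a - c) * (a - c) + (b - c) * (b - c)) (0≤+ (0≤+ (0≤sq (a - b)) (0≤sq (a - c))) (0≤sq (b - c)))
    (solve 3 (λ a b c → κ 3 :* (a :* a :+ b :* b :+ c :* c) :- (a :+ b :+ c) :* (a :+ b :+ c) := (a :- b) :* (a :- b) :+ (a :- c) :* (a :- c) :+ (b :- c) :* (b :- c)) refl a b c)

  inv-unique : ∀ {x y} → x * y ≡ # 1 → y ≡ inv x
  inv-unique {x} {y} e = trans (sym (Rq.*-identityʳ y)) (trans (cong (y *_) (sym (inv-r x≢0))) (trans (solve 3 (λ x y i → y :* (x :* i) := (x :* y) :* i) refl x y (inv x)) (trans (cong (_* inv x) e) (Rq.*-identityˡ _))))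
    where
    x≢0 : x ≢ # 0
    x≢0 z = pos⇒≢0 0<1 (trans (sym e) (trans (cong (_* y) z) (Rq.zeroˡ y)))

  inv-* : ∀ a b → inv (a * b) ≡ inv a * inv b
  inv-* a b with a ≟0 | b ≟0
  ... | yes refl | _ = trans (cong inv (Rq.zeroˡ b)) (trans inv-0 (sym (trans (cong (_* inv b) inv-0) (Rq.zeroˡ _))))
  ... | no _ | yes refl = trans (cong inv (Rq.zeroʳ a)) (trans inv-0 (sym (trans (cong (inv a *_) inv-0) (Rq.zeroʳ _))))
  ... | no p | no q = sym (inv-unique (trans (solve 4 (λ a b i j → a :* b :* (i :* j) := (a :* i) :* (b :* j)) refl a b (inv a) (inv b)) (trans (cong₂ _*_ (inv-r p) (inv-r q)) (Rq.*-identityˡ _))))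

  ∑-inhabited : ∀ (xs : List A) → (xs ≡ []) ⊎ Σ A (_∈ xs)
  ∑-inhabited [] = inj₁ refl
  ∑-inhabited (x ∷ xs) = inj₂ (x , here refl)

  opaque
    unfolding _+_

    qsum-∑ : ∀ (f : A → ℚ) xs → qsum (map f xs) ≡ ∑ xs f
    qsum-∑ f [] = refl
    qsum-∑ f (x ∷ xs) = cong (f x ℚ.+_) (qsum-∑ f xs)

    /1-# : ∀ k → (ℤ.+ k) ℚ./ 1 ≡ # k
    /1-# zero = refl
    /1-# (suc k) = ℚₚ.toℚᵘ-injective (ℚᵘₚ.≃-trans (ℚₚ.toℚᵘ-fromℚᵘ (ℚᵘ.mkℚᵘ (ℤ.+ suc k) 0)) (ℚᵘₚ.≃-trans step
        (ℚᵘₚ.≃-sym (ℚᵘₚ.≃-trans (ℚₚ.toℚᵘ-homo-+ 1ℚ (# k)) (ℚᵘₚ.+-congʳ (ℚ.toℚᵘ 1ℚ) (ℚᵘₚ.≃-trans (ℚᵘₚ.≃-reflexive (cong ℚ.toℚᵘ (sym (/1-# k)))) (ℚₚ.toℚᵘ-fromℚᵘ (ℚᵘ.mkℚᵘ (ℤ.+ k) 0))))))))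
      where
      step : ℚᵘ.mkℚᵘ (ℤ.+ suc k) 0 ℚᵘ.≃ ℚ.toℚᵘ 1ℚ ℚᵘ.+ ℚᵘ.mkℚᵘ (ℤ.+ k) 0
      step = ℚᵘ.*≡* (cong (ℤ._* ℤ.+ 1) (sym (cong (ℤ._+_ (ℤ.+ 1)) (ℤₚ.*-identityʳ (ℤ.+ k)))))

    frac-# : ∀ a b → frac a (suc b) ≡ # a * inv (# (suc b))
    frac-# a b = trans (sym (Rq.*-identityʳ (frac a (suc b)))) (trans (cong (frac a (suc b) *_) (sym (inv-pos-r (0<#suc b)))) (trans (sym (Rq.*-assoc (frac a (suc b)) (# (suc b)) (inv (# (suc b))))) (cong (_* inv (# (suc b))) main)))
      where
      main : ((ℤ.+ a) ℚ./ suc b) ℚ.* # (suc b) ≡ # a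
      main = trans (cong (((ℤ.+ a) ℚ./ suc b) ℚ.*_) (sym (/1-# (suc b)))) (trans (ℚₚ.toℚᵘ-injective (ℚᵘₚ.≃-trans (ℚₚ.toℚᵘ-homo-* ((ℤ.+ a) ℚ./ suc b) ((ℤ.+ suc b) ℚ./ 1)) (ℚᵘₚ.≃-trans (ℚᵘₚ.*-cong (ℚₚ.toℚᵘ-fromℚᵘ (ℚᵘ.mkℚᵘ (ℤ.+ a) b)) (ℚₚ.toℚᵘ-fromℚᵘ (ℚᵘ.mkℚᵘ (ℤ.+ suc b) 0)))
         (ℚᵘₚ.≃-trans (ℚᵘ.*≡* (trans (ℤₚ.*-identityʳ _) (cong (ℤ.+ a ℤ.*_) (cong (λ z → ℤ.+ suc z) (sym (ℕₚ.*-identityʳ b)))))) (ℚᵘₚ.≃-sym (ℚₚ.toℚᵘ-fromℚᵘ (ℚᵘ.mkℚᵘ (ℤ.+ a) 0))))))) (/1-# a))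

    *ℚ : ∀ a b → a ℚ.* b ≡ a * b
    *ℚ a b = refl

  bernoulli : ∀ k {x} → # 0 ≤ x → x ≤ # 1 → # 1 - # k * x ≤ (# 1 - x) ^ k
  bernoulli zero {x} p q = ≤-reflexive (solve 1 (λ x → κ 1 :- κ 0 :* x := κ 1) refl x)
  bernoulli (suc k) {x} p q = ≤-trans (≤-by (# k * (x * x)) (0≤* (0≤# k) (0≤sq x)) (trans (cong (λ z → (# 1 - x) * (# 1 - # k * x) - (# 1 - z * x)) (#-suc k)) (solve 2 (λ x k → (κ 1 :- x) :* (κ 1 :- k :* x) :- (κ 1 :- (κ 1 :+ k) :* x) := k :* (x :* x)) refl x (# k))))
    (*-monoˡ (# 1 - x) (≤⇒0≤- q) (bernoulli k p q))

  *-^ : ∀ x y k → (x * y) ^ k ≡ x ^ k * y ^ k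
  *-^ x y zero = sym (Rq.*-identityˡ (# 1))
  *-^ x y (suc k) = trans (cong (x * y *_) (*-^ x y k)) (solve 4 (λ x y a b → x :* y :* (a :* b) := x :* a :* (y :* b)) refl x y (x ^ k) (y ^ k))

  -- Falling factorials and explicit constants

  fall : ℚ → ℕ → ℚ
  fall x zero = # 1
  fall x (suc k) = x * fall (x - # 1) k

  -- Both sides are the falling factorial of length k + 1, with its first or its last factor split
  -- off.
  fall-shift : ∀ k x → x * fall (x - # 1) k ≡ (x - # k) * fall x k
  fall-shift zero x = solve 1 (λ x → x :* κ 1 := (x :- κ 0) :* κ 1) refl x
  fall-shift (suc k) x = trans (cong (x *_) (fall-shift k (x - # 1))) (trans (solve 3 (λ x k f → x :* ((x :- κ 1 :- k) :* f) := (x :- (κ 1 :+ k)) :* (x :* f)) refl x (# k) (fall (x - # 1) k)) (cong (λ z → (x - z) * (x * fall (x - # 1) k)) (sym (#-suc k))))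

  0≤fall : ∀ k x → # 0 ≤ fall (# x) k
  0≤fall zero x = 0≤1
  0≤fall (suc k) zero = ≤-reflexive (sym (Rq.zeroˡ _))
  0≤fall (suc k) (suc x) = 0≤* (0≤# (suc x)) (subst (λ z → # 0 ≤ fall z k) (trans (solve 1 (λ x → x := κ 1 :+ x :- κ 1) refl (# x)) (cong (_- # 1) (sym (#-suc x)))) (0≤fall k x))

  fall≤^ : ∀ k x → fall (# x) k ≤ # x ^ k
  fall≤^ zero x = ≤-refl
  fall≤^ (suc k) zero = ≤-reflexive (trans (Rq.zeroˡ _) (sym (Rq.zeroˡ _)))
  fall≤^ (suc k) (suc x) = *-monoˡ _ (0≤# (suc x)) (≤-trans (≤-reflexive (cong (λ z → fall z k) (trans (cong (_- # 1) (#-suc x)) (solve 1 (λ x → κ 1 :+ x :- κ 1 := x) refl (# x))))) (≤-trans (fall≤^ k x) (^-mono k)))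
    where
    ^-mono : ∀ k → # x ^ k ≤ # (suc x) ^ k
    ^-mono zero = ≤-refl
    ^-mono (suc k) = *-mono (0≤# x) (0≤^ k (0≤# (suc x))) (#-mono (ℕₚ.n≤1+n x)) (^-mono k)

  ∑sq≤sq∑ : ∀ (xs : List A) (y : A → ℚ) → (∀ x → # 0 ≤ y x) → ∑ xs (λ x → y x * y x) ≤ ∑ xs y * ∑ xs y
  ∑sq≤sq∑ xs y p = ≤-trans (∑-mono∈ xs (λ {x} m → *-monoˡ (y x) (p x) (term≤∑ xs p m))) (≤-reflexive (∑-*ʳ (∑ xs y) xs y))

  sq-shift : ∀ a b → a * a ≤ # 2 * ((a - b) * (a - b)) + # 2 * (b * b)
  sq-shift a b = ≤-by ((a - # 2 * b) * (a - # 2 * b)) (0≤sq (a - # 2 * b)) (solve 2 (λ a b → κ 2 :* ((a :- b) :* (a :- b)) :+ κ 2 :* (b :* b) :- a :* a := (a :- κ 2 :* b) :* (a :- κ 2 :* b)) refl a b)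

  decide-all : ∀ {k} {Q R : Fin k → Set} → (∀ i → Q i ⊎ R i) → (∀ i → Q i) ⊎ Σ (Fin k) R
  decide-all {zero} f = inj₁ (λ ())
  decide-all {suc k} f with f zero | decide-all (λ i → f (suc i))
  ... | inj₂ r | _ = inj₂ (zero , r)
  ... | inj₁ _ | inj₂ (i , r) = inj₂ (suc i , r)
  ... | inj₁ q | inj₁ h = inj₁ (λ where zero → q ; (suc i) → h i)

  decide-any : ∀ (xs : List A) {Q R : A → Set} → (∀ {x} → x ∈ xs → Q x ⊎ R x) → (Σ A λ x → x ∈ xs × Q x) ⊎ (∀ {x} → x ∈ xs → R x)
  decide-any [] f = inj₂ (λ ())
  decide-any (x ∷ xs) f with f (here refl) | decide-any xs (λ m → f (there m))
  ... | inj₁ q | _ = inj₁ (x , here refl , q)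
  ... | inj₂ _ | inj₁ (y , m , q) = inj₁ (y , there m , q)
  ... | inj₂ r | inj₂ h = inj₂ (λ where (here refl) → r ; (there m) → h m)

  IsNat : ℚ → Set
  IsNat x = Σ ℕ λ k → x ≡ # k

  nat-∑ : ∀ (xs : List A) {f : A → ℚ} → (∀ x → IsNat (f x)) → IsNat (∑ xs f)
  nat-∑ [] p = 0 , refl
  nat-∑ (x ∷ xs) p with p x | nat-∑ xs p
  ... | a , u | b , v = a ℕ.+ b , trans (cong₂ _+_ u v) (sym (#-+ a b))

  nat-* : ∀ {x y} → IsNat x → IsNat y → IsNat (x * y)
  nat-* (a , u) (b , v) = a ℕ.* b , trans (cong₂ _*_ u v) (sym (#-* a b))

  nat-≤⊎> : ∀ {x} → IsNat x → ∀ k → x ≤ # k ⊎ # (suc k) ≤ x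
  nat-≤⊎> {x} (a , u) k with a ℕ.≤? k
  ... | yes p = inj₁ (≤-trans (≤-reflexive u) (#-mono p))
  ... | no p = inj₂ (≤-trans (#-mono (ℕₚ.≰⇒> p)) (≤-reflexive (sym u)))

  nat≤sq : ∀ {x} → IsNat x → x ≤ x * x
  nat≤sq (zero , u) = ≤-reflexive (trans u (sym (trans (cong₂ _*_ u u) (Rq.zeroˡ _))))
  nat≤sq {x} (suc k , u) = ≤-trans (≤-reflexive (sym (Rq.*-identityʳ x))) (*-monoˡ x (≤-trans (0≤# (suc k)) (≤-reflexive (sym u))) (≤-trans (#-mono (s≤s z≤n)) (≤-reflexive (sym u))))

  two-terms : ∀ {k} {i j : Fin k} → i ≢ j → (f : Fin k → ℚ) → (∀ l → # 0 ≤ f l) → f i + f j ≤ ∑ (allFin k) f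
  two-terms {k} {i} {j} ne f nn = ≤-trans (≤-reflexive (sym (trans (∑-cong (allFin k) (λ l → Rq.distribʳ (f l) (δ i l) (δ j l))) (trans (∑-+ (allFin k) _ _) (cong₂ _+_ (∑-δ i f) (∑-δ j f)))))) (∑-mono (allFin k) (λ l → ≤-trans (*-monoʳ (f l) (nn l) (le l)) (≤-reflexive (Rq.*-identityˡ _))))
    where
    le : ∀ l → δ i l + δ j l ≤ # 1
    le l with i F.≟ l | j F.≟ l
    ... | yes refl | yes refl = ⊥-elim (ne refl)
    ... | yes refl | no q = ≤-reflexive (trans (cong₂ _+_ (δ-refl i) (δ-≢ q)) (Rq.+-identityʳ _))
    ... | no q | yes refl = ≤-reflexive (trans (cong₂ _+_ (δ-≢ q) (δ-refl j)) (Rq.+-identityˡ _))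
    ... | no q | no r = ≤-trans (≤-reflexive (trans (cong₂ _+_ (δ-≢ q) (δ-≢ r)) (Rq.+-identityˡ _))) 0≤1

  1≰0 : ¬ (# 1 ≤ # 0)
  1≰0 p = <-irrefl refl (<-≤-trans 0<1 p)

  2≰1 : ¬ (# 2 ≤ # 1)
  2≰1 p = 1≰0 (≤-by (# 1 - # 2) (≤⇒0≤- p) (solve 0 (κ 0 :- κ 1 := κ 1 :- κ 2) refl))

  ^-mono-≤ : ∀ k {x y} → # 0 ≤ x → x ≤ y → x ^ k ≤ y ^ k
  ^-mono-≤ zero p q = ≤-refl
  ^-mono-≤ (suc k) p q = *-mono p (0≤^ k (≤-trans p q)) q (^-mono-≤ k p q)

  -- Every factor of `fall z k` is at least `z - # k`, hence at least half of `x`.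
  fall-half : ∀ k {x z} → # 0 ≤ x → x ≤ # 2 * (z - # k) → x ^ k ≤ # 2 ^ k * fall z k
  fall-half zero p q = ≤-reflexive (sym (Rq.*-identityˡ _))
  fall-half (suc k) {x} {z} p q = ≤-trans (*-mono p 0≤rest x≤2z (fall-half k p x≤)) (≤-reflexive (solve 4 (λ z t a f → κ 2 :* z :* (a :* f) := κ 2 :* a :* (z :* f)) refl z (# 1) (# 2 ^ k) (fall (z - # 1) k)))
    where
    x≤ : x ≤ # 2 * ((z - # 1) - # k)
    x≤ = ≤-trans q (≤-reflexive (trans (cong (λ y → # 2 * (z - y)) (#-suc k)) (solve 2 (λ z k → κ 2 :* (z :- (κ 1 :+ k)) := κ 2 :* ((z :- κ 1) :- k)) refl z (# k))))
    x≤2z : x ≤ # 2 * z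
    x≤2z = ≤-trans q (≤-by (# 2 * # (suc k)) (0≤* (0≤# 2) (0≤# (suc k))) (solve 2 (λ z k → κ 2 :* z :- κ 2 :* (z :- k) := κ 2 :* k) refl z (# (suc k))))
    0≤rest : # 0 ≤ # 2 ^ k * fall (z - # 1) k
    0≤rest = ≤-trans (0≤^ k p) (fall-half k p x≤)

  2^8 : # 2 ^ 8 ≡ # 256
  2^8 = solve 0 (κ 2 :* (κ 2 :* (κ 2 :* (κ 2 :* (κ 2 :* (κ 2 :* (κ 2 :* (κ 2 :* κ 1))))))) := κ 256) refl

  fall8-large : ∀ {x} → # 16 ≤ x → x ^ 8 ≤ # 256 * fall x 8
  fall8-large {x} p = ≤-trans (fall-half 8 (≤-trans (0≤# 16) p) (≤-by (x - # 16) (≤⇒0≤- p) (solve 1 (λ x → κ 2 :* (x :- κ 8) :- x := x :- κ 16) refl x))) (≤-reflexive (cong (_* fall x 8) 2^8))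

  c₇ : ℚ
  c₇ = # 16 ^ 7

  0≤c₇ : # 0 ≤ c₇
  0≤c₇ = 0≤^ 7 (0≤# 16)

  -- Expectations of falling factorials are accessible, those of powers are not directly. Beyond 16
  -- the two differ by a factor of at most 2^8; up to 16, where the falling factorial may vanish,
  -- the linear term takes over.
  pow8≤ : ∀ x → # x ^ 8 ≤ c₇ * # x + # 256 * fall (# x) 8
  pow8≤ x with x ℕ.≤? 16
  ... | yes p = ≤-trans (≤-trans (*-monoˡ (# x) (0≤# x) (^-mono-≤ 7 (0≤# x) (#-mono p))) (≤-reflexive (Rq.*-comm (# x) c₇))) (≤-by (# 256 * fall (# x) 8) (0≤* (0≤# 256) (0≤fall 8 x)) (solve 2 (λ a b → a :+ b :- a := b) refl (c₇ * # x) (# 256 * fall (# x) 8)))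
  ... | no p = ≤-trans (fall8-large (#-mono (ℕₚ.<⇒≤ (ℕₚ.≰⇒> p)))) (≤-by (c₇ * # x) (0≤* 0≤c₇ (0≤# x)) (solve 2 (λ a b → a :+ b :- b := a) refl (c₇ * # x) (# 256 * fall (# x) 8)))

  ^-up : ∀ x j k → # x * # x ^ k ≤ # x * # x ^ (j ℕ.+ k)
  ^-up zero j k = ≤-reflexive (trans (Rq.zeroˡ _) (sym (Rq.zeroˡ _)))
  ^-up (suc x) j k = *-monoˡ _ (0≤# (suc x)) (go j)
    where
    go : ∀ j → # (suc x) ^ k ≤ # (suc x) ^ (j ℕ.+ k)
    go zero = ≤-refl
    go (suc j) = ≤-trans (go j) (≤-trans (≤-reflexive (sym (Rq.*-identityˡ _))) (*-monoʳ _ (0≤^ (j ℕ.+ k) (0≤# (suc x))) (#-mono (s≤s z≤n))))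

  ∣∣-≡ : ∀ {x} → # 0 ≤ x → ∣ x - # 0 ∣ ≤ x
  ∣∣-≡ {x} p with ∣∣-spec (x - # 0)
  ... | inj₁ (e , _) = ≤-reflexive (trans e (solve 1 (λ x → x :- κ 0 := x) refl x))
  ... | inj₂ (e , q) = ≤-trans (≤-reflexive e) (≤-by (# 2 * x) (0≤* (0≤# 2) p) (solve 1 (λ x → x :- (:- (x :- κ 0)) := κ 2 :* x) refl x))

  -- `k₂` and `k₄` are the coefficients of 1/t² and d²/(n t) in the bound for one step with t = 2 s.
  -- In `k₂`, 3024 = 189 · 16 comes from the second moment of C and the rest from `D⁸`. In `k₄`,
  -- 217728 = 2 · 72576 + 8 · 9072 covers the terms in μ and μ² and `# 4 * k₅` the bad states, both
  -- for s ≤ n, while 194688 = 2 · 24 · 4056 covers s ≥ n. The two summands of `k₅` belong to those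
  -- of `bad`.
  k₂ k₄ k₅ : ℚ
  k₂ = # 24 * (# 3024 + # 32 * (c₇ + # 256 * # 2 ^ 7))
  k₅ = # 320 ^ 8 + # 256 * # 40 ^ 4 * # 2 ^ 4
  k₄ = # 217728 + # 4 * k₅ + # 194688

  0≤k₅ : # 0 ≤ k₅
  0≤k₅ = 0≤+ (0≤^ 8 (0≤# 320)) (0≤* (0≤* (0≤# 256) (0≤^ 4 (0≤# 40))) (0≤^ 4 (0≤# 2)))

  0≤k₂ : # 0 ≤ k₂
  0≤k₂ = 0≤* (0≤# 24) (0≤+ (0≤# 3024) (0≤* (0≤# 32) (0≤+ 0≤c₇ (0≤* (0≤# 256) (0≤^ 7 (0≤# 2))))))

  -- Harmonic sums

  ∑↓ : ℕ → (ℕ → ℚ) → ℚ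
  ∑↓ zero f = # 0
  ∑↓ (suc r) f = f (suc r) + ∑↓ r f

  harmonic : ℕ → ℚ
  harmonic r = ∑↓ r (λ k → inv (# k))

  inv-antimono : ∀ {x y} → # 0 < x → x ≤ y → inv y ≤ inv x
  inv-antimono {x} {y} p q = *-cancelˡ (x * y) (0<* p 0<y) (≤-trans (≤-reflexive (trans (Rq.*-assoc x y (inv y)) (trans (cong (x *_) (inv-pos-r 0<y)) (Rq.*-identityʳ x)))) (≤-trans q (≤-reflexive (sym (trans (solve 3 (λ x y i → x :* y :* i := y :* (x :* i)) refl x y (inv x)) (trans (cong (y *_) (inv-pos-r p)) (Rq.*-identityʳ y)))))))
    where
    0<y : # 0 < y
    0<y = <-≤-trans p q

  harmonic-+ : ∀ k a → harmonic (k ℕ.+ suc a) ≤ # k * inv (# (suc a)) + harmonic (suc a)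
  harmonic-+ zero a = ≤-reflexive (solve 2 (λ i h → h := κ 0 :* i :+ h) refl (inv (# (suc a))) (harmonic (suc a)))
  harmonic-+ (suc k) a = ≤-trans (+-mono (inv-antimono (0<#suc a) (#-mono (ℕₚ.m≤n+m (suc a) (suc k)))) (harmonic-+ k a))
    (≤-reflexive (trans (solve 3 (λ i k h → i :+ (k :* i :+ h) := (κ 1 :+ k) :* i :+ h) refl (inv (# (suc a))) (# k) (harmonic (suc a))) (cong (λ z → z * inv (# (suc a)) + harmonic (suc a)) (sym (#-suc k)))))

  harmonic-mono : ∀ {r s} → r ℕ.≤ s → harmonic r ≤ harmonic s
  harmonic-mono {r} {s} p = subst (λ s → harmonic r ≤ harmonic s) (ℕₚ.m∸n+n≡m p) (go (s ℕ.∸ r))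
    where
    go : ∀ k → harmonic r ≤ harmonic (k ℕ.+ r)
    go zero = ≤-refl
    go (suc k) = ≤-trans (go k) (≤-by (inv (# (suc (k ℕ.+ r)))) (0≤inv (0≤# (suc (k ℕ.+ r)))) (solve 2 (λ i h → i :+ h :- h := i) refl (inv (# (suc (k ℕ.+ r)))) (harmonic (k ℕ.+ r))))

  harmonic-double : ∀ a → 1 ℕ.≤ a → harmonic (2 ℕ.* a) ≤ # 1 + harmonic a
  harmonic-double (suc a) _ = ≤-trans (≤-reflexive (cong (λ k → harmonic (suc a ℕ.+ k)) (ℕₚ.+-identityʳ (suc a)))) (≤-trans (harmonic-+ (suc a) a) (≤-reflexive (cong (_+ harmonic (suc a)) (inv-pos-r (0<#suc a)))))

  -- Each doubling of the range adds at most 1. Powers of 2 play the role of the logarithm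
  -- throughout.
  harmonic-2^ : ∀ l → harmonic (2 ℕ.^ l) ≤ # (suc l)
  harmonic-2^ zero = ≤-reflexive (trans (cong (_+ # 0) (trans (sym (Rq.*-identityˡ _)) (inv-pos-r 0<1))) (Rq.+-identityʳ (# 1)))
  harmonic-2^ (suc l) = ≤-trans (harmonic-double (2 ℕ.^ l) (ℕₚ.m^n>0 2 l)) (≤-trans (+-monoʳ (# 1) (harmonic-2^ l)) (≤-reflexive (sym (#-suc (suc l)))))

  filterᵇ-cong : ∀ {p q : A → Bool} → (∀ x → p x ≡ q x) → ∀ xs → filterᵇ p xs ≡ filterᵇ q xs
  filterᵇ-cong h [] = refl
  filterᵇ-cong {p = p} {q} h (x ∷ xs) with p x | q x | h x
  ... | true | _ | refl = cong (x ∷_) (filterᵇ-cong h xs)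
  ... | false | _ | refl = filterᵇ-cong h xs

  -- Take c = 1 ± h in the hypothesis, which reads c (R + X - M) ≥ (R - c) (c - 1).
  deviation : ∀ {M R X h} → M ≤ R + X → (∀ c → # 0 < c → M + # 1 ≤ inv c * R + X + c) →
    # 0 ≤ h → # 2 * h ≤ # 1 → # 2 * h ≤ ∣ R - # 1 ∣ → h * h ≤ # 2 * (R + X - M)
  deviation {M} {R} {X} {h} base family 0≤h 2h≤1 far = go (∣∣-spec (R - # 1))
    where
    y = R + X - M
    0≤y : # 0 ≤ y
    0≤y = ≤⇒0≤- base
    at-c : ∀ c → # 0 < c → c ≤ # 2 → h * h ≤ (R - c) * (c - # 1) → h * h ≤ # 2 * y
    at-c c 0<c c≤2 q = ≤-trans q (≤-trans scaled (*-monoʳ y 0≤y c≤2))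
      where
      scaled : (R - c) * (c - # 1) ≤ c * y
      scaled = ≤-by (c * (inv c * R + X + c - (M + # 1))) (0≤* (<⇒≤ 0<c) (≤⇒0≤- (family c 0<c)))
        (trans (solve 4 (λ c r x m → c :* (r :+ x :- m) :- (r :- c) :* (c :- κ 1) := κ 1 :* r :+ c :* (x :+ c :- (m :+ κ 1))) refl c R X M)
          (trans (cong (λ z → z * R + c * (X + c - (M + # 1))) (sym (inv-pos-r 0<c))) (solve 5 (λ c i r x m → c :* i :* r :+ c :* (x :+ c :- (m :+ κ 1)) := c :* (i :* r :+ x :+ c :- (m :+ κ 1))) refl c (inv c) R X M)))
    h≤1 : h ≤ # 1
    h≤1 = ≤-trans (≤-by h 0≤h (solve 1 (λ h → κ 2 :* h :- h := h) refl h)) 2h≤1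
    go : (∣ R - # 1 ∣ ≡ R - # 1 × # 0 ≤ R - # 1) ⊎ (∣ R - # 1 ∣ ≡ - (R - # 1) × R - # 1 ≤ # 0) → h * h ≤ # 2 * y
    go (inj₁ (e , _)) = at-c (# 1 + h) (0<+ 0<1 0≤h) (≤-by (# 1 - h) (≤⇒0≤- h≤1) (solve 1 (λ h → κ 2 :- (κ 1 :+ h) := κ 1 :- h) refl h))
      (≤-by (h * (R - # 1 - # 2 * h)) (0≤* 0≤h (≤⇒0≤- (subst (# 2 * h ≤_) e far))) (solve 2 (λ r h → (r :- (κ 1 :+ h)) :* (κ 1 :+ h :- κ 1) :- h :* h := h :* (r :- κ 1 :- κ 2 :* h)) refl R h))
    go (inj₂ (e , _)) = at-c (# 1 - h) (*-cancel-<2 0<2c) (≤-by (# 1 + h) (0≤+ 0≤1 0≤h) (solve 1 (λ h → κ 2 :- (κ 1 :- h) := κ 1 :+ h) refl h))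
      (≤-by (h * (- (R - # 1) - # 2 * h)) (0≤* 0≤h (≤⇒0≤- (subst (# 2 * h ≤_) e far))) (solve 2 (λ r h → (r :- (κ 1 :- h)) :* (κ 1 :- h :- κ 1) :- h :* h := h :* (:- (r :- κ 1) :- κ 2 :* h)) refl R h))
      where
      0<2c : # 1 ≤ # 2 * (# 1 - h)
      0<2c = ≤-by (# 1 - # 2 * h) (≤⇒0≤- 2h≤1) (solve 1 (λ h → κ 2 :* (κ 1 :- h) :- κ 1 := κ 1 :- κ 2 :* h) refl h)
      *-cancel-<2 : ∀ {c} → # 1 ≤ # 2 * c → # 0 < c
      *-cancel-<2 {c} p = mkPos (*-cancelˡ (# 2) (0<#suc 1) (≤-trans (≤-reflexive (Rq.zeroʳ (# 2))) (≤-trans 0≤1 p))) (λ z → 1≰0 (≤-trans p (≤-reflexive (trans (cong (# 2 *_) z) (Rq.zeroʳ (# 2))))))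

  -- Growth of the degree against the logarithm

  binary-size : ∀ n → Σ ℕ λ l → suc n ℕ.≤ 2 ℕ.^ l × 2 ℕ.^ l ℕ.≤ 2 ℕ.* suc n
  binary-size zero = 0 , s≤s z≤n , s≤s z≤n
  binary-size (suc n) with binary-size n
  ... | l , p , q with suc (suc n) ℕ.≤? 2 ℕ.^ l
  ...   | yes p' = l , p' , ℕₚ.≤-trans q (ℕₚ.*-monoʳ-≤ 2 (ℕₚ.n≤1+n (suc n)))
  ...   | no p' = suc l , ℕₚ.≤-trans (ℕₚ.+-mono-≤ (ℕₚ.m^n>0 2 l) p) (ℕₚ.≤-reflexive (cong (2 ℕ.^ l ℕ.+_) (sym (ℕₚ.+-identityʳ (2 ℕ.^ l))))) , ℕₚ.*-monoʳ-≤ 2 (ℕₚ.≤-pred (ℕₚ.m≤n⇒m≤1+n (ℕₚ.≰⇒> p')))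

  n<2^n : ∀ n → suc n ℕ.≤ 2 ℕ.^ n
  n<2^n zero = s≤s z≤n
  n<2^n (suc n) = ℕₚ.≤-trans (ℕₚ.+-mono-≤ (ℕₚ.m^n>0 2 n) (n<2^n n)) (ℕₚ.≤-reflexive (cong (2 ℕ.^ n ℕ.+_) (sym (ℕₚ.+-identityʳ (2 ℕ.^ n)))))

  ^-distribʳ-* : ∀ o m n → (m ℕ.* n) ℕ.^ o ≡ m ℕ.^ o ℕ.* n ℕ.^ o
  ^-distribʳ-* zero m n = refl
  ^-distribʳ-* (suc o) m n = trans (cong (m ℕ.* n ℕ.*_) (^-distribʳ-* o m n)) (interchange m n (m ℕ.^ o) (n ℕ.^ o))
    where
    interchange : ∀ a b c d → a ℕ.* b ℕ.* (c ℕ.* d) ≡ a ℕ.* c ℕ.* (b ℕ.* d)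
    interchange = solve-∀

  -- If d² log n were not o(n) then n² ≤ (c log n)^K, while log n ≤ 4K·2^q with q = ⌊log n / 2K⌋ makes the right-hand side O(√n).
  module Growth (k C M n d l : ℕ) where

    -- The degree hypothesis `hyp` says d ≤ C n^(1/2 - 1/K). `x` is the bound for the harmonic sum
    -- up to 2^(2l), hence up to m = n d / 2 ≤ n² when n ≤ 2^l. `Bᵏ` is what remains of (x c)^K once
    -- `x` has been replaced by 4 K 2^q.
    K c x Bᵏ : ℕ
    K = suc k
    c = M ℕ.* C ℕ.^ 2
    x = suc (2 ℕ.* l)
    Bᵏ = (2 ℕ.* (2 ℕ.* K) ℕ.* c) ℕ.^ K

    module _ (n≥ : suc (2 ℕ.* (Bᵏ ℕ.* Bᵏ)) ℕ.≤ n) (2^l≤ : 2 ℕ.^ l ℕ.≤ 2 ℕ.* n) (hyp : d ℕ.^ (2 ℕ.* K) ℕ.* n ℕ.^ 2 ℕ.≤ C ℕ.^ (2 ℕ.* K) ℕ.* n ℕ.^ K) where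

      1≤n : 1 ℕ.≤ n
      1≤n = ℕₚ.≤-trans (s≤s z≤n) n≥

      q Pq : ℕ
      q = l ℕ./ (2 ℕ.* K)
      Pq = (2 ℕ.^ q) ℕ.^ K

      x≤ : x ℕ.≤ 2 ℕ.* (2 ℕ.* K) ℕ.* 2 ℕ.^ q
      x≤ = ℕₚ.≤-trans (ℕₚ.≤-trans (ℕₚ.n≤1+n x) (ℕₚ.≤-reflexive (sym (ℕₚ.*-suc 2 l)))) (ℕₚ.≤-trans (ℕₚ.*-monoʳ-≤ 2 l<) (ℕₚ.≤-trans (ℕₚ.≤-reflexive (trans (cong (2 ℕ.*_) (ℕₚ.*-comm (suc q) (2 ℕ.* K))) (sym (ℕₚ.*-assoc 2 (2 ℕ.* K) (suc q))))) (ℕₚ.*-monoʳ-≤ (2 ℕ.* (2 ℕ.* K)) (n<2^n q))))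
        where
        l< : suc l ℕ.≤ suc q ℕ.* (2 ℕ.* K)
        l< = ℕₚ.≤-trans (ℕₚ.≤-reflexive (cong suc (m≡m%n+[m/n]*n l (2 ℕ.* K)))) (ℕₚ.+-monoˡ-≤ (q ℕ.* (2 ℕ.* K)) (m%n<n l (2 ℕ.* K)))

      Pq² : Pq ℕ.* Pq ℕ.≤ 2 ℕ.* n
      Pq² = ℕₚ.≤-trans (ℕₚ.≤-trans (ℕₚ.≤-reflexive (trans (cong₂ ℕ._*_ (ℕₚ.^-*-assoc 2 q K) (ℕₚ.^-*-assoc 2 q K)) (sym (ℕₚ.^-distribˡ-+-* 2 (q ℕ.* K) (q ℕ.* K))))) (ℕₚ.^-monoʳ-≤ 2 (ℕₚ.≤-trans (ℕₚ.≤-reflexive (two q K)) (m/n*n≤m l (2 ℕ.* K))))) 2^l≤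
        where
        two : ∀ q K → q ℕ.* K ℕ.+ q ℕ.* K ≡ q ℕ.* (2 ℕ.* K)
        two = solve-∀

      d² : (d ℕ.* d) ℕ.^ K ≡ d ℕ.^ (2 ℕ.* K)
      d² = trans (cong (ℕ._^ K) (cong (d ℕ.*_) (sym (ℕₚ.*-identityʳ d)))) (ℕₚ.^-*-assoc d 2 K)

      instance
        n^K≢0 : ℕ.NonZero (n ℕ.^ K)
        n^K≢0 = ℕₚ.m^n≢0 n K {{ℕ.>-nonZero 1≤n}}

      -- The K-th power of the assumption is multiplied by n²; the degree hypothesis then trades
      -- d^(2K) n² for C^(2K) n^K, and n^K cancels.
      n²≤ : n ℕ.≤ M ℕ.* x ℕ.* (d ℕ.* d) → n ℕ.^ 2 ℕ.≤ Bᵏ ℕ.* Pq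
      n²≤ p = ℕₚ.≤-trans (ℕₚ.*-cancelˡ-≤ (n ℕ.^ K) (begin
          n ℕ.^ K ℕ.* n ℕ.^ 2                                          ≤⟨ ℕₚ.*-monoˡ-≤ (n ℕ.^ 2) (ℕₚ.^-monoˡ-≤ K p) ⟩
          (M ℕ.* x ℕ.* (d ℕ.* d)) ℕ.^ K ℕ.* n ℕ.^ 2                     ≡⟨ cong (ℕ._* n ℕ.^ 2) (trans (^-distribʳ-* K (M ℕ.* x) (d ℕ.* d)) (cong (Z ℕ.*_) d²)) ⟩
          Z ℕ.* d ℕ.^ (2 ℕ.* K) ℕ.* n ℕ.^ 2                             ≡⟨ ℕₚ.*-assoc Z _ _ ⟩
          Z ℕ.* (d ℕ.^ (2 ℕ.* K) ℕ.* n ℕ.^ 2)                           ≤⟨ ℕₚ.*-monoʳ-≤ Z hyp ⟩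
          Z ℕ.* (C ℕ.^ (2 ℕ.* K) ℕ.* n ℕ.^ K)                           ≡⟨ sym (ℕₚ.*-assoc Z _ _) ⟩
          Z ℕ.* C ℕ.^ (2 ℕ.* K) ℕ.* n ℕ.^ K                             ≡⟨ cong (λ y → Z ℕ.* y ℕ.* n ℕ.^ K) (sym (ℕₚ.^-*-assoc C 2 K)) ⟩
          Z ℕ.* (C ℕ.^ 2) ℕ.^ K ℕ.* n ℕ.^ K                             ≡⟨ cong (ℕ._* n ℕ.^ K) (sym (^-distribʳ-* K (M ℕ.* x) (C ℕ.^ 2))) ⟩
          (M ℕ.* x ℕ.* C ℕ.^ 2) ℕ.^ K ℕ.* n ℕ.^ K                       ≡⟨ ℕₚ.*-comm _ (n ℕ.^ K) ⟩
          n ℕ.^ K ℕ.* (M ℕ.* x ℕ.* C ℕ.^ 2) ℕ.^ K                       ∎))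
        (begin
          (M ℕ.* x ℕ.* C ℕ.^ 2) ℕ.^ K                                  ≡⟨ cong (ℕ._^ K) (shift M x (C ℕ.^ 2)) ⟩
          (x ℕ.* c) ℕ.^ K                                              ≤⟨ ℕₚ.^-monoˡ-≤ K (ℕₚ.*-monoˡ-≤ c x≤) ⟩
          (2 ℕ.* (2 ℕ.* K) ℕ.* 2 ℕ.^ q ℕ.* c) ℕ.^ K                     ≡⟨ cong (ℕ._^ K) (swap (2 ℕ.* (2 ℕ.* K)) (2 ℕ.^ q) c) ⟩
          (2 ℕ.* (2 ℕ.* K) ℕ.* c ℕ.* 2 ℕ.^ q) ℕ.^ K                     ≡⟨ ^-distribʳ-* K (2 ℕ.* (2 ℕ.* K) ℕ.* c) (2 ℕ.^ q) ⟩
          Bᵏ ℕ.* Pq                                                    ∎)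
        where
        open ℕₚ.≤-Reasoning
        Z = (M ℕ.* x) ℕ.^ K
        shift : ∀ a b c → a ℕ.* b ℕ.* c ≡ b ℕ.* (a ℕ.* c)
        shift = solve-∀
        swap : ∀ a b c → a ℕ.* b ℕ.* c ≡ a ℕ.* c ℕ.* b
        swap = solve-∀

      growth : M ℕ.* suc (2 ℕ.* l) ℕ.* (d ℕ.* d) ℕ.≤ n
      growth with M ℕ.* suc (2 ℕ.* l) ℕ.* (d ℕ.* d) ℕ.≤? n
      ... | yes p = p
      ... | no p = ⊥-elim (ℕₚ.<-irrefl refl (begin-strict
          b ℕ.* n                                   <⟨ ℕₚ.*-monoˡ-< n {{ℕ.>-nonZero 1≤n}} n≥ ⟩
          n ℕ.* n                                   ≡⟨ cong (n ℕ.*_) (sym (ℕₚ.*-identityʳ n)) ⟩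
          n ℕ.^ 2                                   ≤⟨ ℕₚ.m≤m*n (n ℕ.^ 2) (n ℕ.^ 2) {{ℕₚ.m^n≢0 n 2 {{ℕ.>-nonZero 1≤n}}}} ⟩
          n ℕ.^ 2 ℕ.* n ℕ.^ 2                       ≤⟨ ℕₚ.*-mono-≤ n²≤' n²≤' ⟩
          Bᵏ ℕ.* Pq ℕ.* (Bᵏ ℕ.* Pq)                 ≡⟨ square Bᵏ Pq ⟩
          Bᵏ ℕ.* Bᵏ ℕ.* (Pq ℕ.* Pq)                 ≤⟨ ℕₚ.*-monoʳ-≤ (Bᵏ ℕ.* Bᵏ) Pq² ⟩
          Bᵏ ℕ.* Bᵏ ℕ.* (2 ℕ.* n)                   ≡⟨ double (Bᵏ ℕ.* Bᵏ) n ⟩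
          b ℕ.* n                                   ∎))
        where
        open ℕₚ.≤-Reasoning
        b = 2 ℕ.* (Bᵏ ℕ.* Bᵏ)
        n²≤' = n²≤ (ℕₚ.<⇒≤ (ℕₚ.≰⇒> p))
        square : ∀ a b → a ℕ.* b ℕ.* (a ℕ.* b) ≡ a ℕ.* a ℕ.* (b ℕ.* b)
        square = solve-∀
        double : ∀ a n → a ℕ.* (2 ℕ.* n) ≡ 2 ℕ.* a ℕ.* n
        double = solve-∀

  module Regular-graphs (n d : ℕ) where

    open Pairs n public

    -- Regular graphs containing a given edge set

    Graph : Set
    Graph = EdgeSet n

    opaque
      Y : Graph → Fin n → Fin n → ℚ
      Y G = lift (λ q → 𝟙 (lookup G q))

    -- Closed adjacency. The unit diagonal lets a single factor `# 1 - Ȳ` exclude both an edge and a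
    -- coincidence of vertices, so that sums over switchings can run over all `k` and `l`.
    Ȳ : Graph → Fin n → Fin n → ℚ
    Ȳ G i j = Y G i j + δ i j

    X : Graph → Graph → Fin n → Fin n → ℚ
    X E G i j = Y G i j - Y E i j

    opaque
      D : Graph → Fin n → ℚ
      D E i = # d - ∑ Vs (Y E i)

    vol : Graph → ℚ
    vol E = ∑ Vs (D E)

    Regular : Graph → Set
    Regular G = ∀ i → ∑ Vs (Y G i) ≡ # d

    opaque
      unfolding Y

      row : ∀ G i → ∑ Vs (Y G i) ≡ # (deg {n} G i)
      row G i = trans (lift-row _ i) (sym (#-deg G i))

    isRegular⇒ : ∀ G → isRegular {n} d G ≡ true → Regular G
    isRegular⇒ G h i = trans (row G i) (cong # (ℕₚ.≡ᵇ⇒≡ _ d (≡true⇒T (all⇒ _ (allFin n) h (∈-allFin i)))))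

    ⇒isRegular : ∀ G → Regular G → isRegular {n} d G ≡ true
    ⇒isRegular G h = ⇒all _ (allFin n) (λ i → T⇒≡true (ℕₚ.≡⇒≡ᵇ _ d (#-injective (trans (sym (row G i)) (h i)))))

    record Ext (E G : Graph) : Set where
      constructor mkExt
      field
        reg : Regular G
        sub : E ⊆ G
    open Ext public

    inᵇ : Graph → Graph → Bool
    inᵇ E G = isRegular {n} d G ∧ subᵇ E G

    𝓗 : Graph → List Graph
    𝓗 E = filterᵇ (inᵇ E) (allVecs (NP n))

    inᵇ⇒ : ∀ {E G} → inᵇ E G ≡ true → Ext E G
    inᵇ⇒ {E} {G} h = mkExt (isRegular⇒ G (proj₁ (∧-true h))) (subᵇ⇒⊆ E G (proj₂ (∧-true {isRegular {n} d G} h)))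

    ⇒inᵇ : ∀ {E G} → Ext E G → inᵇ E G ≡ true
    ⇒inᵇ {E} {G} e = cong₂ _∧_ (⇒isRegular G (reg e)) (⊆⇒subᵇ E G (sub e))

    𝓗⇒ : ∀ {E G} → G ∈ 𝓗 E → Ext E G
    𝓗⇒ {E} m = inᵇ⇒ (proj₂ (∈-filterᵇ⁻ (inᵇ E) (allVecs (NP n)) m))

    ⇒𝓗 : ∀ {E G} → Ext E G → G ∈ 𝓗 E
    ⇒𝓗 {E} {G} e = Mₚ.∈-filter⁺ (T? ∘ inᵇ E) (∈-allVecs G) (≡true⇒T (⇒inᵇ e))

    ∑-𝓗 : ∀ E f → ∑ (𝓗 E) f ≡ ∑ (allVecs (NP n)) (λ G → 𝟙 (inᵇ E G) * f G)
    ∑-𝓗 E f = ∑-filter (inᵇ E) (allVecs (NP n)) f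

    ∑𝓗-mono : ∀ E {f g : Graph → ℚ} → (∀ G → Ext E G → f G ≤ g G) → ∑ (𝓗 E) f ≤ ∑ (𝓗 E) g
    ∑𝓗-mono E h = ∑-mono∈ (𝓗 E) (λ {G} m → h G (𝓗⇒ m))

    ∑𝓗-cong : ∀ E {f g : Graph → ℚ} → (∀ G → Ext E G → f G ≡ g G) → ∑ (𝓗 E) f ≡ ∑ (𝓗 E) g
    ∑𝓗-cong E h = ∑-cong∈ (𝓗 E) (λ {G} m → h G (𝓗⇒ m))

    ∑𝓗-nonneg : ∀ E {f : Graph → ℚ} → (∀ G → Ext E G → # 0 ≤ f G) → # 0 ≤ ∑ (𝓗 E) f
    ∑𝓗-nonneg E h = ∑-nonneg∈ (𝓗 E) (λ {G} m → h G (𝓗⇒ m))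

    opaque
      unfolding Y

      Y-sym : ∀ G i j → Y G i j ≡ Y G j i
      Y-sym G i j = lift-sym _ i j

    Ȳ-sym : ∀ G i j → Ȳ G i j ≡ Ȳ G j i
    Ȳ-sym G i j = cong₂ _+_ (Y-sym G i j) (δ-sym i j)

    X-sym : ∀ E G i j → X E G i j ≡ X E G j i
    X-sym E G i j = cong₂ _-_ (Y-sym G i j) (Y-sym E i j)

    opaque
      unfolding Y

      Y-diag : ∀ G i → Y G i i ≡ # 0
      Y-diag G i = lift-diag _ i

    X-diag : ∀ E G i → X E G i i ≡ # 0
    X-diag E G i = trans (cong₂ _-_ (Y-diag G i) (Y-diag E i)) (solve 0 (κ 0 :- κ 0 := κ 0) refl)

    Ȳ-diag : ∀ G i → Ȳ G i i ≡ # 1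
    Ȳ-diag G i = trans (cong₂ _+_ (Y-diag G i) (δ-refl i)) (Rq.+-identityˡ (# 1))

    Ȳ-off : ∀ G {i j} → i ≢ j → Ȳ G i j ≡ Y G i j
    Ȳ-off G {i} {j} ne = trans (cong (Y G i j +_) (δ-≢ ne)) (Rq.+-identityʳ _)

    opaque
      unfolding Y

      Y-joins : ∀ G {q i j} → Joins q i j → Y G i j ≡ 𝟙 (lookup G q)
      Y-joins G x = lift-joins _ x

    Xᵇ : Graph → Graph → P → Bool
    Xᵇ E G q = lookup G q ∧ not (lookup E q)

    Xq : Graph → Graph → P → ℚ
    Xq E G q = 𝟙 (lookup G q) - 𝟙 (lookup E q)

    X-joins : ∀ E G {q i j} → Joins q i j → X E G i j ≡ Xq E G q
    X-joins E G x = cong₂ _-_ (Y-joins G x) (Y-joins E x)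

    Xq-Xᵇ : ∀ {E G} → E ⊆ G → ∀ q → Xq E G q ≡ 𝟙 (Xᵇ E G q)
    Xq-Xᵇ {E} {G} s q with lookup G q in g | lookup E q in e
    ... | true | true = solve 0 (κ 1 :- κ 1 := κ 0) refl
    ... | true | false = solve 0 (κ 1 :- κ 0 := κ 1) refl
    ... | false | false = solve 0 (κ 0 :- κ 0 := κ 0) refl
    ... | false | true with () ← trans (sym g) (at s q e)

    data Bit : ℚ → Set where
      b0 : Bit (# 0)
      b1 : Bit (# 1)

    𝟙-bit : ∀ b → Bit (𝟙 b)
    𝟙-bit true = b1
    𝟙-bit false = b0

    Y-bit : ∀ G i j → Bit (Y G i j)
    Y-bit G i j with i F.≟ j
    ... | yes refl = subst Bit (sym (Y-diag G i)) b0
    ... | no ne = subst Bit (sym (Y-joins G (ix-joins i j ne))) (𝟙-bit (lookup G (ix i j ne)))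

    Ȳ-bit : ∀ G i j → Bit (Ȳ G i j)
    Ȳ-bit G i j with i F.≟ j
    ... | yes refl = subst Bit (sym (Ȳ-diag G i)) b1
    ... | no ne = subst Bit (sym (Ȳ-off G ne)) (Y-bit G i j)

    X-bit : ∀ {E G} → E ⊆ G → ∀ i j → Bit (X E G i j)
    X-bit {E} {G} s i j with i F.≟ j
    ... | yes refl = subst Bit (sym (X-diag E G i)) b0
    ... | no ne = subst Bit (sym (trans (X-joins E G (ix-joins i j ne)) (Xq-Xᵇ s _))) (𝟙-bit (Xᵇ E G (ix i j ne)))

    bit-0≤ : ∀ {x} → Bit x → # 0 ≤ x
    bit-0≤ b0 = ≤-refl
    bit-0≤ b1 = 0≤1

    bit-≤1 : ∀ {x} → Bit x → x ≤ # 1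
    bit-≤1 b0 = 0≤1
    bit-≤1 b1 = ≤-refl

    bit-sq : ∀ {x} → Bit x → x * x ≡ x
    bit-sq b0 = Rq.zeroˡ (# 0)
    bit-sq b1 = Rq.*-identityˡ (# 1)

    bit-absorb : ∀ {x y} → Bit x → Bit y → x ≤ y → x * y ≡ x
    bit-absorb b0 _ _ = Rq.zeroˡ _
    bit-absorb b1 b1 _ = Rq.*-identityˡ (# 1)
    bit-absorb b1 b0 p = ⊥-elim (<-irrefl refl (<-≤-trans 0<1 p))

    0≤Y : ∀ G i j → # 0 ≤ Y G i j
    0≤Y G i j = bit-0≤ (Y-bit G i j)

    0≤Ȳ : ∀ G i j → # 0 ≤ Ȳ G i j
    0≤Ȳ G i j = bit-0≤ (Ȳ-bit G i j)

    0≤X : ∀ {E G} → E ⊆ G → ∀ i j → # 0 ≤ X E G i j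
    0≤X s i j = bit-0≤ (X-bit s i j)

    X≤Ȳ : ∀ E G i j → X E G i j ≤ Ȳ G i j
    X≤Ȳ E G i j = ≤-by (Y E i j + δ i j) (0≤+ (0≤Y E i j) (0≤δ i j))
      (solve 3 (λ y e d → y :+ d :- (y :- e) := e :+ d) refl (Y G i j) (Y E i j) (δ i j))

    X*Ȳ : ∀ {E G} → E ⊆ G → ∀ i j → X E G i j * Ȳ G i j ≡ X E G i j
    X*Ȳ {E} {G} s i j = bit-absorb (X-bit s i j) (Ȳ-bit G i j) (X≤Ȳ E G i j)

    opaque
      unfolding D

      X-row : ∀ {E G} → Ext E G → ∀ i → ∑ Vs (X E G i) ≡ D E i
      X-row {E} e i = trans (∑-- Vs _ _) (cong (_- ∑ Vs (Y E i)) (reg e i))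

    0≤D : ∀ {E G} → Ext E G → ∀ i → # 0 ≤ D E i
    0≤D e i = subst (# 0 ≤_) (X-row e i) (∑-nonneg Vs (0≤X (sub e) i))

    0≤vol : ∀ {E G} → Ext E G → # 0 ≤ vol E
    0≤vol e = ∑-nonneg Vs (0≤D e)

    opaque
      unfolding inc

      ∑-inc : ∀ q → ∑ Vs (inc q) ≡ # 2
      ∑-inc q = trans (∑-+ Vs _ _) (trans (cong₂ _+_ (∑-δ1 (fst q)) (∑-δ1 (snd q))) (sym (#-+ 1 1)))

      inc-joins : ∀ {q i j} → Joins q i j → ∀ v → inc q v ≡ δ i v + δ j v
      inc-joins (inj₁ (refl , refl)) v = refl
      inc-joins (inj₂ (refl , refl)) v = Rq.+-comm _ _

    add : Graph → P → Graph
    add E q = E [ q ]≔ true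

    opaque
      unfolding Y

      Y-add : ∀ E q a b → Y (add E q) a b ≡ Y E a b + (# 1 - 𝟙 (lookup E q)) * link q a b
      Y-add E q a b = trans (∑-cong Ps (λ r → trans (cong (link r a b *_) (𝟙-add E q r))
          (solve 4 (λ l x c dl → l :* (x :+ c :* dl) := l :* x :+ c :* (dl :* l)) refl (link r a b) (𝟙 (lookup E r)) (# 1 - 𝟙 (lookup E q)) (δ q r))))
        (trans (∑-+ Ps _ _) (cong (Y E a b +_) (trans (∑-*ˡ _ Ps _) (cong ((# 1 - 𝟙 (lookup E q)) *_) (∑-δ q (λ r → link r a b))))))

    opaque
      unfolding D

      D-add : ∀ E q v → D (add E q) v ≡ D E v - (# 1 - 𝟙 (lookup E q)) * inc q v
      D-add E q v = trans (cong (λ z → # d - z) (trans (∑-cong Vs (Y-add E q v)) (trans (∑-+ Vs _ _) (cong (∑ Vs (Y E v) +_)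
          (trans (∑-*ˡ _ Vs _) (cong ((# 1 - 𝟙 (lookup E q)) *_) (∑-link q v)))))))
        (solve 3 (λ d y z → d :- (y :+ z) := (d :- y) :- z) refl (# d) (∑ Vs (Y E v)) ((# 1 - 𝟙 (lookup E q)) * inc q v))

    vol-add : ∀ E q → vol (add E q) ≡ vol E - (# 1 - 𝟙 (lookup E q)) * # 2
    vol-add E q = trans (∑-cong Vs (D-add E q)) (trans (∑-- Vs _ _) (cong (λ z → vol E - z) (trans (∑-*ˡ _ Vs _) (cong ((# 1 - 𝟙 (lookup E q)) *_) (∑-inc q)))))

    ∑𝓗-add : ∀ E q f → ∑ (𝓗 (add E q)) f ≡ ∑ (𝓗 E) (λ G → 𝟙 (lookup G q) * f G)
    ∑𝓗-add E q f = trans (∑-𝓗 (add E q) f) (trans (∑-cong (allVecs (NP n)) λ G → trans (cong (λ b → 𝟙 (isRegular {n} d G ∧ b) * f G) (subᵇ-add E G q))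
        (trans (cong (λ b → 𝟙 b * f G) (sym (Bₚ.∧-assoc (isRegular {n} d G) (subᵇ E G) (lookup G q)))) (trans (cong (_* f G) (𝟙-∧ (inᵇ E G) (lookup G q)))
        (Rq.*-assoc _ _ _)))) (sym (∑-𝓗 E (λ G → 𝟙 (lookup G q) * f G))))

    -- The degenerate pair i = j adds nothing, in accordance with the diagonal of `Ȳ`. Inserting a
    -- factor `Ȳ G i j` is then always a passage to another state, which is how all joint
    -- frequencies below are estimated.
    ext : Graph → Fin n → Fin n → Graph
    ext E i j with i F.≟ j
    ... | yes _ = E
    ... | no ne = add E (ix i j ne)

    ∑𝓗-ext : ∀ E i j f → ∑ (𝓗 (ext E i j)) f ≡ ∑ (𝓗 E) (λ G → Ȳ G i j * f G)
    ∑𝓗-ext E i j f with i F.≟ j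
    ... | yes refl = ∑-cong (𝓗 E) (λ G → sym (trans (cong (_* f G) (Ȳ-diag G i)) (Rq.*-identityˡ (f G))))
    ... | no ne = trans (∑𝓗-add E (ix i j ne) f) (∑-cong (𝓗 E) (λ G → cong (_* f G) (sym (trans (Ȳ-off G ne) (Y-joins G (ix-joins i j ne))))))

    ⊆-refl : ∀ (E : Graph) → E ⊆ E
    ⊆-refl E = mk⊆ λ q p → p

    ⊆-add : ∀ E q → E ⊆ add E q
    ⊆-add E q = mk⊆ go
      where
      go : ∀ r → lookup E r ≡ true → lookup (add E q) r ≡ true
      go r p with q F.≟ r
      ... | yes refl = Vₚ.lookup∘updateAt q E
      ... | no ne = trans (Vₚ.lookup∘updateAt′ r q (λ e → ne (sym e)) E) p

    ⊆-ext : ∀ E i j → E ⊆ ext E i j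
    ⊆-ext E i j with i F.≟ j
    ... | yes _ = ⊆-refl E
    ... | no ne = ⊆-add E (ix i j ne)

    Ext-⊆ : ∀ {E E' G} → E ⊆ E' → Ext E' G → Ext E G
    Ext-⊆ s e = mkExt (reg e) (mk⊆ λ q p → at (sub e) q (at s q p))

    bit-comp : ∀ b → # 0 ≤ # 1 - 𝟙 b
    bit-comp b = ≤⇒0≤- (bit-≤1 (𝟙-bit b))

    opaque
      unfolding inc

      0≤inc : ∀ q v → # 0 ≤ inc q v
      0≤inc q v = 0≤+ (0≤δ (fst q) v) (0≤δ (snd q) v)

    D-ext-≥ : ∀ E i j v → D E v - (# 1 - Ȳ E i j) * (δ i v + δ j v) ≤ D (ext E i j) v
    D-ext-≥ E i j v with i F.≟ j
    ... | yes refl = ≤-reflexive (trans (cong (λ z → D E v - (# 1 - z) * (δ i v + δ i v)) (Ȳ-diag E i)) (solve 2 (λ a b → a :- (κ 1 :- κ 1) :* b := a) refl (D E v) _))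
    ... | no ne = ≤-reflexive (trans (cong₂ (λ y z → D E v - (# 1 - y) * z) (trans (Ȳ-off E ne) (Y-joins E (ix-joins i j ne))) (sym (inc-joins (ix-joins i j ne) v))) (sym (D-add E (ix i j ne) v)))

    vol-ext-≥ : ∀ E i j → vol E - # 2 ≤ vol (ext E i j)
    vol-ext-≥ E i j with i F.≟ j
    ... | yes _ = ≤-by (# 2) (0≤# 2) (solve 1 (λ v → v :- (v :- κ 2) := κ 2) refl (vol E))
    ... | no ne = ≤-by (# 2 * 𝟙 b) (0≤* (0≤# 2) (0≤𝟙 b)) (trans (cong (λ z → z - (vol E - # 2)) (vol-add E (ix i j ne))) (solve 2 (λ v x → (v :- (κ 1 :- x) :* κ 2) :- (v :- κ 2) := κ 2 :* x) refl (vol E) (𝟙 b)))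
      where b = lookup E (ix i j ne)

    SamePair : Fin n → Fin n → Fin n → Fin n → Set
    SamePair i j a b = (i ≡ a × j ≡ b) ⊎ (i ≡ b × j ≡ a)

    Y-ext-≢ : ∀ E i j a b → ¬ SamePair i j a b → Y (ext E i j) a b ≡ Y E a b
    Y-ext-≢ E i j a b ne with i F.≟ j
    ... | yes _ = refl
    ... | no p = trans (Y-add E (ix i j p) a b) (trans (cong (λ z → Y E a b + (# 1 - 𝟙 (lookup E (ix i j p))) * z) (link-¬joins (go (ix-joins i j p)))) (solve 2 (λ y c → y :+ c :* κ 0 := y) refl (Y E a b) _))
      where
      go : ∀ {q} → Joins q i j → ¬ Joins q a b
      go (inj₁ (refl , refl)) (inj₁ (x , y)) = ne (inj₁ (x , y))
      go (inj₁ (refl , refl)) (inj₂ (x , y)) = ne (inj₂ (x , y))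
      go (inj₂ (refl , refl)) (inj₁ (x , y)) = ne (inj₂ (y , x))
      go (inj₂ (refl , refl)) (inj₂ (x , y)) = ne (inj₁ (y , x))

    X-ext-≢ : ∀ E i j G a b → ¬ SamePair i j a b → X (ext E i j) G a b ≡ X E G a b
    X-ext-≢ E i j G a b ne = cong (λ z → Y G a b - z) (Y-ext-≢ E i j a b ne)

    joins-≡ : ∀ {q q' i j a b} → Joins q i j → Joins q' a b → q ≡ q' → SamePair i j a b
    joins-≡ (inj₁ (refl , refl)) (inj₁ (x , y)) refl = inj₁ (x , y)
    joins-≡ (inj₁ (refl , refl)) (inj₂ (x , y)) refl = inj₂ (x , y)
    joins-≡ (inj₂ (refl , refl)) (inj₁ (x , y)) refl = inj₂ (y , x)
    joins-≡ (inj₂ (refl , refl)) (inj₂ (x , y)) refl = inj₁ (y , x)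

    -- Switchings: replace the edges ij, kl of G by ik, jl.
    swᵇ : Graph → P → P → P → P → Graph → Bool
    swᵇ E ij ik kl jl G = (Xᵇ E G ij ∧ not (lookup G ik)) ∧ (Xᵇ E G kl ∧ not (lookup G jl))

    opaque
      unfolding Y

      row-flip : ∀ q G v → ∑ Vs (Y (flip q G) v) ≡ ∑ Vs (Y G v) + (# 1 - # 2 * 𝟙 (lookup G q)) * inc q v
      row-flip q G v = trans (lift-row _ v) (trans (∑-cong Ps (λ r → trans (cong (inc r v *_) (𝟙-flip G q r))
          (solve 4 (λ l x c dl → l :* (x :+ c :* dl) := l :* x :+ c :* (dl :* l)) refl (inc r v) (𝟙 (lookup G r)) (# 1 - # 2 * 𝟙 (lookup G q)) (δ q r))))
        (trans (∑-+ Ps _ _) (cong₂ _+_ (sym (lift-row _ v)) (trans (∑-*ˡ _ Ps _) (cong ((# 1 - # 2 * 𝟙 (lookup G q)) *_) (∑-δ q (λ r → inc r v)))))))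

    row-flip-on : ∀ {q G} v → lookup G q ≡ true → ∑ Vs (Y (flip q G) v) ≡ ∑ Vs (Y G v) - inc q v
    row-flip-on {q} {G} v e = trans (row-flip q G v) (trans (cong (λ b → ∑ Vs (Y G v) + (# 1 - # 2 * 𝟙 b) * inc q v) e)
      (solve 2 (λ s i → s :+ (κ 1 :- κ 2 :* κ 1) :* i := s :- i) refl (∑ Vs (Y G v)) (inc q v)))

    row-flip-off : ∀ {q G} v → lookup G q ≡ false → ∑ Vs (Y (flip q G) v) ≡ ∑ Vs (Y G v) + inc q v
    row-flip-off {q} {G} v e = trans (row-flip q G v) (trans (cong (λ b → ∑ Vs (Y G v) + (# 1 - # 2 * 𝟙 b) * inc q v) e)
      (solve 2 (λ s i → s :+ (κ 1 :- κ 2 :* κ 0) :* i := s :+ i) refl (∑ Vs (Y G v)) (inc q v)))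

    module Switch (E : Graph) {ij ik kl jl : P} {i j k l : Fin n}
      (Jij : Joins ij i j) (Jik : Joins ik i k) (Jkl : Joins kl k l) (Jjl : Joins jl j l)
      (i≢k : i ≢ k) (i≢l : i ≢ l) (j≢k : j ≢ k) (j≢l : j ≢ l) where

      σ : Graph → Graph
      σ G = flip jl (flip kl (flip ik (flip ij G)))

      ij≢ik : ij ≢ ik
      ij≢ik e with joins-≡ Jij Jik e
      ... | inj₁ (_ , x) = j≢k x
      ... | inj₂ (x , _) = i≢k x
      ij≢kl : ij ≢ kl
      ij≢kl e with joins-≡ Jij Jkl e
      ... | inj₁ (x , _) = i≢k x
      ... | inj₂ (x , _) = i≢l x
      ij≢jl : ij ≢ jl
      ij≢jl e with joins-≡ Jij Jjl e
      ... | inj₁ (_ , x) = j≢l x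
      ... | inj₂ (x , _) = i≢l x
      ik≢kl : ik ≢ kl
      ik≢kl e with joins-≡ Jik Jkl e
      ... | inj₁ (x , _) = i≢k x
      ... | inj₂ (x , _) = i≢l x
      ik≢jl : ik ≢ jl
      ik≢jl e with joins-≡ Jik Jjl e
      ... | inj₁ (_ , x) = joins-≢ Jkl x
      ... | inj₂ (x , _) = i≢l x
      kl≢jl : kl ≢ jl
      kl≢jl e with joins-≡ Jkl Jjl e
      ... | inj₁ (x , _) = j≢k (sym x)
      ... | inj₂ (x , _) = joins-≢ Jkl x

      -- Each of the four vertices lies on one removed and one inserted edge, so degrees are kept,
      -- and the removed edges lie outside `E`. The target condition is the original one with `j`
      -- and `k` exchanged.
      σ-sound : ∀ G → (inᵇ E G ∧ swᵇ E ij ik kl jl G) ≡ true → (inᵇ E (σ G) ∧ swᵇ E ik ij jl kl (σ G)) ≡ true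
      σ-sound G h = cong₂ _∧_ (⇒inᵇ {E} {σ G} (mkExt regσ (mk⊆ subσ))) (cong₂ _∧_ (cong₂ _∧_ (cong₂ _∧_ σik (cong not Eik)) (cong not σij)) (cong₂ _∧_ (cong₂ _∧_ σjl (cong not Ejl)) (cong not σkl)))
        where
        e : Ext E G
        e = inᵇ⇒ (proj₁ (∧-true h))
        h' = ∧-true {Xᵇ E G ij ∧ not (lookup G ik)} (proj₂ (∧-true {inᵇ E G} h))
        h₁ = ∧-true {Xᵇ E G ij} (proj₁ h')
        h₂ = ∧-true {Xᵇ E G kl} (proj₂ h')
        Gij : lookup G ij ≡ true
        Gij = proj₁ (∧-true (proj₁ h₁))
        Eij : lookup E ij ≡ false
        Eij = not-true (proj₂ (∧-true {lookup G ij} (proj₁ h₁)))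
        Gik : lookup G ik ≡ false
        Gik = not-true (proj₂ h₁)
        Gkl : lookup G kl ≡ true
        Gkl = proj₁ (∧-true (proj₁ h₂))
        Ekl : lookup E kl ≡ false
        Ekl = not-true (proj₂ (∧-true {lookup G kl} (proj₁ h₂)))
        Gjl : lookup G jl ≡ false
        Gjl = not-true (proj₂ h₂)
        off : ∀ {q} → lookup G q ≡ false → lookup E q ≡ false
        off {q} g = ¬true (λ x → true≢false (trans (sym (at (sub e) q x)) g))
          where true≢false : true ≢ false
                true≢false ()
        Eik = off Gik
        Ejl = off Gjl
        G₁ = flip ij G
        G₂ = flip ik G₁
        G₃ = flip kl G₂
        G₁ik : lookup G₁ ik ≡ false
        G₁ik = trans (lookup-flip-≢ ij≢ik G) Gik
        G₂kl : lookup G₂ kl ≡ true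
        G₂kl = trans (lookup-flip-≢ ik≢kl G₁) (trans (lookup-flip-≢ ij≢kl G) Gkl)
        G₃jl : lookup G₃ jl ≡ false
        G₃jl = trans (lookup-flip-≢ kl≢jl G₂) (trans (lookup-flip-≢ ik≢jl G₁) (trans (lookup-flip-≢ ij≢jl G) Gjl))
        σjl : lookup (σ G) jl ≡ true
        σjl = trans (lookup-flip jl G₃) (cong not G₃jl)
        σkl : lookup (σ G) kl ≡ false
        σkl = trans (lookup-flip-≢ (λ x → kl≢jl (sym x)) G₃) (trans (lookup-flip kl G₂) (cong not G₂kl))
        σik : lookup (σ G) ik ≡ true
        σik = trans (lookup-flip-≢ (λ x → ik≢jl (sym x)) G₃) (trans (lookup-flip-≢ (λ x → ik≢kl (sym x)) G₂) (trans (lookup-flip ik G₁) (cong not G₁ik)))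
        σij : lookup (σ G) ij ≡ false
        σij = trans (lookup-flip-≢ (λ x → ij≢jl (sym x)) G₃) (trans (lookup-flip-≢ (λ x → ij≢kl (sym x)) G₂)
          (trans (lookup-flip-≢ (λ x → ij≢ik (sym x)) G₁) (trans (lookup-flip ij G) (cong not Gij))))
        regσ : Regular (σ G)
        regσ v = trans (row-flip-off v G₃jl) (trans (cong (_+ inc jl v) (trans (row-flip-on v G₂kl) (cong (_- inc kl v) (trans (row-flip-off v G₁ik)
          (cong (_+ inc ik v) (trans (row-flip-on v Gij) (cong (_- inc ij v) (reg e v))))))))
          (trans (cong₂ (λ a b → # d - a + inc ik v - b + inc jl v) (inc-joins Jij v) (inc-joins Jkl v)) (trans (cong₂ (λ a b → # d - (δ i v + δ j v) + a - (δ k v + δ l v) + b) (inc-joins Jik v) (inc-joins Jjl v))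
          (solve 5 (λ d i j k l → d :- (i :+ j) :+ (i :+ k) :- (k :+ l) :+ (j :+ l) := d) refl (# d) (δ i v) (δ j v) (δ k v) (δ l v)))))
        subσ : ∀ q → lookup E q ≡ true → lookup (σ G) q ≡ true
        subσ q p with jl F.≟ q
        ... | yes refl = σjl
        ... | no n₁ with kl F.≟ q
        ... | yes refl with () ← trans (sym p) Ekl
        ... | no n₂ with ik F.≟ q
        ... | yes refl = σik
        ... | no n₃ with ij F.≟ q
        ... | yes refl with () ← trans (sym p) Eij
        ... | no n₄ = trans (lookup-flip-≢ n₁ G₃) (trans (lookup-flip-≢ n₂ G₂) (trans (lookup-flip-≢ n₃ G₁) (trans (lookup-flip-≢ n₄ G) (at (sub e) q p))))

      -- `σ` is a composition of flips, so it permutes all 0-1 vectors, and it carries one counted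
      -- set into the other. The converse inequality in `sw-distinct` is the same statement with `j`
      -- and `k` exchanged.
      sw-≤ : ∑ (𝓗 E) (λ G → 𝟙 (swᵇ E ij ik kl jl G)) ≤ ∑ (𝓗 E) (λ G → 𝟙 (swᵇ E ik ij jl kl G))
      sw-≤ = subst₂ _≤_ (sym (eq ij ik kl jl)) (trans σ-inv (sym (eq ik ij jl kl))) (∑-mono (allVecs (NP n)) (λ G → 𝟙-mono (σ-sound G)))
        where
        eq : ∀ a b c e → ∑ (𝓗 E) (λ G → 𝟙 (swᵇ E a b c e G)) ≡ ∑ (allVecs (NP n)) (λ G → 𝟙 (inᵇ E G ∧ swᵇ E a b c e G))
        eq a b c e = trans (∑-𝓗 E _) (∑-cong (allVecs (NP n)) (λ G → sym (𝟙-∧ (inᵇ E G) (swᵇ E a b c e G))))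
        f : Graph → ℚ
        f G = 𝟙 (inᵇ E G ∧ swᵇ E ik ij jl kl G)
        σ-inv : ∑ (allVecs (NP n)) (λ G → f (σ G)) ≡ ∑ (allVecs (NP n)) f
        σ-inv = trans (∑-flip ij (λ G → f (flip jl (flip kl (flip ik G))))) (trans (∑-flip ik (λ G → f (flip jl (flip kl G)))) (trans (∑-flip kl (λ G → f (flip jl G))) (∑-flip jl f)))

    swQ : Graph → (i j k l : Fin n) → Graph → ℚ
    swQ E i j k l G = (X E G i j * (# 1 - Y G i k)) * (X E G k l * (# 1 - Y G j l))

    𝟙-not : ∀ b → 𝟙 (not b) ≡ # 1 - 𝟙 b
    𝟙-not true = solve 0 (κ 0 := κ 1 :- κ 1) refl
    𝟙-not false = solve 0 (κ 1 := κ 1 :- κ 0) refl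

    swQ-swᵇ : ∀ {E G} → E ⊆ G → ∀ {ij ik kl jl i j k l} → Joins ij i j → Joins ik i k → Joins kl k l → Joins jl j l → swQ E i j k l G ≡ 𝟙 (swᵇ E ij ik kl jl G)
    swQ-swᵇ {E} {G} s {ij} {ik} {kl} {jl} Jij Jik Jkl Jjl = trans (cong₂ _*_ (half Jij Jik) (half Jkl Jjl)) (sym (𝟙-∧ (Xᵇ E G ij ∧ not (lookup G ik)) _))
      where
      half : ∀ {p q a b c e} → Joins p a b → Joins q c e → X E G a b * (# 1 - Y G c e) ≡ 𝟙 (Xᵇ E G p ∧ not (lookup G q))
      half {p} {q} x y = trans (cong₂ _*_ (trans (X-joins E G x) (Xq-Xᵇ s p)) (trans (cong (λ z → # 1 - z) (Y-joins G y)) (sym (𝟙-not (lookup G q))))) (sym (𝟙-∧ (Xᵇ E G p) _))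

    sw-distinct : ∀ E {i j k l} → i ≢ j → i ≢ k → i ≢ l → j ≢ k → j ≢ l → k ≢ l → ∑ (𝓗 E) (swQ E i j k l) ≡ ∑ (𝓗 E) (swQ E i k j l)
    sw-distinct E {i} {j} {k} {l} ij ik il jk jl kl = ≤-antisym (go i j k l ij ik il jk jl kl) (go i k j l ik ij il (λ e → jk (sym e)) kl jl)
      where
      go : ∀ i j k l → i ≢ j → i ≢ k → i ≢ l → j ≢ k → j ≢ l → k ≢ l → ∑ (𝓗 E) (swQ E i j k l) ≤ ∑ (𝓗 E) (swQ E i k j l)
      go i j k l ij ik il jk jl kl = subst₂ _≤_ (sym (∑𝓗-cong E (λ G e → swQ-swᵇ (sub e) Jij Jik Jkl Jjl))) (sym (∑𝓗-cong E (λ G e → swQ-swᵇ (sub e) Jik Jij Jjl Jkl)))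
          (Switch.sw-≤ E Jij Jik Jkl Jjl ik il jk jl)
        where
        Jij = ix-joins i j ij
        Jik = ix-joins i k ik
        Jkl = ix-joins k l kl
        Jjl = ix-joins j l jl

    -- The switching identity

    ∑∑ : (Fin n → Fin n → ℚ) → ℚ
    ∑∑ f = ∑ Vs (λ k → ∑ Vs (λ l → f k l))

    ∑∑-cong : ∀ {f g} → (∀ k l → f k l ≡ g k l) → ∑∑ f ≡ ∑∑ g
    ∑∑-cong h = ∑-cong Vs (λ k → ∑-cong Vs (h k))

    ∑∑-mono : ∀ {f g} → (∀ k l → f k l ≤ g k l) → ∑∑ f ≤ ∑∑ g
    ∑∑-mono h = ∑-mono Vs (λ k → ∑-mono Vs (h k))

    ∑∑-nonneg : ∀ {f} → (∀ k l → # 0 ≤ f k l) → # 0 ≤ ∑∑ f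
    ∑∑-nonneg h = ∑-nonneg Vs (λ k → ∑-nonneg Vs (h k))

    ∑∑-+ : ∀ f g → ∑∑ (λ k l → f k l + g k l) ≡ ∑∑ f + ∑∑ g
    ∑∑-+ f g = trans (∑-cong Vs (λ k → ∑-+ Vs (f k) (g k))) (∑-+ Vs _ _)

    ∑∑-- : ∀ f g → ∑∑ (λ k l → f k l - g k l) ≡ ∑∑ f - ∑∑ g
    ∑∑-- f g = trans (∑-cong Vs (λ k → ∑-- Vs (f k) (g k))) (∑-- Vs _ _)

    ∑∑-*ˡ : ∀ c f → ∑∑ (λ k l → c * f k l) ≡ c * ∑∑ f
    ∑∑-*ˡ c f = trans (∑-cong Vs (λ k → ∑-*ˡ c Vs (f k))) (∑-*ˡ c Vs _)

    ∑∑-swap : ∀ f → ∑∑ f ≡ ∑∑ (λ k l → f l k)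
    ∑∑-swap f = ∑-swap Vs Vs f

    ∑∑-row : ∀ (a : Fin n → ℚ) (x : Fin n → Fin n → ℚ) → ∑∑ (λ k l → a k * x k l) ≡ ∑ Vs (λ k → a k * ∑ Vs (x k))
    ∑∑-row a x = ∑-cong Vs (λ k → ∑-*ˡ (a k) Vs (x k))

    ∑∑-col : ∀ (b : Fin n → ℚ) (x : Fin n → Fin n → ℚ) → ∑∑ (λ k l → b l * x k l) ≡ ∑ Vs (λ l → b l * ∑ Vs (λ k → x k l))
    ∑∑-col b x = trans (∑∑-swap _) (∑∑-row b (λ l k → x k l))

    ∑-∑∑ : ∀ (xs : List A) (f : A → Fin n → Fin n → ℚ) → ∑ xs (λ G → ∑∑ (f G)) ≡ ∑∑ (λ k l → ∑ xs (λ G → f G k l))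
    ∑-∑∑ xs f = trans (∑-swap xs Vs (λ G k → ∑ Vs (f G k))) (∑-cong Vs (λ k → ∑-swap xs Vs (λ G l → f G k l)))

    N : Graph → ℚ
    N E = ∑ (𝓗 E) (λ _ → # 1)

    F : Graph → Fin n → Fin n → ℚ
    F E i j = ∑ (𝓗 E) (λ G → X E G i j)

    -- Number of residual half-edges at the closed neighbourhood of i in G.
    C : Graph → Graph → Fin n → ℚ
    C E G i = ∑ Vs (λ l → Ȳ G i l * D E l)

    -- Second-order terms of the inclusion-exclusion in the two counts of switchings. `W₁` counts
    -- oriented residual edges kl from the closed neighbourhood of i to that of j; `W₂` counts
    -- residual neighbours k of i and l of j that coincide or are adjacent.
    W₁ W₂ : Graph → Graph → Fin n → Fin n → ℚ
    W₁ E G i j = ∑∑ (λ k l → Ȳ G i k * (Ȳ G j l * X E G k l))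
    W₂ E G i j = ∑∑ (λ k l → X E G i k * (X E G j l * Ȳ G k l))

    0≤N : ∀ E → # 0 ≤ N E
    0≤N E = ∑-nonneg (𝓗 E) (λ _ → 0≤1)

    0≤F : ∀ E i j → # 0 ≤ F E i j
    0≤F E i j = ∑𝓗-nonneg E (λ G e → 0≤X (sub e) i j)

    N-* : ∀ E c → ∑ (𝓗 E) (λ _ → c) ≡ c * N E
    N-* E c = trans (∑-cong (𝓗 E) (λ _ → sym (Rq.*-identityʳ c))) (∑-*ˡ c (𝓗 E) (λ _ → # 1))

    bit-cases : ∀ {x} → Bit x → x ≡ # 0 ⊎ x ≡ # 1
    bit-cases b0 = inj₁ refl
    bit-cases b1 = inj₂ refl

    Y-⊆ : ∀ {E G} → E ⊆ G → ∀ i j → Y E i j ≤ Y G i j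
    Y-⊆ s i j = 0≤-⇒≤ (0≤X s i j)

    Ȳ-⊆ : ∀ {E G} → E ⊆ G → ∀ i j → Ȳ E i j ≤ Ȳ G i j
    Ȳ-⊆ s i j = +-monoˡ (δ i j) (Y-⊆ s i j)

    X-E : ∀ {E G} → E ⊆ G → ∀ {i j} → Y E i j ≡ # 1 → X E G i j ≡ # 0
    X-E {E} {G} s {i} {j} h with bit-cases (X-bit s i j)
    ... | inj₁ e = e
    ... | inj₂ e = ⊥-elim (<-irrefl refl (<-≤-trans 0<1 (≤-by (# 1 - Y G i j) (≤⇒0≤- (bit-≤1 (Y-bit G i j)))
        (trans (cong (λ z → # 0 - z) (sym e)) (trans (cong (λ z → # 0 - (Y G i j - z)) h) (solve 1 (λ y → κ 0 :- (y :- κ 1) := κ 1 :- y) refl (Y G i j)))))))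

    X-free : ∀ {E} G {i j} → Y E i j ≡ # 0 → i ≢ j → X E G i j ≡ Ȳ G i j
    X-free G {i} {j} h ne = trans (cong (λ z → Y G i j - z) h) (trans (solve 1 (λ y → y :- κ 0 := y) refl (Y G i j)) (sym (Ȳ-off G ne)))

    1-1 : ∀ {x} → x ≡ # 1 → # 1 - x ≡ # 0
    1-1 refl = solve 0 (κ 1 :- κ 1 := κ 0) refl

    X*1-Ȳ : ∀ {E G} → E ⊆ G → ∀ i j → X E G i j * (# 1 - Ȳ G i j) ≡ # 0
    X*1-Ȳ {E} {G} s i j = trans (solve 2 (λ x y → x :* (κ 1 :- y) := x :- x :* y) refl (X E G i j) (Ȳ G i j))
      (trans (cong (λ z → X E G i j - z) (X*Ȳ s i j)) (solve 1 (λ x → x :- x := κ 0) refl (X E G i j)))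

    1-X*X : ∀ {E G} → E ⊆ G → ∀ i j → (# 1 - X E G i j) * X E G i j ≡ # 0
    1-X*X {E} {G} s i j = trans (solve 1 (λ x → (κ 1 :- x) :* x := x :- x :* x) refl (X E G i j))
      (trans (cong (λ z → X E G i j - z) (bit-sq (X-bit s i j))) (solve 1 (λ x → x :- x := κ 0) refl (X E G i j)))

    0*ˡ : ∀ {a} b → a ≡ # 0 → a * b ≡ # 0
    0*ˡ b refl = Rq.zeroˡ b

    0*ʳ : ∀ a {b} → b ≡ # 0 → a * b ≡ # 0
    0*ʳ a refl = Rq.zeroʳ a

    -- The degenerate index patterns contribute zero to both sides.
    sw-term : ∀ E {i j} → i ≢ j → Y E i j ≡ # 0 → ∀ k l →
      ∑ (𝓗 E) (λ G → X E G i j * ((# 1 - Ȳ G i k) * ((# 1 - Ȳ G j l) * X E G k l)))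
      ≡ ∑ (𝓗 E) (λ G → (# 1 - X E G i j) * (X E G i k * (X E G j l * (# 1 - Ȳ G k l))))
    sw-term E {i} {j} i≢j h k l = by (i F.≟ k) (j F.≟ l) (j F.≟ k) (i F.≟ l) (k F.≟ l)
      where
      by : Dec (i ≡ k) → Dec (j ≡ l) → Dec (j ≡ k) → Dec (i ≡ l) → Dec (k ≡ l) →
        ∑ (𝓗 E) (λ G → X E G i j * ((# 1 - Ȳ G i k) * ((# 1 - Ȳ G j l) * X E G k l)))
        ≡ ∑ (𝓗 E) (λ G → (# 1 - X E G i j) * (X E G i k * (X E G j l * (# 1 - Ȳ G k l))))
      by (yes refl) _ _ _ _ = ∑𝓗-cong E λ G e → trans (0*ʳ (X E G i j) (0*ˡ _ (1-1 (Ȳ-diag G i)))) (sym (0*ʳ (# 1 - X E G i j) (0*ˡ _ (X-diag E G i))))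
      by (no i≢k) (yes refl) _ _ _ = ∑𝓗-cong E λ G e → trans (0*ʳ (X E G i j) (0*ʳ (# 1 - Ȳ G i k) (0*ˡ _ (1-1 (Ȳ-diag G j))))) (sym (0*ʳ (# 1 - X E G i j) (0*ʳ (X E G i k) (0*ˡ _ (X-diag E G j)))))
      by (no i≢k) (no j≢l) (yes refl) _ _ = ∑𝓗-cong E λ G e → trans (trans (sym (Rq.*-assoc _ _ _)) (0*ˡ _ (X*1-Ȳ (sub e) i j))) (sym (trans (sym (Rq.*-assoc _ _ _)) (0*ˡ _ (1-X*X (sub e) i j))))
      by (no i≢k) (no j≢l) (no j≢k) (yes refl) _ = ∑𝓗-cong E λ G e → trans (solve 4 (λ x a y b → x :* (a :* (y :* b)) := (x :* y) :* (a :* b)) refl (X E G i j) (# 1 - Ȳ G i k) (# 1 - Ȳ G j i) (X E G k i))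
          (trans (0*ˡ _ (trans (cong (λ z → X E G i j * (# 1 - z)) (Ȳ-sym G j i)) (X*1-Ȳ (sub e) i j)))
          (sym (trans (solve 4 (λ x a y b → x :* (a :* (y :* b)) := (x :* y) :* (a :* b)) refl (# 1 - X E G i j) (X E G i k) (X E G j i) (# 1 - Ȳ G k i))
          (0*ˡ _ (trans (cong ((# 1 - X E G i j) *_) (X-sym E G j i)) (1-X*X (sub e) i j))))))
      by (no i≢k) (no j≢l) (no j≢k) (no i≢l) (yes refl) = ∑𝓗-cong E λ G e → trans (0*ʳ (X E G i j) (0*ʳ (# 1 - Ȳ G i k) (0*ʳ (# 1 - Ȳ G j k) (X-diag E G k)))) (sym (0*ʳ (# 1 - X E G i j) (0*ʳ (X E G i k) (0*ʳ (X E G j k) (1-1 (Ȳ-diag G k))))))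
      by (no i≢k) (no j≢l) (no j≢k) (no i≢l) (no k≢l) = trans (∑-cong (𝓗 E) (λ G → trans (cong₂ (λ u v → X E G i j * ((# 1 - u) * ((# 1 - v) * X E G k l))) (Ȳ-off G i≢k) (Ȳ-off G j≢l))
          (solve 4 (λ x y z w → x :* (y :* (z :* w)) := (x :* y) :* (w :* z)) refl (X E G i j) (# 1 - Y G i k) (# 1 - Y G j l) (X E G k l))))
        (trans (sw-distinct E i≢j i≢k i≢l j≢k j≢l k≢l)
        (∑-cong (𝓗 E) (λ G → trans (cong₂ (λ u v → (X E G i k * (# 1 - u)) * (X E G j l * (# 1 - v))) (trans (sym (Ȳ-off G i≢j)) (sym (X-free G h i≢j))) (sym (Ȳ-off G k≢l)))
          (solve 4 (λ x y z w → (y :* x) :* (z :* w) := x :* (y :* (z :* w))) refl (# 1 - X E G i j) (X E G i k) (X E G j l) (# 1 - Ȳ G k l)))))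

    ∑∑-1-1- : ∀ (a b : Fin n → ℚ) (x : Fin n → Fin n → ℚ) → ∑∑ (λ k l → (# 1 - a k) * ((# 1 - b l) * x k l))
      ≡ ∑∑ x - ∑ Vs (λ k → a k * ∑ Vs (x k)) - ∑ Vs (λ l → b l * ∑ Vs (λ k → x k l)) + ∑∑ (λ k l → a k * (b l * x k l))
    ∑∑-1-1- a b x = trans (∑∑-cong (λ k l → solve 3 (λ a b x → (κ 1 :- a) :* ((κ 1 :- b) :* x) := x :- a :* x :- b :* x :+ a :* (b :* x)) refl (a k) (b l) (x k l)))
      (trans (∑∑-+ _ _) (cong (_+ ∑∑ (λ k l → a k * (b l * x k l))) (trans (∑∑-- _ _) (cong₂ _-_ (trans (∑∑-- _ _) (cong (λ z → ∑∑ x - z) (∑∑-row a x))) (∑∑-col b x)))))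

    ∑∑-1- : ∀ (x y : Fin n → ℚ) (z : Fin n → Fin n → ℚ) → ∑∑ (λ k l → x k * (y l * (# 1 - z k l)))
      ≡ ∑ Vs x * ∑ Vs y - ∑∑ (λ k l → x k * (y l * z k l))
    ∑∑-1- x y z = trans (∑∑-cong (λ k l → solve 3 (λ x y z → x :* (y :* (κ 1 :- z)) := x :* y :- x :* (y :* z)) refl (x k) (y l) (z k l)))
      (trans (∑∑-- _ _) (cong (_- ∑∑ (λ k l → x k * (y l * z k l))) (trans (∑∑-row x (λ _ → y)) (∑-*ʳ (∑ Vs y) Vs x))))

    X-col : ∀ {E G} → Ext E G → ∀ l → ∑ Vs (λ k → X E G k l) ≡ D E l
    X-col {E} {G} e l = trans (∑-cong Vs (λ k → X-sym E G k l)) (X-row e l)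

    -- Double counting of the switchings that destroy, respectively create, the edge ij.
    switching : ∀ E {i j} → i ≢ j → Y E i j ≡ # 0 →
      ∑ (𝓗 E) (λ G → X E G i j * (vol E - C E G i - C E G j + W₁ E G i j))
      ≡ ∑ (𝓗 E) (λ G → (# 1 - X E G i j) * (D E i * D E j - W₂ E G i j))
    switching E {i} {j} i≢j h = trans (∑𝓗-cong E (λ G e → trans (cong (X E G i j *_) (sym (left G e))) (sym (∑∑-*ˡ (X E G i j) _))))
      (trans (∑-∑∑ (𝓗 E) _) (trans (∑∑-cong (sw-term E i≢j h)) (trans (sym (∑-∑∑ (𝓗 E) _))
      (∑𝓗-cong E (λ G e → trans (∑∑-*ˡ (# 1 - X E G i j) _) (cong ((# 1 - X E G i j) *_) (right G e)))))))
      where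
      left : ∀ G → Ext E G → ∑∑ (λ k l → (# 1 - Ȳ G i k) * ((# 1 - Ȳ G j l) * X E G k l)) ≡ vol E - C E G i - C E G j + W₁ E G i j
      left G e = trans (∑∑-1-1- (Ȳ G i) (Ȳ G j) (X E G)) (cong (_+ W₁ E G i j) (cong₂ _-_ (cong₂ _-_ (∑-cong Vs (X-row e))
        (∑-cong Vs (λ k → cong (Ȳ G i k *_) (X-row e k)))) (∑-cong Vs (λ l → cong (Ȳ G j l *_) (X-col e l)))))
      right : ∀ G → Ext E G → ∑∑ (λ k l → X E G i k * (X E G j l * (# 1 - Ȳ G k l))) ≡ D E i * D E j - W₂ E G i j
      right G e = trans (∑∑-1- (X E G i) (X E G j) (Ȳ G)) (cong (_- W₂ E G i j) (cong₂ _*_ (X-row e i) (X-row e j)))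

    opaque
      unfolding D

      D-⊆ : ∀ {E E'} → E ⊆ E' → ∀ i → D E' i ≤ D E i
      D-⊆ {E} {E'} s i = ≤-by (∑ Vs (X E E' i)) (∑-nonneg Vs (0≤X s i)) (trans (solve 3 (λ d a b → (d :- a) :- (d :- b) := b :- a) refl (# d) (∑ Vs (Y E i)) (∑ Vs (Y E' i))) (sym (∑-- Vs _ _)))

    -- The bounds range over all completions of `E`. As residual degrees only decrease when edges
    -- are added, they pass to every larger state, so that edge estimates can be applied repeatedly
    -- under conditioning.
    record Good (κ' : ℚ) (E : Graph) : Set where
      constructor mkGood
      field
        C≤ : ∀ {G} → Ext E G → ∀ i → C E G i ≤ κ'
        DD≤ : ∀ {G} → Ext E G → ∀ i j → D E i * D E j ≤ κ'
    open Good public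

    Good-⊆ : ∀ {κ' E E'} → E ⊆ E' → Good κ' E → Good κ' E'
    Good-⊆ s g = mkGood (λ {G} e i → ≤-trans (∑-mono Vs (λ l → *-monoˡ (Ȳ G i l) (0≤Ȳ G i l) (D-⊆ s l))) (C≤ g (Ext-⊆ s e) i))
      (λ e i j → ≤-trans (*-mono (0≤D e i) (0≤D (Ext-⊆ s e) j) (D-⊆ s i) (D-⊆ s j)) (DD≤ g (Ext-⊆ s e) i j))

    0≤C : ∀ {E G} → Ext E G → ∀ i → # 0 ≤ C E G i
    0≤C {E} {G} e i = ∑-nonneg Vs (λ l → 0≤* (0≤Ȳ G i l) (0≤D e l))

    0≤W₁ : ∀ {E G} → Ext E G → ∀ i j → # 0 ≤ W₁ E G i j
    0≤W₁ {E} {G} e i j = ∑∑-nonneg (λ k l → 0≤* (0≤Ȳ G i k) (0≤* (0≤Ȳ G j l) (0≤X (sub e) k l)))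

    0≤W₂ : ∀ {E G} → Ext E G → ∀ i j → # 0 ≤ W₂ E G i j
    0≤W₂ {E} {G} e i j = ∑∑-nonneg (λ k l → 0≤* (0≤X (sub e) i k) (0≤* (0≤X (sub e) j l) (0≤Ȳ G k l)))

    bit-*≤ : ∀ {x y} → Bit x → # 0 ≤ y → x * y ≤ y
    bit-*≤ {y = y} b0 p = subst (_≤ y) (sym (Rq.zeroˡ y)) p
    bit-*≤ {y = y} b1 p = ≤-reflexive (Rq.*-identityˡ y)

    W₁≤C : ∀ {E G} → Ext E G → ∀ i j → W₁ E G i j ≤ C E G i
    W₁≤C {E} {G} e i j = ≤-trans (∑∑-mono (λ k l → *-monoˡ (Ȳ G i k) (0≤Ȳ G i k) (bit-*≤ (Ȳ-bit G j l) (0≤X (sub e) k l))))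
      (≤-reflexive (trans (∑∑-row (Ȳ G i) (X E G)) (∑-cong Vs (λ k → cong (Ȳ G i k *_) (X-row e k)))))

    F-E : ∀ E {i j} → Y E i j ≡ # 1 → F E i j ≡ # 0
    F-E E h = trans (∑𝓗-cong E (λ G e → X-E (sub e) h)) (∑-0 (𝓗 E))

    F-diag : ∀ E i → F E i i ≡ # 0
    F-diag E i = trans (∑-cong (𝓗 E) (λ G → X-diag E G i)) (∑-0 (𝓗 E))

    0≤NDD : ∀ E i j → # 0 ≤ D E i * D E j * N E
    0≤NDD E i j = subst (# 0 ≤_) (N-* E _) (∑𝓗-nonneg E (λ G e → 0≤* (0≤D e i) (0≤D e j)))

    -- In the switching identity `W₁` is dropped on the left, `W₂` and the indicator of ij on the
    -- right. Diagonal pairs and pairs of `E` have frequency 0.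
    F-upper₀ : ∀ {κ' E} → Good κ' E → ∀ i j → F E i j * (vol E - # 2 * κ') ≤ D E i * D E j * N E
    F-upper₀ {κ'} {E} g i j = by (i F.≟ j) (bit-cases (Y-bit E i j))
      where
      lower : ∀ G → Ext E G → X E G i j * (vol E - # 2 * κ') ≤ X E G i j * (vol E - C E G i - C E G j + W₁ E G i j)
      lower G e = *-monoˡ _ (0≤X (sub e) i j) (≤-by ((κ' - C E G i) + (κ' - C E G j) + W₁ E G i j)
        (0≤+ (0≤+ (≤⇒0≤- (C≤ g e i)) (≤⇒0≤- (C≤ g e j))) (0≤W₁ e i j))
        (solve 5 (λ v k a b w → (v :- a :- b :+ w) :- (v :- κ 2 :* k) := (k :- a) :+ (k :- b) :+ w) refl (vol E) κ' (C E G i) (C E G j) (W₁ E G i j)))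
      upper : ∀ G → Ext E G → (# 1 - X E G i j) * (D E i * D E j - W₂ E G i j) ≤ D E i * D E j
      upper G e = ≤-by (X E G i j * (D E i * D E j) + (# 1 - X E G i j) * W₂ E G i j)
        (0≤+ (0≤* (0≤X (sub e) i j) (0≤* (0≤D e i) (0≤D e j))) (0≤* (≤⇒0≤- (bit-≤1 (X-bit (sub e) i j))) (0≤W₂ e i j)))
        (solve 3 (λ x a w → a :- (κ 1 :- x) :* (a :- w) := x :* a :+ (κ 1 :- x) :* w) refl (X E G i j) (D E i * D E j) (W₂ E G i j))
      by : Dec (i ≡ j) → Y E i j ≡ # 0 ⊎ Y E i j ≡ # 1 → F E i j * (vol E - # 2 * κ') ≤ D E i * D E j * N E
      by (yes refl) _ = subst (_≤ D E i * D E i * N E) (sym (trans (cong (_* (vol E - # 2 * κ')) (F-diag E i)) (Rq.zeroˡ _))) (0≤NDD E i i)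
      by (no ne) (inj₂ h) = subst (_≤ D E i * D E j * N E) (sym (trans (cong (_* (vol E - # 2 * κ')) (F-E E h)) (Rq.zeroˡ _))) (0≤NDD E i j)
      by (no ne) (inj₁ h) = ≤-trans (≤-reflexive (sym (∑-*ʳ _ (𝓗 E) _))) (≤-trans (∑𝓗-mono E lower) (≤-trans (≤-reflexive (switching E ne h))
        (≤-trans (∑𝓗-mono E upper) (≤-reflexive (N-* E _)))))

    -- Edge frequencies in a state with bounded neighbourhoods

    Ȳ*1-Ȳ : ∀ {E G} → E ⊆ G → ∀ k l → Ȳ G k l * (# 1 - Ȳ E k l) ≡ X E G k l
    Ȳ*1-Ȳ {E} {G} s k l with k F.≟ l
    ... | yes refl = trans (cong₂ (λ u v → u * (# 1 - v)) (Ȳ-diag G k) (Ȳ-diag E k)) (trans (solve 0 (κ 1 :* (κ 1 :- κ 1) := κ 0) refl) (sym (X-diag E G k)))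
    ... | no ne = trans (cong₂ (λ u v → u * (# 1 - v)) (Ȳ-off G ne) (Ȳ-off E ne)) (trans (solve 2 (λ u v → u :* (κ 1 :- v) := u :- v :* u) refl (Y G k l) (Y E k l))
      (cong (λ z → Y G k l - z) (bit-absorb (Y-bit E k l) (Y-bit G k l) (Y-⊆ s k l))))

    ∑𝓗-X : ∀ E {i k} → Y E i k ≡ # 0 → i ≢ k → ∀ f → ∑ (𝓗 (ext E i k)) f ≡ ∑ (𝓗 E) (λ G → X E G i k * f G)
    ∑𝓗-X E {i} {k} h ne f = trans (∑𝓗-ext E i k f) (∑-cong (𝓗 E) (λ G → cong (_* f G) (sym (X-free G h ne))))

    X-dichotomy : ∀ E i k → (∀ G → Ext E G → X E G i k ≡ # 0) ⊎ (Y E i k ≡ # 0 × i ≢ k)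
    X-dichotomy E i k with i F.≟ k
    ... | yes refl = inj₁ (λ G e → X-diag E G i)
    ... | no ne with bit-cases (Y-bit E i k)
    ... | inj₁ h = inj₂ (h , ne)
    ... | inj₂ h = inj₁ (λ G e → X-E (sub e) h)

    ∑𝓗-X0 : ∀ E {i k} → (∀ G → Ext E G → X E G i k ≡ # 0) → ∀ (f : Graph → ℚ) → ∑ (𝓗 E) (λ G → X E G i k * f G) ≡ # 0
    ∑𝓗-X0 E z f = trans (∑𝓗-cong E (λ G e → 0*ˡ (f G) (z G e))) (∑-0 (𝓗 E))

    r : Graph → Graph → Fin n → ℚ
    r E G i = ∑ Vs (λ k → X E G i k * C E G k)

    module Base (E : Graph) (κ' : ℚ) (g : Good κ' E) (1≤κ : # 1 ≤ κ') (big : # 20 * κ' ≤ vol E) where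

      -- `c` is 1/t with relative error `η`. With v = κ'/t the factor 20 makes (1 + 20 v)(1 - 10 v)
      -- ≥ 1, which absorbs the loss of 10 κ' from `t` in `F-upper`; the hypothesis `big` is just η
      -- ≤ 1.
      t τ η c : ℚ
      t = vol E
      τ = inv t
      η = # 20 * κ' * τ
      c = (# 1 + η) * τ

      0≤κ : # 0 ≤ κ'
      0≤κ = ≤-trans 0≤1 1≤κ

      0<t : # 0 < t
      0<t = <-≤-trans (<-≤-trans (0<#suc 19) (≤-reflexive (sym (Rq.*-identityʳ (# 20))))) (≤-trans (*-monoˡ (# 20) (0≤# 20) 1≤κ) big)

      tτ : t * τ ≡ # 1
      tτ = inv-pos-r 0<t

      0≤τ : # 0 ≤ τ
      0≤τ = 0≤inv (<⇒≤ 0<t)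

      0≤η : # 0 ≤ η
      0≤η = 0≤* (0≤* (0≤# 20) 0≤κ) 0≤τ

      η≤1 : η ≤ # 1
      η≤1 = ≤-trans (*-monoʳ τ 0≤τ big) (≤-reflexive tτ)

      0≤c : # 0 ≤ c
      0≤c = 0≤* (0≤+ 0≤1 0≤η) 0≤τ

      cκ≤η : c * κ' ≤ η
      cκ≤η = ≤-by ((# 18 + (# 1 - η)) * (κ' * τ) + (# 0)) (0≤+ (0≤* (0≤+ (0≤# 18) (≤⇒0≤- η≤1)) (0≤* 0≤κ 0≤τ)) ≤-refl)
        (solve 3 (λ k t h → κ 20 :* k :* t :- (κ 1 :+ h) :* t :* k := (κ 18 :+ (κ 1 :- h)) :* (k :* t) :+ κ 0) refl κ' τ η)

      κτ≤1 : κ' * τ ≤ # 1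
      κτ≤1 = ≤-trans (≤-by (# 19 * (κ' * τ)) (0≤* (0≤# 19) (0≤* 0≤κ 0≤τ)) (solve 2 (λ k t → κ 20 :* k :* t :- k :* t := κ 19 :* (k :* t)) refl κ' τ)) η≤1

      -- States reached from `E` by adding a few edges, `s` bounding the half-edges used up. Since 1
      -- ≤ κ', up to eight lost half-edges cost at most 8 κ', so all these states share the constant
      -- `c`.
      record Near (s : ℕ) (E' : Graph) : Set where
        constructor mkNear
        field
          above : E ⊆ E'
          slack : t - # s ≤ vol E'
      open Near

      near₀ : Near 0 E
      near₀ = mkNear (⊆-refl E) (≤-reflexive (solve 1 (λ v → v :- κ 0 := v) refl t))

      near-ext : ∀ {s E'} i j → Near s E' → Near (2 ℕ.+ s) (ext E' i j)
      near-ext {s} {E'} i j nr = mkNear (mk⊆ (λ q p → at (⊆-ext E' i j) q (at (above nr) q p)))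
        (≤-trans (≤-reflexive (trans (cong (λ z → t - z) (#-+ 2 s)) (solve 2 (λ v s → v :- (κ 2 :+ s) := (v :- s) :- κ 2) refl t (# s))))
          (≤-trans (+-monoˡ (- # 2) (slack nr)) (vol-ext-≥ E' i j)))

      F-upper : ∀ {s E'} → Near s E' → s ℕ.≤ 8 → ∀ a b → F E' a b ≤ c * (D E' a * D E' b * N E')
      F-upper {s} {E'} nr s≤8 a b = ≤-trans (≤-reflexive (sym (Rq.*-identityˡ (F E' a b)))) (≤-trans (*-monoʳ (F E' a b) (0≤F E' a b) one)
        (≤-trans (≤-reflexive (solve 3 (λ c f z → (c :* z) :* f := c :* (f :* z)) refl c (F E' a b) (t - # 10 * κ')))
        (*-monoˡ c 0≤c (≤-trans (*-monoˡ (F E' a b) (0≤F E' a b) room) (F-upper₀ (Good-⊆ (above nr) g) a b)))))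
        where
        one : # 1 ≤ c * (t - # 10 * κ')
        one = ≤-by (# 10 * (κ' * τ) * (# 1 - η)) (0≤* (0≤* (0≤# 10) (0≤* 0≤κ 0≤τ)) (≤⇒0≤- η≤1))
          (trans (cong (λ z → c * (t - # 10 * κ') - z) (sym tτ)) (trans (solve 3 (λ t u k → (κ 1 :+ κ 20 :* k :* u) :* u :* (t :- κ 10 :* k) :- t :* u := κ 20 :* k :* u :* (t :* u) :- κ 10 :* (k :* u) :- κ 10 :* (k :* u) :* (κ 20 :* k :* u)) refl t τ κ')
          (trans (cong (λ z → # 20 * κ' * τ * z - # 10 * (κ' * τ) - # 10 * (κ' * τ) * (# 20 * κ' * τ)) tτ) (solve 2 (λ u k → κ 20 :* k :* u :* κ 1 :- κ 10 :* (k :* u) :- κ 10 :* (k :* u) :* (κ 20 :* k :* u) := κ 10 :* (k :* u) :* (κ 1 :- κ 20 :* k :* u)) refl τ κ'))))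
        room : t - # 10 * κ' ≤ vol E' - # 2 * κ'
        room = ≤-by ((vol E' - (t - # s)) + (# 8 * (κ' - # 1) + (# 8 - # s))) (0≤+ (≤⇒0≤- (slack nr)) (0≤+ (0≤* (0≤# 8) (≤⇒0≤- 1≤κ)) (≤⇒0≤- (#-mono s≤8))))
          (solve 4 (λ v t k s → (v :- κ 2 :* k) :- (t :- κ 10 :* k) := (v :- (t :- s)) :+ (κ 8 :* (k :- κ 1) :+ (κ 8 :- s))) refl (vol E') t κ' (# s))

      F-upper' : ∀ {s E'} E₀ → E₀ ⊆ E' → Near s E' → s ℕ.≤ 8 → ∀ a b → F E' a b ≤ c * (D E₀ a * D E₀ b) * N E'
      F-upper' {s} {E'} E₀ sb nr s≤8 a b = ≤-trans (F-upper nr s≤8 a b) (≤-trans (*-monoˡ c 0≤c (subst₂ _≤_ (N-* E' _) (N-* E' _)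
          (∑𝓗-mono E' (λ G e → *-mono (0≤D e a) (0≤D (Ext-⊆ sb e) b) (D-⊆ sb a) (D-⊆ sb b))))) (≤-reflexive (sym (Rq.*-assoc c _ _))))

      module AtNear {s E'} (nr : Near s E') (s≤4 : s ℕ.≤ 4) where

        -- Conditioning on ik and kl means passing to `E₂`, where the upper bound for jl applies.
        -- The two inequalities keep jl different from the added pairs.
        path : ∀ {i j k} → i ≢ j → j ≢ k → ∀ l → ∑ (𝓗 E') (λ G → X E' G i k * (Ȳ G k l * X E' G j l)) ≤ c * (D E' j * D E' l) * ∑ (𝓗 E') (λ G → X E' G i k * Ȳ G k l)
        path {i} {j} {k} i≢j j≢k l = by (X-dichotomy E' i k)
          where
          E₁ = ext E' i k
          E₂ = ext E₁ k l
          module _ (h : Y E' i k ≡ # 0) (i≢k : i ≢ k) where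
            both : ∀ f → ∑ (𝓗 E₂) f ≡ ∑ (𝓗 E') (λ G → X E' G i k * (Ȳ G k l * f G))
            both f = trans (∑𝓗-ext E₁ k l f) (∑𝓗-X E' h i≢k _)
            ne₁ : ¬ SamePair i k j l
            ne₁ (inj₁ (x , _)) = i≢j x
            ne₁ (inj₂ (_ , x)) = j≢k (sym x)
            ne₂ : ¬ SamePair k l j l
            ne₂ (inj₁ (x , _)) = j≢k (sym x)
            ne₂ (inj₂ (x , y)) = j≢k (sym (trans x y))
            lhs : F E₂ j l ≡ ∑ (𝓗 E') (λ G → X E' G i k * (Ȳ G k l * X E' G j l))
            lhs = trans (∑-cong (𝓗 E₂) (λ G → trans (X-ext-≢ E₁ k l G j l ne₂) (X-ext-≢ E' i k G j l ne₁))) (both _)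
            rhs : N E₂ ≡ ∑ (𝓗 E') (λ G → X E' G i k * Ȳ G k l)
            rhs = trans (both _) (∑-cong (𝓗 E') (λ G → cong (X E' G i k *_) (Rq.*-identityʳ _)))
            main : ∑ (𝓗 E') (λ G → X E' G i k * (Ȳ G k l * X E' G j l)) ≤ c * (D E' j * D E' l) * ∑ (𝓗 E') (λ G → X E' G i k * Ȳ G k l)
            main = subst₂ _≤_ lhs (cong (c * (D E' j * D E' l) *_) rhs) (F-upper' E' (mk⊆ λ q p → at (⊆-ext E₁ k l) q (at (⊆-ext E' i k) q p)) (near-ext k l (near-ext i k nr)) (ℕₚ.+-monoʳ-≤ 4 s≤4) j l)
          by : (∀ G → Ext E' G → X E' G i k ≡ # 0) ⊎ (Y E' i k ≡ # 0 × i ≢ k) → ∑ (𝓗 E') (λ G → X E' G i k * (Ȳ G k l * X E' G j l)) ≤ c * (D E' j * D E' l) * ∑ (𝓗 E') (λ G → X E' G i k * Ȳ G k l)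
          by (inj₁ z) = ≤-reflexive (trans (∑𝓗-X0 E' z _) (sym (0*ʳ _ (∑𝓗-X0 E' z _))))
          by (inj₂ (h , i≢k)) = main h i≢k

        -- Each term is an instance of `path`, except for k = j, where the factor `# 1 - X E' G i j`
        -- annihilates it.
        W₂-upper : ∀ {i j} → i ≢ j → ∑ (𝓗 E') (λ G → (# 1 - X E' G i j) * W₂ E' G i j) ≤ c * D E' j * ∑ (𝓗 E') (λ G → r E' G i)
        W₂-upper {i} {j} i≢j = ≤-trans (≤-reflexive (trans (∑-cong (𝓗 E') (λ G → sym (∑∑-*ˡ (# 1 - X E' G i j) _))) (∑-∑∑ (𝓗 E') _)))
          (≤-trans (∑∑-mono term) (≤-reflexive (trans (∑∑-cong (λ k l → trans (Rq.*-assoc c _ _) (trans (cong (c *_) (Rq.*-assoc (D E' j) _ _)) (trans (sym (Rq.*-assoc c _ _)) (cong (c * D E' j *_) (sym (∑-*ˡ (D E' l) (𝓗 E') _)))))))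
            (trans (∑∑-*ˡ (c * D E' j) _) (cong (c * D E' j *_) (trans (sym (∑-∑∑ (𝓗 E') _)) (∑-cong (𝓗 E') inner)))))))
          where
          inner : ∀ G → ∑∑ (λ k l → D E' l * (X E' G i k * Ȳ G k l)) ≡ r E' G i
          inner G = trans (∑∑-cong (λ k l → solve 3 (λ d x y → d :* (x :* y) := x :* (y :* d)) refl (D E' l) (X E' G i k) (Ȳ G k l))) (∑∑-row (X E' G i) (λ k l → Ȳ G k l * D E' l))
          nonneg : ∀ k l → # 0 ≤ c * (D E' j * D E' l) * ∑ (𝓗 E') (λ G → X E' G i k * Ȳ G k l)
          nonneg k l = subst (# 0 ≤_) (∑-*ˡ _ (𝓗 E') _) (∑𝓗-nonneg E' (λ G e → 0≤* (0≤* 0≤c (0≤* (0≤D e j) (0≤D e l))) (0≤* (0≤X (sub e) i k) (0≤Ȳ G k l))))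
          term : ∀ k l → ∑ (𝓗 E') (λ G → (# 1 - X E' G i j) * (X E' G i k * (X E' G j l * Ȳ G k l))) ≤ c * (D E' j * D E' l) * ∑ (𝓗 E') (λ G → X E' G i k * Ȳ G k l)
          term k l = by (j F.≟ k)
            where
            by : Dec (j ≡ k) → ∑ (𝓗 E') (λ G → (# 1 - X E' G i j) * (X E' G i k * (X E' G j l * Ȳ G k l))) ≤ c * (D E' j * D E' l) * ∑ (𝓗 E') (λ G → X E' G i k * Ȳ G k l)
            by (yes refl) = ≤-trans (≤-reflexive (trans (∑𝓗-cong E' (λ G e → trans (sym (Rq.*-assoc _ _ _)) (0*ˡ _ (1-X*X (sub e) i j)))) (∑-0 (𝓗 E')))) (nonneg j l)
            by (no j≢k) = ≤-trans (∑𝓗-mono E' (λ G e → ≤-by (X E' G i j * (X E' G i k * (Ȳ G k l * X E' G j l)))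
                (0≤* (0≤X (sub e) i j) (0≤* (0≤X (sub e) i k) (0≤* (0≤Ȳ G k l) (0≤X (sub e) j l))))
                (solve 4 (λ x a b y → a :* (y :* b) :- (κ 1 :- x) :* (a :* (b :* y)) := x :* (a :* (y :* b))) refl (X E' G i j) (X E' G i k) (X E' G j l) (Ȳ G k l)))) (path i≢j j≢k l)

        g' : Good κ' E'
        g' = Good-⊆ (above nr) g

        r≤ : ∀ {G} → Ext E' G → ∀ i → r E' G i ≤ κ' * D E' i
        r≤ {G} e i = ≤-trans (∑-mono Vs (λ k → ≤-trans (*-monoˡ _ (0≤X (sub e) i k) (C≤ g' e k)) (≤-reflexive (Rq.*-comm _ κ')))) (≤-reflexive (trans (∑-*ˡ κ' Vs _) (cong (κ' *_) (X-row e i))))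

        vol≤ : vol E' ≤ t
        vol≤ = ∑-mono Vs (D-⊆ (above nr))

        -- Uses (1 - 20v)(1 + v) ≤ 1 - 2v with v = κ/t.
        F-lower : ∀ {a b} → a ≢ b → Y E' a b ≡ # 0 → (# 1 - η) * τ * (D E' a * D E' b * N E') ≤ F E' a b
        F-lower {a} {b} ne h = *-cancelˡ (t + κ') (0<+ 0<t 0≤κ) (≤-trans (≤-by (# 17 * (κ' * τ) * R + # 20 * ((κ' * τ) * (κ' * τ)) * R + (κ' * τ) * (# 1 - η) * R) nn eqA) stepB)
          where
          R = D E' a * D E' b * N E'
          f = F E' a b
          0≤R = 0≤NDD E' a b
          nn : # 0 ≤ # 17 * (κ' * τ) * R + # 20 * ((κ' * τ) * (κ' * τ)) * R + (κ' * τ) * (# 1 - η) * R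
          nn = 0≤+ (0≤+ (0≤* (0≤* (0≤# 17) (0≤* 0≤κ 0≤τ)) 0≤R) (0≤* (0≤* (0≤# 20) (0≤sq (κ' * τ))) 0≤R)) (0≤* (0≤* (0≤* 0≤κ 0≤τ) (≤⇒0≤- η≤1)) 0≤R)
          eqA : (R - c * κ' * R) - (t + κ') * ((# 1 - η) * τ * R) ≡ # 17 * (κ' * τ) * R + # 20 * ((κ' * τ) * (κ' * τ)) * R + (κ' * τ) * (# 1 - η) * R
          eqA = trans (solve 4 (λ t u k R → (R :- (κ 1 :+ κ 20 :* k :* u) :* u :* k :* R) :- (t :+ k) :* ((κ 1 :- κ 20 :* k :* u) :* u :* R) := (R :- (κ 1 :+ κ 20 :* k :* u) :* u :* k :* R) :- ((t :* u) :+ k :* u) :* ((κ 1 :- κ 20 :* k :* u) :* R)) refl t τ κ' R)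
            (trans (cong (λ z → (R - (# 1 + η) * τ * κ' * R) - (z + κ' * τ) * ((# 1 - η) * R)) tτ)
            (solve 3 (λ u k R → (R :- (κ 1 :+ κ 20 :* k :* u) :* u :* k :* R) :- (κ 1 :+ k :* u) :* ((κ 1 :- κ 20 :* k :* u) :* R) := κ 17 :* (k :* u) :* R :+ κ 20 :* ((k :* u) :* (k :* u)) :* R :+ (k :* u) :* (κ 1 :- κ 20 :* k :* u) :* R) refl τ κ' R))
          β = ∑ (𝓗 E') (λ G → (# 1 - X E' G a b) * W₂ E' G a b)
          β≤ : β ≤ c * κ' * R
          β≤ = ≤-trans (W₂-upper ne) (≤-trans (≤-reflexive (sym (∑-*ˡ _ (𝓗 E') _))) (≤-trans (∑𝓗-mono E' (λ G e → *-monoˡ _ (0≤* 0≤c (0≤D e b)) (r≤ e a))) (≤-reflexive (trans (N-* E' _) (solve 5 (λ c k x y N → c :* y :* (k :* x) :* N := c :* k :* (x :* y :* N)) refl c κ' (D E' a) (D E' b) (N E'))))))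
          low : R - D E' a * D E' b * f - β ≤ f * vol E'
          low = ≤-trans (≤-reflexive (trans (sym sums) (sym (switching E' ne h)))) (≤-trans (∑𝓗-mono E' (λ G e → *-monoˡ _ (0≤X (sub e) a b) (≤-by ((C E' G a - W₁ E' G a b) + C E' G b)
              (0≤+ (≤⇒0≤- (W₁≤C e a b)) (0≤C e b)) (solve 4 (λ v x y w → v :- (v :- x :- y :+ w) := (x :- w) :+ y) refl (vol E') (C E' G a) (C E' G b) (W₁ E' G a b))))) (≤-reflexive (∑-*ʳ (vol E') (𝓗 E') _)))
            where
            sums : ∑ (𝓗 E') (λ G → (# 1 - X E' G a b) * (D E' a * D E' b - W₂ E' G a b)) ≡ R - D E' a * D E' b * f - β
            sums = trans (∑-cong (𝓗 E') (λ G → solve 3 (λ x y w → (κ 1 :- x) :* (y :- w) := y :* κ 1 :- y :* x :- (κ 1 :- x) :* w) refl (X E' G a b) (D E' a * D E' b) (W₂ E' G a b)))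
              (trans (∑-- (𝓗 E') _ _) (cong (_- β) (trans (∑-- (𝓗 E') _ _) (cong₂ _-_ (∑-*ˡ _ (𝓗 E') _) (∑-*ˡ _ (𝓗 E') _)))))
          DDf : D E' a * D E' b * f ≤ κ' * f
          DDf = ≤-trans (≤-reflexive (sym (∑-*ˡ _ (𝓗 E') _))) (≤-trans (∑𝓗-mono E' (λ G e → *-monoʳ _ (0≤X (sub e) a b) (DD≤ g' e a b))) (≤-reflexive (∑-*ˡ κ' (𝓗 E') _)))
          stepB : R - c * κ' * R ≤ (t + κ') * f
          stepB = ≤-by ((f * vol E' - (R - D E' a * D E' b * f - β)) + (c * κ' * R - β) + (κ' * f - D E' a * D E' b * f) + f * (t - vol E'))
            (0≤+ (0≤+ (0≤+ (≤⇒0≤- low) (≤⇒0≤- β≤)) (≤⇒0≤- DDf)) (0≤* (0≤F E' a b) (≤⇒0≤- vol≤)))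
            (solve 8 (λ f v R x b c k t → (t :+ k) :* f :- (R :- c :* k :* R) := (f :* v :- (R :- x :* f :- b)) :+ (c :* k :* R :- b) :+ (k :* f :- x :* f) :+ f :* (t :- v)) refl f (vol E') R (D E' a * D E' b) β c κ' t)

    module Pair (E : Graph) (κ' : ℚ) (g : Good κ' E) (1≤κ : # 1 ≤ κ') (big : # 20 * κ' ≤ vol E)
      {i j : Fin n} (i≢j : i ≢ j) (free : Y E i j ≡ # 0) where

      open Base E κ' g 1≤κ big public

      S : (Graph → ℚ) → ℚ
      S = ∑ (𝓗 E)

      S-* : ∀ x f → S (λ G → x * f G) ≡ x * S f
      S-* x f = ∑-*ˡ x (𝓗 E) f

      S-mono : ∀ {f h} → (∀ G → Ext E G → f G ≤ h G) → S f ≤ S h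
      S-mono = ∑𝓗-mono E

      x : Graph → ℚ
      x G = X E G i j

      0≤x : ∀ {G} → Ext E G → # 0 ≤ x G
      0≤x e = 0≤X (sub e) i j

      Dᵢ Dⱼ : ℚ
      Dᵢ = D E i
      Dⱼ = D E j

      f : ℚ
      f = F E i j

      X≤D : ∀ {G} → Ext E G → ∀ a b → X E G a b ≤ D E a
      X≤D {G} e a b = subst (X E G a b ≤_) (X-row e a) (term≤∑ Vs (0≤X (sub e) a) (∈-allFin b))

      δ1 : ∀ {m} (a : Fin m) y → δ a a * y ≡ y
      δ1 a y = trans (cong (_* y) (δ-refl a)) (Rq.*-identityˡ y)

      -- The index pairs whose edge kl may coincide with one of ij, ik, jl.
      ex : Graph → Fin n → Fin n → ℚ
      ex G k l = δ j k * X E G j l + δ i l * X E G i k + δ i k * (δ j l * X E G i j)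

      ∑∑ex : ∀ {G} → Ext E G → ∑∑ (ex G) ≡ Dⱼ + Dᵢ + X E G i j
      ∑∑ex {G} e = trans (∑∑-+ _ _) (cong₂ _+_ (trans (∑∑-+ _ _) (cong₂ _+_
          (trans (∑∑-row (δ j) (λ _ → X E G j)) (trans (∑-δ j (λ _ → ∑ Vs (X E G j))) (X-row e j)))
          (trans (∑∑-col (δ i) (λ k _ → X E G i k)) (trans (∑-δ i (λ _ → ∑ Vs (X E G i))) (X-row e i)))))
          (trans (∑∑-row (δ i) (λ _ l → δ j l * X E G i j)) (trans (∑-δ i (λ _ → ∑ Vs (λ l → δ j l * X E G i j))) (∑-δ j (λ _ → X E G i j)))))

      -- Conditioning on ij, ik and jl removes at most six half-edges, and the upper bound for kl
      -- applies in the resulting state. When kl may be one of these three pairs, the term is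
      -- charged to `ex` instead.
      W₁-term : ∀ k l → S (λ G → x G * (Ȳ G i k * (Ȳ G j l * X E G k l))) ≤ S (λ G → x G * ex G k l) + c * (D E k * D E l) * S (λ G → x G * (Ȳ G i k * Ȳ G j l))
      W₁-term k l = cases
        where
        0≤ex₁ : ∀ {G} → Ext E G → # 0 ≤ δ j k * X E G j l
        0≤ex₁ e = 0≤* (0≤δ j k) (0≤X (sub e) j l)
        0≤ex₂ : ∀ {G} → Ext E G → # 0 ≤ δ i l * X E G i k
        0≤ex₂ e = 0≤* (0≤δ i l) (0≤X (sub e) i k)
        0≤ex₃ : ∀ {G} → Ext E G → # 0 ≤ δ i k * (δ j l * X E G i j)
        0≤ex₃ e = 0≤* (0≤δ i k) (0≤* (0≤δ j l) (0≤x e))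
        0≤main : # 0 ≤ c * (D E k * D E l) * S (λ G → x G * (Ȳ G i k * Ȳ G j l))
        0≤main = subst (# 0 ≤_) (S-* _ _) (∑𝓗-nonneg E (λ G e → 0≤* (0≤* 0≤c (0≤* (0≤D e k) (0≤D e l))) (0≤* (0≤x e) (0≤* (0≤Ȳ G i k) (0≤Ȳ G j l)))))
        0≤exS : # 0 ≤ S (λ G → x G * ex G k l)
        0≤exS = ∑𝓗-nonneg E (λ G e → 0≤* (0≤x e) (0≤+ (0≤+ (0≤ex₁ e) (0≤ex₂ e)) (0≤ex₃ e)))
        left : ∀ {a b b'} → a ≤ b → # 0 ≤ b' → a ≤ b + b'
        left {a} {b} {b'} p q = ≤-trans p (≤-by b' q (solve 2 (λ b c → b :+ c :- b := c) refl b b'))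
        right : ∀ {a b b'} → a ≤ b → # 0 ≤ b' → a ≤ b' + b
        right {a} {b} {b'} p q = ≤-trans p (≤-by b' q (solve 2 (λ b c → c :+ b :- b := c) refl b b'))
        two : ∀ {G} → Ext E G → Ȳ G i k * (Ȳ G j l * X E G k l) ≤ X E G k l
        two {G} e = ≤-trans (bit-*≤ (Ȳ-bit G i k) (0≤* (0≤Ȳ G j l) (0≤X (sub e) k l))) (bit-*≤ (Ȳ-bit G j l) (0≤X (sub e) k l))
        irregular : (∀ G → Ext E G → X E G k l ≤ ex G k l) → S (λ G → x G * (Ȳ G i k * (Ȳ G j l * X E G k l))) ≤ S (λ G → x G * ex G k l) + c * (D E k * D E l) * S (λ G → x G * (Ȳ G i k * Ȳ G j l))
        irregular p = left (S-mono (λ G e → *-monoˡ (x G) (0≤x e) (≤-trans (two e) (p G e)))) 0≤main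
        regular : j ≢ k → i ≢ l → ¬ (i ≡ k × j ≡ l) → S (λ G → x G * (Ȳ G i k * (Ȳ G j l * X E G k l))) ≤ S (λ G → x G * ex G k l) + c * (D E k * D E l) * S (λ G → x G * (Ȳ G i k * Ȳ G j l))
        regular j≢k i≢l ne = right (subst₂ _≤_ lhs (cong (c * (D E k * D E l) *_) rhs) (F-upper' E (mk⊆ λ q p → at (⊆-ext E₂ j l) q (at (⊆-ext E₁ i k) q (at (⊆-ext E i j) q p)))
            (near-ext j l (near-ext i k (near-ext i j near₀))) (ℕₚ.m≤n+m 6 2) k l)) 0≤exS
          where
          E₁ = ext E i j
          E₂ = ext E₁ i k
          E₃ = ext E₂ j l
          all₃ : ∀ h → ∑ (𝓗 E₃) h ≡ S (λ G → x G * (Ȳ G i k * (Ȳ G j l * h G)))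
          all₃ h = trans (∑𝓗-ext E₂ j l h) (trans (∑𝓗-ext E₁ i k _) (∑𝓗-X E free i≢j _))
          n₁ : ¬ SamePair i j k l
          n₁ (inj₁ p) = ne p
          n₁ (inj₂ (p , _)) = i≢l p
          n₂ : ¬ SamePair i k k l
          n₂ (inj₁ (p , q)) = i≢l (trans p q)
          n₂ (inj₂ (p , _)) = i≢l p
          n₃ : ¬ SamePair j l k l
          n₃ (inj₁ (p , _)) = j≢k p
          n₃ (inj₂ (p , q)) = j≢k (trans p q)
          lhs : F E₃ k l ≡ S (λ G → x G * (Ȳ G i k * (Ȳ G j l * X E G k l)))
          lhs = trans (∑-cong (𝓗 E₃) (λ G → trans (X-ext-≢ E₂ j l G k l n₃) (trans (X-ext-≢ E₁ i k G k l n₂) (X-ext-≢ E i j G k l n₁)))) (all₃ _)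
          rhs : N E₃ ≡ S (λ G → x G * (Ȳ G i k * Ȳ G j l))
          rhs = trans (all₃ _) (∑-cong (𝓗 E) (λ G → cong (λ z → x G * (Ȳ G i k * z)) (Rq.*-identityʳ _)))
        cases : S (λ G → x G * (Ȳ G i k * (Ȳ G j l * X E G k l))) ≤ S (λ G → x G * ex G k l) + c * (D E k * D E l) * S (λ G → x G * (Ȳ G i k * Ȳ G j l))
        cases = by (j F.≟ k) (i F.≟ l) (i F.≟ k) (j F.≟ l)
          where
          by : Dec (j ≡ k) → Dec (i ≡ l) → Dec (i ≡ k) → Dec (j ≡ l) → S (λ G → x G * (Ȳ G i k * (Ȳ G j l * X E G k l))) ≤ S (λ G → x G * ex G k l) + c * (D E k * D E l) * S (λ G → x G * (Ȳ G i k * Ȳ G j l))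
          by (yes refl) _ _ _ = irregular (λ G e → left (left (≤-reflexive (sym (δ1 j _))) (0≤ex₂ e)) (0≤ex₃ e))
          by (no j≢k) (yes refl) _ _ = irregular (λ G e → left (right (≤-reflexive (trans (X-sym E G k i) (sym (δ1 i _)))) (0≤ex₁ e)) (0≤ex₃ e))
          by (no j≢k) (no i≢l) (yes refl) (yes refl) = irregular (λ G e → right (≤-reflexive (sym (trans (δ1 i _) (δ1 j _)))) (0≤+ (0≤ex₁ e) (0≤ex₂ e)))
          by (no j≢k) (no i≢l) (no i≢k) _ = regular j≢k i≢l (λ p → i≢k (proj₁ p))
          by (no j≢k) (no i≢l) (yes _) (no j≢l) = regular j≢k i≢l (λ p → j≢l (proj₂ p))

      XC SC : ℚ
      XC = S (λ G → x G * C E G j)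
      SC = S (λ G → C E G j)

      W₁-upper : S (λ G → x G * W₁ E G i j) ≤ (# 2 * Dᵢ + Dⱼ) * f + η * XC
      W₁-upper = ≤-trans (≤-reflexive (trans (∑-cong (𝓗 E) (λ G → sym (∑∑-*ˡ (x G) _))) (∑-∑∑ (𝓗 E) _))) (≤-trans (∑∑-mono W₁-term)
        (≤-trans (≤-reflexive (trans (∑∑-+ _ _) (cong₂ _+_ first second))) (+-mono (≤-trans (S-mono firstG) (≤-reflexive (S-* _ _))) (≤-trans (S-mono secondG) (≤-reflexive (S-* _ _))))))
        where
        first : ∑∑ (λ k l → S (λ G → x G * ex G k l)) ≡ S (λ G → x G * (Dⱼ + Dᵢ + X E G i j))
        first = trans (sym (∑-∑∑ (𝓗 E) _)) (∑𝓗-cong E (λ G e → trans (∑∑-*ˡ (x G) _) (cong (x G *_) (∑∑ex e))))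
        second : ∑∑ (λ k l → c * (D E k * D E l) * S (λ G → x G * (Ȳ G i k * Ȳ G j l))) ≡ S (λ G → c * (x G * (C E G i * C E G j)))
        second = trans (∑∑-cong (λ k l → sym (S-* _ _))) (trans (sym (∑-∑∑ (𝓗 E) _)) (∑-cong (𝓗 E) (λ G →
          trans (∑∑-cong (λ k l → solve 6 (λ c a b x y z → c :* (a :* b) :* (x :* (y :* z)) := (c :* x) :* ((y :* a) :* (z :* b))) refl c (D E k) (D E l) (x G) (Ȳ G i k) (Ȳ G j l)))
          (trans (∑∑-*ˡ (c * x G) _) (trans (cong (c * x G *_) (trans (∑∑-row (λ k → Ȳ G i k * D E k) (λ _ l → Ȳ G j l * D E l)) (∑-*ʳ (C E G j) Vs _))) (Rq.*-assoc c _ _))))))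
        firstG : ∀ G → Ext E G → x G * (Dⱼ + Dᵢ + X E G i j) ≤ (# 2 * Dᵢ + Dⱼ) * x G
        firstG G e = ≤-by (x G * (Dᵢ - X E G i j)) (0≤* (0≤x e) (≤⇒0≤- (X≤D e i j))) (solve 3 (λ x a b → (κ 2 :* a :+ b) :* x :- x :* (b :+ a :+ x) := x :* (a :- x)) refl (x G) Dᵢ Dⱼ)
        secondG : ∀ G → Ext E G → c * (x G * (C E G i * C E G j)) ≤ η * (x G * C E G j)
        secondG G e = ≤-by (c * (x G * C E G j) * (κ' - C E G i) + (η - c * κ') * (x G * C E G j))
          (0≤+ (0≤* (0≤* 0≤c (0≤* (0≤x e) (0≤C e j))) (≤⇒0≤- (C≤ g e i))) (0≤* (≤⇒0≤- cκ≤η) (0≤* (0≤x e) (0≤C e j))))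
          (solve 6 (λ c x a b k h → h :* (x :* b) :- c :* (x :* (a :* b)) := c :* (x :* b) :* (k :- a) :+ (h :- c :* k) :* (x :* b)) refl c (x G) (C E G i) (C E G j) κ' η)

      -- Losses in the lower bound for pairs of edges ik, jl with kl in G.
      cor : Graph → Fin n → Fin n → ℚ
      cor G k l = δ j k * (Ȳ G k l * D E l) + δ i l * D E l + Ȳ G k l * (Ȳ E j l * D E l) + (δ k l + X E G k l)

      β Xr : ℚ
      β = S (λ G → (# 1 - x G) * W₂ E G i j)
      Xr = S (λ G → x G * r E G i)

      ρ : ℚ
      ρ = (# 1 - η) * τ

      0≤ρ : # 0 ≤ ρ
      0≤ρ = 0≤* (≤⇒0≤- η≤1) 0≤τ

      -- This is `path` in the state that also contains ij; residual degrees there are at most those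
      -- of `E`.
      triple : ∀ {k l} → j ≢ k → i ≢ l → S (λ G → x G * (X E G i k * (X E G j l * Ȳ G k l))) ≤ c * (Dⱼ * D E l) * S (λ G → x G * (X E G i k * Ȳ G k l))
      triple {k} {l} j≢k i≢l = subst₂ _≤_ lhs refl (≤-trans (AtNear.path (near-ext i j near₀) (ℕₚ.m≤n+m 2 2) i≢j j≢k l)
          (≤-trans (≤-reflexive (cong (c * (D E₁ j * D E₁ l) *_) rhs)) (≤-trans (≤-reflexive (sym (S-* _ _))) (≤-trans (subst₂ _≤_ (sym unf) (sym unf') mono) (≤-reflexive (S-* _ _))))))
        where
        E₁ = ext E i j
        n₁ : ¬ SamePair i j i k
        n₁ (inj₁ (_ , p)) = j≢k p
        n₁ (inj₂ (p , q)) = i≢j (sym q)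
        n₂ : ¬ SamePair i j j l
        n₂ (inj₁ (p , _)) = i≢j p
        n₂ (inj₂ (p , _)) = i≢l p
        lhs : ∑ (𝓗 E₁) (λ G → X E₁ G i k * (Ȳ G k l * X E₁ G j l)) ≡ S (λ G → x G * (X E G i k * (X E G j l * Ȳ G k l)))
        lhs = trans (∑𝓗-X E free i≢j _) (∑-cong (𝓗 E) (λ G → cong (x G *_) (cong₂ _*_ (X-ext-≢ E i j G i k n₁) (trans (cong (Ȳ G k l *_) (X-ext-≢ E i j G j l n₂)) (Rq.*-comm _ _)))))
        rhs : ∑ (𝓗 E₁) (λ G → X E₁ G i k * Ȳ G k l) ≡ S (λ G → x G * (X E G i k * Ȳ G k l))
        rhs = trans (∑𝓗-X E free i≢j _) (∑-cong (𝓗 E) (λ G → cong (λ z → x G * (z * Ȳ G k l)) (X-ext-≢ E i j G i k n₁)))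
        unf : S (λ G → c * (D E₁ j * D E₁ l) * (x G * (X E G i k * Ȳ G k l))) ≡ ∑ (𝓗 E₁) (λ G → c * (D E₁ j * D E₁ l) * (X E G i k * Ȳ G k l))
        unf = sym (trans (∑𝓗-X E free i≢j _) (∑-cong (𝓗 E) (λ G → solve 3 (λ x c y → x :* (c :* y) := c :* (x :* y)) refl (x G) (c * (D E₁ j * D E₁ l)) (X E G i k * Ȳ G k l))))
        unf' : S (λ G → c * (Dⱼ * D E l) * (x G * (X E G i k * Ȳ G k l))) ≡ ∑ (𝓗 E₁) (λ G → c * (Dⱼ * D E l) * (X E G i k * Ȳ G k l))
        unf' = sym (trans (∑𝓗-X E free i≢j _) (∑-cong (𝓗 E) (λ G → solve 3 (λ x c y → x :* (c :* y) := c :* (x :* y)) refl (x G) (c * (Dⱼ * D E l)) (X E G i k * Ȳ G k l))))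
        mono : ∑ (𝓗 E₁) (λ G → c * (D E₁ j * D E₁ l) * (X E G i k * Ȳ G k l)) ≤ ∑ (𝓗 E₁) (λ G → c * (Dⱼ * D E l) * (X E G i k * Ȳ G k l))
        mono = ∑𝓗-mono E₁ (λ G e → let e₀ = Ext-⊆ (⊆-ext E i j) e in *-monoʳ _ (0≤* (0≤X (sub e₀) i k) (0≤Ȳ G k l))
          (*-monoˡ c 0≤c (*-mono (0≤D e j) (0≤D e₀ l) (D-⊆ (⊆-ext E i j) j) (D-⊆ (⊆-ext E i j) l))))

      -- The joint frequency of ik, kl and jl is bounded below by `F-lower` for jl in the state
      -- containing ik and kl. Graphs that also contain ij have to be discarded; `triple` bounds
      -- them by the second summand on the right.
      W₂-term : ∀ k l → ρ * (Dⱼ * S (λ G → X E G i k * (Ȳ G k l * D E l - cor G k l)))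
        ≤ S (λ G → (# 1 - x G) * (X E G i k * (X E G j l * Ȳ G k l))) + c * (Dⱼ * D E l) * S (λ G → x G * (X E G i k * Ȳ G k l))
      W₂-term k l = cases
        where
        0≤c₁ : ∀ {G} → Ext E G → # 0 ≤ δ j k * (Ȳ G k l * D E l)
        0≤c₁ {G} e = 0≤* (0≤δ j k) (0≤* (0≤Ȳ G k l) (0≤D e l))
        0≤c₂ : ∀ {G} → Ext E G → # 0 ≤ δ i l * D E l
        0≤c₂ e = 0≤* (0≤δ i l) (0≤D e l)
        0≤c₃ : ∀ {G} → Ext E G → # 0 ≤ Ȳ G k l * (Ȳ E j l * D E l)
        0≤c₃ {G} e = 0≤* (0≤Ȳ G k l) (0≤* (0≤Ȳ E j l) (0≤D e l))
        0≤c₄ : ∀ {G} → Ext E G → # 0 ≤ δ k l + X E G k l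
        0≤c₄ e = 0≤+ (0≤δ k l) (0≤X (sub e) k l)
        Goal : Set
        Goal = ρ * (Dⱼ * S (λ G → X E G i k * (Ȳ G k l * D E l - cor G k l))) ≤ S (λ G → (# 1 - x G) * (X E G i k * (X E G j l * Ȳ G k l))) + c * (Dⱼ * D E l) * S (λ G → x G * (X E G i k * Ȳ G k l))
        irregular : (∀ G → Ext E G → X E G i k * (Ȳ G k l * D E l - cor G k l) ≤ # 0) → Goal
        irregular p = ≤-trans {j = # 0} (≤-trans (*-monoˡ ρ 0≤ρ (≤-trans (≤-reflexive (sym (S-* Dⱼ _))) (≤-trans (S-mono (λ G e → ≤-trans (*-monoˡ Dⱼ (0≤D e j) (p G e)) (≤-reflexive (Rq.zeroʳ Dⱼ)))) (≤-reflexive (∑-0 (𝓗 E)))))) (≤-reflexive (Rq.zeroʳ ρ)))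
          (0≤+ (∑𝓗-nonneg E (λ G e → 0≤* (≤⇒0≤- (bit-≤1 (X-bit (sub e) i j))) (0≤* (0≤X (sub e) i k) (0≤* (0≤X (sub e) j l) (0≤Ȳ G k l)))))
            (subst (# 0 ≤_) (S-* _ _) (∑𝓗-nonneg E (λ G e → 0≤* (0≤* 0≤c (0≤* (0≤D e j) (0≤D e l))) (0≤* (0≤x e) (0≤* (0≤X (sub e) i k) (0≤Ȳ G k l)))))))
        neg : ∀ {G} → Ext E G → Ȳ G k l * D E l ≤ cor G k l → X E G i k * (Ȳ G k l * D E l - cor G k l) ≤ # 0
        neg {G} e p = ≤-trans (*-monoˡ _ {b = # 0} (0≤X (sub e) i k) (≤-by (cor G k l - Ȳ G k l * D E l) (≤⇒0≤- p) (solve 2 (λ a b → κ 0 :- (a :- b) := b :- a) refl _ _))) (≤-reflexive (Rq.zeroʳ _))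
        regular : j ≢ k → i ≢ l → j ≢ l → i ≢ k → Y E j l ≡ # 0 → Y E i k ≡ # 0 → Goal
        regular j≢k i≢l j≢l i≢k hjl hik = ≤-by ((F E₂ j l - ρ * (Dⱼ * (S U))) + (c * (Dⱼ * D E l) * S (λ G → x G * (X E G i k * Ȳ G k l)) - T'))
            (0≤+ (≤⇒0≤- main) (≤⇒0≤- (triple j≢k i≢l)))
            (trans (cong (λ z → z + c * (Dⱼ * D E l) * S (λ G → x G * (X E G i k * Ȳ G k l)) - ρ * (Dⱼ * S U)) Tsplit)
              (solve 4 (λ a b c d → a :- b :+ c :- d := (a :- d) :+ (c :- b)) refl (F E₂ j l) T' _ _))
          where
          U : Graph → ℚ
          U G = X E G i k * (Ȳ G k l * D E l - cor G k l)
          T' = S (λ G → x G * (X E G i k * (X E G j l * Ȳ G k l)))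
          E₁ = ext E i k
          E₂ = ext E₁ k l
          both : ∀ h → ∑ (𝓗 E₂) h ≡ S (λ G → X E G i k * (Ȳ G k l * h G))
          both h = trans (∑𝓗-ext E₁ k l h) (∑𝓗-X E hik i≢k _)
          n₁ : ¬ SamePair i k j l
          n₁ (inj₁ (p , _)) = i≢j p
          n₁ (inj₂ (_ , p)) = j≢k (sym p)
          n₂ : ¬ SamePair k l j l
          n₂ (inj₁ (p , _)) = j≢k (sym p)
          n₂ (inj₂ (p , q)) = j≢k (sym (trans p q))
          n₃ : ¬ SamePair i k k l
          n₃ (inj₁ (p , _)) = i≢k p
          n₃ (inj₂ (p , _)) = i≢l p
          Feq : F E₂ j l ≡ S (λ G → X E G i k * (X E G j l * Ȳ G k l))
          Feq = trans (∑-cong (𝓗 E₂) (λ G → trans (X-ext-≢ E₁ k l G j l n₂) (X-ext-≢ E i k G j l n₁))) (trans (both _) (∑-cong (𝓗 E) (λ G → cong (X E G i k *_) (Rq.*-comm _ _))))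
          Tsplit : S (λ G → (# 1 - x G) * (X E G i k * (X E G j l * Ȳ G k l))) ≡ F E₂ j l - T'
          Tsplit = trans (∑-cong (𝓗 E) (λ G → solve 2 (λ x y → (κ 1 :- x) :* y := y :- x :* y) refl (x G) (X E G i k * (X E G j l * Ȳ G k l)))) (trans (∑-- (𝓗 E) _ _) (cong (_- T') (sym Feq)))
          Y₂ : Y E₂ j l ≡ # 0
          Y₂ = trans (Y-ext-≢ E₁ k l j l n₂) (trans (Y-ext-≢ E i k j l n₁) hjl)
          Dj₂ : Dⱼ ≤ D E₂ j
          Dj₂ = ≤-trans (≤-trans (≤-reflexive (sym (trans (cong₂ (λ u v → Dⱼ - (# 1 - Ȳ E i k) * (u + v)) (δ-≢ i≢j) (δ-≢ (λ p → j≢k (sym p)))) (solve 2 (λ d y → d :- y :* (κ 0 :+ κ 0) := d) refl Dⱼ _)))) (D-ext-≥ E i k j))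
            (≤-trans (≤-reflexive (sym (trans (cong₂ (λ u v → D E₁ j - (# 1 - Ȳ E₁ k l) * (u + v)) (δ-≢ (λ p → j≢k (sym p))) (δ-≢ (λ p → j≢l (sym p)))) (solve 2 (λ d y → d :- y :* (κ 0 :+ κ 0) := d) refl (D E₁ j) _)))) (D-ext-≥ E₁ k l j))
          Dl₁ : D E l - δ k l ≤ D E₁ l
          Dl₁ = ≤-trans (≤-reflexive (sym (trans (cong₂ (λ u v → D E l - (# 1 - u) * (v + δ k l)) (trans (Ȳ-off E i≢k) hik) (δ-≢ i≢l)) (solve 2 (λ d y → d :- (κ 1 :- κ 0) :* (κ 0 :+ y) := d :- y) refl (D E l) (δ k l))))) (D-ext-≥ E i k l)
          Dl₂ : D E₁ l - (# 1 - Ȳ E k l) ≤ D E₂ l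
          Dl₂ = go (k F.≟ l)
            where
            go : Dec (k ≡ l) → D E₁ l - (# 1 - Ȳ E k l) ≤ D E₂ l
            go (yes refl) = ≤-trans (≤-reflexive (trans (cong (λ z → D E₁ k - (# 1 - z)) (Ȳ-diag E k)) (trans (solve 2 (λ d y → d :- (κ 1 :- κ 1) := d :- (κ 1 :- κ 1) :* y) refl (D E₁ k) (δ k k + δ k k)) (cong (λ z → D E₁ k - (# 1 - z) * (δ k k + δ k k)) (sym (Ȳ-diag E₁ k)))))) (D-ext-≥ E₁ k k k)
            go (no k≢l) = ≤-trans (≤-reflexive (trans (cong (λ z → D E₁ l - (# 1 - z)) (trans (Ȳ-off E k≢l) (trans (sym (Y-ext-≢ E i k k l n₃)) (sym (Ȳ-off E₁ k≢l)))))
              (trans (solve 2 (λ d y → d :- (κ 1 :- y) := d :- (κ 1 :- y) :* (κ 0 :+ κ 1)) refl (D E₁ l) (Ȳ E₁ k l)) (cong₂ (λ u v → D E₁ l - (# 1 - Ȳ E₁ k l) * (u + v)) (sym (δ-≢ k≢l)) (sym (δ-refl l)))))) (D-ext-≥ E₁ k l l)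
          low : ρ * (D E₂ j * D E₂ l * N E₂) ≤ F E₂ j l
          low = AtNear.F-lower (near-ext k l (near-ext i k near₀)) ℕₚ.≤-refl j≢l Y₂
          main : ρ * (Dⱼ * S U) ≤ F E₂ j l
          main = ≤-trans (*-monoˡ ρ 0≤ρ (≤-trans (≤-reflexive (sym (S-* Dⱼ U))) (≤-trans (S-mono bound) (≤-reflexive (trans (sym (both _)) (N-* E₂ _)))))) low
            where
            bound : ∀ G → Ext E G → Dⱼ * U G ≤ X E G i k * (Ȳ G k l * (D E₂ j * D E₂ l))
            bound G e = go (bit-cases (X-bit (sub e) i k)) (bit-cases (Ȳ-bit G k l))
              where
              go : X E G i k ≡ # 0 ⊎ X E G i k ≡ # 1 → Ȳ G k l ≡ # 0 ⊎ Ȳ G k l ≡ # 1 → Dⱼ * U G ≤ X E G i k * (Ȳ G k l * (D E₂ j * D E₂ l))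
              go (inj₁ z) _ = ≤-reflexive (trans (trans (cong (λ u → Dⱼ * (u * (Ȳ G k l * D E l - cor G k l))) z) (solve 2 (λ a b → a :* (κ 0 :* b) := κ 0) refl Dⱼ _)) (sym (0*ˡ _ z)))
              go (inj₂ o) (inj₁ z) = ≤-trans {j = # 0} (≤-by (Dⱼ * cor G k l) (0≤* (0≤D e j) 0≤cor) (trans (cong₂ (λ u v → # 0 - Dⱼ * (u * (v * D E l - cor G k l))) o z) (solve 3 (λ a b c → κ 0 :- a :* (κ 1 :* (κ 0 :* b :- c)) := a :* c) refl Dⱼ (D E l) (cor G k l))))
                 (≤-reflexive (sym (0*ʳ _ (0*ˡ _ z))))
                where 0≤cor = 0≤+ (0≤+ (0≤+ (0≤c₁ e) (0≤c₂ e)) (0≤c₃ e)) (0≤c₄ e)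
              -- Both pairs lie in `G`, so `G` completes `E₂` and the residual degrees of `E₂` are
              -- nonnegative. Adding ik lowers the residual degree of l by `δ k l`, adding kl by
              -- `X E G k l`: these are the last terms of `cor`.
              go (inj₂ o) (inj₂ o') = ≤-trans (≤-trans (≤-reflexive (cong₂ (λ u v → Dⱼ * (u * (v * D E l - cor G k l))) o o')) (≤-trans (*-monoˡ Dⱼ (0≤D e j) (≤-trans (≤-reflexive (solve 2 (λ a b → κ 1 :* (κ 1 :* a :- b) := a :- b) refl (D E l) (cor G k l))) Dl)) (*-monoʳ (D E₂ l) (0≤D e₂ l) Dj₂)))
                 (≤-reflexive (sym (trans (cong₂ (λ u v → u * (v * (D E₂ j * D E₂ l))) o o') (solve 1 (λ a → κ 1 :* (κ 1 :* a) := a) refl _))))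
                where
                e₂ : Ext E₂ G
                e₂ = 𝓗⇒ (∈E₂ (⇒𝓗 e))
                  where
                  Ȳ1 : ∀ {a b} → Ȳ G a b ≡ # 1 → ∀ {E'} → Ext E' G → Ext (ext E' a b) G
                  Ȳ1 {a} {b} p {E'} e' with a F.≟ b
                  ... | yes _ = e'
                  ... | no ne = mkExt (reg e') (mk⊆ λ q s → up q s)
                    where
                    up : ∀ q → lookup (add E' (ix a b ne)) q ≡ true → lookup G q ≡ true
                    up q s with ix a b ne F.≟ q
                    ... | yes refl = 𝟙1 (trans (sym (Y-joins G (ix-joins a b ne))) (trans (sym (Ȳ-off G ne)) p))
                      where
                      𝟙1 : ∀ {bb} → 𝟙 bb ≡ # 1 → bb ≡ true
                      𝟙1 {true} _ = refl
                      𝟙1 {false} w = ⊥-elim (pos⇒≢0 0<1 (sym w))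
                    ... | no w = at (sub e') q (trans (sym (Vₚ.lookup∘updateAt′ q (ix a b ne) (λ z → w (sym z)) E')) s)
                  ∈E₂ : G ∈ 𝓗 E → G ∈ 𝓗 E₂
                  ∈E₂ _ = ⇒𝓗 (Ȳ1 o' (Ȳ1 (trans (sym (X-free G hik i≢k)) o) e))
                Dl : D E l - cor G k l ≤ D E₂ l
                Dl = ≤-trans (≤-by (δ j k * (Ȳ G k l * D E l) + δ i l * D E l + Ȳ G k l * (Ȳ E j l * D E l)) (0≤+ (0≤+ (0≤c₁ e) (0≤c₂ e)) (0≤c₃ e))
                    (solve 6 (λ d a b c x y → (d :- x :- y) :- (d :- (a :+ b :+ c :+ (x :+ y))) := a :+ b :+ c) refl (D E l) (δ j k * (Ȳ G k l * D E l)) (δ i l * D E l) (Ȳ G k l * (Ȳ E j l * D E l)) (δ k l) (X E G k l)))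
                  (≤-trans (≤-trans (≤-reflexive (cong (λ z → D E l - δ k l - z) (trans (sym (Ȳ*1-Ȳ (sub e) k l)) (trans (cong (_* (# 1 - Ȳ E k l)) o') (Rq.*-identityˡ _))))) (+-monoˡ (- (# 1 - Ȳ E k l)) Dl₁)) Dl₂)
        left₄ : ∀ {a b c' d' e'} → a ≤ b → # 0 ≤ c' → # 0 ≤ d' → # 0 ≤ e' → a ≤ b + c' + d' + e'
        left₄ {a} {b} {c'} {d'} {e'} p q r s = ≤-trans p (≤-by (c' + d' + e') (0≤+ (0≤+ q r) s) (solve 4 (λ b c d e → b :+ c :+ d :+ e :- b := c :+ d :+ e) refl b c' d' e'))
        cases : Goal
        cases = by (X-dichotomy E i k) (j F.≟ k) (i F.≟ l) (bit-cases (Ȳ-bit E j l)) (j F.≟ l)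
          where
          by : (∀ G → Ext E G → X E G i k ≡ # 0) ⊎ (Y E i k ≡ # 0 × i ≢ k) → Dec (j ≡ k) → Dec (i ≡ l) → Ȳ E j l ≡ # 0 ⊎ Ȳ E j l ≡ # 1 → Dec (j ≡ l) → Goal
          by (inj₁ z) _ _ _ _ = irregular (λ G e → ≤-reflexive (0*ˡ _ (z G e)))
          by (inj₂ _) (yes refl) _ _ _ = irregular (λ G e → neg e (left₄ (≤-reflexive (sym (δ1 j _))) (0≤c₂ e) (0≤c₃ e) (0≤c₄ e)))
          by (inj₂ _) (no j≢k) (yes refl) _ _ = irregular (λ G e → neg e (≤-trans (left₄ (≤-trans (bit-*≤ (Ȳ-bit G k i) (0≤D e i)) (≤-reflexive (sym (δ1 i _)))) (0≤c₁ e) (0≤c₃ e) (0≤c₄ e))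
              (≤-reflexive (solve 4 (λ a b c d → b :+ a :+ c :+ d := a :+ b :+ c :+ d) refl _ _ _ _))))
          by (inj₂ _) (no j≢k) (no i≢l) (inj₂ o) _ = irregular (λ G e → neg e (≤-trans (left₄ (≤-reflexive (cong (Ȳ G k l *_) (sym (trans (cong (_* D E l) o) (Rq.*-identityˡ _))))) (0≤c₁ e) (0≤c₂ e) (0≤c₄ e))
              (≤-reflexive (solve 4 (λ a b c d → c :+ a :+ b :+ d := a :+ b :+ c :+ d) refl _ _ _ _))))
          by (inj₂ _) (no j≢k) (no i≢l) (inj₁ z) (yes refl) = ⊥-elim (pos⇒≢0 0<1 (trans (sym (Ȳ-diag E j)) z))
          by (inj₂ (hik , i≢k)) (no j≢k) (no i≢l) (inj₁ z) (no j≢l) = regular j≢k i≢l j≢l i≢k (trans (sym (Ȳ-off E j≢l)) z) hik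

    -- Deviation of the edge frequencies from proportionality to the weights

    module Deviation (E : Graph) (κ' : ℚ) (g : Good κ' E) (1≤κ : # 1 ≤ κ') (big : # 20 * κ' ≤ vol E)
      {G₀ : Graph} (e₀ : Ext E G₀) (μ ν : ℚ) (0≤μ : # 0 ≤ μ) (0≤ν : # 0 ≤ ν) where

      open Base E κ' g 1≤κ big public

      S : (Graph → ℚ) → ℚ
      S = ∑ (𝓗 E)

      S-mono : ∀ {f h} → (∀ G → Ext E G → f G ≤ h G) → S f ≤ S h
      S-mono = ∑𝓗-mono E

      -- Collects the errors local to a vertex: the deviation of C from `μ`, the relative error `η`
      -- of the conditional bounds, and the few residual edges excluded at the vertex. `μ` and `ν`
      -- stay free here; later both are 0 in the middle regime and expectations in the upper one.
      h : Graph → Fin n → ℚ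
      h G a = ∣ C E G a - μ ∣ + η * C E G a + # 2 * D E a

      γ : Fin n → Fin n → ℚ
      γ i j = ∣ D E i * D E j - ν ∣

      K : Fin n → (Graph → Fin n → ℚ) → ℚ
      K i φ = S (λ G → ∑ Vs (λ k → X E G i k * φ G k))

      0≤D₀ : ∀ i → # 0 ≤ D E i
      0≤D₀ = 0≤D e₀

      0≤h : ∀ {G} → Ext E G → ∀ a → # 0 ≤ h G a
      0≤h {G} e a = 0≤+ (0≤+ (0≤∣∣ (C E G a - μ)) (0≤* 0≤η (0≤C e a))) (0≤* (0≤# 2) (0≤D e a))

      0≤γ : ∀ i j → # 0 ≤ γ i j
      0≤γ i j = 0≤∣∣ _

      K-mono : ∀ i {φ ψ} → (∀ G → Ext E G → ∀ k → X E G i k * φ G k ≤ X E G i k * ψ G k) → K i φ ≤ K i ψ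
      K-mono i p = S-mono (λ G e → ∑-mono Vs (p G e))

      K-mono' : ∀ i {φ ψ} → (∀ G → Ext E G → ∀ k → φ G k ≤ ψ G k) → K i φ ≤ K i ψ
      K-mono' i p = K-mono i (λ G e k → *-monoˡ _ (0≤X (sub e) i k) (p G e k))

      K-+ : ∀ i φ ψ → K i (λ G k → φ G k + ψ G k) ≡ K i φ + K i ψ
      K-+ i φ ψ = trans (∑-cong (𝓗 E) (λ G → trans (∑-cong Vs (λ k → Rq.distribˡ _ _ _)) (∑-+ Vs _ _))) (∑-+ (𝓗 E) _ _)

      K-* : ∀ i a φ → K i (λ G k → a * φ G k) ≡ a * K i φ
      K-* i a φ = trans (∑-cong (𝓗 E) (λ G → trans (∑-cong Vs (λ k → solve 3 (λ x a y → x :* (a :* y) := a :* (x :* y)) refl (X E G i k) a (φ G k))) (∑-*ˡ a Vs _))) (∑-*ˡ a (𝓗 E) _)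

      K-const : ∀ i (φ : Graph → ℚ) → K i (λ G _ → φ G) ≡ D E i * S φ
      K-const i φ = trans (∑𝓗-cong E (λ G e → trans (∑-*ʳ (φ G) Vs _) (cong (_* φ G) (X-row e i)))) (∑-*ˡ (D E i) (𝓗 E) φ)

      K-nonneg : ∀ i {φ} → (∀ G → Ext E G → ∀ k → # 0 ≤ φ G k) → # 0 ≤ K i φ
      K-nonneg i p = ∑𝓗-nonneg E (λ G e → ∑-nonneg Vs (λ k → 0≤* (0≤X (sub e) i k) (p G e k)))

      module Bound {i j : Fin n} (i≢j : i ≢ j) (free : Y E i j ≡ # 0) where
        open Pair E κ' g 1≤κ big i≢j free using (x; Dᵢ; Dⱼ; f; XC; SC; W₁-upper; W₂-term; cor; β; Xr; ρ; 0≤ρ; X≤D)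

        -- `M` is the error in the equation obtained from the switching identity by putting `μ` for
        -- both values of C, `ν` for the product of residual degrees in front of F, 0 for `W₁`, and
        -- `μ * τ` times `Dᵢ * Dⱼ * N E` for the `W₂` term. The solution F of `M` = 0 is
        -- proportional to the weight used by Procedure A. The three parts of the bound average over
        -- graphs containing ij, over residual edges at i, and over all completions.
        R₁ R₂ R₃ M w K₁ K₂ K₃ Zt Aᵢ Aⱼ : ℚ
        R₁ = S (λ G → x G * (h G i + h G j + (# 2 * γ i j + η * ν)))
        R₂ = τ * Dⱼ * K i (λ G k → h G k + h G i)
        R₃ = τ * (Dᵢ * Dⱼ) * S (λ G → h G j)
        M = f * (t - # 2 * μ + ν) - Dᵢ * Dⱼ * N E * (# 1 - μ * τ)
        w = S (λ G → x G * W₁ E G i j)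
        K₁ = K i (λ G k → ∣ C E G k - μ ∣)
        K₂ = S (λ G → r E G i)
        K₃ = K i (λ G k → D E k)
        Zt = K i (λ G k → ∑ Vs (λ l → Ȳ G k l * (Ȳ E j l * D E l)))
        Aᵢ = S (λ G → x G * ∣ C E G i - μ ∣)
        Aⱼ = S (λ G → x G * ∣ C E G j - μ ∣)

        0≤x : ∀ {G} → Ext E G → # 0 ≤ x G
        0≤x e = 0≤X (sub e) i j

        0≤f : # 0 ≤ f
        0≤f = 0≤F E i j

        Sx-+ : ∀ (φ ψ : Graph → ℚ) → S (λ G → x G * (φ G + ψ G)) ≡ S (λ G → x G * φ G) + S (λ G → x G * ψ G)
        Sx-+ φ ψ = trans (∑-cong (𝓗 E) (λ G → Rq.distribˡ _ _ _)) (∑-+ (𝓗 E) _ _)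

        Sx-* : ∀ a (φ : Graph → ℚ) → S (λ G → x G * (a * φ G)) ≡ a * S (λ G → x G * φ G)
        Sx-* a φ = trans (∑-cong (𝓗 E) (λ G → solve 3 (λ x a y → x :* (a :* y) := a :* (x :* y)) refl (x G) a (φ G))) (∑-*ˡ a (𝓗 E) _)

        Sx-c : ∀ a → S (λ G → x G * a) ≡ a * f
        Sx-c a = trans (∑-*ʳ a (𝓗 E) _) (Rq.*-comm f a)

        identity : t * f ≡ (S (λ G → x G * C E G i) + XC) - w + (Dᵢ * Dⱼ * N E - Dᵢ * Dⱼ * f - β)
        identity = trans (solve 4 (λ T a b w → T := a :+ b :- w :+ (T :- a :- b :+ w)) refl (t * f) (S (λ G → x G * C E G i)) XC w)
          (cong (λ z → (S (λ G → x G * C E G i) + XC) - w + z) (trans (sym lhs) (trans (switching E i≢j free) rhs)))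
          where
          lhs : S (λ G → x G * (vol E - C E G i - C E G j + W₁ E G i j)) ≡ t * f - S (λ G → x G * C E G i) - XC + w
          lhs = trans (∑-cong (𝓗 E) (λ G → solve 5 (λ x v a b w → x :* (v :- a :- b :+ w) := v :* x :- x :* a :- x :* b :+ x :* w) refl (x G) t (C E G i) (C E G j) (W₁ E G i j)))
            (trans (∑-+ (𝓗 E) _ _) (cong (_+ w) (trans (∑-- (𝓗 E) _ _) (cong (_- XC) (trans (∑-- (𝓗 E) _ _) (cong (_- S (λ G → x G * C E G i)) (∑-*ˡ t (𝓗 E) _)))))))
          rhs : S (λ G → (# 1 - x G) * (D E i * D E j - W₂ E G i j)) ≡ Dᵢ * Dⱼ * N E - Dᵢ * Dⱼ * f - β
          rhs = trans (∑-cong (𝓗 E) (λ G → solve 3 (λ x y w → (κ 1 :- x) :* (y :- w) := y :* κ 1 :- y :* x :- (κ 1 :- x) :* w) refl (x G) (Dᵢ * Dⱼ) (W₂ E G i j)))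
              (trans (∑-- (𝓗 E) _ _) (cong (_- β) (trans (∑-- (𝓗 E) _ _) (cong₂ _-_ (∑-*ˡ _ (𝓗 E) _) (∑-*ˡ _ (𝓗 E) _)))))

        dev : ∀ a → S (λ G → x G * (C E G a - μ)) ≡ S (λ G → x G * C E G a) - μ * f
        dev a = trans (∑-cong (𝓗 E) (λ G → solve 3 (λ x c m → x :* (c :- m) := x :* c :- m :* x) refl (x G) (C E G a) μ)) (trans (∑-- (𝓗 E) _ _) (cong (λ z → S (λ G → x G * C E G a) - z) (∑-*ˡ μ (𝓗 E) _)))

        Bμ : ℚ
        Bμ = μ * τ * (Dᵢ * Dⱼ * N E)

        M-eq : M ≡ S (λ G → x G * (C E G i - μ)) + S (λ G → x G * (C E G j - μ)) - (Dᵢ * Dⱼ - ν) * f - w + (Bμ - β)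
        M-eq = trans (solve 6 (λ f t m v R u → f :* (t :- κ 2 :* m :+ v) :- R :* (κ 1 :- m :* u) := t :* f :- κ 2 :* m :* f :+ v :* f :- R :+ m :* u :* R) refl f t μ ν (Dᵢ * Dⱼ * N E) τ)
          (trans (cong (λ z → z - # 2 * μ * f + ν * f - Dᵢ * Dⱼ * N E + Bμ) identity)
          (trans (solve 10 (λ a b w R p f be m v B → (a :+ b) :- w :+ (R :- p :* f :- be) :- κ 2 :* m :* f :+ v :* f :- R :+ B := (a :- m :* f) :+ (b :- m :* f) :- (p :- v) :* f :- w :+ (B :- be)) refl
               (S (λ G → x G * C E G i)) XC w (Dᵢ * Dⱼ * N E) (Dᵢ * Dⱼ) f β μ ν Bμ)
            (cong₂ (λ u v → u + v - (Dᵢ * Dⱼ - ν) * f - w + (Bμ - β)) (sym (dev i)) (sym (dev j)))))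

        dev≤ : ∀ a → S (λ G → x G * (C E G a - μ)) ≤ S (λ G → x G * ∣ C E G a - μ ∣)
        dev≤ a = S-mono (λ G e → *-monoˡ _ (0≤x e) (≤∣∣ _))

        -dev≤ : ∀ a → - S (λ G → x G * (C E G a - μ)) ≤ S (λ G → x G * ∣ C E G a - μ ∣)
        -dev≤ a = ≤-trans (≤-reflexive (trans (solve 1 (λ s → :- s := (:- κ 1) :* s) refl _) (trans (sym (∑-*ˡ (- # 1) (𝓗 E) _)) (∑-cong (𝓗 E) (λ G → solve 2 (λ x y → (:- κ 1) :* (x :* y) := x :* (:- y)) refl (x G) (C E G a - μ))))))
          (S-mono (λ G e → *-monoˡ _ (0≤x e) (-≤∣∣ _)))

        K₂-dev : K₂ - μ * (Dᵢ * N E) ≡ K i (λ G k → C E G k - μ)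
        K₂-dev = sym (trans (K-+ i (λ G k → C E G k) (λ _ _ → - μ)) (cong (K₂ +_) (trans (K-const i (λ _ → - μ)) (trans (cong (Dᵢ *_) (N-* E (- μ))) (solve 3 (λ d m n → d :* ((:- m) :* n) := :- (m :* (d :* n))) refl Dᵢ μ (N E))))))

        K₂-upper : K₂ - μ * (Dᵢ * N E) ≤ K₁
        K₂-upper = ≤-trans (≤-reflexive K₂-dev) (K-mono' i (λ G e k → ≤∣∣ _))

        K₂-lower : μ * (Dᵢ * N E) - K₂ ≤ K₁
        K₂-lower = ≤-trans (≤-reflexive (trans (solve 2 (λ a b → a :- b := (:- κ 1) :* (b :- a)) refl (μ * (Dᵢ * N E)) K₂) (trans (cong (- # 1 *_) K₂-dev) (sym (K-* i (- # 1) _)))))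
          (K-mono' i (λ G e k → ≤-trans (≤-reflexive (solve 1 (λ y → (:- κ 1) :* y := :- y) refl (C E G k - μ))) (-≤∣∣ _)))

        DD : ℚ
        DD = Dᵢ * Dⱼ

        0≤DD : # 0 ≤ DD
        0≤DD = 0≤* (0≤D₀ i) (0≤D₀ j)

        β-upper : β - Bμ ≤ τ * Dⱼ * (K₁ + η * K₂)
        β-upper = ≤-by ((c * Dⱼ * K₂ - β) + τ * Dⱼ * (K₁ - (K₂ - μ * (Dᵢ * N E)))) (0≤+ (≤⇒0≤- (AtNear.W₂-upper near₀ ℕ.z≤n i≢j)) (0≤* (0≤* 0≤τ (0≤D₀ j)) (≤⇒0≤- K₂-upper)))
          (solve 9 (λ u a b N m h K1 K2 be → u :* b :* (K1 :+ h :* K2) :- (be :- m :* u :* (a :* b :* N)) := ((κ 1 :+ h) :* u :* b :* K2 :- be) :+ u :* b :* (K1 :- (K2 :- m :* (a :* N)))) refl τ Dᵢ Dⱼ (N E) μ η K₁ K₂ β)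

        Xr≤ : Xr ≤ κ' * Dᵢ * f
        Xr≤ = ≤-trans (S-mono (λ G e → *-monoˡ _ (0≤x e) (AtNear.r≤ near₀ ℕ.z≤n e i))) (≤-reflexive (Sx-c (κ' * Dᵢ)))

        XC≤ : XC ≤ κ' * f
        XC≤ = ≤-trans (S-mono (λ G e → *-monoˡ _ (0≤x e) (C≤ g e j))) (≤-reflexive (Sx-c κ'))

        st : Graph → ℚ
        st G = ∑∑ (λ k l → X E G i k * cor G k l)

        W₂-lower : ρ * (Dⱼ * (K₂ - S st)) ≤ β + c * Dⱼ * Xr
        W₂-lower = ≤-trans (≤-reflexive (sym left)) (≤-trans (∑∑-mono W₂-term) (≤-reflexive right))
          where
          left : ∑∑ (λ k l → ρ * (Dⱼ * S (λ G → X E G i k * (Ȳ G k l * D E l - cor G k l)))) ≡ ρ * (Dⱼ * (K₂ - S st))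
          left = trans (∑∑-*ˡ ρ _) (cong (ρ *_) (trans (∑∑-*ˡ Dⱼ _) (cong (Dⱼ *_) (trans (sym (∑-∑∑ (𝓗 E) _)) (trans (∑-cong (𝓗 E) (λ G → trans (∑∑-cong (λ k l → solve 3 (λ x a b → x :* (a :- b) := x :* a :- x :* b) refl (X E G i k) (Ȳ G k l * D E l) (cor G k l)))
              (trans (∑∑-- _ _) (cong (_- st G) (∑∑-row (X E G i) (λ k l → Ȳ G k l * D E l)))))) (∑-- (𝓗 E) _ _))))))
          right : ∑∑ (λ k l → S (λ G → (# 1 - x G) * (X E G i k * (X E G j l * Ȳ G k l))) + c * (Dⱼ * D E l) * S (λ G → x G * (X E G i k * Ȳ G k l))) ≡ β + c * Dⱼ * Xr
          right = trans (∑∑-+ _ _) (cong₂ _+_ (trans (sym (∑-∑∑ (𝓗 E) _)) (∑-cong (𝓗 E) (λ G → ∑∑-*ˡ (# 1 - x G) _)))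
            (trans (∑∑-cong (λ k l → trans (solve 4 (λ c a b s → c :* (a :* b) :* s := c :* a :* (b :* s)) refl c Dⱼ (D E l) _) (cong (c * Dⱼ *_) (sym (∑-*ˡ (D E l) (𝓗 E) _)))))
            (trans (∑∑-*ˡ (c * Dⱼ) _) (cong (c * Dⱼ *_) (trans (sym (∑-∑∑ (𝓗 E) _)) (∑-cong (𝓗 E) (λ G → trans (∑∑-cong (λ k l → solve 4 (λ d x y z → d :* (x :* (y :* z)) := x :* (y :* (z :* d))) refl (D E l) (x G) (X E G i k) (Ȳ G k l)))
              (trans (∑∑-*ˡ (x G) _) (cong (x G *_) (∑∑-row (X E G i) (λ k l → Ȳ G k l * D E l)))))))))))

        D≤DD : ∀ {G} → Ext E G → ∀ a → D E a ≤ D E a * D E a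
        D≤DD {G} e a = subst₂ _≤_ (X-row e a) (trans (∑-*ʳ (D E a) Vs _) (cong (_* D E a) (X-row e a))) (∑-mono Vs (λ k → ≤-trans (≤-reflexive (sym (bit-sq (X-bit (sub e) a k))))
          (*-monoˡ _ (0≤X (sub e) a k) (X≤D e a k))))

        st-eq : ∀ G → Ext E G → st G ≡ x G * C E G j + Dᵢ * Dᵢ + ∑ Vs (λ k → X E G i k * ∑ Vs (λ l → Ȳ G k l * (Ȳ E j l * D E l))) + (Dᵢ + ∑ Vs (λ k → X E G i k * D E k))
        st-eq G e = trans (∑∑-cong (λ k l → solve 5 (λ x a b c d → x :* (a :+ b :+ c :+ d) := x :* a :+ x :* b :+ x :* c :+ x :* d) refl (X E G i k) _ _ _ _)) (trans (∑∑-+ _ _) (cong₂ _+_ (trans (∑∑-+ _ _) (cong₂ _+_ (trans (∑∑-+ _ _) (cong₂ _+_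
            (trans (∑∑-cong (λ k l → solve 3 (λ x a b → x :* (a :* b) := a :* (x :* b)) refl (X E G i k) (δ j k) (Ȳ G k l * D E l))) (trans (∑∑-row (δ j) (λ k l → X E G i k * (Ȳ G k l * D E l))) (trans (∑-δ j (λ k → ∑ Vs (λ l → X E G i k * (Ȳ G k l * D E l)))) (∑-*ˡ (x G) Vs _))))
            (trans (∑∑-row (X E G i) (λ _ l → δ i l * D E l)) (trans (∑-*ʳ _ Vs _) (cong₂ _*_ (X-row e i) (∑-δ i (D E)))))))
            (∑∑-row (X E G i) (λ k l → Ȳ G k l * (Ȳ E j l * D E l)))))
            (trans (∑∑-row (X E G i) (λ k l → δ k l + X E G k l)) (trans (∑-cong Vs (λ k → trans (cong (X E G i k *_) (trans (∑-+ Vs _ _) (cong₂ _+_ (∑-δ1 k) (X-row e k)))) (solve 2 (λ x y → x :* (κ 1 :+ y) := x :+ x :* y) refl (X E G i k) (D E k))))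
              (trans (∑-+ Vs _ _) (cong (_+ ∑ Vs (λ k → X E G i k * D E k)) (X-row e i)))))))

        st≤ : S st ≤ XC + # 2 * (Dᵢ * Dᵢ * N E) + Zt + K₃
        st≤ = ≤-trans (S-mono (λ G e → ≤-trans (≤-reflexive (st-eq G e)) (≤-by (Dᵢ * Dᵢ - Dᵢ) (≤⇒0≤- (D≤DD e i))
            (solve 5 (λ a d dd z k → a :+ κ 2 :* dd :+ z :+ k :- (a :+ dd :+ z :+ (d :+ k)) := dd :- d) refl (x G * C E G j) Dᵢ (Dᵢ * Dᵢ) _ _))))
          (≤-reflexive (trans (∑-+ (𝓗 E) _ _) (cong (_+ K₃) (trans (∑-+ (𝓗 E) _ _) (cong (_+ Zt) (trans (∑-+ (𝓗 E) _ _) (cong (XC +_) (trans (N-* E _) (Rq.*-assoc _ _ _)))))))))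

        -- Conditioning on kl, the pair ik is bounded by `F-upper'`. The index l = i, where the two
        -- pairs would coincide, has weight 0 because ij is not in `E`.
        Zt≤ : Zt ≤ c * κ' * Dᵢ * SC
        Zt≤ = ≤-trans (≤-reflexive lhs) (≤-trans (∑∑-mono term) (≤-trans (≤-reflexive rhs) (≤-trans (∑-mono Vs rhs≤) (≤-trans (≤-reflexive (∑-*ˡ (c * κ' * Dᵢ) Vs _)) (*-monoˡ _ (0≤* (0≤* 0≤c 0≤κ) (0≤D₀ i)) last)))))
          where
          a : Fin n → ℚ
          a l = Ȳ E j l * D E l
          0≤a : ∀ l → # 0 ≤ a l
          0≤a l = 0≤* (0≤Ȳ E j l) (0≤D₀ l)
          lhs : Zt ≡ ∑∑ (λ k l → a l * S (λ G → X E G i k * Ȳ G k l))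
          lhs = trans (∑-cong (𝓗 E) (λ G → trans (sym (∑∑-row (X E G i) _)) (∑∑-cong (λ k l → solve 3 (λ x y z → x :* (y :* z) := z :* (x :* y)) refl (X E G i k) (Ȳ G k l) (a l))))) (trans (∑-∑∑ (𝓗 E) _) (∑∑-cong (λ k l → ∑-*ˡ (a l) (𝓗 E) _)))
          term : ∀ k l → a l * S (λ G → X E G i k * Ȳ G k l) ≤ a l * (c * (Dᵢ * D E k) * S (λ G → Ȳ G k l))
          term k l = by (i F.≟ l)
            where
            by : Dec (i ≡ l) → a l * S (λ G → X E G i k * Ȳ G k l) ≤ a l * (c * (Dᵢ * D E k) * S (λ G → Ȳ G k l))
            by (yes refl) = ≤-reflexive (trans (0*ˡ _ al0) (sym (0*ˡ _ al0)))
              where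
              al0 : a i ≡ # 0
              al0 = 0*ˡ (D E i) (trans (Ȳ-off E (λ p → i≢j (sym p))) (trans (Y-sym E j i) free))
            by (no i≢l) = *-monoˡ (a l) (0≤a l) (subst₂ _≤_ (trans (∑-cong (𝓗 E₁) (λ G → X-ext-≢ E k l G i k ne)) (trans (∑𝓗-ext E k l _) (∑-cong (𝓗 E) (λ G → Rq.*-comm _ _)))) (cong (c * (Dᵢ * D E k) *_) (trans (∑𝓗-ext E k l _) (∑-cong (𝓗 E) (λ G → Rq.*-identityʳ _))))
                   (F-upper' E (⊆-ext E k l) (near-ext k l near₀) (ℕₚ.m≤n+m 2 6) i k))
              where
              E₁ = ext E k l
              ne : ¬ SamePair k l i k
              ne (inj₁ (p , q)) = i≢l (sym (trans q p))
              ne (inj₂ (_ , p)) = i≢l (sym p)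
          rhs : ∑∑ (λ k l → a l * (c * (Dᵢ * D E k) * S (λ G → Ȳ G k l))) ≡ ∑ Vs (λ l → a l * (c * Dᵢ * S (λ G → C E G l)))
          rhs = trans (∑∑-col a (λ k l → c * (Dᵢ * D E k) * S (λ G → Ȳ G k l))) (∑-cong Vs (λ l → cong (a l *_) (trans (∑-cong Vs (λ k → trans (solve 4 (λ c d e s → c :* (d :* e) :* s := c :* d :* (e :* s)) refl c Dᵢ (D E k) (S (λ G → Ȳ G k l))) (cong (c * Dᵢ *_) (trans (sym (∑-*ˡ (D E k) (𝓗 E) _)) (∑-cong (𝓗 E) (λ G → trans (Rq.*-comm _ _) (cong (_* D E k) (Ȳ-sym G k l)))))))) (trans (∑-*ˡ (c * Dᵢ) Vs _) (cong (c * Dᵢ *_) (sym (∑-swap (𝓗 E) Vs _)))))))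
          rhs≤ : ∀ l → a l * (c * Dᵢ * S (λ G → C E G l)) ≤ c * κ' * Dᵢ * (a l * N E)
          rhs≤ l = ≤-trans (*-monoˡ _ (0≤a l) (*-monoˡ _ (0≤* 0≤c (0≤D₀ i)) (≤-trans (S-mono (λ G e → C≤ g e l)) (≤-reflexive (N-* E κ'))))) (≤-reflexive (solve 5 (λ a c d k N → a :* (c :* d :* (k :* N)) := c :* k :* d :* (a :* N)) refl (a l) c Dᵢ κ' (N E)))
          last : ∑ Vs (λ l → a l * N E) ≤ SC
          last = ≤-trans (≤-reflexive (trans (∑-*ʳ (N E) Vs a) (sym (N-* E _)))) (S-mono (λ G e → ∑-mono Vs (λ l → *-monoʳ (D E l) (0≤D₀ l) (Ȳ-⊆ (sub e) j l))))

        0≤Dⱼτ : # 0 ≤ τ * Dⱼ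
        0≤Dⱼτ = 0≤* 0≤τ (0≤D₀ j)

        0≤S : ∀ {φ : Graph → ℚ} → (∀ G → Ext E G → # 0 ≤ φ G) → # 0 ≤ S φ
        0≤S = ∑𝓗-nonneg E

        0≤SC : # 0 ≤ SC
        0≤SC = 0≤S (λ G e → 0≤C e j)

        0≤DDN' : # 0 ≤ Dᵢ * Dᵢ * N E
        0≤DDN' = 0≤* (0≤sq Dᵢ) (0≤N E)

        0≤K₃ : # 0 ≤ K₃
        0≤K₃ = K-nonneg i (λ G e k → 0≤D e k)

        St' : ℚ
        St' = XC + # 2 * (Dᵢ * Dᵢ * N E) + c * κ' * Dᵢ * SC + K₃

        0≤St' : # 0 ≤ St'
        0≤St' = 0≤+ (0≤+ (0≤+ (0≤S (λ G e → 0≤* (0≤x e) (0≤C e j))) (0≤* (0≤# 2) 0≤DDN')) (0≤* (0≤* (0≤* 0≤c 0≤κ) (0≤D₀ i)) 0≤SC)) 0≤K₃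

        β-lower : Bμ - β ≤ τ * Dⱼ * (K₁ + η * K₂ + St') + c * Dⱼ * Xr
        β-lower = ≤-by ((β + c * Dⱼ * Xr - ρ * (Dⱼ * (K₂ - S st))) + τ * Dⱼ * (K₁ - (μ * (Dᵢ * N E) - K₂)) + τ * Dⱼ * ((# 1 - η) * (St' - S st) + η * St'))
          (0≤+ (0≤+ (≤⇒0≤- W₂-lower) (0≤* 0≤Dⱼτ (≤⇒0≤- K₂-lower))) (0≤* 0≤Dⱼτ (0≤+ (0≤* (≤⇒0≤- η≤1) (≤⇒0≤- (≤-trans st≤ (+-monoˡ K₃ (+-monoʳ _ Zt≤))))) (0≤* 0≤η 0≤St'))))
          (solve 12 (λ u a b N m h K1 K2 be s s' xr → u :* b :* (K1 :+ h :* K2 :+ s') :+ (κ 1 :+ h) :* u :* b :* xr :- (m :* u :* (a :* b :* N) :- be) := (be :+ (κ 1 :+ h) :* u :* b :* xr :- (κ 1 :- h) :* u :* (b :* (K2 :- s))) :+ u :* b :* (K1 :- (m :* (a :* N) :- K2)) :+ u :* b :* ((κ 1 :- h) :* (s' :- s) :+ h :* s')) refl τ Dᵢ Dⱼ (N E) μ η K₁ K₂ β (S st) St' Xr)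

        R₁-eq : R₁ ≡ Aᵢ + η * S (λ G → x G * C E G i) + # 2 * Dᵢ * f + (Aⱼ + η * XC + # 2 * Dⱼ * f) + (# 2 * γ i j + η * ν) * f
        R₁-eq = trans (Sx-+ _ _) (cong₂ _+_ (trans (Sx-+ _ _) (cong₂ _+_ (part i) (part j))) (Sx-c _))
          where
          part : ∀ a → S (λ G → x G * h G a) ≡ S (λ G → x G * ∣ C E G a - μ ∣) + η * S (λ G → x G * C E G a) + # 2 * D E a * f
          part a = trans (Sx-+ _ _) (cong₂ _+_ (trans (Sx-+ _ _) (cong (S (λ G → x G * ∣ C E G a - μ ∣) +_) (Sx-* η _))) (Sx-c _))

        R₂-eq : R₂ ≡ τ * Dⱼ * (K₁ + η * K₂ + # 2 * K₃ + Dᵢ * S (λ G → h G i))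
        R₂-eq = cong (τ * Dⱼ *_) (trans (K-+ i _ _) (cong₂ _+_ (trans (K-+ i _ _) (cong₂ _+_ (trans (K-+ i _ _) (cong (K₁ +_) (K-* i η _))) (K-* i (# 2) _))) (K-const i (λ G → h G i))))

        Sh≥ : ∀ a → # 2 * D E a * N E ≤ S (λ G → h G a)
        Sh≥ a = ≤-trans (≤-reflexive (sym (N-* E _))) (S-mono (λ G e → ≤-by (∣ C E G a - μ ∣ + η * C E G a) (0≤+ (0≤∣∣ _) (0≤* 0≤η (0≤C e a))) (solve 2 (λ a b → a :+ b :- b := a) refl _ (# 2 * D E a))))

        Sh≥C : η * SC ≤ S (λ G → h G j)
        Sh≥C = ≤-trans (≤-reflexive (sym (∑-*ˡ η (𝓗 E) _))) (S-mono (λ G e → ≤-by (∣ C E G j - μ ∣ + # 2 * D E j) (0≤+ (0≤∣∣ _) (0≤* (0≤# 2) (0≤D e j))) (solve 3 (λ a b c → a :+ b :+ c :- b := a :+ c) refl (∣ C E G j - μ ∣) (η * C E G j) (# 2 * D E j))))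

        0≤Sh : ∀ a → # 0 ≤ S (λ G → h G a)
        0≤Sh a = 0≤S (λ G e → 0≤h e a)

        0≤w : # 0 ≤ w
        0≤w = 0≤S (λ G e → 0≤* (0≤x e) (0≤W₁ e i j))

        0≤XCᵢ : # 0 ≤ S (λ G → x G * C E G i)
        0≤XCᵢ = 0≤S (λ G e → 0≤* (0≤x e) (0≤C e i))

        0≤XCⱼ : # 0 ≤ XC
        0≤XCⱼ = 0≤S (λ G e → 0≤* (0≤x e) (0≤C e j))

        R : ℚ
        R = R₁ + R₂ + R₃

        DD≤ν+γ : DD ≤ ν + γ i j
        DD≤ν+γ = ≤-by (γ i j - (DD - ν)) (≤⇒0≤- (≤∣∣ (DD - ν))) (solve 3 (λ v g d → v :+ g :- d := g :- (d :- v)) refl ν (γ i j) DD)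

        Rx : ℚ
        Rx = Aᵢ + η * S (λ G → x G * C E G i) + # 2 * Dᵢ * f + (Aⱼ + η * XC + # 2 * Dⱼ * f) + (# 2 * γ i j + η * ν) * f
          + τ * Dⱼ * (K₁ + η * K₂ + # 2 * K₃ + Dᵢ * S (λ G → h G i)) + τ * (Dᵢ * Dⱼ) * S (λ G → h G j)

        R-eq : R ≡ Rx
        R-eq = cong (_+ R₃) (cong₂ _+_ R₁-eq R₂-eq)

        Q : ℚ
        Q = τ * Dⱼ * (K₁ + η * K₂ + St') + c * Dⱼ * Xr

        M≤Q : M ≤ Aᵢ + Aⱼ + γ i j * f + Q
        M≤Q = ≤-trans (≤-reflexive M-eq) (≤-by
            ((Aᵢ - aᵢ) + (Aⱼ - aⱼ) + (γ i j - - (DD - ν)) * f + w + (Q - (Bμ - β)))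
            (0≤+ (0≤+ (0≤+ (0≤+ (≤⇒0≤- (dev≤ i)) (≤⇒0≤- (dev≤ j))) (0≤* (≤⇒0≤- (-≤∣∣ (DD - ν))) 0≤f)) 0≤w) (≤⇒0≤- β-lower))
            (solve 10 (λ a a' b b' gm dv f w q z → a :+ b :+ gm :* f :+ q :- (a' :+ b' :- dv :* f :- w :+ z) := (a :- a') :+ (b :- b') :+ (gm :- (:- dv)) :* f :+ w :+ (q :- z)) refl Aᵢ aᵢ Aⱼ aⱼ (γ i j) (DD - ν) f w Q (Bμ - β)))
          where
          aᵢ = S (λ G → x G * (C E G i - μ))
          aⱼ = S (λ G → x G * (C E G j - μ))

        -- Here `W₁` has the favourable sign and only the lower bound for `β` enters; the reverse
        -- inequality `-M≤R` relies on `W₁-upper` and `β-upper`. In both proofs the slack is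
        -- displayed as a sum of products of nonnegative factors and checked by one polynomial
        -- identity.
        M≤R : M ≤ R
        M≤R = ≤-trans M≤Q (≤-trans (≤-by
            (η * XCᵢ + # 2 * Dᵢ * f + η * XC + (Dⱼ * f + Dⱼ * ((# 1 - κ' * τ) * f) + τ * Dⱼ * (κ' * f - XC))
              + (γ i j * (# 1 - η) * f + η * (ν + γ i j - DD) * f + (η - c * κ') * (DD * f) + c * Dⱼ * (κ' * Dᵢ * f - Xr))
              + τ * Dⱼ * K₃ + τ * Dⱼ * (Dᵢ * (Shᵢ - # 2 * Dᵢ * N E)) + τ * DD * ((Shⱼ - η * SC) + (η - c * κ') * SC))
            (0≤+ (0≤+ (0≤+ (0≤+ (0≤+ (0≤+ (0≤+ (0≤* 0≤η 0≤XCᵢ) (0≤* (0≤* (0≤# 2) (0≤D₀ i)) 0≤f)) (0≤* 0≤η 0≤XCⱼ))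
              (0≤+ (0≤+ (0≤* (0≤D₀ j) 0≤f) (0≤* (0≤D₀ j) (0≤* (≤⇒0≤- κτ≤1) 0≤f))) (0≤* 0≤Dⱼτ (≤⇒0≤- XC≤))))
              (0≤+ (0≤+ (0≤+ (0≤* (0≤* (0≤γ i j) (≤⇒0≤- η≤1)) 0≤f) (0≤* (0≤* 0≤η (≤⇒0≤- DD≤ν+γ)) 0≤f)) (0≤* (≤⇒0≤- cκ≤η) (0≤* 0≤DD 0≤f))) (0≤* (0≤* 0≤c (0≤D₀ j)) (≤⇒0≤- Xr≤))))
              (0≤* 0≤Dⱼτ 0≤K₃)) (0≤* 0≤Dⱼτ (0≤* (0≤D₀ i) (≤⇒0≤- (Sh≥ i))))) (0≤* (0≤* 0≤τ 0≤DD) (0≤+ (≤⇒0≤- Sh≥C) (0≤* (≤⇒0≤- cκ≤η) 0≤SC))))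
            (solve 21 (λ Ai Aj f u a b h c k v gm XCi xc sc K1 K2 K3 Shi Shj xr N →
               (Ai :+ h :* XCi :+ κ 2 :* a :* f :+ (Aj :+ h :* xc :+ κ 2 :* b :* f) :+ (κ 2 :* gm :+ h :* v) :* f
                 :+ u :* b :* (K1 :+ h :* K2 :+ κ 2 :* K3 :+ a :* Shi) :+ u :* (a :* b) :* Shj)
               :- (Ai :+ Aj :+ gm :* f :+ (u :* b :* (K1 :+ h :* K2 :+ (xc :+ κ 2 :* (a :* a :* N) :+ c :* k :* a :* sc :+ K3)) :+ c :* b :* xr))
               := h :* XCi :+ κ 2 :* a :* f :+ h :* xc :+ (b :* f :+ b :* ((κ 1 :- k :* u) :* f) :+ u :* b :* (k :* f :- xc))
                 :+ (gm :* (κ 1 :- h) :* f :+ h :* (v :+ gm :- a :* b) :* f :+ (h :- c :* k) :* (a :* b :* f) :+ c :* b :* (k :* a :* f :- xr))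
                 :+ u :* b :* K3 :+ u :* b :* (a :* (Shi :- κ 2 :* a :* N)) :+ u :* (a :* b) :* ((Shj :- h :* sc) :+ (h :- c :* k) :* sc))
               refl Aᵢ Aⱼ f τ Dᵢ Dⱼ η c κ' ν (γ i j) XCᵢ XC SC K₁ K₂ K₃ Shᵢ Shⱼ Xr (N E))) (≤-reflexive (sym R-eq)))
          where
          XCᵢ = S (λ G → x G * C E G i)
          Shᵢ = S (λ G → h G i)
          Shⱼ = S (λ G → h G j)

        -M≤R : - M ≤ R
        -M≤R = ≤-trans (≤-by
            ((Aᵢ - - aᵢ) + (Aⱼ - - aⱼ) + (γ i j - (DD - ν)) * f + ((# 2 * Dᵢ + Dⱼ) * f + η * XC - w) + (τ * Dⱼ * (K₁ + η * K₂) - (β - Bμ))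
              + (η * XCᵢ + Dⱼ * f + (γ i j + η * ν) * f + τ * Dⱼ * (# 2 * K₃ + Dᵢ * Shᵢ) + τ * DD * Shⱼ))
            (0≤+ (0≤+ (0≤+ (0≤+ (0≤+ (≤⇒0≤- (-dev≤ i)) (≤⇒0≤- (-dev≤ j))) (0≤* (≤⇒0≤- (≤∣∣ (DD - ν))) 0≤f)) (≤⇒0≤- W₁-upper)) (≤⇒0≤- β-upper))
              (0≤+ (0≤+ (0≤+ (0≤+ (0≤* 0≤η 0≤XCᵢ) (0≤* (0≤D₀ j) 0≤f)) (0≤* (0≤+ (0≤γ i j) (0≤* 0≤η 0≤ν)) 0≤f)) (0≤* 0≤Dⱼτ (0≤+ (0≤* (0≤# 2) 0≤K₃) (0≤* (0≤D₀ i) (0≤Sh i))))) (0≤* (0≤* 0≤τ 0≤DD) (0≤Sh j))))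
            (trans (cong (λ z → Rx - - z) M-eq) (solve 21 (λ Ai Aj f u a b h v gm XCi xc K1 K2 K3 Shi Shj w ai aj B be →
               (Ai :+ h :* XCi :+ κ 2 :* a :* f :+ (Aj :+ h :* xc :+ κ 2 :* b :* f) :+ (κ 2 :* gm :+ h :* v) :* f
                 :+ u :* b :* (K1 :+ h :* K2 :+ κ 2 :* K3 :+ a :* Shi) :+ u :* (a :* b) :* Shj)
               :- (:- (ai :+ aj :- (a :* b :- v) :* f :- w :+ (B :- be)))
               := (Ai :- (:- ai)) :+ (Aj :- (:- aj)) :+ (gm :- (a :* b :- v)) :* f :+ ((κ 2 :* a :+ b) :* f :+ h :* xc :- w) :+ (u :* b :* (K1 :+ h :* K2) :- (be :- B))
                 :+ (h :* XCi :+ b :* f :+ (gm :+ h :* v) :* f :+ u :* b :* (κ 2 :* K3 :+ a :* Shi) :+ u :* (a :* b) :* Shj))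
               refl Aᵢ Aⱼ f τ Dᵢ Dⱼ η ν (γ i j) XCᵢ XC K₁ K₂ K₃ Shᵢ Shⱼ w aᵢ aⱼ Bμ β))) (≤-reflexive (sym R-eq))
          where
          aᵢ = S (λ G → x G * (C E G i - μ))
          aⱼ = S (λ G → x G * (C E G j - μ))
          XCᵢ = S (λ G → x G * C E G i)
          Shᵢ = S (λ G → h G i)
          Shⱼ = S (λ G → h G j)

    -- Chi-square distance of a single step

    joins-ends : ∀ q → Joins q (fst q) (snd q)
    joins-ends q = inj₁ (refl , refl)

    Xq-row : ∀ {E G} → Ext E G → ∀ i → ∑ Ps (λ q → inc q i * Xq E G q) ≡ D E i
    Xq-row {E} {G} e i = trans (sym (lift-row (Xq E G) i)) (trans (∑-cong Vs (λ j → lem j)) (X-row e i))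
      where
      lem : ∀ j → lift (Xq E G) i j ≡ X E G i j
      lem j with i F.≟ j
      ... | yes refl = trans (lift-diag _ i) (sym (X-diag E G i))
      ... | no ne = trans (lift-ix _ i j ne) (sym (X-joins E G (ix-joins i j ne)))

    ∑Xq : ∀ {E G} → Ext E G → # 2 * ∑ Ps (Xq E G) ≡ vol E
    ∑Xq {E} {G} e = trans (sym (∑-*ˡ (# 2) Ps _)) (trans (∑-cong Ps (λ q → trans (cong (_* Xq E G q) (sym (∑-inc q))) (sym (∑-*ʳ (Xq E G q) Vs _)))) (trans (∑-swap Ps Vs _) (∑-cong Vs (Xq-row e))))

    0≤Xq : ∀ {E G} → E ⊆ G → ∀ q → # 0 ≤ Xq E G q
    0≤Xq {E} {G} s q = subst (# 0 ≤_) (sym (Xq-Xᵇ s q)) (0≤𝟙 (Xᵇ E G q))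

    opaque
      unfolding link

      -- An ordered pair of distinct vertices is an orientation of exactly one pair; only the
      -- diagonal of the double sum is lost.
      ∑-ends : ∀ (φ : Fin n → Fin n → ℚ) → (∀ i j → # 0 ≤ φ i j) → ∑ Ps (λ q → φ (fst q) (snd q) + φ (snd q) (fst q)) ≤ ∑∑ φ
      ∑-ends φ 0≤φ = ≤-trans (≤-reflexive (trans (∑-cong Ps (λ q → sym (expand q))) (trans (∑-∑∑ Ps _) (∑∑-cong (λ i j → ∑-*ʳ (φ i j) Ps _)))))
          (∑∑-mono (λ i j → ≤-trans (*-monoʳ (φ i j) (0≤φ i j) (one i j)) (≤-reflexive (Rq.*-identityˡ _))))
        where
        expand : ∀ q → ∑∑ (λ i j → link q i j * φ i j) ≡ φ (fst q) (snd q) + φ (snd q) (fst q)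
        expand q = trans (∑∑-cong (λ i j → solve 5 (λ a b c d f → (a :* b :+ c :* d) :* f := a :* (b :* f) :+ d :* (c :* f)) refl (δ (fst q) i) (δ (snd q) j) (δ (fst q) j) (δ (snd q) i) (φ i j)))
          (trans (∑∑-+ _ _) (cong₂ _+_ (trans (∑∑-row (δ (fst q)) (λ i j → δ (snd q) j * φ i j)) (trans (∑-δ (fst q) (λ i → ∑ Vs (λ j → δ (snd q) j * φ i j))) (∑-δ (snd q) (φ (fst q)))))
            (trans (∑∑-row (δ (snd q)) (λ i j → δ (fst q) j * φ i j)) (trans (∑-δ (snd q) (λ i → ∑ Vs (λ j → δ (fst q) j * φ i j))) (∑-δ (fst q) (φ (snd q)))))))
        one : ∀ i j → ∑ Ps (λ q → link q i j) ≤ # 1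
        one i j with i F.≟ j
        ... | yes refl = ≤-trans (≤-reflexive (trans (∑-cong Ps (λ q → link-¬joins (λ x → joins-≢ x refl))) (∑-0 Ps))) 0≤1
        ... | no ne = ≤-reflexive (trans (∑-cong Ps (link-ix i j ne)) (∑-δ1 (ix i j ne)))

    wt : Graph → P → ℚ
    wt E q = (# 1 - 𝟙 (lookup E q)) * (D E (fst q) * D E (snd q))

    Wt : Graph → ℚ
    Wt E = ∑ Ps (wt E)

    Fq : Graph → P → ℚ
    Fq E q = ∑ (𝓗 E) (λ G → Xq E G q)

    -- As U_q = F_q / (s N) and A_q = w_q / W, the sum of U_q²/A_q is `χ E` divided by (s N)². With
    -- vol = 2 s, one plus the chi-square distance is therefore 4 χ / (vol² N²).
    χ : Graph → ℚ
    χ E = Wt E * ∑ Ps (λ q → Fq E q * Fq E q * inv (wt E q))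

    Fq-F : ∀ E q → Fq E q ≡ F E (fst q) (snd q)
    Fq-F E q = ∑-cong (𝓗 E) (λ G → sym (X-joins E G (joins-ends q)))

    0≤Fq : ∀ E q → # 0 ≤ Fq E q
    0≤Fq E q = ∑𝓗-nonneg E (λ G e → 0≤Xq (sub e) q)

    ∑Fq : ∀ E → # 2 * ∑ Ps (Fq E) ≡ vol E * N E
    ∑Fq E = trans (cong (# 2 *_) (∑-swap Ps (𝓗 E) _)) (trans (sym (∑-*ˡ (# 2) (𝓗 E) _)) (trans (∑𝓗-cong E (λ G e → ∑Xq e)) (N-* E (vol E))))

    module _ {E G₀ : Graph} (e₀ : Ext E G₀) where

      0≤wt : ∀ q → # 0 ≤ wt E q
      0≤wt q = 0≤* (bit-comp (lookup E q)) (0≤* (0≤D e₀ (fst q)) (0≤D e₀ (snd q)))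

      0≤Wt : # 0 ≤ Wt E
      0≤Wt = ∑-nonneg Ps 0≤wt

      Wt≤ : # 2 * Wt E ≤ vol E * vol E
      Wt≤ = ≤-trans (≤-reflexive (sym (∑-*ˡ (# 2) Ps _))) (≤-trans (∑-mono Ps (λ q → ≤-by (# 2 * (𝟙 (lookup E q) * (D E (fst q) * D E (snd q)))) (0≤* (0≤# 2) (0≤* (0≤𝟙 (lookup E q)) (0≤* (0≤D e₀ (fst q)) (0≤D e₀ (snd q)))))
          (solve 3 (λ x a b → a :* b :+ b :* a :- κ 2 :* ((κ 1 :- x) :* (a :* b)) := κ 2 :* (x :* (a :* b))) refl (𝟙 (lookup E q)) (D E (fst q)) (D E (snd q)))))
        (≤-trans (∑-ends (λ i j → D E i * D E j) (λ i j → 0≤* (0≤D e₀ i) (0≤D e₀ j))) (≤-reflexive (trans (∑∑-row (D E) (λ _ → D E)) (∑-*ʳ (vol E) Vs (D E))))))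

      -- A new edge of a completion gives both of its ends a positive residual degree. This absolute
      -- continuity of U with respect to A makes the value `inv (# 0)` = 0 harmless in `χ`.
      wt0⇒Fq0 : ∀ q → wt E q ≡ # 0 → Fq E q ≡ # 0
      wt0⇒Fq0 q z = trans (∑𝓗-cong E (λ G e → X0 G e)) (∑-0 (𝓗 E))
        where
        X0 : ∀ G → Ext E G → Xq E G q ≡ # 0
        X0 G e with bit-cases (𝟙-bit (Xᵇ E G q))
        ... | inj₁ p = trans (Xq-Xᵇ (sub e) q) p
        ... | inj₂ p = ⊥-elim (pos⇒≢0 (0<* (<-≤-trans 0<1 one) (0<* (D>0 (joins-ends q)) (D>0 (joins-sym (joins-ends q))))) z)
          where
          Xq1 : Xq E G q ≡ # 1
          Xq1 = trans (Xq-Xᵇ (sub e) q) p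
          one : # 1 ≤ # 1 - 𝟙 (lookup E q)
          one = ≤-trans (≤-reflexive (sym Xq1)) (+-monoˡ (- 𝟙 (lookup E q)) (bit-≤1 (𝟙-bit (lookup G q))))
          D>0 : ∀ {a b} → Joins q a b → # 0 < D E a
          D>0 {a} {b} J = <-≤-trans 0<1 (≤-trans (≤-reflexive (sym (trans (X-joins E G J) Xq1))) (subst (X E G a b ≤_) (X-row e a) (term≤∑ Vs (0≤X (sub e) a) (∈-allFin b))))

      -- Expanding F = a w + (F - a w) gives χ = 2 a W ∑F - a² W² + W ∑ (F - a w)²/w. As 2 ∑F = vol
      -- N, four times the first two terms fall short of (vol N)² by the square of vol N - 2 a W,
      -- and 4 W ≤ 2 vol² treats the last one.
      χ-linear : ∀ a → # 4 * χ E ≤ vol E * vol E * (N E * N E) + # 2 * (vol E * vol E) * ∑ Ps (λ q → (Fq E q - a * wt E q) * (Fq E q - a * wt E q) * inv (wt E q))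
      χ-linear a = ≤-by (z * z + (# 2 * (v * v) - # 4 * W) * Y') (0≤+ (0≤sq z) (0≤* (≤⇒0≤- 4W≤) (∑-nonneg Ps (λ q → 0≤* (0≤sq (Fq E q - a * wt E q)) (0≤inv (0≤wt q))))))
          (trans (cong (λ s → v * v * (N E * N E) + # 2 * (v * v) * Y' - # 4 * (W * s)) split)
            (trans (solve 6 (λ v n W a f y → v :* v :* (n :* n) :+ κ 2 :* (v :* v) :* y :- κ 4 :* (W :* (κ 2 :* a :* f :- a :* a :* W :+ y)) := (v :* n) :* (v :* n) :- κ 4 :* W :* a :* (κ 2 :* f) :+ κ 4 :* (W :* a :* (W :* a)) :+ (κ 2 :* (v :* v) :- κ 4 :* W) :* y) refl v (N E) W a (∑ Ps (Fq E)) Y')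
            (trans (cong (λ s → (v * N E) * (v * N E) - # 4 * W * a * s + # 4 * (W * a * (W * a)) + (# 2 * (v * v) - # 4 * W) * Y') (∑Fq E))
              (solve 5 (λ v n W a y → (v :* n) :* (v :* n) :- κ 4 :* W :* a :* (v :* n) :+ κ 4 :* (W :* a :* (W :* a)) :+ (κ 2 :* (v :* v) :- κ 4 :* W) :* y := (v :* n :- κ 2 :* W :* a) :* (v :* n :- κ 2 :* W :* a) :+ (κ 2 :* (v :* v) :- κ 4 :* W) :* y) refl v (N E) W a Y'))))
        where
        v = vol E
        W = Wt E
        z = v * N E - # 2 * W * a
        Y' = ∑ Ps (λ q → (Fq E q - a * wt E q) * (Fq E q - a * wt E q) * inv (wt E q))
        4W≤ : # 4 * W ≤ # 2 * (v * v)
        4W≤ = ≤-by (# 2 * (v * v - # 2 * W)) (0≤* (0≤# 2) (≤⇒0≤- Wt≤)) (solve 2 (λ w v → κ 2 :* v :- κ 4 :* w := κ 2 :* (v :- κ 2 :* w)) refl W (v * v))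
        term : ∀ q → Fq E q * Fq E q * inv (wt E q) ≡ # 2 * a * Fq E q - a * a * wt E q + (Fq E q - a * wt E q) * (Fq E q - a * wt E q) * inv (wt E q)
        term q = by (wt E q ≟0)
          where
          f = Fq E q
          w = wt E q
          i = inv w
          by : Dec (w ≡ # 0) → f * f * i ≡ # 2 * a * f - a * a * w + (f - a * w) * (f - a * w) * i
          by (yes p) = trans (cong (λ s → s * s * i) (wt0⇒Fq0 q p)) (trans (solve 2 (λ a i → κ 0 :* κ 0 :* i := κ 2 :* a :* κ 0 :- a :* a :* κ 0 :+ (κ 0 :- a :* κ 0) :* (κ 0 :- a :* κ 0) :* i) refl a i)
            (cong₂ (λ s w → # 2 * a * s - a * a * w + (s - a * w) * (s - a * w) * i) (sym (wt0⇒Fq0 q p)) (sym p)))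
          by (no p) = trans (solve 4 (λ a f w i → f :* f :* i := κ 2 :* a :* f :- a :* a :* w :+ (f :- a :* w) :* (f :- a :* w) :* i :+ (κ 2 :* a :* f :- a :* a :* w) :* (w :* i :- κ 1)) refl a f w i)
            (trans (cong (λ s → # 2 * a * f - a * a * w + (f - a * w) * (f - a * w) * i + (# 2 * a * f - a * a * w) * (s - # 1)) (inv-r p))
              (solve 2 (λ x z → x :+ z :* (κ 1 :- κ 1) := x) refl (# 2 * a * f - a * a * w + (f - a * w) * (f - a * w) * i) (# 2 * a * f - a * a * w)))
        split : ∑ Ps (λ q → Fq E q * Fq E q * inv (wt E q)) ≡ # 2 * a * ∑ Ps (Fq E) - a * a * W + Y'
        split = trans (∑-cong Ps term) (trans (∑-+ Ps _ _) (cong (_+ Y') (trans (∑-- Ps _ _) (cong₂ _-_ (∑-*ˡ (# 2 * a) Ps _) (∑-*ˡ (a * a) Ps _)))))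

    module Psi (E : Graph) (κ' : ℚ) (g : Good κ' E) (1≤κ : # 1 ≤ κ') (big : # 20 * κ' ≤ vol E)
      {G₀ : Graph} (e₀ : Ext E G₀) (μ ν : ℚ) (0≤μ : # 0 ≤ μ) (0≤ν : # 0 ≤ ν) (4μ≤ : # 4 * μ ≤ vol E) where

      open Deviation E κ' g 1≤κ big e₀ μ ν 0≤μ 0≤ν public

      H : Graph → Fin n → ℚ
      H G a = h G a * h G a

      -- Cauchy-Schwarz turns the squares of `R₁`, `R₂`, `R₃` into second moments times
      -- `D E i * D E j * N E`, the factor that division by the weight removes. The 3 comes from
      -- squaring a sum of three terms; 8 = 4 · 2 comes from four squares and from F ≤ 2 τ D_i D_j
      -- N.
      Θ : Fin n → Fin n → ℚ
      Θ i j = # 3 * (# 8 * τ * S (λ G → X E G i j * (H G i + H G j + # 4 * (γ i j * γ i j) + η * ν * (η * ν)))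
        + # 2 * (τ * τ) * (D E j * K i (λ G k → H G k + H G i)) + τ * τ * (D E i * D E j * S (λ G → H G j)))

      0≤Θ : ∀ i j → # 0 ≤ Θ i j
      0≤Θ i j = 0≤* (0≤# 3) (0≤+ (0≤+ (0≤* (0≤* (0≤# 8) 0≤τ) (∑𝓗-nonneg E (λ G e → 0≤* (0≤X (sub e) i j) (0≤+ (0≤+ (0≤+ (0≤sq (h G i)) (0≤sq (h G j))) (0≤* (0≤# 4) (0≤sq (γ i j)))) (0≤sq (η * ν))))))
        (0≤* (0≤* (0≤# 2) (0≤sq τ)) (0≤* (0≤D₀ j) (K-nonneg i (λ G e k → 0≤+ (0≤sq (h G k)) (0≤sq (h G i))))))) (0≤* (0≤sq τ) (0≤* (0≤* (0≤D₀ i) (0≤D₀ j)) (∑𝓗-nonneg E (λ G e → 0≤sq (h G j))))))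

      K-cauchy : ∀ i φ → K i φ * K i φ ≤ D E i * N E * K i (λ G k → φ G k * φ G k)
      K-cauchy i φ = ≤-trans (≤-reflexive (cong₂ _*_ one one)) (≤-trans (cauchy (𝓗 E) {w = λ _ → # 1} (λ G → ∑ Vs (λ k → X E G i k * φ G k)) (λ _ → 0≤1))
        (≤-trans (*-monoˡ (N E) (0≤N E) (≤-trans (S-mono (λ G e → ≤-trans (≤-reflexive (Rq.*-identityˡ _)) (≤-trans (cauchy Vs (φ G) (λ {k} _ → 0≤X (sub e) i k)) (≤-reflexive (cong (_* ∑ Vs (λ k → X E G i k * (φ G k * φ G k))) (X-row e i)))))) (≤-reflexive (∑-*ˡ (D E i) (𝓗 E) _))))
          (≤-reflexive (solve 3 (λ n d k → n :* (d :* k) := d :* n :* k) refl (N E) (D E i) (K i (λ G k → φ G k * φ G k))))))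
        where
        one : K i φ ≡ S (λ G → # 1 * ∑ Vs (λ k → X E G i k * φ G k))
        one = ∑-cong (𝓗 E) (λ G → sym (Rq.*-identityˡ _))

      M²≤ : ∀ {i j} (i≢j : i ≢ j) (free : Y E i j ≡ # 0) → Bound.M i≢j free * Bound.M i≢j free ≤ D E i * D E j * N E * Θ i j
      M²≤ {i} {j} i≢j free = ≤-trans (sq-≤ M≤R -M≤R) (≤-trans (sq-+₃ R₁ R₂ R₃) (≤-trans (*-monoˡ (# 3) (0≤# 3) (+-mono (+-mono R₁² R₂²) R₃²))
          (≤-reflexive (solve 4 (λ q a b c → κ 3 :* (q :* a :+ q :* b :+ q :* c) := q :* (κ 3 :* (a :+ b :+ c))) refl (D E i * D E j * N E) _ _ _))))
        where
        open Bound i≢j free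
        q = D E i * D E j * N E
        f = F E i j
        f≤ : f ≤ # 2 * τ * q
        f≤ = ≤-trans (F-upper near₀ ℕ.z≤n i j) (*-monoʳ q (0≤NDD E i j) (≤-by ((# 1 - η) * τ) (0≤* (≤⇒0≤- η≤1) 0≤τ) (solve 2 (λ h u → κ 2 :* u :- (κ 1 :+ h) :* u := (κ 1 :- h) :* u) refl η τ)))
        x : Graph → ℚ
        x G = X E G i j
        V₁ : Graph → ℚ
        V₁ G = H G i + H G j + # 4 * (γ i j * γ i j) + η * ν * (η * ν)
        four : ∀ G → (h G i + h G j + (# 2 * γ i j + η * ν)) * (h G i + h G j + (# 2 * γ i j + η * ν)) ≤ # 4 * V₁ G
        four G = ≤-trans (sq-+₂ (h G i + h G j) (# 2 * γ i j + η * ν)) (≤-trans (*-monoˡ (# 2) (0≤# 2) (+-mono (sq-+₂ (h G i) (h G j)) (sq-+₂ (# 2 * γ i j) (η * ν))))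
          (≤-reflexive (solve 4 (λ a b c z → κ 2 :* (κ 2 :* (a :* a :+ b :* b) :+ κ 2 :* (κ 2 :* c :* (κ 2 :* c) :+ z :* z)) := κ 4 :* (a :* a :+ b :* b :+ κ 4 :* (c :* c) :+ z :* z)) refl (h G i) (h G j) (γ i j) (η * ν))))
        SV = S (λ G → x G * V₁ G)
        0≤SV : # 0 ≤ SV
        0≤SV = ∑𝓗-nonneg E (λ G e → 0≤* (0≤X (sub e) i j) (0≤+ (0≤+ (0≤+ (0≤sq (h G i)) (0≤sq (h G j))) (0≤* (0≤# 4) (0≤sq (γ i j)))) (0≤sq (η * ν))))
        R₁² : R₁ * R₁ ≤ q * (# 8 * τ * SV)
        R₁² = ≤-trans (cauchy (𝓗 E) (λ G → h G i + h G j + (# 2 * γ i j + η * ν)) (λ m → 0≤X (sub (𝓗⇒ m)) i j))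
          (≤-trans (*-monoˡ f (0≤F E i j) (≤-trans (S-mono (λ G e → ≤-trans (*-monoˡ (x G) (0≤X (sub e) i j) (four G)) (≤-reflexive (solve 2 (λ x v → x :* (κ 4 :* v) := κ 4 :* (x :* v)) refl (x G) (V₁ G))))) (≤-reflexive (∑-*ˡ (# 4) (𝓗 E) _))))
          (≤-trans (*-monoʳ (# 4 * SV) (0≤* (0≤# 4) 0≤SV) f≤) (≤-reflexive (solve 3 (λ u q s → κ 2 :* u :* q :* (κ 4 :* s) := q :* (κ 8 :* u :* s)) refl τ q SV))))
        R₂² : R₂ * R₂ ≤ q * (# 2 * (τ * τ) * (D E j * K i (λ G k → H G k + H G i)))
        R₂² = ≤-trans (≤-reflexive (solve 3 (λ u d k → u :* d :* k :* (u :* d :* k) := u :* u :* (d :* d) :* (k :* k)) refl τ (D E j) _)) (≤-trans (*-monoˡ _ (0≤* (0≤sq τ) (0≤sq (D E j))) (≤-trans (K-cauchy i (λ G k → h G k + h G i))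
            (*-monoˡ _ (0≤* (0≤D₀ i) (0≤N E)) (≤-trans (K-mono' i (λ G e k → sq-+₂ (h G k) (h G i))) (≤-reflexive (K-* i (# 2) _))))))
          (≤-reflexive (solve 5 (λ u d a n k → u :* u :* (d :* d) :* (a :* n :* (κ 2 :* k)) := a :* d :* n :* (κ 2 :* (u :* u) :* (d :* k))) refl τ (D E j) (D E i) (N E) (K i (λ G k → H G k + H G i)))))
        R₃² : R₃ * R₃ ≤ q * (τ * τ * (D E i * D E j * S (λ G → H G j)))
        R₃² = ≤-trans (≤-reflexive (solve 3 (λ u d s → u :* d :* s :* (u :* d :* s) := u :* u :* (d :* d) :* (s :* s)) refl τ (D E i * D E j) _)) (≤-trans (*-monoˡ _ (0≤* (0≤sq τ) (0≤sq (D E i * D E j)))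
            (≤-trans (≤-reflexive (cong₂ _*_ one one)) (≤-trans (cauchy (𝓗 E) {w = λ _ → # 1} (λ G → h G j) (λ _ → 0≤1)) (≤-reflexive (cong (N E *_) (∑-cong (𝓗 E) (λ G → Rq.*-identityˡ _)))))))
          (≤-reflexive (solve 4 (λ u d n s → u :* u :* (d :* d) :* (n :* s) := d :* n :* (u :* u :* (d :* s))) refl τ (D E i * D E j) (N E) (S (λ G → H G j)))))
          where
          one : S (λ G → h G j) ≡ S (λ G → # 1 * h G j)
          one = ∑-cong (𝓗 E) (λ G → sym (Rq.*-identityˡ _))

      -- What `Θ` sums to over ordered pairs, up to `# 3 * τ`, once row sums of X have become
      -- residual degrees and t τ = 1: 21 = 8 · 2 + 2 · 2 + 1 and 32 = 8 · 4.
      Ψ : Graph → ℚ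
      Ψ G = # 21 * ∑ Vs (λ a → D E a * H G a) + # 32 * ∑∑ (λ i j → X E G i j * (γ i j * γ i j)) + # 8 * (η * ν * (η * ν)) * t

      ∑∑Θ : ∑∑ Θ ≡ # 3 * τ * S Ψ
      ∑∑Θ = trans (∑∑-*ˡ (# 3) _) (trans (cong (# 3 *_) (trans (∑∑-+ _ _) (cong₂ _+_ (trans (∑∑-+ _ _) (cong₂ _+_ (trans (∑∑-*ˡ (# 8 * τ) _) (cong (# 8 * τ *_) first)) (trans (∑∑-*ˡ (# 2 * (τ * τ)) _) (cong (# 2 * (τ * τ) *_) second)))) (trans (∑∑-*ˡ (τ * τ) _) (cong (τ * τ *_) third)))))
          (trans (solve 6 (λ u t a b z n → κ 3 :* (κ 8 :* u :* (κ 2 :* a :+ κ 4 :* b :+ z :* t :* n) :+ κ 2 :* (u :* u) :* (t :* (κ 2 :* a)) :+ u :* u :* (t :* a)) := κ 3 :* u :* ((κ 16 :+ κ 5 :* (t :* u)) :* a :+ κ 32 :* b :+ κ 8 :* z :* t :* n)) refl τ t SH SΓ (η * ν * (η * ν)) (N E))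
          (trans (cong (λ s → # 3 * τ * ((# 16 + # 5 * s) * SH + # 32 * SΓ + # 8 * (η * ν * (η * ν)) * t * N E)) tτ)
            (cong (# 3 * τ *_) (trans (cong (λ s → s * SH + # 32 * SΓ + # 8 * (η * ν * (η * ν)) * t * N E) (solve 0 (κ 16 :+ κ 5 :* κ 1 := κ 21) refl)) (sym SΨ))))))
        where
        SH = S (λ G → ∑ Vs (λ a → D E a * H G a))
        SΓ = S (λ G → ∑∑ (λ i j → X E G i j * (γ i j * γ i j)))
        SΨ : S Ψ ≡ # 21 * SH + # 32 * SΓ + # 8 * (η * ν * (η * ν)) * t * N E
        SΨ = trans (∑-+ (𝓗 E) _ _) (cong₂ _+_ (trans (∑-+ (𝓗 E) _ _) (cong₂ _+_ (∑-*ˡ (# 21) (𝓗 E) _) (∑-*ˡ (# 32) (𝓗 E) _))) (N-* E _))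
        rowH : ∀ G → Ext E G → ∑∑ (λ i k → X E G i k * H G i) ≡ ∑ Vs (λ a → D E a * H G a)
        rowH G e = ∑-cong Vs (λ i → trans (∑-*ʳ (H G i) Vs _) (cong (_* H G i) (X-row e i)))
        colH : ∀ G → Ext E G → ∑∑ (λ i k → X E G i k * H G k) ≡ ∑ Vs (λ a → D E a * H G a)
        colH G e = trans (∑∑-swap _) (∑-cong Vs (λ k → trans (∑-*ʳ (H G k) Vs _) (cong (_* H G k) (X-col e k))))
        first : ∑∑ (λ i j → S (λ G → X E G i j * (H G i + H G j + # 4 * (γ i j * γ i j) + η * ν * (η * ν)))) ≡ # 2 * SH + # 4 * SΓ + η * ν * (η * ν) * t * N E
        first = trans (sym (∑-∑∑ (𝓗 E) _)) (trans (∑𝓗-cong E (λ G e → trans (∑∑-cong (λ i j → solve 5 (λ x a b c z → x :* (a :+ b :+ κ 4 :* c :+ z) := x :* a :+ x :* b :+ κ 4 :* (x :* c) :+ z :* x) refl (X E G i j) (H G i) (H G j) (γ i j * γ i j) (η * ν * (η * ν))))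
            (trans (∑∑-+ _ _) (cong₂ _+_ (trans (∑∑-+ _ _) (cong₂ _+_ (trans (∑∑-+ _ _) (trans (cong₂ _+_ (rowH G e) (colH G e)) (solve 1 (λ a → a :+ a := κ 2 :* a) refl (∑ Vs (λ a → D E a * H G a))))) (∑∑-*ˡ (# 4) _))) (trans (∑∑-*ˡ _ _) (cong (η * ν * (η * ν) *_) (∑-cong Vs (X-row e))))))))
            (trans (∑-+ (𝓗 E) _ _) (cong₂ _+_ (trans (∑-+ (𝓗 E) _ _) (cong₂ _+_ (∑-*ˡ (# 2) (𝓗 E) _) (∑-*ˡ (# 4) (𝓗 E) _))) (N-* E _))))
        second : ∑∑ (λ i j → D E j * K i (λ G k → H G k + H G i)) ≡ t * (# 2 * SH)
        second = trans (∑∑-col (D E) (λ i _ → K i (λ G k → H G k + H G i))) (trans (∑-*ʳ _ Vs (D E)) (cong (t *_) (trans (sym (∑-swap (𝓗 E) Vs _)) (trans (∑𝓗-cong E (λ G e → trans (∑∑-cong (λ i k → Rq.distribˡ _ _ _)) (trans (∑∑-+ _ _) (trans (cong₂ _+_ (colH G e) (rowH G e)) (solve 1 (λ a → a :+ a := κ 2 :* a) refl (∑ Vs (λ a → D E a * H G a))))))) (∑-*ˡ (# 2) (𝓗 E) _)))))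
        third : ∑∑ (λ i j → D E i * D E j * S (λ G → H G j)) ≡ t * SH
        third = trans (∑∑-cong (λ i j → Rq.*-assoc _ _ _)) (trans (∑∑-row (D E) (λ _ j → D E j * S (λ G → H G j))) (trans (∑-*ʳ _ Vs (D E)) (cong (t *_) (trans (∑-cong Vs (λ j → sym (∑-*ˡ (D E j) (𝓗 E) _))) (sym (∑-swap (𝓗 E) Vs _))))))

      -- `χ-linear` is applied with the factor `a` for which F = a w solves `M` = 0. Its denominator
      -- L is at least t/2 because 4 μ ≤ t, which costs 4 on the squares; 24 = 2 · 4 · 3 collects
      -- this with the factors of `χ-linear` and `∑∑Θ`.
      χ-bound : # 4 * χ E ≤ vol E * vol E * (N E * S (λ G → # 1 + # 24 * (τ * τ * τ) * Ψ G))
      χ-bound = ≤-trans (χ-linear e₀ a) (≤-trans (+-monoʳ _ (*-monoˡ _ (0≤* (0≤# 2) (0≤sq t)) (≤-trans (∑-mono Ps perq) (≤-trans (≤-reflexive (∑-*ˡ (# 4 * (τ * τ) * N E) Ps _)) (*-monoˡ _ 0≤coef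
          (≤-trans (≤-trans (∑-mono Ps (λ q → ≤-by (Θ (snd q) (fst q)) (0≤Θ _ _) (solve 2 (λ a b → a :+ b :- a := b) refl (Θ (fst q) (snd q)) (Θ (snd q) (fst q))))) (∑-ends Θ 0≤Θ)) (≤-reflexive ∑∑Θ)))))))
          (≤-reflexive (trans (solve 4 (λ t n u s → t :* t :* (n :* n) :+ κ 2 :* (t :* t) :* (κ 4 :* (u :* u) :* n :* (κ 3 :* u :* s)) := t :* t :* (n :* (n :+ κ 24 :* (u :* u :* u) :* s))) refl t (N E) τ (S Ψ))
            (cong (λ s → t * t * (N E * s)) (sym (trans (∑-+ (𝓗 E) _ _) (cong (N E +_) (∑-*ˡ (# 24 * (τ * τ * τ)) (𝓗 E) Ψ))))))))
        where
        L : ℚ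
        L = t - # 2 * μ + ν
        t≤2L : t ≤ # 2 * L
        t≤2L = ≤-by ((t - # 4 * μ) + # 2 * ν) (0≤+ (≤⇒0≤- 4μ≤) (0≤* (0≤# 2) 0≤ν)) (solve 3 (λ t m v → κ 2 :* (t :- κ 2 :* m :+ v) :- t := (t :- κ 4 :* m) :+ κ 2 :* v) refl t μ ν)
        0<L : # 0 < L
        0<L = mkPos (*-cancelˡ (# 2) (0<#suc 1) (≤-trans (≤-reflexive (Rq.zeroʳ (# 2))) (≤-trans (<⇒≤ 0<t) t≤2L))) (λ z → <-irrefl refl (<-≤-trans 0<t (≤-trans t≤2L (≤-reflexive (trans (cong (# 2 *_) z) (Rq.zeroʳ (# 2)))))))
        a : ℚ
        a = N E * (# 1 - μ * τ) * inv L
        0≤coef : # 0 ≤ # 4 * (τ * τ) * N E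
        0≤coef = 0≤* (0≤* (0≤# 4) (0≤sq τ)) (0≤N E)
        perq : ∀ q → (Fq E q - a * wt E q) * (Fq E q - a * wt E q) * inv (wt E q) ≤ # 4 * (τ * τ) * N E * Θ (fst q) (snd q)
        perq q = by (wt E q ≟0) (bit-cases (𝟙-bit (lookup E q)))
          where
          i = fst q
          j = snd q
          w = wt E q
          y = Fq E q - a * w
          Goal = y * y * inv w ≤ # 4 * (τ * τ) * N E * Θ i j
          i≢j = fst≢snd q
          0≤w = 0≤wt e₀ q
          module _ (w≢0 : w ≢ # 0) (z : 𝟙 (lookup E q) ≡ # 0) where
            free : Y E i j ≡ # 0
            free = trans (Y-joins E (joins-ends q)) z
            w≡ : w ≡ D E i * D E j
            w≡ = trans (cong (λ s → (# 1 - s) * (D E i * D E j)) z) (solve 1 (λ a → (κ 1 :- κ 0) :* a := a) refl (D E i * D E j))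
            M = Bound.M i≢j free
            M≡ : M ≡ L * y
            M≡ = sym (trans (cong₂ (λ u v → L * (u - a * v)) (Fq-F E q) w≡) (trans (solve 6 (λ L f n m i p → L :* (f :- n :* m :* i :* p) := f :* L :- p :* n :* m :* (L :* i)) refl L (F E i j) (N E) (# 1 - μ * τ) (inv L) (D E i * D E j))
              (trans (cong (λ s → F E i j * L - D E i * D E j * N E * (# 1 - μ * τ) * s) (inv-pos-r 0<L)) (cong (λ s → F E i j * L - s) (Rq.*-identityʳ _)))))
            eq : L * L * (y * y * inv w) ≡ M * M * inv w
            eq = trans (solve 3 (λ L y i → L :* L :* (y :* y :* i) := L :* y :* (L :* y) :* i) refl L y (inv w)) (cong (λ s → s * s * inv w) (sym M≡))
            eq' : D E i * D E j * N E * Θ i j * inv w ≡ N E * Θ i j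
            eq' = trans (cong (λ s → s * N E * Θ i j * inv w) (sym w≡)) (trans (solve 4 (λ w n h i → w :* n :* h :* i := (w :* i) :* (n :* h)) refl w (N E) (Θ i j) (inv w)) (trans (cong (_* (N E * Θ i j)) (inv-r w≢0)) (Rq.*-identityˡ _)))
            bnd : N E * Θ i j ≤ L * L * (# 4 * (τ * τ) * N E * Θ i j)
            bnd = ≤-trans (≤-reflexive (sym (trans (cong₂ (λ u v → u * v * (N E * Θ i j)) tτ tτ) (solve 1 (λ a → κ 1 :* κ 1 :* a := a) refl (N E * Θ i j)))))
              (≤-trans (≤-reflexive (solve 3 (λ t u y → (t :* u) :* (t :* u) :* y := (t :* t) :* (u :* u :* y)) refl t τ (N E * Θ i j))) (≤-trans (*-monoʳ _ (0≤* (0≤sq τ) (0≤* (0≤N E) (0≤Θ i j))) (*-mono (<⇒≤ 0<t) (≤-trans (<⇒≤ 0<t) t≤2L) t≤2L t≤2L))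
              (≤-reflexive (solve 4 (λ L u n h → (κ 2 :* L) :* (κ 2 :* L) :* (u :* u :* (n :* h)) := L :* L :* (κ 4 :* (u :* u) :* n :* h)) refl L τ (N E) (Θ i j)))))
            main : Goal
            main = *-cancelˡ (L * L) (0<* 0<L 0<L) (≤-trans (≤-reflexive eq) (≤-trans (*-monoʳ (inv w) (0≤inv 0≤w) (M²≤ i≢j free)) (≤-trans (≤-reflexive eq') bnd)))
          by : Dec (w ≡ # 0) → 𝟙 (lookup E q) ≡ # 0 ⊎ 𝟙 (lookup E q) ≡ # 1 → Goal
          by (yes z) _ = ≤-trans (≤-reflexive (trans (cong (λ s → y * y * inv s) z) (trans (cong (y * y *_) inv-0) (Rq.zeroʳ (y * y))))) (0≤* 0≤coef (0≤Θ i j))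
          by (no w≢0) (inj₂ o) = ⊥-elim (w≢0 (trans (cong (λ s → (# 1 - s) * (D E i * D E j)) o) (solve 1 (λ a → (κ 1 :- κ 1) :* a := κ 0) refl (D E i * D E j))))
          by (no w≢0) (inj₁ z) = main w≢0 z

    -- Output probabilities of Procedure A

    -- The truncated difference in `resid` is exact because `E` lies in a d-regular graph.
    D-resid : ∀ {E G} → Ext E G → ∀ i → # (resid n d E i) ≡ D E i
    D-resid {E} e i = go
      where
      opaque
        unfolding D
        D≡ : D E i ≡ # d - # (deg {n} E i)
        D≡ = cong (λ z → # d - z) (row E i)
      deg≤ : deg {n} E i ℕ.≤ d
      deg≤ = #-cancel-≤ (0≤-⇒≤ (subst (# 0 ≤_) D≡ (0≤D e i)))
      go : # (d ℕ.∸ deg {n} E i) ≡ D E i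
      go = trans (trans (solve 2 (λ a b → a := (b :+ a) :- b) refl (# (d ℕ.∸ deg {n} E i)) (# (deg {n} E i))) (cong (_- # (deg {n} E i)) (trans (sym (#-+ (deg {n} E i) _)) (cong # (ℕₚ.m+[n∸m]≡n deg≤))))) (sym D≡)

    #weight : ∀ {E G} → Ext E G → ∀ q → # (weight n d E q) ≡ wt E q
    #weight {E} e q with lookup E q
    ... | true = solve 1 (λ a → κ 0 := (κ 1 :- κ 1) :* a) refl (D E (fst q) * D E (snd q))
    ... | false = trans (#-* (resid n d E (fst q)) (resid n d E (snd q))) (trans (cong₂ _*_ (D-resid e (fst q)) (D-resid e (snd q))) (solve 1 (λ a → a := (κ 1 :- κ 0) :* a) refl (D E (fst q) * D E (snd q))))

    #totalWeight : ∀ {E G} → Ext E G → # (totalWeight n d E) ≡ Wt E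
    #totalWeight {E} e = trans (#-sum (weight n d E) Ps) (∑-cong Ps (#weight e))

    qsum-reach : ∀ G f E W → qsum (map (λ q → frac (weight n d E q) (suc W) ℚ.* reach n d G f (add E q)) Ps) ≡ ∑ Ps (λ q → # (weight n d E q) * inv (# (suc W)) * reach n d G f (add E q))
    qsum-reach G f E W = trans (qsum-∑ _ Ps) (∑-cong Ps (λ q → trans (*ℚ _ _) (cong (_* reach n d G f (add E q)) (frac-# (weight n d E q) W))))

    reach-step : ∀ G f E → totalWeight n d E ≢ 0 → reach n d G (suc f) E ≡ ∑ Ps (λ q → # (weight n d E q) * inv (# (totalWeight n d E)) * reach n d G f (add E q))
    reach-step G f E ne with totalWeight n d E
    ... | zero = ⊥-elim (ne refl)
    ... | suc W = qsum-reach G f E W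

    reach-done : ∀ G f E → totalWeight n d E ≡ 0 → (eqVec E G ∧ (countᵇ {NP n} (lookup E) ℕ.* 2 ≡ᵇ n ℕ.* d)) ≡ true → reach n d G f E ≡ 1ℚ
    reach-done G f E z b with totalWeight n d E
    ... | zero = cong (if_then 1ℚ else 0ℚ) b

    0≤if : ∀ b → # 0 ≤ (if b then 1ℚ else 0ℚ)
    0≤if true = subst (# 0 ≤_) #1 0≤1
    0≤if false = ≤-reflexive #0

    0≤reach : ∀ G f E → # 0 ≤ reach n d G f E
    0≤reach G f E with totalWeight n d E
    0≤reach G f E | zero = 0≤if (eqVec E G ∧ _)
    0≤reach G zero E | suc W = ≤-reflexive #0
    0≤reach G (suc f) E | suc W = subst (# 0 ≤_) (sym (qsum-reach G f E W)) (∑-nonneg Ps (λ q → 0≤* (0≤* (0≤# (weight n d E q)) (0≤inv (0≤# (suc W)))) (0≤reach G f (add E q))))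

    if≤𝟙 : ∀ b c → (if b ∧ c then 1ℚ else 0ℚ) ≤ 𝟙 b
    if≤𝟙 true true = ≤-reflexive (sym #1)
    if≤𝟙 true false = subst (_≤ # 1) #0 0≤1
    if≤𝟙 false c = ≤-reflexive (sym #0)

    -- The outputs of the procedure on distinct graphs are disjoint events.
    ∑reach≤1 : ∀ f E → ∑ (allVecs (NP n)) (λ G → reach n d G f E) ≤ # 1
    ∑reach≤1 f E with totalWeight n d E in eq
    ∑reach≤1 f E | zero = ≤-trans (∑-mono (allVecs (NP n)) (λ G → if≤𝟙 (eqVec E G) _)) (≤-reflexive (∑-eqVec E))
    ∑reach≤1 zero E | suc W = ≤-trans (≤-reflexive (trans (∑-cong (allVecs (NP n)) (λ _ → sym #0)) (∑-0 (allVecs (NP n))))) 0≤1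
    ∑reach≤1 (suc f) E | suc W = ≤-trans (≤-reflexive (trans (∑-cong (allVecs (NP n)) (λ G → qsum-reach G f E W)) (trans (∑-swap (allVecs (NP n)) Ps _) (∑-cong Ps (λ q → ∑-*ˡ _ (allVecs (NP n)) _)))))
      (≤-trans (∑-mono Ps (λ q → *-monoˡ _ (0≤* (0≤# (weight n d E q)) (0≤inv (0≤# (suc W)))) (∑reach≤1 f (add E q))))
      (≤-reflexive (trans (∑-cong Ps (λ q → Rq.*-identityʳ _)) (trans (∑-*ʳ (inv (# (suc W))) Ps _) (trans (cong (_* inv (# (suc W))) (trans (sym (#-sum (weight n d E) Ps)) (cong # eq))) (inv-pos-r (0<#suc W)))))))

    Sized : ℕ → Graph → Set
    Sized s E = vol E ≡ # 2 * # s

    sized-pred : ∀ {s E} q → Sized (suc s) E → lookup E q ≡ false → Sized s (add E q)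
    sized-pred {s} {E} q h z = trans (vol-add E q) (trans (cong₂ (λ v b → v - (# 1 - 𝟙 b) * # 2) h z) (trans (cong (λ k → # 2 * k - (# 1 - # 0) * # 2) (#-suc s)) (solve 1 (λ s → κ 2 :* (κ 1 :+ s) :- (κ 1 :- κ 0) :* κ 2 := κ 2 :* s) refl (# s))))

    ∑Xq-sized : ∀ {s E G} → Sized s E → Ext E G → ∑ Ps (Xq E G) ≡ # s
    ∑Xq-sized {s} {E} {G} h e = ≤-antisym (*-cancelˡ (# 2) (0<#suc 1) (≤-reflexive eq)) (*-cancelˡ (# 2) (0<#suc 1) (≤-reflexive (sym eq)))
      where eq = trans (∑Xq e) h

    Xq-cases : ∀ {E G} → Ext E G → ∀ q → Xq E G q ≡ # 0 ⊎ (Xq E G q ≡ # 1 × lookup G q ≡ true × lookup E q ≡ false)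
    Xq-cases {E} {G} e q with Xᵇ E G q in eq
    ... | false = inj₁ (trans (Xq-Xᵇ (sub e) q) (cong 𝟙 eq))
    ... | true = inj₂ (trans (Xq-Xᵇ (sub e) q) (cong 𝟙 eq) , proj₁ (∧-true eq) , not-true (proj₂ (∧-true {lookup G q} eq)))

    Ext-add : ∀ {E G q} → Ext E G → lookup G q ≡ true → Ext (add E q) G
    Ext-add {E} {G} {q} e p = mkExt (reg e) (mk⊆ go)
      where
      go : ∀ r → lookup (add E q) r ≡ true → lookup G r ≡ true
      go r s with q F.≟ r
      ... | yes refl = p
      ... | no w = at (sub e) r (trans (sym (Vₚ.lookup∘updateAt′ r q (λ z → w (sym z)) E)) s)

    ∑Xq-mono : ∀ {E G} → Ext E G → {φ ψ : P → ℚ} → (∀ q → lookup G q ≡ true → lookup E q ≡ false → φ q ≤ ψ q) → ∑ Ps (λ q → Xq E G q * φ q) ≤ ∑ Ps (λ q → Xq E G q * ψ q)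
    ∑Xq-mono {E} {G} e {φ} {ψ} p = ∑-mono Ps lem
      where
      lem : ∀ q → Xq E G q * φ q ≤ Xq E G q * ψ q
      lem q with Xq-cases e q
      ... | inj₁ z = ≤-reflexive (trans (0*ˡ _ z) (sym (0*ˡ _ z)))
      ... | inj₂ (o , g , w) = *-monoˡ _ (0≤Xq (sub e) q) (p q g w)

    xq : ℕ → Graph → P → ℚ
    xq s E q = Fq E q * Wt E * inv (# s * N E * wt E q)

    -- The expectation over insertion orders, unfolded along the first inserted edge.
    XG : ℕ → Graph → Graph → ℚ
    XG zero G E = # 0
    XG (suc s) G E = inv (# (suc s)) * ∑ Ps (λ q → Xq E G q * (xq (suc s) E q + XG s G (add E q)))

    1≤N : ∀ {E G} → Ext E G → # 1 ≤ N E
    1≤N {E} e = term≤∑ (𝓗 E) (λ _ → 0≤1) (⇒𝓗 e)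

    Fq-add : ∀ E q → lookup E q ≡ false → ∀ φ → ∑ (𝓗 (add E q)) φ ≡ ∑ (𝓗 E) (λ G → Xq E G q * φ G)
    Fq-add E q z φ = trans (∑𝓗-add E q φ) (∑-cong (𝓗 E) (λ G → cong (_* φ G) (trans (solve 1 (λ x → x := x :- κ 0) refl (𝟙 (lookup G q))) (cong (λ b → 𝟙 (lookup G q) - 𝟙 b) (sym z)))))

    N-add : ∀ E q → lookup E q ≡ false → N (add E q) ≡ Fq E q
    N-add E q z = trans (Fq-add E q z _) (∑-cong (𝓗 E) (λ G → Rq.*-identityʳ _))

    module Positivity {E G : Graph} (e : Ext E G) {q : P} (g : lookup G q ≡ true) (z : lookup E q ≡ false) where

      Xq1 : Xq E G q ≡ # 1
      Xq1 = trans (cong₂ (λ a b → 𝟙 a - 𝟙 b) g z) (solve 0 (κ 1 :- κ 0 := κ 1) refl)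

      0<N : # 0 < N E
      0<N = <-≤-trans 0<1 (1≤N e)

      0<Fq : # 0 < Fq E q
      0<Fq = subst (# 0 <_) (N-add E q z) (<-≤-trans 0<1 (1≤N (Ext-add e g)))

      0<wt : # 0 < wt E q
      0<wt = mkPos (0≤wt e q) (λ w → pos⇒≢0 0<Fq (wt0⇒Fq0 e q w))

      0<Wt : # 0 < Wt E
      0<Wt = <-≤-trans 0<wt (term≤∑ Ps (0≤wt e) (∈-allFin q))

      0<xq : ∀ s → # 0 < xq (suc s) E q
      0<xq s = 0<* (0<* 0<Fq 0<Wt) (0<inv (0<* (0<* (0<#suc s) 0<N) 0<wt))

      -- With A_q = w_q / W this is N(E) A_q = N(E + q) / (s x_q).
      xq-inv : ∀ s → inv (# (suc s)) * (inv (xq (suc s) E q) * N (add E q)) ≡ N E * (wt E q * inv (Wt E))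
      xq-inv s = trans (cong₂ (λ u v → inv S * (u * v)) (sym (inv-unique eq)) (N-add E q z)) (trans (solve 7 (λ iS S n w iW iF f → iS :* (S :* n :* w :* iW :* iF :* f) := (S :* iS) :* (f :* iF) :* (n :* (w :* iW))) refl (inv S) S (N E) (wt E q) (inv (Wt E)) (inv (Fq E q)) (Fq E q))
          (trans (cong₂ (λ u v → u * v * (N E * (wt E q * inv (Wt E)))) (inv-pos-r (0<#suc s)) (inv-pos-r 0<Fq)) (solve 1 (λ a → κ 1 :* κ 1 :* a := a) refl (N E * (wt E q * inv (Wt E))))))
        where
        S = # (suc s)
        T₀ = S * N E * wt E q
        eq : xq (suc s) E q * (S * N E * wt E q * inv (Wt E) * inv (Fq E q)) ≡ # 1
        eq = trans (solve 6 (λ f w iT T iw if → f :* w :* iT :* (T :* iw :* if) := (f :* if) :* (w :* iw) :* (T :* iT)) refl (Fq E q) (Wt E) (inv T₀) T₀ (inv (Wt E)) (inv (Fq E q)))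
          (trans (cong₂ _*_ (cong₂ _*_ (inv-pos-r 0<Fq) (inv-pos-r 0<Wt)) (inv-pos-r (0<* (0<* (0<#suc s) 0<N) 0<wt))) (solve 0 (κ 1 :* κ 1 :* κ 1 := κ 1) refl))

    -- Without residual half-edges `E` is its own only completion, so `E` and `G` agree. All weights
    -- vanish, the procedure stops, and the edge count passes the test for success.
    reach-complete : ∀ {E G} → Ext E G → Sized 0 E → ∀ f → reach n d G f E ≡ # 1
    reach-complete {E} {G} e h f = go
      where
      X0 : ∀ q → Xq E G q ≡ # 0
      X0 q = ≤-antisym (≤-trans (term≤∑ Ps (0≤Xq (sub e)) (∈-allFin q)) (≤-reflexive (∑Xq-sized h e))) (0≤Xq (sub e) q)
      same : ∀ q → lookup E q ≡ lookup G q
      same q = cmp (lookup E q) (lookup G q) refl refl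
        where
        cmp : ∀ a b → lookup E q ≡ a → lookup G q ≡ b → lookup E q ≡ lookup G q
        cmp true _ x _ = trans x (sym (at (sub e) q x))
        cmp false false x y = trans x (sym y)
        cmp false true x y = ⊥-elim (pos⇒≢0 0<1 (trans (sym (Positivity.Xq1 e y x)) (X0 q)))
      eqv : ∀ {k} (u v : Vec Bool k) → (∀ q → lookup u q ≡ lookup v q) → eqVec u v ≡ true
      eqv [] [] p = refl
      eqv (true ∷ u) (true ∷ v) p = eqv u v (λ q → p (suc q))
      eqv (false ∷ u) (false ∷ v) p = eqv u v (λ q → p (suc q))
      eqv (true ∷ u) (false ∷ v) p = sym (p zero)
      eqv (false ∷ u) (true ∷ v) p = p zero
      W0 : totalWeight n d E ≡ 0
      W0 = #-injective (trans (#totalWeight e) (≤-antisym (*-cancelˡ (# 2) (0<#suc 1) (≤-trans (Wt≤ e) (≤-reflexive (trans (cong₂ _*_ h h) (solve 0 (κ 2 :* κ 0 :* (κ 2 :* κ 0) := κ 2 :* κ 0) refl))))) (0≤Wt e)))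
      count : countᵇ {NP n} (lookup E) ℕ.* 2 ≡ n ℕ.* d
      count = #-injective (trans (#-* (countᵇ {NP n} (lookup E)) 2) (trans (cong (_* # 2) (trans (#-countᵇ {NP n} (lookup E)) (∑-cong Ps (λ q → cong 𝟙 (same q))))) (trans (sym (∑-*ʳ (# 2) Ps _))
        (trans (∑-cong Ps (λ q → trans (cong (𝟙 (lookup G q) *_) (sym (∑-inc q))) (trans (sym (∑-*ˡ _ Vs _)) (∑-cong Vs (λ v → Rq.*-comm _ _))))) (trans (∑-swap Ps Vs _) (trans (∑-cong Vs (λ v → trans (sym (#-deg G v)) (trans (sym (row G v)) (reg e v)))) (trans (∑-const Vs (# d)) (trans (cong (λ k → # k * # d) (Lₚ.length-tabulate id)) (sym (#-* n d))))))))))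
      go : reach n d G f E ≡ # 1
      go = trans (reach-done G f E W0 (cong₂ _∧_ (eqv E G same) (T⇒≡true (ℕₚ.≡⇒≡ᵇ (countᵇ {NP n} (lookup E) ℕ.* 2) (n ℕ.* d) count)))) (sym #1)

    -- AM-GM along every order of inserting G ∖ E; a and cs carry the inverse of, respectively the list of, the ratios met so far.
    path-am-gm : ∀ s {E G} → Ext E G → Sized s E → ∀ f → s ℕ.≤ f → ∀ a cs → # 0 < a → Positives cs → # 1 ≤ a * ∏ cs →
      # (suc s) + # (length cs) ≤ a * (N E * reach n d G f E) + XG s G E + ∑id cs
    path-am-gm zero {E} {G} e h f _ a cs 0<a ps p = ≤-trans (≤-reflexive (sym (#-+ 1 (length cs)))) (≤-trans (length≤∑ a cs (0<a ∷ ps) p)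
        (≤-by (a * (N E - # 1)) (0≤* (<⇒≤ 0<a) (≤⇒0≤- (1≤N e))) (trans (cong (λ r → a * (N E * r) + # 0 + ∑id cs - (a + ∑id cs)) (reach-complete e h f)) (solve 3 (λ a n c → a :* (n :* κ 1) :+ κ 0 :+ c :- (a :+ c) := a :* (n :- κ 1)) refl a (N E) (∑id cs)))))
    path-am-gm (suc s) {E} {G} e h (suc f) (s≤s le) a cs 0<a ps p = ≤-trans (≤-reflexive (sym constant)) (≤-trans (*-monoˡ iS 0≤iS (∑Xq-mono e per)) (≤-trans (≤-reflexive average) (+-monoˡ (∑id cs) (+-monoˡ (XG (suc s) G E) (*-monoˡ a (<⇒≤ 0<a) step)))))
      where
      S = # (suc s)
      iS = inv S
      0≤iS = 0≤inv (0≤# (suc s))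
      Rr : P → ℚ
      Rr q = reach n d G f (add E q)
      K₀ = # (suc (suc s)) + # (length cs)
      φ : P → ℚ
      φ q = a * (inv (xq (suc s) E q) * (N (add E q) * Rr q)) + (xq (suc s) E q + XG s G (add E q)) + ∑id cs
      -- The ratio `y` of the inserted edge joins the list while the multiplier becomes `a * inv y`,
      -- so that the product is unchanged.
      per : ∀ q → lookup G q ≡ true → lookup E q ≡ false → K₀ ≤ φ q
      per q g z = ≤-trans (≤-reflexive (trans (cong (_+ # (length cs)) (#-suc (suc s))) (trans (solve 2 (λ s l → κ 1 :+ s :+ l := s :+ (κ 1 :+ l)) refl S (# (length cs))) (cong (S +_) (sym (#-suc (length cs)))))))
          (≤-trans (path-am-gm s (Ext-add e g) (sized-pred q h z) f le (a * inv y) (y ∷ cs) (0<* 0<a (0<inv 0<y)) (0<y ∷ ps) (≤-trans p (≤-reflexive prod)))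
            (≤-reflexive (solve 6 (λ a i nr X y c → a :* i :* nr :+ X :+ (y :+ c) := a :* (i :* nr) :+ (y :+ X) :+ c) refl a (inv y) (N (add E q) * Rr q) (XG s G (add E q)) y (∑id cs))))
        where
        open Positivity e g z
        y = xq (suc s) E q
        0<y = 0<xq s
        prod : a * ∏ cs ≡ a * inv y * (y * ∏ cs)
        prod = sym (trans (solve 4 (λ a i y c → a :* i :* (y :* c) := (y :* i) :* (a :* c)) refl a (inv y) y (∏ cs)) (trans (cong (_* (a * ∏ cs)) (inv-pos-r 0<y)) (Rq.*-identityˡ _)))
      ∑X = ∑Xq-sized h e
      iSS : iS * S ≡ # 1
      iSS = trans (Rq.*-comm iS S) (inv-pos-r (0<#suc s))
      constant : iS * ∑ Ps (λ q → Xq E G q * K₀) ≡ K₀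
      constant = trans (cong (iS *_) (trans (∑-*ʳ K₀ Ps _) (cong (_* K₀) ∑X))) (trans (sym (Rq.*-assoc iS S K₀)) (trans (cong (_* K₀) iSS) (Rq.*-identityˡ K₀)))
      Z = ∑ Ps (λ q → Xq E G q * (inv (xq (suc s) E q) * (N (add E q) * Rr q)))
      average : iS * ∑ Ps (λ q → Xq E G q * φ q) ≡ a * (iS * Z) + XG (suc s) G E + ∑id cs
      average = trans (cong (iS *_) (trans (∑-cong Ps (λ q → solve 5 (λ x a u v c → x :* (a :* u :+ v :+ c) := a :* (x :* u) :+ x :* v :+ x :* c) refl (Xq E G q) a _ _ (∑id cs))) (trans (∑-+ Ps _ _) (cong₂ _+_ (trans (∑-+ Ps _ _) (cong (_+ _) (∑-*ˡ a Ps _))) (trans (∑-*ʳ (∑id cs) Ps _) (cong (_* ∑id cs) ∑X))))))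
        (trans (solve 6 (λ i a z w S c → i :* (a :* z :+ w :+ S :* c) := a :* (i :* z) :+ i :* w :+ (i :* S) :* c) refl iS a Z _ S (∑id cs)) (cong (a * (iS * Z) + XG (suc s) G E +_) (trans (cong (_* ∑id cs) iSS) (Rq.*-identityˡ _))))
      W≢0 : totalWeight n d E ≢ 0
      W≢0 w = pos⇒≢0 (0<#suc s) (trans (sym ∑X) (trans (∑-cong Ps none) (∑-0 Ps)))
        where
        none : ∀ q → Xq E G q ≡ # 0
        none q = by (Xq-cases e q)
          where
          by : Xq E G q ≡ # 0 ⊎ (Xq E G q ≡ # 1 × lookup G q ≡ true × lookup E q ≡ false) → Xq E G q ≡ # 0
          by (inj₁ z) = z
          by (inj₂ (_ , g , z)) = ⊥-elim (pos⇒≢0 (Positivity.0<Wt e g z) (trans (sym (#totalWeight e)) (cong # w)))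
      -- Only the edges of `G` outside `E` are kept in the recursion for `reach`; the remaining
      -- terms are nonnegative and may be dropped.
      step : iS * Z ≤ N E * reach n d G (suc f) E
      step = ≤-trans (≤-reflexive (sym (∑-*ˡ iS Ps _))) (≤-trans (∑-mono Ps lem) (≤-reflexive (trans (∑-*ˡ (N E) Ps _) (cong (N E *_) (sym (trans (reach-step G f E W≢0) (∑-cong Ps (λ q → cong₂ (λ u v → u * inv v * Rr q) (#weight e q) (#totalWeight e)))))))))
        where
        lem : ∀ q → iS * (Xq E G q * (inv (xq (suc s) E q) * (N (add E q) * Rr q))) ≤ N E * (wt E q * inv (Wt E) * Rr q)
        lem q = by (Xq-cases e q)
          where
          y = inv (xq (suc s) E q)
          by : Xq E G q ≡ # 0 ⊎ (Xq E G q ≡ # 1 × lookup G q ≡ true × lookup E q ≡ false) → iS * (Xq E G q * (y * (N (add E q) * Rr q))) ≤ N E * (wt E q * inv (Wt E) * Rr q)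
          by (inj₁ z) = ≤-trans (≤-reflexive (trans (cong (iS *_) (0*ˡ _ z)) (Rq.zeroʳ iS))) (0≤* (0≤N E) (0≤* (0≤* (0≤wt e q) (0≤inv (0≤Wt e))) (0≤reach G f (add E q))))
          by (inj₂ (o , g , z)) = ≤-reflexive (trans (cong (λ x → iS * (x * (y * (N (add E q) * Rr q)))) o) (trans (solve 4 (λ i y n r → i :* (κ 1 :* (y :* (n :* r))) := i :* (y :* n) :* r) refl iS y (N (add E q)) (Rr q))
             (trans (cong (_* Rr q) (Positivity.xq-inv e g z s)) (Rq.*-assoc (N E) _ _))))

    module Averaged (ψ : ℕ → Graph → Graph → ℚ)
      (key : ∀ s {E G₀} → Ext E G₀ → Sized (suc s) E → # 4 * χ E ≤ vol E * vol E * (N E * ∑ (𝓗 E) (λ G → # 1 + ψ (suc s) G E))) where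

      -- The recursion of `XG` with each expected ratio replaced by 1 plus an error. The error may
      -- depend on `G`, as `key` compares only sums over the completions of `E`; this is what later
      -- permits fixing `G` and averaging over `E`.
      PS : ℕ → Graph → Graph → ℚ
      PS zero G E = # 0
      PS (suc s) G E = # 1 + ψ (suc s) G E + inv (# (suc s)) * ∑ Ps (λ q → Xq E G q * PS s G (add E q))

      -- The left-hand side is χ / (s² N), and vol = 2 s brings `key` into this form.
      one-step : ∀ s E {G₀} → Ext E G₀ → Sized (suc s) E → inv (# (suc s)) * ∑ Ps (λ q → Fq E q * xq (suc s) E q) ≤ ∑ (𝓗 E) (λ G → # 1 + ψ (suc s) G E)
      one-step s E e h = ≤-trans (≤-reflexive eq) (*-cancelˡ T₀ (0<* (0<* (0<#suc 3) (0<* (0<#suc s) (0<#suc s))) 0<N) (≤-trans (≤-reflexive eq₂) (≤-trans (key s e h) (≤-reflexive eq₃))))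
        where
        S = # (suc s)
        0<N : # 0 < N E
        0<N = <-≤-trans 0<1 (1≤N e)
        T₀ = # 4 * (S * S) * N E
        Σ₁ = ∑ (𝓗 E) (λ G → # 1 + ψ (suc s) G E)
        eq : inv S * ∑ Ps (λ q → Fq E q * xq (suc s) E q) ≡ inv S * (inv (S * N E) * χ E)
        eq = cong (inv S *_) (trans (∑-cong Ps (λ q → trans (cong (λ z → Fq E q * (Fq E q * Wt E * z)) (inv-* (S * N E) (wt E q))) (solve 4 (λ f w i j → f :* (f :* w :* (i :* j)) := i :* (w :* (f :* f :* j))) refl (Fq E q) (Wt E) (inv (S * N E)) (inv (wt E q))))) (trans (∑-*ˡ _ Ps _) (cong (inv (S * N E) *_) (∑-*ˡ (Wt E) Ps _))))
        eq₂ : T₀ * (inv S * (inv (S * N E) * χ E)) ≡ # 4 * χ E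
        eq₂ = trans (cong (λ z → T₀ * (inv S * (z * χ E))) (inv-* S (N E))) (trans (solve 5 (λ S n i j x → κ 4 :* (S :* S) :* n :* (i :* (i :* j :* x)) := (S :* i) :* (S :* i) :* (n :* j) :* (κ 4 :* x)) refl S (N E) (inv S) (inv (N E)) (χ E))
          (trans (cong₂ (λ u v → u * u * v * (# 4 * χ E)) (inv-pos-r (0<#suc s)) (inv-pos-r 0<N)) (solve 1 (λ x → κ 1 :* κ 1 :* κ 1 :* x := x) refl (# 4 * χ E))))
        eq₃ : vol E * vol E * (N E * Σ₁) ≡ T₀ * Σ₁
        eq₃ = trans (cong (λ v → v * v * (N E * Σ₁)) h) (solve 3 (λ S n x → (κ 2 :* S) :* (κ 2 :* S) :* (n :* x) := κ 4 :* (S :* S) :* n :* x) refl S (N E) Σ₁)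

      -- After exchanging the sums over `G` and `q`, the completions of `E` with `q` as a new edge
      -- are those of `add E q`, where the induction hypothesis applies.
      XG≤PS : ∀ s E → Sized s E → ∑ (𝓗 E) (λ G → XG s G E) ≤ ∑ (𝓗 E) (λ G → PS s G E)
      XG≤PS zero E h = ≤-refl
      XG≤PS (suc s) E h = either (∑-inhabited (𝓗 E))
        where
        iS = inv (# (suc s))
        swap : ∀ (φ : P → Graph → ℚ) → ∑ (𝓗 E) (λ G → iS * ∑ Ps (λ q → Xq E G q * φ q G)) ≡ iS * ∑ Ps (λ q → ∑ (𝓗 E) (λ G → Xq E G q * φ q G))
        swap φ = trans (∑-*ˡ iS (𝓗 E) _) (cong (iS *_) (∑-swap (𝓗 E) Ps _))
        main : ∀ {G₀} → Ext E G₀ → ∑ (𝓗 E) (λ G → XG (suc s) G E) ≤ ∑ (𝓗 E) (λ G → PS (suc s) G E)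
        main e₀ = ≤-trans (≤-reflexive (trans (∑-cong (𝓗 E) (λ G → trans (cong (iS *_) (trans (∑-cong Ps (λ q → Rq.distribˡ _ _ _)) (∑-+ Ps _ _))) (Rq.distribˡ iS _ _))) (trans (∑-+ (𝓗 E) _ _) (cong₂ _+_ (trans (swap (λ q G → xq (suc s) E q)) (cong (iS *_) (∑-cong Ps (λ q → ∑-*ʳ _ (𝓗 E) _)))) (swap (λ q G → XG s G (add E q)))))))
          (≤-trans (+-mono (one-step s E e₀ h) (*-monoˡ iS (0≤inv (0≤# (suc s))) (∑-mono Ps perq))) (≤-reflexive (trans (cong (∑ (𝓗 E) (λ G → # 1 + ψ (suc s) G E) +_) (sym (swap (λ q G → PS s G (add E q))))) (sym (∑-+ (𝓗 E) _ _)))))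
          where
          perq : ∀ q → ∑ (𝓗 E) (λ G → Xq E G q * XG s G (add E q)) ≤ ∑ (𝓗 E) (λ G → Xq E G q * PS s G (add E q))
          perq q = go (lookup E q) refl
            where
            go : ∀ b → lookup E q ≡ b → ∑ (𝓗 E) (λ G → Xq E G q * XG s G (add E q)) ≤ ∑ (𝓗 E) (λ G → Xq E G q * PS s G (add E q))
            go false z = subst₂ _≤_ (Fq-add E q z _) (Fq-add E q z _) (XG≤PS s (add E q) (sized-pred q h z))
            go true z = ≤-reflexive (trans (∑𝓗-cong E (λ G e → 0*ˡ _ (X0 G e))) (sym (∑𝓗-cong E (λ G e → 0*ˡ _ (X0 G e)))))
              where
              X0 : ∀ G → Ext E G → Xq E G q ≡ # 0
              X0 G e = trans (cong₂ (λ a b → 𝟙 a - 𝟙 b) (at (sub e) q z) z) (solve 0 (κ 1 :- κ 1 := κ 0) refl)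
        either : (𝓗 E ≡ []) ⊎ Σ Graph (_∈ 𝓗 E) → ∑ (𝓗 E) (λ G → XG (suc s) G E) ≤ ∑ (𝓗 E) (λ G → PS (suc s) G E)
        either (inj₁ z) = ≤-reflexive (trans (cong (λ l → ∑ l (λ G → XG (suc s) G E)) z) (cong (λ l → ∑ l (λ G → PS (suc s) G E)) (sym z)))
        either (inj₂ (_ , m)) = main (𝓗⇒ m)

    -- Random subsets of the edges of a fixed graph

    ∅ : Graph
    ∅ = V.replicate (NP n) false

    avg : Graph → ℕ → (Graph → ℚ) → Graph → ℚ
    avg G r φ E = inv (# r) * ∑ Ps (λ q → Xq E G q * φ (add E q))

    Xq-add : ∀ E G {q} → lookup E q ≡ false → ∀ r → Xq (add E q) G r ≡ Xq E G r - δ q r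
    Xq-add E G {q} z r = trans (cong (λ y → 𝟙 (lookup G r) - y) (trans (𝟙-add E q r) (cong (λ b → 𝟙 (lookup E r) + (# 1 - 𝟙 b) * δ q r) z))) (solve 3 (λ g e x → g :- (e :+ (κ 1 :- κ 0) :* x) := g :- e :- x) refl (𝟙 (lookup G r)) (𝟙 (lookup E r)) (δ q r))

    ∑Xq-cong : ∀ {E G} → Ext E G → {φ ψ : P → ℚ} → (∀ q → lookup G q ≡ true → lookup E q ≡ false → φ q ≡ ψ q) → ∑ Ps (λ q → Xq E G q * φ q) ≡ ∑ Ps (λ q → Xq E G q * ψ q)
    ∑Xq-cong e p = ≤-antisym (∑Xq-mono e (λ q g z → ≤-reflexive (p q g z))) (∑Xq-mono e (λ q g z → ≤-reflexive (sym (p q g z))))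

    -- Expectations of functions of the state after j uniformly random edges of G have been added to ∅.
    module Walk {G : Graph} (m : ℕ) (e∅ : Ext ∅ G) (h∅ : Sized m ∅) where

      ex : ℕ → (Graph → ℚ) → ℚ
      ex zero φ = φ ∅
      ex (suc j) φ = ex j (avg G (m ℕ.∸ j) φ)

      pred-∸ : ∀ {j} → suc j ℕ.≤ m → m ℕ.∸ j ≡ suc (m ℕ.∸ suc j)
      pred-∸ {j} le = ℕₚ.+-∸-assoc 1 le

      ex-mono : ∀ j {φ ψ : Graph → ℚ} → j ℕ.≤ m → (∀ E → Ext E G → Sized (m ℕ.∸ j) E → φ E ≤ ψ E) → ex j φ ≤ ex j ψ
      ex-mono zero le p = p ∅ e∅ h∅
      ex-mono (suc j) le p = ex-mono j (ℕₚ.<⇒≤ le) (λ E e h → *-monoˡ _ (0≤inv (0≤# (m ℕ.∸ j))) (∑Xq-mono e (λ q g z → p (add E q) (Ext-add e g) (sized-pred q (subst (λ r → Sized r E) (pred-∸ le) h) z))))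

      ex-cong : ∀ j {φ ψ : Graph → ℚ} → j ℕ.≤ m → (∀ E → Ext E G → Sized (m ℕ.∸ j) E → φ E ≡ ψ E) → ex j φ ≡ ex j ψ
      ex-cong j le p = ≤-antisym (ex-mono j le (λ E e h → ≤-reflexive (p E e h))) (ex-mono j le (λ E e h → ≤-reflexive (sym (p E e h))))

      ex-cong₀ : ∀ j {φ ψ : Graph → ℚ} → (∀ E → φ E ≡ ψ E) → ex j φ ≡ ex j ψ
      ex-cong₀ zero p = p ∅
      ex-cong₀ (suc j) p = ex-cong₀ j (λ E → cong (inv (# (m ℕ.∸ j)) *_) (∑-cong Ps (λ q → cong (Xq E G q *_) (p (add E q)))))

      ex-+ : ∀ j (φ ψ : Graph → ℚ) → ex j (λ E → φ E + ψ E) ≡ ex j φ + ex j ψ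
      ex-+ zero φ ψ = refl
      ex-+ (suc j) φ ψ = trans (ex-cong₀ j (λ E → trans (cong (inv (# (m ℕ.∸ j)) *_) (trans (∑-cong Ps (λ q → Rq.distribˡ _ _ _)) (∑-+ Ps _ _))) (Rq.distribˡ _ _ _))) (ex-+ j _ _)

      ex-* : ∀ j c (φ : Graph → ℚ) → ex j (λ E → c * φ E) ≡ c * ex j φ
      ex-* zero c φ = refl
      ex-* (suc j) c φ = trans (ex-cong₀ j (λ E → trans (cong (inv (# (m ℕ.∸ j)) *_) (trans (∑-cong Ps (λ q → solve 3 (λ x c y → x :* (c :* y) := c :* (x :* y)) refl (Xq E G q) c (φ (add E q)))) (∑-*ˡ c Ps _))) (solve 3 (λ i c y → i :* (c :* y) := c :* (i :* y)) refl (inv (# (m ℕ.∸ j))) c _))) (ex-* j c _)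

      ex-∑ : ∀ j (xs : List A) (φ : A → Graph → ℚ) → ex j (λ E → ∑ xs (λ x → φ x E)) ≡ ∑ xs (λ x → ex j (φ x))
      ex-∑ j [] φ = trans (ex-cong₀ j (λ E → sym (Rq.zeroˡ (# 0)))) (trans (ex-* j (# 0) (λ _ → # 0)) (Rq.zeroˡ _))
      ex-∑ j (x ∷ xs) φ = trans (ex-+ j (φ x) _) (cong (ex j (φ x) +_) (ex-∑ j xs φ))

      ex-const : ∀ j c → j ℕ.≤ m → ex j (λ _ → c) ≡ c
      ex-const zero c le = refl
      ex-const (suc j) c le = trans (ex-cong j (ℕₚ.<⇒≤ le) (λ E e h → trans (cong (inv (# (m ℕ.∸ j)) *_) (trans (∑-*ʳ c Ps _) (cong (_* c) (∑Xq-sized h e)))) (trans (sym (Rq.*-assoc _ _ c)) (trans (cong (_* c) (trans (Rq.*-comm _ _) (inv-pos-r (subst (λ r → # 0 < # r) (sym (pred-∸ le)) (0<#suc _))))) (Rq.*-identityˡ c))))) (ex-const j c (ℕₚ.<⇒≤ le))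

      ex-nonneg : ∀ j {φ : Graph → ℚ} → j ℕ.≤ m → (∀ E → Ext E G → # 0 ≤ φ E) → # 0 ≤ ex j φ
      ex-nonneg j le p = ≤-trans (≤-reflexive (sym (ex-const j (# 0) le))) (ex-mono j le (λ E e h → p E e))

      -- The property of a statistic that counts k-tuples of distinct edges still to be added: of
      -- the r possible next edges, all but k leave a given tuple intact. Its expectation is an
      -- explicit product of factors 1 - k/r.
      Hom : ℕ → (Graph → ℚ) → Set
      Hom k φ = ∀ r E → Ext E G → Sized r E → ∑ Ps (λ q → Xq E G q * φ (add E q)) ≡ (# r - # k) * φ E

      ex-hom : ∀ {k φ} → Hom k φ → ∀ j → suc j ℕ.≤ m → ex (suc j) φ ≡ (# 1 - # k * inv (# (m ℕ.∸ j))) * ex j φ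
      ex-hom {k} {φ} H j le = trans (ex-cong j (ℕₚ.<⇒≤ le) (λ E e h → trans (cong (inv R *_) (H (m ℕ.∸ j) E e h)) (trans (solve 4 (λ i r k f → i :* ((r :- k) :* f) := (r :* i :- k :* i) :* f) refl (inv R) R (# k) (φ E)) (cong (λ z → (z - # k * inv R) * φ E) RiR)))) (ex-* j _ φ)
        where
        R = # (m ℕ.∸ j)
        RiR : R * inv R ≡ # 1
        RiR = inv-pos-r (subst (λ r → # 0 < # r) (sym (pred-∸ le)) (0<#suc _))

      p : ℕ → ℚ
      p r = # r * inv (# m)

      0≤p : ∀ r → # 0 ≤ p r
      0≤p r = 0≤* (0≤# r) (0≤inv (0≤# m))

      module _ (0<m : # 0 < # m) where

        pm : p m ≡ # 1
        pm = inv-pos-r 0<m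

        1^ : ∀ k → # 1 ^ k ≡ # 1
        1^ zero = refl
        1^ (suc k) = trans (Rq.*-identityˡ _) (1^ k)

        module _ {j} (le : suc j ℕ.≤ m) where
          R R' : ℚ
          R = # (m ℕ.∸ j)
          R' = # (m ℕ.∸ suc j)

          R≡ : R ≡ # 1 + R'
          R≡ = trans (cong # (pred-∸ le)) (#-suc _)

          0<R : # 0 < R
          0<R = subst (λ r → # 0 < # r) (sym (pred-∸ le)) (0<#suc _)

          1-inv : # 1 - inv R ≡ R' * inv R
          1-inv = trans (cong (_- inv R) (sym (inv-pos-r 0<R))) (trans (cong (λ z → z * inv R - inv R) R≡) (solve 2 (λ r i → (κ 1 :+ r) :* i :- i := r :* i) refl R' (inv R)))

          inv≤1 : inv R ≤ # 1
          inv≤1 = ≤-by (R' * inv R) (0≤* (0≤# _) (0≤inv (<⇒≤ 0<R))) 1-inv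

        -- Bernoulli's inequality gives 1 - k/r ≤ (1 - 1/r)^k, and the product of the factors (r -
        -- 1)/r telescopes.
        ex-hom-≤ : ∀ {k φ} → Hom k φ → (∀ E → Ext E G → # 0 ≤ φ E) → ∀ j → j ℕ.≤ m → ex j φ ≤ p (m ℕ.∸ j) ^ k * φ ∅
        ex-hom-≤ {k} {φ} H nn zero le = ≤-reflexive (sym (trans (cong (λ z → z ^ k * φ ∅) pm) (trans (cong (_* φ ∅) (1^ k)) (Rq.*-identityˡ _))))
        ex-hom-≤ {k} {φ} H nn (suc j) le = ≤-trans (≤-reflexive (ex-hom {k} {φ} H j le)) (≤-trans (*-monoʳ (ex j φ) (ex-nonneg j (ℕₚ.<⇒≤ le) nn) (≤-trans (bernoulli k (0≤inv (<⇒≤ (0<R le))) (inv≤1 le)) (≤-reflexive (cong (_^ k) (1-inv le)))))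
          (≤-trans (*-monoˡ _ (0≤^ k (0≤* (0≤# _) (0≤inv (<⇒≤ (0<R le))))) (ex-hom-≤ {k} {φ} H nn j (ℕₚ.<⇒≤ le))) (≤-reflexive (trans (sym (Rq.*-assoc _ _ _)) (cong (_* φ ∅) (trans (sym (*-^ (R' le * inv (R le)) (p (m ℕ.∸ j)) k)) (cong (_^ k)
            (trans (solve 4 (λ a b c i → a :* b :* (c :* i) := (c :* b) :* (a :* i)) refl (R' le) (inv (R le)) (R le) (inv (# m))) (trans (cong (_* (R' le * inv (# m))) (inv-pos-r (0<R le))) (Rq.*-identityˡ _))))))))))

        -- With r edges left the bound has the factor r (r - 1)/m². It satisfies the same recursion
        -- as the expectation and starts below it.
        ex-hom₂-≥ : ∀ {φ} → Hom 2 φ → # 0 ≤ φ ∅ → ∀ j → suc j ℕ.≤ m → p (m ℕ.∸ j) * (p (m ℕ.∸ j) - inv (# m)) * φ ∅ ≤ ex j φ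
        ex-hom₂-≥ {φ} H nn zero le = ≤-by (inv (# m) * φ ∅) (0≤* (0≤inv (<⇒≤ 0<m)) nn) (trans (cong (λ z → φ ∅ - z * (z - inv (# m)) * φ ∅) pm) (solve 2 (λ i f → f :- κ 1 :* (κ 1 :- i) :* f := i :* f) refl (inv (# m)) (φ ∅)))
        ex-hom₂-≥ {φ} H nn (suc j) le = ≤-trans (≤-reflexive eq) (≤-trans (*-monoˡ _ nonneg (ex-hom₂-≥ {φ} H nn j le')) (≤-reflexive (sym (ex-hom {2} {φ} H j le'))))
          where
          le' = ℕₚ.<⇒≤ le
          i = inv (# m)
          c = # 1 - # 2 * inv (R le')
          Rinv = inv-pos-r (0<R le')
          nonneg : # 0 ≤ c
          nonneg = *-cancelˡ (R le') (0<R le') (≤-by (R' le) (0≤# _) (trans (solve 2 (λ r v → r :* (κ 1 :- κ 2 :* v) :- r :* κ 0 := r :- κ 2 :* (r :* v)) refl (R le') (inv (R le'))) (trans (cong₂ (λ a b → a - # 2 * b) (trans (R≡ le') (cong (# 1 +_) (R≡ le))) Rinv) (solve 1 (λ r → κ 1 :+ (κ 1 :+ r) :- κ 2 :* κ 1 := r) refl (R' le)))))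
          eq : p (m ℕ.∸ suc j) * (p (m ℕ.∸ suc j) - i) * φ ∅ ≡ c * (p (m ℕ.∸ j) * (p (m ℕ.∸ j) - i) * φ ∅)
          eq = sym (trans (solve 4 (λ r v i f → (κ 1 :- κ 2 :* v) :* (r :* i :* (r :* i :- i) :* f) := ((r :- κ 1) :* (r :- κ 2 :* (r :* v))) :* (i :* i :* f)) refl (R le') (inv (R le')) i (φ ∅))
             (trans (cong₂ (λ a b → ((a - # 1) * (a - # 2 * b)) * (i * i * φ ∅)) (R≡ le') Rinv) (solve 3 (λ r i f → ((κ 1 :+ r :- κ 1) :* (κ 1 :+ r :- κ 2 :* κ 1)) :* (i :* i :* f) := r :* i :* (r :* i :- i) :* f) refl (R' le') i (φ ∅))))

      lin : (P → ℚ) → Graph → ℚ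
      lin a E = ∑ Ps (λ q → a q * Xq E G q)

      lin-add : ∀ a E {q} → lookup E q ≡ false → lin a (add E q) ≡ lin a E - a q
      lin-add a E {q} z = trans (∑-cong Ps (λ r → trans (cong (a r *_) (Xq-add E G z r)) (solve 3 (λ a x y → a :* (x :- y) := a :* x :- y :* a) refl (a r) (Xq E G r) (δ q r)))) (trans (∑-- Ps _ _) (cong (λ y → lin a E - y) (∑-δ q a)))

      -- The falling factorial counts ordered k-tuples of distinct marked edges still to be added.
      fall-hom : ∀ (b : P → Bool) k → Hom k (λ E → fall (lin (λ q → 𝟙 (b q)) E) k)
      fall-hom b k r E e h = trans (∑Xq-cong e (λ q g z → trans (cong (λ y → fall y k) (lin-add (λ q → 𝟙 (b q)) E z)) (split (b q)))) (trans (∑-cong Ps (λ q → solve 4 (λ x b u v → x :* (b :* u :+ (κ 1 :- b) :* v) := b :* x :* u :+ (x :- b :* x) :* v) refl (Xq E G q) (𝟙 (b q)) (fall (L - # 1) k) (fall L k)))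
        (trans (∑-+ Ps _ _) (trans (cong₂ _+_ (∑-*ʳ _ Ps _) (trans (∑-*ʳ _ Ps _) (cong (_* fall L k) (trans (∑-- Ps _ _) (cong (_- L) (∑Xq-sized h e)))))) (trans (cong (_+ (# r - L) * fall L k) (fall-shift k L)) (solve 4 (λ l k f r → (l :- k) :* f :+ (r :- l) :* f := (r :- k) :* f) refl L (# k) (fall L k) (# r))))))
        where
        L = lin (λ q → 𝟙 (b q)) E
        split : ∀ x → fall (L - 𝟙 x) k ≡ 𝟙 x * fall (L - # 1) k + (# 1 - 𝟙 x) * fall L k
        split true = solve 2 (λ a b → a := κ 1 :* a :+ (κ 1 :- κ 1) :* b) refl (fall (L - # 1) k) (fall L k)
        split false = trans (cong (λ y → fall y k) (solve 1 (λ l → l :- κ 0 := l) refl L)) (solve 2 (λ a b → b := κ 0 :* a :+ (κ 1 :- κ 0) :* b) refl (fall (L - # 1) k) (fall L k))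

      lin-ℕ : ∀ (b : P → Bool) {E} → Ext E G → Σ ℕ λ x → lin (λ q → 𝟙 (b q)) E ≡ # x
      lin-ℕ b {E} e = countᵇ {NP n} (λ q → b q ∧ Xᵇ E G q) , sym (trans (#-countᵇ {NP n} _) (∑-cong Ps (λ q → trans (𝟙-∧ (b q) _) (cong (𝟙 (b q) *_) (sym (Xq-Xᵇ (sub e) q))))))

      module SecondMoment (0<m : # 0 < # m) (a : P → ℚ) (0≤a : ∀ q → # 0 ≤ a q) (a≤2 : ∀ q → a q ≤ # 2) (q₀ : P) (G∋q₀ : lookup G q₀ ≡ true) where

        -- `z` indicates that `q₀` is still to be added. Deleting `q₀` from the weights makes `f₂`,
        -- `f₂'` and `f₃` sums over tuples of distinct edges, hence homogeneous of degrees 2, 2 and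
        -- 3.
        ã z̃ : P → ℚ
        ã q = (# 1 - δ q₀ q) * a q
        z̃ = δ q₀

        z L̃ Q̃ : Graph → ℚ
        z E = lin z̃ E
        L̃ E = lin ã E
        Q̃ E = lin (λ q → ã q * ã q) E

        z≡ : ∀ E → z E ≡ Xq E G q₀
        z≡ E = ∑-δ q₀ (Xq E G)

        δ-bit : ∀ q → Bit (δ q₀ q)
        δ-bit q with q₀ F.≟ q
        ... | yes refl = subst Bit (sym (δ-refl q₀)) b1
        ... | no ne = subst Bit (sym (δ-≢ ne)) b0

        δã : ∀ q → δ q₀ q * ã q ≡ # 0
        δã q = trans (solve 2 (λ x a → x :* ((κ 1 :- x) :* a) := (x :- x :* x) :* a) refl (δ q₀ q) (a q)) (trans (cong (λ y → (δ q₀ q - y) * a q) (bit-sq (δ-bit q))) (solve 2 (λ x a → (x :- x) :* a := κ 0) refl (δ q₀ q) (a q)))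

        0≤ã : ∀ q → # 0 ≤ ã q
        0≤ã q = 0≤* (≤⇒0≤- (bit-≤1 (δ-bit q))) (0≤a q)

        ã≤a : ∀ q → ã q ≤ a q
        ã≤a q = ≤-by (δ q₀ q * a q) (0≤* (0≤δ q₀ q) (0≤a q)) (solve 2 (λ x a → a :- (κ 1 :- x) :* a := x :* a) refl (δ q₀ q) (a q))

        linear : ∀ {r E} → Ext E G → Sized r E → ∀ c₀ c₁ c₂ c₃ → ∑ Ps (λ q → Xq E G q * (c₀ + c₁ * ã q + c₂ * (ã q * ã q) + c₃ * δ q₀ q)) ≡ c₀ * # r + c₁ * L̃ E + c₂ * Q̃ E + c₃ * z E
        linear {r} {E} e h c₀ c₁ c₂ c₃ = trans (∑-cong Ps (λ q → solve 7 (λ x c₀ c₁ c₂ c₃ a y → x :* (c₀ :+ c₁ :* a :+ c₂ :* (a :* a) :+ c₃ :* y) := c₀ :* x :+ c₁ :* (a :* x) :+ c₂ :* (a :* a :* x) :+ c₃ :* (y :* x)) refl (Xq E G q) c₀ c₁ c₂ c₃ (ã q) (δ q₀ q)))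
          (trans (∑-+ Ps _ _) (cong₂ _+_ (trans (∑-+ Ps _ _) (cong₂ _+_ (trans (∑-+ Ps _ _) (cong₂ _+_ (trans (∑-*ˡ c₀ Ps _) (cong (c₀ *_) (∑Xq-sized h e))) (∑-*ˡ c₁ Ps _))) (∑-*ˡ c₂ Ps _))) (∑-*ˡ c₃ Ps _)))

        hom : ∀ k (φ : Graph → ℚ) (c₀ c₁ c₂ c₃ : Graph → ℚ) → (∀ E q → lookup E q ≡ false → φ (add E q) ≡ c₀ E + c₁ E * ã q + c₂ E * (ã q * ã q) + c₃ E * δ q₀ q)
          → (∀ r E → c₀ E * # r + c₁ E * L̃ E + c₂ E * Q̃ E + c₃ E * z E ≡ (# r - # k) * φ E) → Hom k φ
        hom k φ c₀ c₁ c₂ c₃ p₁ p₂ r E e h = trans (∑Xq-cong e (λ q _ w → p₁ E q w)) (trans (linear e h (c₀ E) (c₁ E) (c₂ E) (c₃ E)) (p₂ r E))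

        f₂ f₂' f₃ : Graph → ℚ
        f₂ E = z E * L̃ E
        f₂' E = z E * Q̃ E
        f₃ E = z E * (L̃ E * L̃ E - Q̃ E)

        hom₁ : Hom 1 z
        hom₁ = hom 1 z z (λ _ → # 0) (λ _ → # 0) (λ _ → - # 1) (λ E q w → trans (lin-add z̃ E w) (solve 3 (λ z y a → z :- y := z :+ κ 0 :* a :+ κ 0 :* (a :* a) :+ (:- κ 1) :* y) refl (z E) (δ q₀ q) (ã q)))
          (λ r E → solve 4 (λ z r l q → z :* r :+ κ 0 :* l :+ κ 0 :* q :+ (:- κ 1) :* z := (r :- κ 1) :* z) refl (z E) (# r) (L̃ E) (Q̃ E))

        drop : ∀ q {x y} c → x ≡ y + δ q₀ q * ã q * c → x ≡ y
        drop q {x} {y} c e = trans e (trans (cong (λ u → y + u * c) (δã q)) (solve 2 (λ y d → y :+ κ 0 :* d := y) refl y c))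

        hom₂ : Hom 2 f₂
        hom₂ = hom 2 f₂ f₂ (λ E → - z E) (λ _ → # 0) (λ E → - L̃ E) (λ E q w → drop q (# 1) (trans (cong₂ _*_ (lin-add z̃ E w) (lin-add ã E w)) (solve 4 (λ z l y a → (z :- y) :* (l :- a) := z :* l :+ (:- z) :* a :+ κ 0 :* (a :* a) :+ (:- l) :* y :+ y :* a :* κ 1) refl (z E) (L̃ E) (δ q₀ q) (ã q))))
          (λ r E → solve 4 (λ z r l q → z :* l :* r :+ (:- z) :* l :+ κ 0 :* q :+ (:- l) :* z := (r :- κ 2) :* (z :* l)) refl (z E) (# r) (L̃ E) (Q̃ E))

        hom₂' : Hom 2 f₂'
        hom₂' = hom 2 f₂' f₂' (λ _ → # 0) (λ E → - z E) (λ E → - Q̃ E) (λ E q w → drop q (ã q) (trans (cong₂ _*_ (lin-add z̃ E w) (lin-add (λ q → ã q * ã q) E w)) (solve 4 (λ z l y a → (z :- y) :* (l :- a :* a) := z :* l :+ κ 0 :* a :+ (:- z) :* (a :* a) :+ (:- l) :* y :+ y :* a :* a) refl (z E) (Q̃ E) (δ q₀ q) (ã q))))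
          (λ r E → solve 4 (λ z r l q → z :* q :* r :+ κ 0 :* l :+ (:- z) :* q :+ (:- q) :* z := (r :- κ 2) :* (z :* q)) refl (z E) (# r) (L̃ E) (Q̃ E))

        hom₃ : Hom 3 f₃
        hom₃ = hom 3 f₃ f₃ (λ E → - (# 2 * (z E * L̃ E))) (λ E → # 2 * z E) (λ E → - (L̃ E * L̃ E - Q̃ E))
          (λ E q w → drop q (# 2 * L̃ E - # 2 * ã q) (trans (cong₂ _*_ (lin-add z̃ E w) (cong₂ (λ u v → u * u - v) (lin-add ã E w) (lin-add (λ q → ã q * ã q) E w)))
            (solve 5 (λ z l s y a → (z :- y) :* ((l :- a) :* (l :- a) :- (s :- a :* a)) := z :* (l :* l :- s) :+ (:- (κ 2 :* (z :* l))) :* a :+ (κ 2 :* z) :* (a :* a) :+ (:- (l :* l :- s)) :* y :+ y :* a :* (κ 2 :* l :- κ 2 :* a)) refl (z E) (L̃ E) (Q̃ E) (δ q₀ q) (ã q))))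
          (λ r E → solve 4 (λ z r l q → z :* (l :* l :- q) :* r :+ (:- (κ 2 :* (z :* l))) :* l :+ (κ 2 :* z) :* q :+ (:- (l :* l :- q)) :* z := (r :- κ 3) :* (z :* (l :* l :- q))) refl (z E) (# r) (L̃ E) (Q̃ E))

        0≤z : ∀ {E} → Ext E G → # 0 ≤ z E
        0≤z {E} e = subst (# 0 ≤_) (sym (z≡ E)) (0≤Xq (sub e) q₀)

        0≤L̃ : ∀ {E} → Ext E G → # 0 ≤ L̃ E
        0≤L̃ e = ∑-nonneg Ps (λ q → 0≤* (0≤ã q) (0≤Xq (sub e) q))

        0≤Q̃ : ∀ {E} → Ext E G → # 0 ≤ Q̃ E
        0≤Q̃ e = ∑-nonneg Ps (λ q → 0≤* (0≤sq (ã q)) (0≤Xq (sub e) q))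

        Xq-sq : ∀ {E} → Ext E G → ∀ q → Xq E G q * Xq E G q ≡ Xq E G q
        Xq-sq {E} e q = subst (λ x → x * x ≡ x) (sym (Xq-Xᵇ (sub e) q)) (bit-sq (𝟙-bit (Xᵇ E G q)))

        Q̃≤L̃² : ∀ {E} → Ext E G → Q̃ E ≤ L̃ E * L̃ E
        Q̃≤L̃² {E} e = ≤-trans (≤-reflexive (∑-cong Ps (λ q → trans (cong (ã q * ã q *_) (sym (Xq-sq e q))) (solve 2 (λ a x → a :* a :* (x :* x) := a :* x :* (a :* x)) refl (ã q) (Xq E G q))))) (∑sq≤sq∑ Ps (λ q → ã q * Xq E G q) (λ q → 0≤* (0≤ã q) (0≤Xq (sub e) q)))

        Q̃≤2L̃ : ∀ {E} → Ext E G → Q̃ E ≤ # 2 * L̃ E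
        Q̃≤2L̃ {E} e = ≤-trans (∑-mono Ps (λ q → ≤-trans (*-monoʳ _ (0≤Xq (sub e) q) (*-monoʳ (ã q) (0≤ã q) (≤-trans (ã≤a q) (a≤2 q)))) (≤-reflexive (Rq.*-assoc _ _ _)))) (≤-reflexive (∑-*ˡ (# 2) Ps _))

        z∅ : z ∅ ≡ # 1
        z∅ = trans (z≡ ∅) (trans (cong₂ (λ x y → 𝟙 x - 𝟙 y) G∋q₀ (Vₚ.lookup-replicate q₀ false)) (solve 0 (κ 1 :- κ 0 := κ 1) refl))

        Ã : ℚ
        Ã = L̃ ∅

        lin-split : ∀ {E} → Ext E G → z E * (lin a E) ≡ z E * (L̃ E + a q₀)
        lin-split {E} e = trans (cong (z E *_) (trans (∑-cong Ps (λ q → solve 3 (λ a y x → a :* x := (κ 1 :- y) :* a :* x :+ y :* (a :* x)) refl (a q) (δ q₀ q) (Xq E G q))) (trans (∑-+ Ps _ _) (cong (L̃ E +_) (trans (∑-δ q₀ (λ q → a q * Xq E G q)) (cong (a q₀ *_) (sym (z≡ E))))))))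
          (trans (solve 3 (λ z l a → z :* (l :+ a :* z) := z :* l :+ a :* (z :* z)) refl (z E) (L̃ E) (a q₀)) (trans (cong (λ y → z E * L̃ E + a q₀ * y) (trans (cong₂ _*_ (z≡ E) (z≡ E)) (trans (Xq-sq e q₀) (sym (z≡ E))))) (solve 3 (λ z l a → z :* l :+ a :* z := z :* (l :+ a)) refl (z E) (L̃ E) (a q₀))))

        lin∅ : lin a ∅ ≡ Ã + a q₀
        lin∅ = trans (sym (trans (cong (_* lin a ∅) z∅) (Rq.*-identityˡ _))) (trans (lin-split e∅) (trans (cong (_* (L̃ ∅ + a q₀)) z∅) (Rq.*-identityˡ _)))

        first-moment : ∀ j → j ℕ.≤ m → ex j (λ E → z E * (lin a E - a q₀)) ≤ p (m ℕ.∸ j) * p (m ℕ.∸ j) * Ã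
        first-moment j le = ≤-trans (≤-reflexive (ex-cong j le (λ E e h → trans (solve 3 (λ z l a → z :* (l :- a) := z :* l :- z :* a) refl (z E) (lin a E) (a q₀)) (trans (cong (_- z E * a q₀) (lin-split e)) (solve 3 (λ z l a → z :* (l :+ a) :- z :* a := z :* l) refl (z E) (L̃ E) (a q₀)))))) (≤-trans (ex-hom-≤ 0<m {2} {f₂} hom₂ (λ E e → 0≤* (0≤z e) (0≤L̃ e)) j le)
          (≤-reflexive (trans (cong (λ y → p (m ℕ.∸ j) ^ 2 * (y * L̃ ∅)) z∅) (solve 2 (λ p l → p :* (p :* κ 1) :* (κ 1 :* l) := p :* p :* l) refl (p (m ℕ.∸ j)) Ã))))

        -- The conditioning on `q₀` mirrors the weighting of vertices by residual degree. After L̃²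
        -- is split into `L̃² - Q̃` and `Q̃`, the terms of order q³ Ã² cancel; what is left is the
        -- diagonal part and the 1/m correction from `ex-hom₂-≥`, absorbed by Ã ≤ m. The edge `q₀`
        -- itself shifts the sum by at most 2, whence the term `# 8 * p (m ℕ.∸ j)`.
        second-moment : ∀ j → suc j ℕ.≤ m → lin a ∅ ≤ # m → ex j (λ E → z E * ((lin a E - lin a ∅ * p (m ℕ.∸ j)) * (lin a E - lin a ∅ * p (m ℕ.∸ j)))) ≤ # 8 * (lin a ∅ * (p (m ℕ.∸ j) * p (m ℕ.∸ j))) + # 8 * p (m ℕ.∸ j)
        second-moment j le' A≤m = ≤-trans (ex-mono j le (λ E e h → pointwise E e)) (≤-trans (≤-reflexive expand) (≤-trans bounds final))
          where
          le = ℕₚ.<⇒≤ le'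
          lv = m ℕ.∸ j
          q = p lv
          A' = lin a ∅
          i = inv (# m)
          a₀ = a q₀
          q≤1 : q ≤ # 1
          q≤1 = ≤-trans (*-monoʳ i (0≤inv (<⇒≤ 0<m)) (#-mono (ℕₚ.m∸n≤m m j))) (≤-reflexive (inv-pos-r 0<m))
          pointwise : ∀ E → Ext E G → z E * ((lin a E - A' * q) * (lin a E - A' * q)) ≤ # 2 * (f₃ E + (f₂' E + (- (# 2 * Ã * q) * f₂ E + Ã * Ã * (q * q) * z E))) + # 8 * z E
          pointwise E e = ≤-trans (≤-reflexive eq) (≤-trans (*-monoˡ (z E) (0≤z e) (≤-trans (sq-+₂ (L̃ E - Ã * q) (a₀ * (# 1 - q))) (+-bound))) (≤-reflexive (solve 5 (λ z l s A q → z :* (κ 2 :* ((l :- A :* q) :* (l :- A :* q)) :+ κ 8) := κ 2 :* (z :* (l :* l :- s) :+ (z :* s :+ ((:- (κ 2 :* A :* q)) :* (z :* l) :+ A :* A :* (q :* q) :* z))) :+ κ 8 :* z) refl (z E) (L̃ E) (Q̃ E) Ã q)))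
            where
            eq : z E * ((lin a E - A' * q) * (lin a E - A' * q)) ≡ z E * ((L̃ E - Ã * q + a₀ * (# 1 - q)) * (L̃ E - Ã * q + a₀ * (# 1 - q)))
            eq = trans (solve 3 (λ z l c → z :* ((l :- c) :* (l :- c)) := z :* l :* l :- κ 2 :* c :* (z :* l) :+ z :* (c :* c)) refl (z E) (lin a E) (A' * q))
              (trans (cong (λ y → y * lin a E - # 2 * (A' * q) * y + z E * (A' * q * (A' * q))) (lin-split e)) (trans (solve 5 (λ z l ll a c → z :* (l :+ a) :* ll :- κ 2 :* c :* (z :* (l :+ a)) :+ z :* (c :* c) := (l :+ a) :* (z :* ll) :- κ 2 :* c :* (z :* (l :+ a)) :+ z :* (c :* c)) refl (z E) (L̃ E) (lin a E) a₀ (A' * q))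
              (trans (cong (λ y → (L̃ E + a₀) * y - # 2 * (A' * q) * (z E * (L̃ E + a₀)) + z E * (A' * q * (A' * q))) (lin-split e)) (trans (cong (λ y → (L̃ E + a₀) * (z E * (L̃ E + a₀)) - # 2 * (y * q) * (z E * (L̃ E + a₀)) + z E * (y * q * (y * q))) lin∅)
                (solve 5 (λ z l a A q → (l :+ a) :* (z :* (l :+ a)) :- κ 2 :* ((A :+ a) :* q) :* (z :* (l :+ a)) :+ z :* ((A :+ a) :* q :* ((A :+ a) :* q)) := z :* ((l :- A :* q :+ a :* (κ 1 :- q)) :* (l :- A :* q :+ a :* (κ 1 :- q)))) refl (z E) (L̃ E) a₀ Ã q)))))
            +-bound : # 2 * ((L̃ E - Ã * q) * (L̃ E - Ã * q) + a₀ * (# 1 - q) * (a₀ * (# 1 - q))) ≤ # 2 * ((L̃ E - Ã * q) * (L̃ E - Ã * q)) + # 8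
            +-bound = ≤-trans (≤-reflexive (Rq.distribˡ _ _ _)) (+-monoʳ _ (≤-trans (*-monoˡ (# 2) (0≤# 2) (*-mono 0≤aq (0≤# 2) aq≤2 aq≤2)) (≤-reflexive (solve 0 (κ 2 :* (κ 2 :* κ 2) := κ 8) refl))))
              where
              0≤aq : # 0 ≤ a₀ * (# 1 - q)
              0≤aq = 0≤* (0≤a q₀) (≤⇒0≤- q≤1)
              aq≤2 : a₀ * (# 1 - q) ≤ # 2
              aq≤2 = ≤-trans (≤-by (a₀ * q) (0≤* (0≤a q₀) (0≤p lv)) (solve 2 (λ a q → a :- a :* (κ 1 :- q) := a :* q) refl a₀ q)) (a≤2 q₀)
          expand : ex j (λ E → # 2 * (f₃ E + (f₂' E + (- (# 2 * Ã * q) * f₂ E + Ã * Ã * (q * q) * z E))) + # 8 * z E) ≡ # 2 * (ex j f₃ + (ex j f₂' + (- (# 2 * Ã * q) * ex j f₂ + Ã * Ã * (q * q) * ex j z))) + # 8 * ex j z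
          expand = trans (ex-+ j _ _) (cong₂ _+_ (trans (ex-* j (# 2) _) (cong (# 2 *_) (trans (ex-+ j _ _) (cong (ex j f₃ +_) (trans (ex-+ j _ _) (cong (ex j f₂' +_) (trans (ex-+ j _ _) (cong₂ _+_ (ex-* j _ f₂) (ex-* j _ z))))))))) (ex-* j (# 8) z))
          0≤Ã : # 0 ≤ Ã
          0≤Ã = 0≤L̃ e∅
          b₃ : ex j f₃ ≤ q * q * q * (Ã * Ã)
          b₃ = ≤-trans (ex-hom-≤ 0<m {3} {f₃} hom₃ (λ E e → 0≤* (0≤z e) (≤⇒0≤- (Q̃≤L̃² e))) j le) (≤-trans (≤-reflexive (trans (cong (λ y → q ^ 3 * (y * (L̃ ∅ * L̃ ∅ - Q̃ ∅))) z∅) (solve 3 (λ q l s → q :* (q :* (q :* κ 1)) :* (κ 1 :* (l :* l :- s)) := q :* q :* q :* (l :* l :- s)) refl q Ã (Q̃ ∅))))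
            (*-monoˡ _ (0≤* (0≤* (0≤p lv) (0≤p lv)) (0≤p lv)) (≤-by (Q̃ ∅) (0≤Q̃ e∅) (solve 2 (λ l s → l :- (l :- s) := s) refl (Ã * Ã) (Q̃ ∅)))))
          b₂' : ex j f₂' ≤ q * q * (# 2 * Ã)
          b₂' = ≤-trans (ex-hom-≤ 0<m {2} {f₂'} hom₂' (λ E e → 0≤* (0≤z e) (0≤Q̃ e)) j le) (≤-trans (≤-reflexive (trans (cong (λ y → q ^ 2 * (y * Q̃ ∅)) z∅) (solve 2 (λ q s → q :* (q :* κ 1) :* (κ 1 :* s) := q :* q :* s) refl q (Q̃ ∅)))) (*-monoˡ _ (0≤sq q) (Q̃≤2L̃ e∅)))
          b₂ : q * (q - i) * Ã ≤ ex j f₂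
          b₂ = ≤-trans (≤-reflexive (sym (cong (q * (q - i) *_) (trans (cong (_* Ã) z∅) (Rq.*-identityˡ _))))) (ex-hom₂-≥ 0<m {f₂} hom₂ (0≤* (0≤z e∅) 0≤Ã) j le')
          b₁ : ex j z ≤ q
          b₁ = ≤-trans (ex-hom-≤ 0<m {1} {z} hom₁ (λ E e → 0≤z e) j le) (≤-reflexive (trans (cong (λ y → q ^ 1 * y) z∅) (solve 1 (λ q → q :* κ 1 :* κ 1 := q) refl q)))
          bounds : # 2 * (ex j f₃ + (ex j f₂' + (- (# 2 * Ã * q) * ex j f₂ + Ã * Ã * (q * q) * ex j z))) + # 8 * ex j z ≤ # 2 * (q * q * q * (Ã * Ã) + (q * q * (# 2 * Ã) + (- (# 2 * Ã * q) * (q * (q - i) * Ã) + Ã * Ã * (q * q) * q))) + # 8 * q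
          bounds = +-mono (*-monoˡ (# 2) (0≤# 2) (+-mono b₃ (+-mono b₂' (+-mono (≤-by (# 2 * Ã * q * (ex j f₂ - q * (q - i) * Ã)) (0≤* (0≤* (0≤* (0≤# 2) 0≤Ã) (0≤p lv)) (≤⇒0≤- b₂)) (solve 3 (λ c x y → (:- c) :* y :- (:- c) :* x := c :* (x :- y)) refl (# 2 * Ã * q) (ex j f₂) (q * (q - i) * Ã))) (*-monoˡ _ (0≤* (0≤sq Ã) (0≤sq q)) b₁))))) (*-monoˡ (# 8) (0≤# 8) b₁)
          Ã≤A : Ã ≤ A'
          Ã≤A = ≤-by a₀ (0≤a q₀) (trans (cong (_- Ã) lin∅) (solve 2 (λ x y → x :+ y :- x := y) refl Ã a₀))
          Ãi≤1 : Ã * i ≤ # 1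
          Ãi≤1 = ≤-trans (*-monoʳ i (0≤inv (<⇒≤ 0<m)) (≤-trans Ã≤A A≤m)) (≤-reflexive (inv-pos-r 0<m))
          final : # 2 * (q * q * q * (Ã * Ã) + (q * q * (# 2 * Ã) + (- (# 2 * Ã * q) * (q * (q - i) * Ã) + Ã * Ã * (q * q) * q))) + # 8 * q ≤ # 8 * (A' * (q * q)) + # 8 * q
          final = ≤-by (# 8 * ((A' - Ã) * (q * q)) + # 4 * (Ã * (q * q) * (# 1 - Ã * i))) (0≤+ (0≤* (0≤# 8) (0≤* (≤⇒0≤- Ã≤A) (0≤sq q))) (0≤* (0≤# 4) (0≤* (0≤* 0≤Ã (0≤sq q)) (≤⇒0≤- Ãi≤1))))
            (solve 4 (λ q A B i → κ 8 :* (B :* (q :* q)) :+ κ 8 :* q :- (κ 2 :* (q :* q :* q :* (A :* A) :+ (q :* q :* (κ 2 :* A) :+ ((:- (κ 2 :* A :* q)) :* (q :* (q :- i) :* A) :+ A :* A :* (q :* q) :* q))) :+ κ 8 :* q) := κ 8 :* ((B :- A) :* (q :* q)) :+ κ 4 :* (A :* (q :* q) :* (κ 1 :- A :* i))) refl q Ã A' i)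

    -- Moments of residual degrees and neighbourhood counts

    D∅ : ∀ i → D ∅ i ≡ # d
    D∅ i = go
      where
      z : ∀ j → Y ∅ i j ≡ # 0
      z j = by (i F.≟ j)
        where
        by : Dec (i ≡ j) → Y ∅ i j ≡ # 0
        by (yes refl) = Y-diag ∅ i
        by (no ne) = trans (Y-joins ∅ (ix-joins i j ne)) (cong 𝟙 (Vₚ.lookup-replicate (ix i j ne) false))
      opaque
        unfolding D
        go : D ∅ i ≡ # d
        go = trans (cong (λ y → # d - y) (trans (∑-cong Vs z) (∑-0 Vs))) (solve 1 (λ x → x :- κ 0 := x) refl (# d))

    vol∅ : vol ∅ ≡ # n * # d
    vol∅ = trans (∑-cong Vs D∅) (trans (∑-const Vs (# d)) (cong (λ k → # k * # d) (Lₚ.length-tabulate id)))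

    ∅⊆ : ∀ G → ∅ ⊆ G
    ∅⊆ G = mk⊆ (λ q t → ⊥-elim (true≢false (trans (sym t) (Vₚ.lookup-replicate q false))))
      where
      true≢false : true ≢ false
      true≢false ()

    ∑Ȳ : ∀ {G} → Regular G → ∀ i → ∑ Vs (Ȳ G i) ≡ # d + # 1
    ∑Ȳ rg i = trans (∑-+ Vs _ _) (cong₂ _+_ (rg i) (∑-δ1 i))

    deg⁺ : ℚ
    deg⁺ = # d * (# d + # 1)

    C∅ : ∀ {G} → Regular G → ∀ i → C ∅ G i ≡ deg⁺
    C∅ {G} rg i = trans (∑-cong Vs (λ l → trans (cong (Ȳ G i l *_) (D∅ l)) (Rq.*-comm _ _))) (trans (∑-*ˡ (# d) Vs _) (cong (# d *_) (∑Ȳ rg i)))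

    D≤d : ∀ {E G} → Ext E G → ∀ i → D E i ≤ # d
    D≤d {E} e i = ≤-trans (D-⊆ (∅⊆ E) i) (≤-reflexive (D∅ i))

    C≤deg⁺ : ∀ {E G} → Ext E G → ∀ i → C E G i ≤ deg⁺
    C≤deg⁺ {E} {G} e i = ≤-trans (∑-mono Vs (λ l → *-monoˡ _ (0≤Ȳ G i l) (D-⊆ (∅⊆ E) l))) (≤-reflexive (C∅ (reg e) i))

    -- The number of ends of `q` in the closed neighbourhood of `i`. It makes `C E G i` linear in
    -- the residual edges, with weights that depend on `G` alone.
    aw : Graph → Fin n → P → ℚ
    aw G i q = ∑ Vs (λ l → Ȳ G i l * inc q l)

    opaque
      unfolding inc

      aw≡ : ∀ G i q → aw G i q ≡ Ȳ G i (fst q) + Ȳ G i (snd q)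
      aw≡ G i q = trans (∑-cong Vs (λ l → trans (Rq.distribˡ _ _ _) (cong₂ _+_ (Rq.*-comm _ _) (Rq.*-comm _ _)))) (trans (∑-+ Vs _ _) (cong₂ _+_ (∑-δ (fst q) (Ȳ G i)) (∑-δ (snd q) (Ȳ G i))))

      inc≡ : ∀ q i → inc q i ≡ δ (fst q) i + δ (snd q) i
      inc≡ q i = refl

    δ-bit' : ∀ {k} (a b : Fin k) → Bit (δ a b)
    δ-bit' a b with a F.≟ b
    ... | yes refl = subst Bit (sym (δ-refl a)) b1
    ... | no ne = subst Bit (sym (δ-≢ ne)) b0

    2≡1+1 : # 1 + # 1 ≡ # 2
    2≡1+1 = solve 0 (κ 1 :+ κ 1 := κ 2) refl

    0≤aw : ∀ G i q → # 0 ≤ aw G i q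
    0≤aw G i q = ∑-nonneg Vs (λ l → 0≤* (0≤Ȳ G i l) (0≤inc q l))

    aw≤2 : ∀ G i q → aw G i q ≤ # 2
    aw≤2 G i q = ≤-trans (≤-reflexive (aw≡ G i q)) (≤-trans (+-mono (bit-≤1 (Ȳ-bit G i (fst q))) (bit-≤1 (Ȳ-bit G i (snd q)))) (≤-reflexive 2≡1+1))

    inc≤2 : ∀ i q → inc q i ≤ # 2
    inc≤2 i q = ≤-trans (≤-reflexive (inc≡ q i)) (≤-trans (+-mono (bit-≤1 (δ-bit' (fst q) i)) (bit-≤1 (δ-bit' (snd q) i))) (≤-reflexive 2≡1+1))

    inc-bit : ∀ q i → Bit (inc q i)
    inc-bit q i with fst q F.≟ i | snd q F.≟ i
    ... | yes a | yes b = ⊥-elim (fst≢snd q (trans a (sym b)))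
    ... | yes refl | no ne = subst Bit (sym (trans (inc≡ q i) (trans (cong₂ _+_ (δ-refl (fst q)) (δ-≢ ne)) (Rq.+-identityʳ _)))) b1
    ... | no ne | yes refl = subst Bit (sym (trans (inc≡ q i) (trans (cong₂ _+_ (δ-≢ ne) (δ-refl (snd q))) (Rq.+-identityˡ _)))) b1
    ... | no ne | no ne' = subst Bit (sym (trans (inc≡ q i) (trans (cong₂ _+_ (δ-≢ ne) (δ-≢ ne')) (Rq.+-identityˡ _)))) b0

    -- An edge of G at i lies twice in the closed neighbourhood of i.
    aw-incident : ∀ G i q → lookup G q ≡ true → inc q i ≡ # 1 → aw G i q ≡ # 2
    aw-incident G i q g o = trans (aw≡ G i q) (go (fst q F.≟ i) (snd q F.≟ i))
      where
      Y1 : Ȳ G (fst q) (snd q) ≡ # 1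
      Y1 = trans (Ȳ-off G (fst≢snd q)) (trans (Y-joins G (joins-ends q)) (cong 𝟙 g))
      go : Dec (fst q ≡ i) → Dec (snd q ≡ i) → Ȳ G i (fst q) + Ȳ G i (snd q) ≡ # 2
      go (yes refl) _ = trans (cong₂ _+_ (Ȳ-diag G (fst q)) Y1) 2≡1+1
      go (no _) (yes refl) = trans (cong₂ _+_ (trans (Ȳ-sym G (snd q) (fst q)) Y1) (Ȳ-diag G (snd q))) 2≡1+1
      go (no a) (no b) = ⊥-elim (pos⇒≢0 0<1 (trans (sym o) (trans (inc≡ q i) (trans (cong₂ _+_ (δ-≢ a) (δ-≢ b)) (Rq.+-identityˡ _)))))

    bitᵇ : ∀ {x} → Bit x → Bool
    bitᵇ b0 = false
    bitᵇ b1 = true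

    𝟙-bitᵇ : ∀ {x} (b : Bit x) → 𝟙 (bitᵇ b) ≡ x
    𝟙-bitᵇ b0 = refl
    𝟙-bitᵇ b1 = refl

    -- Factorial moments need weights 0 and 1, so an edge meeting the closed neighbourhood is
    -- counted once even if both ends lie in it; C is at most twice this count.
    ball : Graph → Fin n → P → Bool
    ball G i q = bitᵇ (Ȳ-bit G i (fst q)) ∨ bitᵇ (Ȳ-bit G i (snd q))

    ball≥ : ∀ G i q → aw G i q ≤ # 2 * 𝟙 (ball G i q)
    ball≥ G i q = ≤-trans (≤-reflexive (aw≡ G i q)) (go (Ȳ-bit G i (fst q)) (Ȳ-bit G i (snd q)))
      where
      go : ∀ {x y} (a : Bit x) (b : Bit y) → x + y ≤ # 2 * 𝟙 (bitᵇ a ∨ bitᵇ b)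
      go b0 b0 = ≤-reflexive (solve 0 (κ 0 :+ κ 0 := κ 2 :* κ 0) refl)
      go b0 b1 = ≤-by (# 1) 0≤1 (solve 0 (κ 2 :* κ 1 :- (κ 0 :+ κ 1) := κ 1) refl)
      go b1 b0 = ≤-by (# 1) 0≤1 (solve 0 (κ 2 :* κ 1 :- (κ 1 :+ κ 0) := κ 1) refl)
      go b1 b1 = ≤-reflexive (solve 0 (κ 1 :+ κ 1 := κ 2 :* κ 1) refl)

    ball≤ : ∀ G i q → 𝟙 (ball G i q) ≤ aw G i q
    ball≤ G i q = ≤-trans (go (Ȳ-bit G i (fst q)) (Ȳ-bit G i (snd q))) (≤-reflexive (sym (aw≡ G i q)))
      where
      go : ∀ {x y} (a : Bit x) (b : Bit y) → 𝟙 (bitᵇ a ∨ bitᵇ b) ≤ x + y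
      go b0 b0 = ≤-reflexive (solve 0 (κ 0 := κ 0 :+ κ 0) refl)
      go b0 b1 = ≤-reflexive (solve 0 (κ 1 := κ 0 :+ κ 1) refl)
      go b1 b0 = ≤-reflexive (solve 0 (κ 1 := κ 1 :+ κ 0) refl)
      go b1 b1 = ≤-by (# 1) 0≤1 (solve 0 (κ 1 :+ κ 1 :- κ 1 := κ 1) refl)

    Rb Db : Graph → Fin n → Graph → ℚ
    Rb G i E = ∑ Ps (λ q → 𝟙 (ball G i q) * Xq E G q)
    Db G i E = ∑ Ps (λ q → 𝟙 (bitᵇ (inc-bit q i)) * Xq E G q)

    Db≡ : ∀ {E G} → Ext E G → ∀ i → Db G i E ≡ D E i
    Db≡ {E} {G} e i = trans (∑-cong Ps (λ q → cong (_* Xq E G q) (𝟙-bitᵇ (inc-bit q i)))) (Xq-row e i)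

    C-lin : ∀ {E G} → Ext E G → ∀ i → ∑ Ps (λ q → aw G i q * Xq E G q) ≡ C E G i
    C-lin {E} {G} e i = trans (∑-cong Ps (λ q → sym (∑-*ʳ (Xq E G q) Vs _))) (trans (∑-swap Ps Vs _) (∑-cong Vs (λ l → trans (∑-cong Ps (λ q → Rq.*-assoc _ _ _)) (trans (∑-*ˡ (Ȳ G i l) Ps _) (cong (Ȳ G i l *_) (Xq-row e l))))))

    C≤2R : ∀ {E G} → Ext E G → ∀ i → C E G i ≤ # 2 * Rb G i E
    C≤2R {E} {G} e i = ≤-trans (≤-reflexive (sym (C-lin e i))) (≤-trans (∑-mono Ps (λ q → ≤-trans (*-monoʳ _ (0≤Xq (sub e) q) (ball≥ G i q)) (≤-reflexive (Rq.*-assoc _ _ _)))) (≤-reflexive (∑-*ˡ (# 2) Ps _)))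

    bool-ℕ : ∀ (b : P → Bool) {E G} → Ext E G → Σ ℕ λ x → ∑ Ps (λ q → 𝟙 (b q) * Xq E G q) ≡ # x
    bool-ℕ b {E} {G} e = countᵇ {NP n} (λ q → b q ∧ Xᵇ E G q) , sym (trans (#-countᵇ {NP n} _) (∑-cong Ps (λ q → trans (𝟙-∧ (b q) _) (cong (𝟙 (b q) *_) (sym (Xq-Xᵇ (sub e) q))))))

    module Expect {G : Graph} (m : ℕ) (e∅ : Ext ∅ G) (h∅ : Sized m ∅) (0<m : # 0 < # m) where
      open Walk m e∅ h∅ public

      lin-inc : ∀ {E} → Ext E G → ∀ i → lin (λ q → inc q i) E ≡ D E i
      lin-inc e i = Xq-row e i

      lin-aw : ∀ {E} → Ext E G → ∀ i → lin (aw G i) E ≡ C E G i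
      lin-aw e i = C-lin e i

      Xq∉ : ∀ {E q} → Ext E G → lookup G q ≡ false → Xq E G q ≡ # 0
      Xq∉ {E} {q} e g = trans (Xq-Xᵇ (sub e) q) (cong (λ b → 𝟙 (b ∧ not (lookup E q))) g)

      vol-m : # 2 * # m ≡ # n * # d
      vol-m = trans (sym h∅) vol∅

      -- A sum weighted by residual degrees is a sum over residual half-edges. The 2 m half-edges of
      -- `G` are treated one by one.
      incident : ∀ j → j ℕ.≤ m → (φ : Fin n → P → Graph → ℚ) (B : ℚ) →
        (∀ i q → lookup G q ≡ true → ex j (λ E → inc q i * (Xq E G q * φ i q E)) ≤ inc q i * B) →
        ex j (λ E → ∑ Vs (λ i → ∑ Ps (λ q → inc q i * (Xq E G q * φ i q E)))) ≤ # 2 * # m * B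
      incident j le φ B p₁ = ≤-trans (≤-reflexive (trans (ex-∑ j Vs _) (∑-cong Vs (λ i → ex-∑ j Ps _)))) (≤-trans (∑-mono Vs (λ i → ∑-mono Ps (λ q → each i q (lookup G q) refl)))
          (≤-reflexive (trans (∑-cong Vs (λ i → trans (∑-*ʳ B Ps _) (cong (_* B) (trans (sym (#-deg G i)) (trans (sym (row G i)) (reg e∅ i)))))) (trans (∑-const Vs (# d * B)) (trans (cong (λ k → # k * (# d * B)) (Lₚ.length-tabulate id)) (trans (sym (Rq.*-assoc _ _ _)) (cong (_* B) (sym vol-m))))))))
        where
        each : ∀ i q b → lookup G q ≡ b → ex j (λ E → inc q i * (Xq E G q * φ i q E)) ≤ inc q i * 𝟙 (lookup G q) * B
        each i q true g = ≤-trans (p₁ i q g) (≤-reflexive (trans (cong (_* B) (sym (Rq.*-identityʳ (inc q i)))) (cong (λ b → inc q i * 𝟙 b * B) (sym g))))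
        each i q false g = ≤-reflexive (trans (trans (ex-cong j le (λ E e h → trans (cong (λ x → inc q i * (x * φ i q E)) (Xq∉ e g)) (solve 2 (λ a b → a :* (κ 0 :* b) := κ 0) refl (inc q i) (φ i q E)))) (ex-const j (# 0) le))
           (sym (trans (cong (λ b → inc q i * 𝟙 b * B) g) (solve 2 (λ a b → a :* κ 0 :* b := κ 0) refl (inc q i) B))))

      D-split : ∀ {E} → Ext E G → ∀ i y → D E i * y ≡ ∑ Ps (λ q → inc q i * (Xq E G q * y))
      D-split {E} e i y = trans (cong (_* y) (sym (Xq-row e i))) (trans (sym (∑-*ʳ y Ps _)) (∑-cong Ps (λ q → Rq.*-assoc _ _ _)))

      z-lin : ∀ q E → lin (δ q) E ≡ Xq E G q
      z-lin q E = ∑-δ q (Xq E G)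

      variance : ∀ j → suc j ℕ.≤ m → (a : Fin n → P → ℚ) (A₀ : ℚ) → (∀ i q → # 0 ≤ a i q) → (∀ i q → a i q ≤ # 2) → (∀ i → lin (a i) ∅ ≡ A₀) → A₀ ≤ # m →
        ex j (λ E → ∑ Vs (λ i → D E i * ((lin (a i) E - A₀ * p (m ℕ.∸ j)) * (lin (a i) E - A₀ * p (m ℕ.∸ j))))) ≤ # 2 * # m * (# 8 * (A₀ * (p (m ℕ.∸ j) * p (m ℕ.∸ j))) + # 8 * p (m ℕ.∸ j))
      variance j le a A₀ 0≤a a≤2 a∅ A≤m = ≤-trans (≤-reflexive (ex-cong j (ℕₚ.<⇒≤ le) (λ E e h → ∑-cong Vs (λ i → D-split e i _)))) (incident j (ℕₚ.<⇒≤ le) _ _ (λ i q g →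
          ≤-trans (≤-reflexive (ex-* j (inc q i) _)) (*-monoˡ _ (0≤inc q i) (≤-trans (≤-reflexive (ex-cong₀ j (λ E → cong₂ (λ x A₁ → x * ((lin (a i) E - A₁ * p (m ℕ.∸ j)) * (lin (a i) E - A₁ * p (m ℕ.∸ j)))) (sym (z-lin q E)) (sym (a∅ i)))))
            (≤-trans (SecondMoment.second-moment 0<m (a i) (0≤a i) (a≤2 i) q g j le (≤-trans (≤-reflexive (a∅ i)) A≤m)) (≤-reflexive (cong (λ A₁ → # 8 * (A₁ * (p (m ℕ.∸ j) * p (m ℕ.∸ j))) + # 8 * p (m ℕ.∸ j)) (a∅ i))))))))

      -- The subtracted 2 is the contribution to C of the very edge at i on which one conditions, by
      -- `aw-incident`. The rest involves a second edge still to be added, hence the factor p².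
      excess : ∀ j → j ℕ.≤ m → ex j (λ E → ∑ Vs (λ i → D E i * (C E G i - # 2))) ≤ # 2 * # m * (p (m ℕ.∸ j) * p (m ℕ.∸ j) * deg⁺)
      excess j le = ≤-trans (≤-reflexive (ex-cong j le (λ E e h → ∑-cong Vs (λ i → D-split e i _)))) (incident j le _ _ (λ i q g → each i q g (bit-cases (inc-bit q i))))
        where
        B₀ = p (m ℕ.∸ j) * p (m ℕ.∸ j) * deg⁺
        each : ∀ i q → lookup G q ≡ true → inc q i ≡ # 0 ⊎ inc q i ≡ # 1 → ex j (λ E → inc q i * (Xq E G q * (C E G i - # 2))) ≤ inc q i * B₀
        each i q g (inj₁ o) = ≤-trans (≤-reflexive (trans (ex-* j (inc q i) _) (trans (cong (_* ex j (λ E → Xq E G q * (C E G i - # 2))) o) (Rq.zeroˡ _)))) (≤-reflexive (sym (trans (cong (_* B₀) o) (Rq.zeroˡ B₀))))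
        each i q g (inj₂ o) = ≤-trans (≤-reflexive (ex-* j (inc q i) _)) (*-monoˡ _ (0≤inc q i) (≤-trans (≤-reflexive (ex-cong j le (λ E e h → cong₂ (λ x y → x * y) (sym (z-lin q E)) (cong₂ _-_ (sym (lin-aw e i)) (sym (aw-incident G i q g o))))))
            (≤-trans (SecondMoment.first-moment 0<m (aw G i) (0≤aw G i) (aw≤2 G i) q g j le) (*-monoˡ _ (0≤sq _) Ã≤))))
          where
          Ã≤ : SecondMoment.Ã 0<m (aw G i) (0≤aw G i) (aw≤2 G i) q g ≤ deg⁺
          Ã≤ = ≤-trans (≤-by (aw G i q) (0≤aw G i q) (trans (cong (_- SecondMoment.Ã 0<m (aw G i) (0≤aw G i) (aw≤2 G i) q g) (SecondMoment.lin∅ 0<m (aw G i) (0≤aw G i) (aw≤2 G i) q g)) (solve 2 (λ x y → x :+ y :- x := y) refl _ _))) (≤-reflexive (trans (lin-aw e∅ i) (C∅ (reg e∅) i)))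

      falling : ∀ j → j ℕ.≤ m → (b : P → Bool) (k : ℕ) (A₀ : ℚ) → lin (λ q → 𝟙 (b q)) ∅ ≤ A₀ → ex j (λ E → fall (lin (λ q → 𝟙 (b q)) E) k) ≤ (p (m ℕ.∸ j) * A₀) ^ k
      falling j le b k A₀ A≤ = ≤-trans (ex-hom-≤ 0<m {k} (fall-hom b k) (λ E e → subst (λ x → # 0 ≤ fall x k) (sym (proj₂ (lin-ℕ b e))) (0≤fall k _)) j le)
        (≤-trans (*-monoˡ _ (0≤^ k (0≤p _)) (≤-trans (≤-trans (≤-reflexive (cong (λ x → fall x k) eq)) (≤-trans (fall≤^ k _) (≤-reflexive (cong (_^ k) (sym eq))))) (^-mono k))) (≤-reflexive (sym (*-^ _ A₀ k))))
        where
        eq = proj₂ (lin-ℕ b e∅)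
        L₀ = lin (λ q → 𝟙 (b q)) ∅
        0≤L₀ : # 0 ≤ L₀
        0≤L₀ = subst (# 0 ≤_) (sym eq) (0≤# _)
        ^-mono : ∀ k → L₀ ^ k ≤ A₀ ^ k
        ^-mono zero = ≤-refl
        ^-mono (suc k) = *-mono 0≤L₀ (0≤^ k (≤-trans 0≤L₀ A≤)) A≤ (^-mono k)

      Rb∅ : ∀ i → Rb G i ∅ ≤ deg⁺
      Rb∅ i = ≤-trans (∑-mono Ps (λ q → *-monoʳ _ (0≤Xq (sub e∅) q) (ball≤ G i q))) (≤-reflexive (trans (lin-aw e∅ i) (C∅ (reg e∅) i)))

      ex-Rb : ∀ j → j ℕ.≤ m → ∀ i k → ex j (λ E → fall (Rb G i E) k) ≤ (p (m ℕ.∸ j) * deg⁺) ^ k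
      ex-Rb j le i k = falling j le (ball G i) k deg⁺ (Rb∅ i)

      ex-Db : ∀ j → j ℕ.≤ m → ∀ i k → ex j (λ E → fall (Db G i E) k) ≤ (p (m ℕ.∸ j) * # d) ^ k
      ex-Db j le i k = falling j le (λ q → bitᵇ (inc-bit q i)) k (# d) (≤-reflexive (trans (Db≡ e∅ i) (D∅ i)))

    -- Bounds for a single step in the three regimes

    Bound-by : Graph → (Graph → ℚ) → Set
    Bound-by E ψ = # 4 * χ E ≤ vol E * vol E * (N E * ∑ (𝓗 E) (λ G → # 1 + ψ G))

    from-N : ∀ {E} (ψ : Graph → ℚ) {v} → (∀ G → Ext E G → v ≤ # 1 + ψ G) → # 4 * χ E ≤ vol E * vol E * (N E * (v * N E)) → Bound-by E ψ
    from-N {E} ψ {v} p q = ≤-trans q (*-monoˡ _ (0≤sq (vol E)) (*-monoˡ _ (0≤N E) (≤-trans (≤-reflexive (sym (N-* E v))) (∑𝓗-mono E p))))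

    bit-nat : ∀ {x} → Bit x → IsNat x
    bit-nat b0 = 0 , refl
    bit-nat b1 = 1 , refl

    opaque
      D-nat : ∀ {E G} → Ext E G → ∀ i → IsNat (D E i)
      D-nat {E} e i = resid n d E i , sym (D-resid e i)

      C-nat : ∀ {E G} → Ext E G → ∀ i → IsNat (C E G i)
      C-nat {E} {G} e i = nat-∑ Vs (λ l → nat-* (bit-nat (Ȳ-bit G i l)) (D-nat e l))

    -- Weights are natural numbers, so the inverse of each is at most 1, also for weight 0; moreover
    -- `Fq E q ≤ N E`.
    χ-trivial : ∀ {E G₀} → Ext E G₀ → # 4 * χ E ≤ vol E * vol E * (N E * (vol E * N E))
    χ-trivial {E} e₀ = ≤-trans (*-monoˡ (# 4) (0≤# 4) (*-monoˡ _ (0≤Wt e₀) (≤-trans (∑-mono Ps term) (≤-reflexive (∑-*ʳ (N E) Ps _)))))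
        (≤-trans (≤-reflexive (trans (solve 3 (λ w f n → κ 4 :* (w :* (f :* n)) := (κ 2 :* w) :* ((κ 2 :* f) :* n)) refl (Wt E) (∑ Ps (Fq E)) (N E)) (cong (λ z → # 2 * Wt E * (z * N E)) (∑Fq E))))
        (≤-trans (*-monoʳ _ (0≤* (0≤* (0≤vol e₀) (0≤N E)) (0≤N E)) (Wt≤ e₀)) (≤-reflexive (solve 2 (λ v n → v :* v :* (v :* n :* n) := v :* v :* (n :* (v :* n))) refl (vol E) (N E)))))
      where
      Fq≤N : ∀ q → Fq E q ≤ N E
      Fq≤N q = ∑𝓗-mono E (λ G e → subst (_≤ # 1) (sym (Xq-Xᵇ (sub e) q)) (bit-≤1 (𝟙-bit (Xᵇ E G q))))
      inv-nat : ∀ k → inv (# k) ≤ # 1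
      inv-nat zero = ≤-trans (≤-reflexive inv-0) 0≤1
      inv-nat (suc k) = *-cancelˡ (# (suc k)) (0<#suc k) (≤-trans (≤-reflexive (inv-pos-r (0<#suc k))) (≤-trans (#-mono (s≤s z≤n)) (≤-reflexive (sym (Rq.*-identityʳ _)))))
      term : ∀ q → Fq E q * Fq E q * inv (wt E q) ≤ Fq E q * N E
      term q = ≤-trans (*-monoˡ _ (0≤* (0≤Fq E q) (0≤Fq E q)) (subst (λ w → inv w ≤ # 1) (#weight e₀ q) (inv-nat (weight n d E q)))) (≤-trans (≤-reflexive (Rq.*-identityʳ _)) (*-monoˡ _ (0≤Fq E q) (Fq≤N q)))

    key-trivial : ∀ {E G₀} → Ext E G₀ → (ψ : Graph → ℚ) → (∀ G → Ext E G → vol E ≤ # 1 + ψ G) → Bound-by E ψ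
    key-trivial e₀ ψ p = from-N ψ p (χ-trivial e₀)

    D≤D² : ∀ {E G} → Ext E G → ∀ i → D E i ≤ D E i * D E i
    D≤D² e i = nat≤sq (D-nat e i)

    X≤D : ∀ {E G} → Ext E G → ∀ a b → X E G a b ≤ D E a
    X≤D {E} {G} e a b = subst (X E G a b ≤_) (X-row e a) (term≤∑ Vs (0≤X (sub e) a) (∈-allFin b))

    YD : Graph → Fin n → ℚ
    YD E i = ∑ Vs (λ l → Y E i l * D E l)

    XD : Graph → Graph → Fin n → ℚ
    XD E G i = ∑ Vs (λ l → X E G i l * D E l)

    C-split : ∀ E G i → C E G i ≡ D E i + YD E i + XD E G i
    C-split E G i = trans (∑-cong Vs (λ l → solve 4 (λ y e x d → (y :+ x) :* d := x :* d :+ e :* d :+ (y :- e) :* d) refl (Y G i l) (Y E i l) (δ i l) (D E l))) (trans (∑-+ Vs _ _) (cong (_+ XD E G i) (trans (∑-+ Vs _ _) (cong (_+ YD E i) (∑-δ i (D E))))))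

    0≤YD : ∀ {E G} → Ext E G → ∀ i → # 0 ≤ YD E i
    0≤YD {E} e i = ∑-nonneg Vs (λ l → 0≤* (0≤Y E i l) (0≤D e l))

    D≤XD : ∀ {E G} → Ext E G → ∀ i → D E i ≤ XD E G i
    D≤XD {E} {G} e i = ≤-trans (≤-reflexive (sym (X-row e i))) (∑-mono Vs (λ l → ≤-trans (≤-reflexive (sym (bit-sq (X-bit (sub e) i l)))) (*-monoˡ _ (0≤X (sub e) i l) (≤-trans (≤-reflexive (X-sym E G i l)) (X≤D e l i)))))

    2D≤C : ∀ {E G} → Ext E G → ∀ i → # 2 * D E i ≤ C E G i
    2D≤C {E} {G} e i = ≤-trans (≤-by (YD E i + (XD E G i - D E i)) (0≤+ (0≤YD e i) (≤⇒0≤- (D≤XD e i))) (solve 3 (λ d y x → d :+ y :+ x :- κ 2 :* d := y :+ (x :- d)) refl (D E i) (YD E i) (XD E G i))) (≤-reflexive (sym (C-split E G i)))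

    -- It vanishes when all vertices are calm, has nonnegative terms because C ≥ 2 at a vertex of
    -- positive residual degree, and by integrality is at least 1 as soon as one vertex is not calm.
    exc : Graph → Graph → ℚ
    exc E G = ∑ Vs (λ i → D E i * (C E G i - # 2))

    0≤exc : ∀ {E G} → Ext E G → ∀ i → # 0 ≤ D E i * (C E G i - # 2)
    0≤exc {E} {G} e i = ≤-trans (0≤* (0≤# 2) (≤⇒0≤- (D≤D² e i))) (≤-by (D E i * (C E G i - # 2 * D E i)) (0≤* (0≤D e i) (≤⇒0≤- (2D≤C e i))) (solve 2 (λ d c → d :* (c :- κ 2) :- κ 2 :* (d :* d :- d) := d :* (c :- κ 2 :* d)) refl (D E i) (C E G i)))

    -- Phrased by `E` alone, although `calm?` decides it through a completion: one completion with
    -- `exc` below 1 settles the structure of all of them.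
    Calm : Graph → Fin n → Set
    Calm E i = D E i ≡ # 0 ⊎ (D E i ≡ # 1 × YD E i ≡ # 0)

    calm? : ∀ {E G} → Ext E G → (∀ i → Calm E i) ⊎ # 1 ≤ exc E G
    calm? {E} {G} e = conv (decide-all per)
      where
      per : ∀ i → Calm E i ⊎ # 1 ≤ D E i * (C E G i - # 2)
      per i = first (nat-≤⊎> (D-nat e i) 0)
        where
        second : # 1 ≤ D E i → C E G i ≤ # 2 ⊎ # 3 ≤ C E G i → Calm E i ⊎ # 1 ≤ D E i * (C E G i - # 2)
        second 1≤D (inj₂ 3≤C) = inj₂ (≤-trans (≤-reflexive (solve 0 (κ 1 := κ 1 :* κ 1) refl)) (*-mono 0≤1 (≤-trans 0≤1 1≤C-2) 1≤D 1≤C-2))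
          where
          1≤C-2 : # 1 ≤ C E G i - # 2
          1≤C-2 = ≤-by (C E G i - # 3) (≤⇒0≤- 3≤C) (solve 1 (λ c → c :- κ 2 :- κ 1 := c :- κ 3) refl (C E G i))
        second 1≤D (inj₁ C≤2) = inj₁ (inj₂ (D1 , Y0))
          where
          D1 : D E i ≡ # 1
          D1 = ≤-antisym (*-cancelˡ (# 2) (0<#suc 1) (≤-trans (2D≤C e i) (≤-trans C≤2 (≤-reflexive (sym (Rq.*-identityʳ _)))))) 1≤D
          Y0 : YD E i ≡ # 0
          Y0 = ≤-antisym (≤-by ((# 2 - C E G i) + (XD E G i - D E i)) (0≤+ (≤⇒0≤- C≤2) (≤⇒0≤- (D≤XD e i))) (trans (cong (λ z → # 0 - z) (solve 3 (λ d y x → y := (d :+ y :+ x) :- d :- x) refl (D E i) (YD E i) (XD E G i))) (trans (cong₂ (λ u v → # 0 - (u - v - XD E G i)) (sym (C-split E G i)) D1)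
               (trans (solve 2 (λ c x → κ 0 :- (c :- κ 1 :- x) := (κ 2 :- c) :+ (x :- κ 1)) refl (C E G i) (XD E G i)) (cong (λ z → (# 2 - C E G i) + (XD E G i - z)) (sym D1)))))) (0≤YD e i)
        first : D E i ≤ # 0 ⊎ # 1 ≤ D E i → Calm E i ⊎ # 1 ≤ D E i * (C E G i - # 2)
        first (inj₁ p) = inj₁ (inj₁ (≤-antisym p (0≤D e i)))
        first (inj₂ 1≤D) = second 1≤D (nat-≤⊎> (C-nat e i) 2)
      conv : (∀ i → Calm E i) ⊎ Σ (Fin n) (λ i → # 1 ≤ D E i * (C E G i - # 2)) → (∀ i → Calm E i) ⊎ # 1 ≤ exc E G
      conv (inj₁ h) = inj₁ h
      conv (inj₂ (i , p)) = inj₂ (≤-trans p (term≤∑ Vs (0≤exc e) (∈-allFin i)))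

    -- In a calm state the completions are exactly the perfect matchings of the active vertices.
    module CalmState {E : Graph} (calm : ∀ i → Calm E i) where

      active : ∀ {G} → Ext E G → ∀ {i k} → X E G i k ≡ # 1 → D E i ≡ # 1
      active {G} e {i} {k} o = by (calm i)
        where
        by : Calm E i → D E i ≡ # 1
        by (inj₂ (p , _)) = p
        by (inj₁ z) = ⊥-elim (1≰0 (≤-trans (≤-reflexive (sym o)) (≤-trans (X≤D e i k) (≤-reflexive z))))

      XD≡ : ∀ {G} → Ext E G → ∀ i → XD E G i ≡ D E i
      XD≡ {G} e i = trans (∑-cong Vs (λ l → lem l (bit-cases (X-bit (sub e) i l)))) (X-row e i)
        where
        lem : ∀ l → X E G i l ≡ # 0 ⊎ X E G i l ≡ # 1 → X E G i l * D E l ≡ X E G i l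
        lem l (inj₁ z) = trans (0*ˡ _ z) (sym z)
        lem l (inj₂ o) = trans (cong (X E G i l *_) (active e (trans (X-sym E G l i) o))) (Rq.*-identityʳ _)

      C≡2 : ∀ {G} → Ext E G → ∀ {i} → D E i ≡ # 1 → C E G i ≡ # 2
      C≡2 {G} e {i} o = by (calm i)
        where
        by : Calm E i → C E G i ≡ # 2
        by (inj₁ z) = ⊥-elim (pos⇒≢0 0<1 (trans (sym o) z))
        by (inj₂ (_ , y)) = trans (C-split E G i) (trans (cong₂ _+_ (cong₂ _+_ o y) (trans (XD≡ e i) o)) (solve 0 (κ 1 :+ κ 0 :+ κ 1 := κ 2) refl))

      once : ∀ {G} → Ext E G → ∀ {k a b} → X E G k a ≡ # 1 → X E G k b ≡ # 1 → a ≡ b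
      once {G} e {k} {a} {b} p q = by (a F.≟ b)
        where
        by : Dec (a ≡ b) → a ≡ b
        by (yes w) = w
        by (no ne) = ⊥-elim (2≰1 (≤-trans (≤-reflexive (sym (trans (cong₂ _+_ p q) 2≡1+1))) (≤-trans (two-terms ne (X E G k) (0≤X (sub e) k)) (≤-reflexive (trans (X-row e k) (active e p))))))

      module _ {i j : Fin n} (i≢j : i ≢ j) (free : Y E i j ≡ # 0) (Dᵢ : D E i ≡ # 1) (Dⱼ : D E j ≡ # 1) where

        W₁≡2 : ∀ {G} → Ext E G → X E G i j ≡ # 1 → W₁ E G i j ≡ # 2
        W₁≡2 {G} e o = ≤-antisym (≤-trans (W₁≤C e i j) (≤-reflexive (C≡2 e Dᵢ))) (≤-trans (≤-trans (≤-reflexive (sym 2≡1+1)) (+-mono (rowᵢ) (rowⱼ))) (two-terms i≢j _ (λ k → ∑-nonneg Vs (λ l → 0≤* (0≤Ȳ G i k) (0≤* (0≤Ȳ G j l) (0≤X (sub e) k l))))))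
          where
          Ȳij : Ȳ G i j ≡ # 1
          Ȳij = trans (sym (X-free G free i≢j)) o
          rowᵢ : # 1 ≤ ∑ Vs (λ l → Ȳ G i i * (Ȳ G j l * X E G i l))
          rowᵢ = ≤-trans (≤-reflexive (sym (trans (cong₂ _*_ (Ȳ-diag G i) (cong₂ _*_ (Ȳ-diag G j) o)) (solve 0 (κ 1 :* (κ 1 :* κ 1) := κ 1) refl)))) (term≤∑ Vs (λ l → 0≤* (0≤Ȳ G i i) (0≤* (0≤Ȳ G j l) (0≤X (sub e) i l))) (∈-allFin j))
          rowⱼ : # 1 ≤ ∑ Vs (λ l → Ȳ G i j * (Ȳ G j l * X E G j l))
          rowⱼ = ≤-trans (≤-reflexive (sym (trans (cong₂ _*_ Ȳij (cong₂ _*_ (trans (Ȳ-sym G j i) Ȳij) (trans (X-sym E G j i) o))) (solve 0 (κ 1 :* (κ 1 :* κ 1) := κ 1) refl)))) (term≤∑ Vs (λ l → 0≤* (0≤Ȳ G i j) (0≤* (0≤Ȳ G j l) (0≤X (sub e) j l))) (∈-allFin i))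

        W₂≡0 : ∀ {G} → Ext E G → X E G i j ≡ # 0 → W₂ E G i j ≡ # 0
        W₂≡0 {G} e z = trans (∑∑-cong (λ k l → term k l (bit-cases (X-bit (sub e) i k)) (bit-cases (X-bit (sub e) j l)) (bit-cases (Ȳ-bit G k l)))) (trans (∑-cong Vs (λ _ → ∑-0 Vs)) (∑-0 Vs))
          where
          term : ∀ k l → X E G i k ≡ # 0 ⊎ X E G i k ≡ # 1 → X E G j l ≡ # 0 ⊎ X E G j l ≡ # 1 → Ȳ G k l ≡ # 0 ⊎ Ȳ G k l ≡ # 1 → X E G i k * (X E G j l * Ȳ G k l) ≡ # 0
          term k l (inj₁ u) _ _ = 0*ˡ _ u
          term k l (inj₂ _) (inj₁ v) _ = 0*ʳ _ (0*ˡ _ v)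
          term k l (inj₂ _) (inj₂ _) (inj₁ w) = 0*ʳ _ (0*ʳ _ w)
          term k l (inj₂ u) (inj₂ v) (inj₂ w) = ⊥-elim (absurd (k F.≟ l))
            where
            Xki : X E G k i ≡ # 1
            Xki = trans (X-sym E G k i) u
            Dl : D E l ≡ # 1
            Dl = active e (trans (X-sym E G l j) v)
            absurd : Dec (k ≡ l) → ⊥
            absurd (yes refl) = i≢j (once e Xki (trans (X-sym E G k j) v))
            absurd (no ne) = pos⇒≢0 0<1 (trans (sym (trans (X-sym E G i j) (subst (λ b → X E G j b ≡ # 1) (sym (once e Xki Xkl)) v))) z)
              where
              YE0 : Y E k l ≡ # 0
              YE0 = by (calm k) (bit-cases (Y-bit E k l))
                where
                by : Calm E k → Y E k l ≡ # 0 ⊎ Y E k l ≡ # 1 → Y E k l ≡ # 0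
                by _ (inj₁ y) = y
                by (inj₁ y) (inj₂ _) = ⊥-elim (pos⇒≢0 0<1 (trans (sym (active e Xki)) y))
                by (inj₂ (_ , y)) (inj₂ o) = ⊥-elim (1≰0 (≤-trans (≤-reflexive (sym (trans (cong₂ _*_ o Dl) (Rq.*-identityˡ _)))) (≤-trans (term≤∑ Vs (λ b → 0≤* (0≤Y E k b) (0≤D e b)) (∈-allFin l)) (≤-reflexive y))))
              Xkl : X E G k l ≡ # 1
              Xkl = trans (X-free G YE0 ne) w

        -- Since C = 2 at both ends, `W₁` = 2 when ij is in `G` and `W₂` = 0 otherwise, the
        -- switching identity becomes F (vol - 2) = N - F.
        F-calm : F E i j * (vol E - # 1) ≡ N E
        F-calm = trans (solve 2 (λ f v → f :* (v :- κ 1) := f :* (v :- κ 2) :+ f) refl (F E i j) (vol E)) (trans (cong (_+ F E i j) (trans (sym lhs) (trans (switching E i≢j free) rhs))) (solve 2 (λ n f → n :- f :+ f := n) refl (N E) (F E i j)))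
          where
          lhs : ∑ (𝓗 E) (λ G → X E G i j * (vol E - C E G i - C E G j + W₁ E G i j)) ≡ F E i j * (vol E - # 2)
          lhs = trans (∑𝓗-cong E (λ G e → by G e (bit-cases (X-bit (sub e) i j)))) (∑-*ʳ _ (𝓗 E) _)
            where
            by : ∀ G → Ext E G → X E G i j ≡ # 0 ⊎ X E G i j ≡ # 1 → X E G i j * (vol E - C E G i - C E G j + W₁ E G i j) ≡ X E G i j * (vol E - # 2)
            by G e (inj₁ u) = trans (0*ˡ _ u) (sym (0*ˡ _ u))
            by G e (inj₂ u) = cong (X E G i j *_) (trans (cong₂ (λ a b → vol E - a - b + W₁ E G i j) (C≡2 e Dᵢ) (C≡2 e Dⱼ)) (trans (cong (vol E - # 2 - # 2 +_) (W₁≡2 e u)) (solve 1 (λ v → v :- κ 2 :- κ 2 :+ κ 2 := v :- κ 2) refl (vol E))))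
          rhs : ∑ (𝓗 E) (λ G → (# 1 - X E G i j) * (D E i * D E j - W₂ E G i j)) ≡ N E - F E i j
          rhs = trans (∑𝓗-cong E (λ G e → by G e (bit-cases (X-bit (sub e) i j)))) (∑-- (𝓗 E) _ _)
            where
            by : ∀ G → Ext E G → X E G i j ≡ # 0 ⊎ X E G i j ≡ # 1 → (# 1 - X E G i j) * (D E i * D E j - W₂ E G i j) ≡ # 1 - X E G i j
            by G e (inj₂ u) = trans (0*ˡ _ (1-1 u)) (sym (1-1 u))
            by G e (inj₁ u) = trans (cong ((# 1 - X E G i j) *_) (trans (cong₂ (λ a b → a * b - W₂ E G i j) Dᵢ Dⱼ) (trans (cong (λ w → # 1 * # 1 - w) (W₂≡0 e u)) (solve 0 (κ 1 :* κ 1 :- κ 0 := κ 1) refl)))) (Rq.*-identityʳ _)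

      Fq-calm : ∀ {G₀} → Ext E G₀ → ∀ q → Fq E q * (vol E - # 1) ≡ N E * wt E q
      Fq-calm e₀ q = go (wt E q ≟0) (bit-cases (𝟙-bit (lookup E q))) (calm (fst q)) (calm (snd q))
        where
        Goal = Fq E q * (vol E - # 1) ≡ N E * wt E q
        zeroCase : wt E q ≡ # 0 → Goal
        zeroCase w = trans (0*ˡ _ (wt0⇒Fq0 e₀ q w)) (sym (0*ʳ _ w))
        go : Dec (wt E q ≡ # 0) → 𝟙 (lookup E q) ≡ # 0 ⊎ 𝟙 (lookup E q) ≡ # 1 → Calm E (fst q) → Calm E (snd q) → Goal
        go (yes w) _ _ _ = zeroCase w
        go (no w) (inj₂ o) _ _ = ⊥-elim (w (0*ˡ _ (1-1 o)))
        go (no w) (inj₁ z) (inj₁ u) _ = ⊥-elim (w (0*ʳ _ (0*ˡ _ u)))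
        go (no w) (inj₁ z) (inj₂ _) (inj₁ v) = ⊥-elim (w (0*ʳ _ (0*ʳ _ v)))
        go (no w) (inj₁ z) (inj₂ (u , _)) (inj₂ (v , _)) = trans (cong (_* (vol E - # 1)) (Fq-F E q)) (trans (F-calm (fst≢snd q) (trans (Y-joins E (joins-ends q)) z) u v) (sym (trans (cong (N E *_) wt1) (Rq.*-identityʳ _))))
          where
          wt1 : wt E q ≡ # 1
          wt1 = trans (cong₂ (λ a b → (# 1 - a) * b) z (cong₂ _*_ u v)) (solve 0 ((κ 1 :- κ 0) :* (κ 1 :* κ 1) := κ 1) refl)

    key-calm : ∀ {E G₀} → Ext E G₀ → # 2 ≤ vol E → (∀ i → Calm E i) → # 4 * χ E ≤ vol E * vol E * (N E * (# 1 * N E))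
    key-calm {E} e₀ 2≤v calm = ≤-trans (χ-linear e₀ a) (≤-reflexive (trans (cong (λ y → vol E * vol E * (N E * N E) + # 2 * (vol E * vol E) * y) (trans (∑-cong Ps zero-term) (∑-0 Ps))) (solve 2 (λ v n → v :* v :* (n :* n) :+ κ 2 :* (v :* v) :* κ 0 := v :* v :* (n :* (κ 1 :* n))) refl (vol E) (N E))))
      where
      v1 = vol E - # 1
      0<v1 : # 0 < v1
      0<v1 = <-≤-trans 0<1 (≤-by (vol E - # 2) (≤⇒0≤- 2≤v) (solve 1 (λ v → v :- κ 1 :- κ 1 := v :- κ 2) refl (vol E)))
      a = N E * inv v1
      Fq≡ : ∀ q → Fq E q ≡ a * wt E q
      Fq≡ q = trans (sym (trans (cong (Fq E q *_) (inv-pos-r 0<v1)) (Rq.*-identityʳ _))) (trans (sym (Rq.*-assoc _ _ _)) (trans (cong (_* inv v1) (CalmState.Fq-calm calm e₀ q)) (solve 3 (λ n w i → n :* w :* i := n :* i :* w) refl (N E) (wt E q) (inv v1))))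
      zero-term : ∀ q → (Fq E q - a * wt E q) * (Fq E q - a * wt E q) * inv (wt E q) ≡ # 0
      zero-term q = trans (cong (λ y → (y - a * wt E q) * (y - a * wt E q) * inv (wt E q)) (Fq≡ q)) (solve 2 (λ x i → (x :- x) :* (x :- x) :* i := κ 0) refl (a * wt E q) (inv (wt E q)))

    -- Either `E` is calm and the step is exact, or every completion has `exc` at least 1 and the
    -- trivial bound is paid for.
    key₀ : ∀ {E G₀} → Ext E G₀ → # 2 ≤ vol E → Bound-by E (λ G → vol E * exc E G)
    key₀ {E} e₀ 2≤v = go (decide-any (𝓗 E) (λ m → calm? (𝓗⇒ m)))
      where
      0≤ψ : ∀ G → Ext E G → # 0 ≤ vol E * exc E G
      0≤ψ G e = 0≤* (0≤vol e) (∑-nonneg Vs (0≤exc e))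
      go : (Σ Graph λ G → G ∈ 𝓗 E × (∀ i → Calm E i)) ⊎ (∀ {G} → G ∈ 𝓗 E → # 1 ≤ exc E G) → Bound-by E (λ G → vol E * exc E G)
      go (inj₁ (_ , _ , calm)) = from-N _ (λ G e → ≤-by (vol E * exc E G) (0≤ψ G e) (solve 1 (λ y → κ 1 :+ y :- κ 1 := y) refl (vol E * exc E G))) (key-calm e₀ 2≤v calm)
      go (inj₂ h) = key-trivial e₀ _ (λ G e → ≤-by (# 1 + vol E * (exc E G - # 1)) (0≤+ 0≤1 (0≤* (0≤vol e) (≤⇒0≤- (h (⇒𝓗 e))))) (solve 2 (λ v y → κ 1 :+ v :* y :- v := κ 1 :+ v :* (y :- κ 1)) refl (vol E) (exc E G)))

    DC² : Graph → Graph → ℚ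
    DC² E G = ∑ Vs (λ i → D E i * (C E G i * C E G i))

    D⁸ : Graph → Graph → ℚ
    D⁸ E G = ∑ Vs (λ i → c₇ * D E i + # 256 * fall (Db G i E) 8)

    bad : ℚ → Graph → Graph → ℚ
    bad τ E G = ∑ Vs (λ i → (# 160 * τ) ^ 8 * fall (Rb G i E) 8 + # 256 * (# 40 * τ) ^ 4 * fall (Db G i E) 8)

    -- The first part bounds `Ψ` with μ = ν = 0, where h ≤ 3 C gives 189 = 21 · 9. The second part
    -- pays the trivial bound, which is t, in states where the neighbourhoods are too large.
    ψA : ℚ → Graph → Graph → ℚ
    ψA t E G = # 24 * (inv t * inv t * inv t) * (# 189 * DC² E G + # 32 * D⁸ E G) + t * bad (inv t) E G

    ψB : ℚ → ℚ → ℚ → Graph → Graph → ℚ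
    ψB t μ ν E G = # 24 * (inv t * inv t * inv t) * (# 21 * ∑ Vs (λ i → D E i * (# 3 * ((C E G i - μ) * (C E G i - μ) + η * C E G i * (η * C E G i) + # 2 * D E i * (# 2 * D E i))))
        + # 32 * ∑∑ (λ i j → X E G i j * ((D E i * D E j - ν) * (D E i * D E j - ν))) + # 8 * (η * ν * (η * ν)) * t)
      where η = # 20 * deg⁺ * inv t

    0≤fall-D : ∀ {E G} → Ext E G → ∀ i → # 0 ≤ fall (Db G i E) 8
    0≤fall-D e i = subst (λ x → # 0 ≤ fall x 8) (sym (proj₂ (bool-ℕ (λ q → bitᵇ (inc-bit q i)) e))) (0≤fall 8 _)

    0≤fall-R : ∀ {E G} → Ext E G → ∀ i → # 0 ≤ fall (Rb G i E) 8
    0≤fall-R {E} {G} e i = subst (λ x → # 0 ≤ fall x 8) (sym (proj₂ (bool-ℕ (ball G i) e))) (0≤fall 8 _)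

    D⁵≤ : ∀ {E G} → Ext E G → ∀ i → D E i * (D E i * D E i * (D E i * D E i)) ≤ c₇ * D E i + # 256 * fall (Db G i E) 8
    D⁵≤ {E} {G} e i = ≤-trans (≤-reflexive (trans (cong (λ x → x * (x * x * (x * x))) u) (solve 1 (λ x → x :* (x :* x :* (x :* x)) := x :* (x :* (x :* (x :* (x :* κ 1))))) refl (# k)))) (≤-trans (^-up k 3 4) (≤-trans (pow8≤ k) (≤-reflexive (cong₂ (λ a b → c₇ * a + # 256 * fall b 8) (sym u) (trans (sym u) (sym (Db≡ e i)))))))
      where
      k = proj₁ (D-nat e i)
      u : D E i ≡ # k
      u = proj₂ (D-nat e i)

    module SmallState {E G₀ : Graph} (e₀ : Ext E G₀) (large : # 10240 ≤ vol E) where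

      -- The choice makes 20 κ' equal to t; one half of κ' serves the part of C determined by `E`,
      -- the other half the residual neighbours. As 10240 = 40 · 256, v is at least 256, so a
      -- residual degree with square at least v is at least 16 and its powers are controlled by
      -- falling factorials.
      t τ v κ' : ℚ
      t = vol E
      τ = inv t
      v = t * inv (# 40)
      κ' = # 2 * v

      0<t : # 0 < t
      0<t = <-≤-trans (0<#suc 10239) large

      tτ : t * τ ≡ # 1
      tτ = inv-pos-r 0<t

      40v : # 40 * v ≡ t
      40v = trans (solve 2 (λ t i → κ 40 :* (t :* i) := (κ 40 :* i) :* t) refl t (inv (# 40))) (trans (cong (_* t) (inv-pos-r (0<#suc 39))) (Rq.*-identityˡ t))

      256≤v : # 256 ≤ v
      256≤v = *-cancelˡ (# 40) (0<#suc 39) (≤-trans (≤-trans (≤-reflexive (sym (#-* 40 256))) large) (≤-reflexive (sym 40v)))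

      0≤v : # 0 ≤ v
      0≤v = ≤-trans (0≤# 256) 256≤v

      OK : Graph → Fin n → Set
      OK G i = (C E G i ≤ v) × (D E i * D E i ≤ v)

      -- From one completion to all: `D E i + YD E i` depends on `E` only. In any other completion,
      -- `XD` is a sum of `D E i` residual degrees, each at most `v` divided by `D E i`, because all
      -- products of two residual degrees are at most `v`.
      good : ∀ {G} → Ext E G → (∀ i → OK G i) → Good κ' E
      good {G} e ok = mkGood CC DD
        where
        DD' : ∀ {G'} → Ext E G' → ∀ i j → D E i * D E j ≤ v
        DD' e' i j = *-cancelˡ (# 2) (0<#suc 1) (≤-trans (≤-by ((D E i - D E j) * (D E i - D E j)) (0≤sq (D E i - D E j)) (solve 2 (λ a b → a :* a :+ b :* b :- κ 2 :* (a :* b) := (a :- b) :* (a :- b)) refl (D E i) (D E j))) (≤-trans (+-mono (proj₂ (ok i)) (proj₂ (ok j))) (≤-reflexive (solve 1 (λ v → v :+ v := κ 2 :* v) refl v))))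
        DD : ∀ {G'} → Ext E G' → ∀ i j → D E i * D E j ≤ κ'
        DD e' i j = ≤-trans (DD' e' i j) (≤-by v 0≤v (solve 1 (λ v → κ 2 :* v :- v := v) refl v))
        XD≤ : ∀ {G'} → Ext E G' → ∀ i → XD E G' i ≤ v
        XD≤ {G'} e' i with D E i ≟0
        ... | yes z = ≤-trans (≤-reflexive (trans (∑-cong Vs (λ l → 0*ˡ _ (≤-antisym (≤-trans (X≤D e' i l) (≤-reflexive z)) (0≤X (sub e') i l)))) (∑-0 Vs))) 0≤v
        ... | no nz = *-cancelˡ (D E i) (mkPos (0≤D e' i) nz) (≤-trans (≤-reflexive (sym (∑-*ˡ (D E i) Vs _))) (≤-trans (∑-mono Vs (λ l → ≤-trans (≤-reflexive (solve 3 (λ d x y → d :* (x :* y) := x :* (d :* y)) refl (D E i) (X E G' i l) (D E l))) (*-monoˡ _ (0≤X (sub e') i l) (DD' e' i l)))) (≤-reflexive (trans (∑-*ʳ v Vs _) (cong (_* v) (X-row e' i))))))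
        CC : ∀ {G'} → Ext E G' → ∀ i → C E G' i ≤ κ'
        CC {G'} e' i = ≤-trans (≤-reflexive (C-split E G' i)) (≤-by ((v - (D E i + YD E i)) + (v - XD E G' i)) (0≤+ (≤⇒0≤- base) (≤⇒0≤- (XD≤ e' i))) (solve 4 (λ v d y x → κ 2 :* v :- (d :+ y :+ x) := (v :- (d :+ y)) :+ (v :- x)) refl v (D E i) (YD E i) (XD E G' i)))
          where
          base : D E i + YD E i ≤ v
          base = ≤-trans (≤-by (XD E G i) (≤-trans (0≤D e i) (D≤XD e i)) (trans (cong (_- (D E i + YD E i)) (C-split E G i)) (solve 2 (λ a x → a :+ x :- a := x) refl (D E i + YD E i) (XD E G i)))) (proj₁ (ok i))

      -- A vertex violating OK makes one of the two eighth factorial moments large, so the sum is at least 1 on bad states.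
      bad-term : Graph → Fin n → ℚ
      bad-term G i = (# 160 * τ) ^ 8 * fall (Rb G i E) 8 + # 256 * (# 40 * τ) ^ 4 * fall (Db G i E) 8

      0≤τ : # 0 ≤ τ
      0≤τ = 0≤inv (<⇒≤ 0<t)

      0≤α : # 0 ≤ (# 160 * τ) ^ 8
      0≤α = 0≤^ 8 (0≤* (0≤# 160) 0≤τ)

      0≤β : # 0 ≤ # 256 * (# 40 * τ) ^ 4
      0≤β = 0≤* (0≤# 256) (0≤^ 4 (0≤* (0≤# 40) 0≤τ))

      0≤bad-term : ∀ {G} → Ext E G → ∀ i → # 0 ≤ bad-term G i
      0≤bad-term e i = 0≤+ (0≤* 0≤α (0≤fall-R e i)) (0≤* 0≤β (0≤fall-D e i))

      40τv : # 40 * τ * v ≡ # 1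
      40τv = trans (solve 2 (λ u v → κ 40 :* u :* v := (κ 40 :* v) :* u) refl τ v) (trans (cong (_* τ) 40v) tτ)

      1^ : ∀ k → # 1 ^ k ≡ # 1
      1^ zero = refl
      1^ (suc k) = trans (Rq.*-identityˡ _) (1^ k)

      -- Because 40 τ v = 1, the inequality v ≤ 2 R reads 2 ≤ 160 τ R. The eighth power of 2 pays
      -- for the factor 256 in passing from R^8 to the falling factorial.
      R-large : ∀ {G} → Ext E G → ∀ i → v ≤ C E G i → # 1 ≤ (# 160 * τ) ^ 8 * fall (Rb G i E) 8
      R-large {G} e i p = *-cancelˡ (# 256) (0<#suc 255) (≤-trans (≤-trans (≤-reflexive (trans (Rq.*-identityʳ (# 256)) (trans (sym (Rq.*-identityʳ (# 256))) (cong₂ _*_ (sym 2^8) (sym (1^ 8)))))) (≤-trans (≤-reflexive (sym (*-^ (# 2) (# 1) 8))) (≤-trans (^-mono-≤ 8 (0≤* (0≤# 2) 0≤1) step) (≤-reflexive (*-^ (# 160 * τ) R 8)))))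
          (≤-trans (*-monoˡ _ 0≤α (fall8-large 16≤R)) (≤-reflexive (solve 2 (λ a f → a :* (κ 256 :* f) := κ 256 :* (a :* f)) refl ((# 160 * τ) ^ 8) (fall R 8)))))
        where
        R = Rb G i E
        v≤2R : v ≤ # 2 * R
        v≤2R = ≤-trans p (C≤2R e i)
        16≤R : # 16 ≤ R
        16≤R = *-cancelˡ (# 2) (0<#suc 1) (≤-trans (≤-trans (≤-reflexive (sym (#-* 2 16))) (#-mono (ℕₚ.≤ᵇ⇒≤ 32 256 tt))) (≤-trans 256≤v v≤2R))
        step : # 2 * # 1 ≤ # 160 * τ * R
        step = ≤-trans (≤-reflexive (cong (# 2 *_) (sym 40τv))) (≤-trans (*-monoˡ (# 2) (0≤# 2) (*-monoˡ _ (0≤* (0≤# 40) 0≤τ) v≤2R)) (≤-reflexive (solve 2 (λ u r → κ 2 :* (κ 40 :* u :* (κ 2 :* r)) := κ 160 :* u :* r) refl τ R)))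

      D-large : ∀ {G} → Ext E G → ∀ i → v ≤ D E i * D E i → # 1 ≤ # 256 * (# 40 * τ) ^ 4 * fall (Db G i E) 8
      D-large {G} e i p = ≤-trans (≤-trans (≤-reflexive (sym (1^ 4))) (≤-trans (^-mono-≤ 4 0≤1 (≤-trans (≤-reflexive (sym 40τv)) (*-monoˡ _ (0≤* (0≤# 40) 0≤τ) p))) (≤-reflexive (*-^ (# 40 * τ) (D E i * D E i) 4))))
          (≤-trans (*-monoˡ _ (0≤^ 4 (0≤* (0≤# 40) 0≤τ)) (≤-trans (≤-reflexive (solve 1 (λ x → x :* x :* (x :* x :* (x :* x :* (x :* x :* κ 1))) := x :* (x :* (x :* (x :* (x :* (x :* (x :* (x :* κ 1)))))))) refl (D E i))) (fall8-large 16≤D)))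
          (≤-reflexive (trans (solve 2 (λ a f → a :* (κ 256 :* f) := κ 256 :* a :* f) refl ((# 40 * τ) ^ 4) (fall (D E i) 8)) (cong (λ x → # 256 * (# 40 * τ) ^ 4 * fall x 8) (sym (Db≡ e i))))))
        where
        16≤D : # 16 ≤ D E i
        16≤D = by (nat-≤⊎> (D-nat e i) 15)
          where
          by : D E i ≤ # 15 ⊎ # 16 ≤ D E i → # 16 ≤ D E i
          by (inj₂ q) = q
          by (inj₁ q) = ⊥-elim (absurd (#-cancel-≤ (≤-trans 256≤v (≤-trans p (≤-trans (*-mono (0≤D e i) (0≤# 15) q q) (≤-reflexive (sym (#-* 15 15))))))))
            where
            absurd : ¬ (256 ℕ.≤ 225)
            absurd h = ℕₚ.<⇒≱ (ℕₚ.<ᵇ⇒< 225 256 tt) h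

      ok? : ∀ {G} → Ext E G → (∀ i → OK G i) ⊎ # 1 ≤ bad τ E G
      ok? {G} e = conv (decide-all per)
        where
        per : ∀ i → OK G i ⊎ # 1 ≤ bad-term G i
        per i = by (≤-total (C E G i) v) (≤-total (D E i * D E i) v)
          where
          by : C E G i ≤ v ⊎ v ≤ C E G i → D E i * D E i ≤ v ⊎ v ≤ D E i * D E i → OK G i ⊎ # 1 ≤ bad-term G i
          by (inj₁ a) (inj₁ b) = inj₁ (a , b)
          by (inj₂ a) _ = inj₂ (≤-trans (R-large e i a) (≤-by _ (0≤* 0≤β (0≤fall-D e i)) (solve 2 (λ a b → a :+ b :- a := b) refl _ _)))
          by (inj₁ _) (inj₂ b) = inj₂ (≤-trans (D-large e i b) (≤-by _ (0≤* 0≤α (0≤fall-R e i)) (solve 2 (λ a b → a :+ b :- b := a) refl _ _)))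
        conv : (∀ i → OK G i) ⊎ Σ (Fin n) (λ i → # 1 ≤ bad-term G i) → (∀ i → OK G i) ⊎ # 1 ≤ bad τ E G
        conv (inj₁ h) = inj₁ h
        conv (inj₂ (i , q)) = inj₂ (≤-trans q (term≤∑ Vs (0≤bad-term e) (∈-allFin i)))

      0≤bad : ∀ {G} → Ext E G → # 0 ≤ bad τ E G
      0≤bad e = ∑-nonneg Vs (0≤bad-term e)

      0≤core : ∀ {G} → Ext E G → # 0 ≤ # 189 * DC² E G + # 32 * D⁸ E G
      0≤core {G} e = 0≤+ (0≤* (0≤# 189) (∑-nonneg Vs (λ i → 0≤* (0≤D e i) (0≤sq (C E G i))))) (0≤* (0≤# 32) (∑-nonneg Vs (λ i → 0≤+ (0≤* 0≤c₇ (0≤D e i)) (0≤* (0≤# 256) (0≤fall-D e i)))))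

      0≤τ³ : # 0 ≤ # 24 * (τ * τ * τ)
      0≤τ³ = 0≤* (0≤# 24) (0≤* (0≤* 0≤τ 0≤τ) 0≤τ)

      keyA : Bound-by E (ψA t E)
      keyA = go (decide-any (𝓗 E) (λ m → ok? (𝓗⇒ m)))
        where
        go : (Σ Graph λ G → G ∈ 𝓗 E × (∀ i → OK G i)) ⊎ (∀ {G} → G ∈ 𝓗 E → # 1 ≤ bad τ E G) → Bound-by E (ψA t E)
        go (inj₂ h) = key-trivial e₀ _ (λ G e → ≤-by (# 1 + # 24 * (τ * τ * τ) * (# 189 * DC² E G + # 32 * D⁸ E G) + t * (bad τ E G - # 1)) (0≤+ (0≤+ 0≤1 (0≤* 0≤τ³ (0≤core e))) (0≤* (<⇒≤ 0<t) (≤⇒0≤- (h (⇒𝓗 e))))) (solve 3 (λ t a b → κ 1 :+ (a :+ t :* b) :- t := κ 1 :+ a :+ t :* (b :- κ 1)) refl t (# 24 * (τ * τ * τ) * (# 189 * DC² E G + # 32 * D⁸ E G)) (bad τ E G)))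
        go (inj₁ (G₁ , m , ok)) = ≤-trans Pm.χ-bound (*-monoˡ _ (0≤sq t) (*-monoˡ _ (0≤N E) (∑𝓗-mono E (λ G e → +-monoʳ (# 1) (≤-trans (*-monoˡ _ 0≤τ³ (Ψ≤ G e)) (≤-by (t * bad τ E G) (0≤* (<⇒≤ 0<t) (0≤bad e)) (solve 2 (λ a b → a :+ b :- a := b) refl _ _)))))))
          where
          big : # 20 * κ' ≤ vol E
          big = ≤-reflexive (trans (solve 1 (λ v → κ 20 :* (κ 2 :* v) := κ 40 :* v) refl v) 40v)
          1≤κ : # 1 ≤ κ'
          1≤κ = ≤-trans (≤-trans (#-mono (s≤s z≤n)) 256≤v) (≤-by v 0≤v (solve 1 (λ v → κ 2 :* v :- v := v) refl v))
          module Pm = Psi E κ' (good (𝓗⇒ m) ok) 1≤κ big e₀ (# 0) (# 0) ≤-refl ≤-refl (≤-trans (≤-reflexive (Rq.zeroʳ (# 4))) (<⇒≤ 0<t))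
          h≤ : ∀ G → Ext E G → ∀ i → Pm.h G i ≤ # 3 * C E G i
          h≤ G e i = ≤-trans (+-mono (+-mono (∣∣-≡ (0≤C e i)) (*-monoʳ _ (0≤C e i) Pm.η≤1)) (2D≤C e i)) (≤-reflexive (solve 1 (λ c → c :+ κ 1 :* c :+ c := κ 3 :* c) refl (C E G i)))
          H≤ : ∀ G → Ext E G → ∑ Vs (λ a → D E a * Pm.H G a) ≤ # 9 * DC² E G
          H≤ G e = ≤-trans (∑-mono Vs (λ i → ≤-trans (*-monoˡ _ (0≤D e i) (*-mono (Pm.0≤h e i) (0≤* (0≤# 3) (0≤C e i)) (h≤ G e i) (h≤ G e i))) (≤-reflexive (solve 2 (λ d c → d :* (κ 3 :* c :* (κ 3 :* c)) := κ 9 :* (d :* (c :* c))) refl (D E i) (C E G i))))) (≤-reflexive (∑-*ˡ (# 9) Vs _))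
          Γ≤ : ∀ G → Ext E G → ∑∑ (λ i j → X E G i j * (Pm.γ i j * Pm.γ i j)) ≤ D⁸ E G
          Γ≤ G e = *-cancelˡ (# 2) (0<#suc 1) (≤-trans (≤-reflexive (sym (∑∑-*ˡ (# 2) _))) (≤-trans (∑∑-mono term) (≤-trans (≤-reflexive sums) (*-monoˡ (# 2) (0≤# 2) (∑-mono Vs (D⁵≤ e))))))
            where
            q4 : Fin n → ℚ
            q4 i = D E i * D E i * (D E i * D E i)
            term : ∀ i j → # 2 * (X E G i j * (Pm.γ i j * Pm.γ i j)) ≤ X E G i j * q4 i + X E G i j * q4 j
            term i j = ≤-trans (≤-reflexive (cong (λ y → # 2 * (X E G i j * y)) (∣∣-sq (D E i * D E j - # 0)))) (≤-by (X E G i j * ((D E i * D E i - D E j * D E j) * (D E i * D E i - D E j * D E j))) (0≤* (0≤X (sub e) i j) (0≤sq (D E i * D E i - D E j * D E j)))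
              (solve 3 (λ x a b → x :* (a :* a :* (a :* a)) :+ x :* (b :* b :* (b :* b)) :- κ 2 :* (x :* ((a :* b :- κ 0) :* (a :* b :- κ 0))) := x :* ((a :* a :- b :* b) :* (a :* a :- b :* b))) refl (X E G i j) (D E i) (D E j)))
            sums : ∑∑ (λ i j → X E G i j * q4 i + X E G i j * q4 j) ≡ # 2 * ∑ Vs (λ i → D E i * q4 i)
            sums = trans (∑∑-+ _ _) (trans (cong₂ _+_ (∑-cong Vs (λ i → trans (∑-*ʳ (q4 i) Vs _) (cong (_* q4 i) (X-row e i)))) (trans (∑∑-swap _) (∑-cong Vs (λ j → trans (∑-*ʳ (q4 j) Vs _) (cong (_* q4 j) (X-col e j)))))) (solve 1 (λ a → a :+ a := κ 2 :* a) refl (∑ Vs (λ i → D E i * q4 i))))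
          Ψ≤ : ∀ G → Ext E G → Pm.Ψ G ≤ # 189 * DC² E G + # 32 * D⁸ E G
          Ψ≤ G e = ≤-trans (+-monoˡ _ (+-mono (*-monoˡ (# 21) (0≤# 21) (H≤ G e)) (*-monoˡ (# 32) (0≤# 32) (Γ≤ G e)))) (≤-reflexive (solve 4 (λ a b h t → κ 21 :* (κ 9 :* a) :+ κ 32 :* b :+ κ 8 :* (h :* κ 0 :* (h :* κ 0)) :* t := κ 189 :* a :+ κ 32 :* b) refl (DC² E G) (D⁸ E G) Pm.η t))

    -- The a priori bounds C ≤ d (d + 1) and D_i D_j ≤ d² make every state good with κ' = `deg⁺`, so
    -- there are no exceptional states and `Ψ` can be used with arbitrary centres.
    keyB : ∀ {E G₀} → Ext E G₀ → # 1 ≤ deg⁺ → # 20 * deg⁺ ≤ vol E → ∀ μ ν → # 0 ≤ μ → # 0 ≤ ν → # 4 * μ ≤ vol E → Bound-by E (ψB (vol E) μ ν E)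
    keyB {E} e₀ 1≤κ big μ ν 0≤μ 0≤ν 4μ≤ = ≤-trans χ-bound (*-monoˡ _ (0≤sq (vol E)) (*-monoˡ _ (0≤N E) (∑𝓗-mono E (λ G e → +-monoʳ (# 1) (*-monoˡ _ (0≤* (0≤# 24) (0≤* (0≤* 0≤τ 0≤τ) 0≤τ)) (+-monoˡ _ (+-mono (*-monoˡ (# 21) (0≤# 21) (∑-mono Vs (λ i → *-monoˡ _ (0≤D e i) (H≤ G i))))
        (≤-reflexive (cong (# 32 *_) (∑∑-cong (λ i j → cong (X E G i j *_) (∣∣-sq (D E i * D E j - ν)))))))))))))
      where
      good : Good deg⁺ E
      good = mkGood (λ e i → C≤deg⁺ e i) (λ e i j → ≤-trans (*-mono (0≤D e i) (0≤# d) (D≤d e i) (D≤d e j)) (*-monoˡ (# d) (0≤# d) (≤-by (# 1) 0≤1 (solve 1 (λ d → d :+ κ 1 :- d := κ 1) refl (# d)))))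
      open Psi E deg⁺ good 1≤κ big e₀ μ ν 0≤μ 0≤ν 4μ≤
      H≤ : ∀ G i → H G i ≤ # 3 * ((C E G i - μ) * (C E G i - μ) + η * C E G i * (η * C E G i) + # 2 * D E i * (# 2 * D E i))
      H≤ G i = ≤-trans (sq-+₃ (∣ C E G i - μ ∣) (η * C E G i) (# 2 * D E i)) (≤-reflexive (cong (λ y → # 3 * (y + η * C E G i * (η * C E G i) + # 2 * D E i * (# 2 * D E i))) (∣∣-sq (C E G i - μ))))

    -- Expected bounds at each level

    dd ι ω : ℚ
    dd = # d * # d
    ι = inv (# n)
    ω = dd * ι

    -- The factor 80 = 20 · 2 · 2 combines the 20 in η with deg⁺ ≤ 2 d² and d + 1 ≤ 2 d; it yields η
    -- μ ≤ d and η ν ≤ θ in the upper regime.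
    module Sparse (1≤d : 1 ℕ.≤ d) (n≥ : # 80 * dd ≤ # n) where

      1≤d' : # 1 ≤ # d
      1≤d' = #-mono 1≤d

      0≤d : # 0 ≤ # d
      0≤d = 0≤# d

      1≤dd : # 1 ≤ dd
      1≤dd = ≤-trans (≤-reflexive (solve 0 (κ 1 := κ 1 :* κ 1) refl)) (*-mono 0≤1 0≤d 1≤d' 1≤d')

      0≤dd : # 0 ≤ dd
      0≤dd = 0≤sq (# d)

      d≤dd : # d ≤ dd
      d≤dd = ≤-trans (≤-reflexive (sym (Rq.*-identityʳ _))) (*-monoˡ (# d) 0≤d 1≤d')

      0<n : # 0 < # n
      0<n = <-≤-trans (0<#suc 79) (≤-trans (≤-trans (≤-reflexive (sym (Rq.*-identityʳ _))) (*-monoˡ (# 80) (0≤# 80) 1≤dd)) n≥)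

      nι : # n * ι ≡ # 1
      nι = inv-pos-r 0<n

      0≤ι : # 0 ≤ ι
      0≤ι = 0≤inv (<⇒≤ 0<n)

      80ddι : # 80 * (dd * ι) ≤ # 1
      80ddι = ≤-trans (≤-reflexive (sym (Rq.*-assoc _ _ _))) (≤-trans (*-monoʳ ι 0≤ι n≥) (≤-reflexive nι))

      d+1≤ : # d + # 1 ≤ # 2 * # d
      d+1≤ = ≤-by (# d - # 1) (≤⇒0≤- 1≤d') (solve 1 (λ d → κ 2 :* d :- (d :+ κ 1) := d :- κ 1) refl (# d))

      deg⁺≤ : deg⁺ ≤ # 2 * dd
      deg⁺≤ = ≤-trans (*-monoˡ (# d) 0≤d d+1≤) (≤-reflexive (solve 1 (λ d → d :* (κ 2 :* d) := κ 2 :* (d :* d)) refl (# d)))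

    module AtLevel {G : Graph} (m : ℕ) (e∅ : Ext ∅ G) (h∅ : Sized m ∅) (1≤d : 1 ℕ.≤ d) (n≥ : # 80 * dd ≤ # n)
      (j : ℕ) (j<m : suc j ℕ.≤ m) where

      0<m : # 0 < # m
      0<m = <-≤-trans (0<#suc j) (#-mono j<m)

      open Expect m e∅ h∅ 0<m
      open Sparse 1≤d n≥

      j≤m : j ℕ.≤ m
      j≤m = ℕₚ.<⇒≤ j<m

      lv : ℕ
      lv = m ℕ.∸ j

      -- `q` is the probability that a given edge of `G` is still missing; `θ` and `μ` are the
      -- expectations of a residual degree and of C. The relation `τθ` reduces the estimates to
      -- powers of 1/n and 1/t.
      q t τ θ μ : ℚ
      q = p lv
      t = # 2 * # lv
      τ = inv t
      θ = q * # d
      μ = deg⁺ * q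

      lv≥1 : 1 ℕ.≤ lv
      lv≥1 = subst (1 ℕ.≤_) (sym (pred-∸ j<m)) (s≤s z≤n)

      0<t : # 0 < t
      0<t = 0<* (0<#suc 1) (<-≤-trans 0<1 (#-mono lv≥1))

      tτ : t * τ ≡ # 1
      tτ = inv-pos-r 0<t

      0≤τ : # 0 ≤ τ
      0≤τ = 0≤inv (<⇒≤ 0<t)

      0≤q : # 0 ≤ q
      0≤q = 0≤p lv

      0≤θ : # 0 ≤ θ
      0≤θ = 0≤* 0≤q 0≤d

      2mq : # 2 * # m * q ≡ t
      2mq = trans (solve 3 (λ m r i → κ 2 :* m :* (r :* i) := κ 2 :* r :* (m :* i)) refl (# m) (# lv) (inv (# m))) (trans (cong (t *_) (inv-pos-r 0<m)) (Rq.*-identityʳ t))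

      nθ : # n * θ ≡ t
      nθ = trans (solve 3 (λ n q d → n :* (q :* d) := n :* d :* q) refl (# n) q (# d)) (trans (cong (_* q) (sym vol-m)) 2mq)

      θ≡ : θ ≡ t * ι
      θ≡ = trans (sym (Rq.*-identityˡ θ)) (trans (cong (_* θ) (sym nι)) (trans (solve 3 (λ n i x → n :* i :* x := n :* x :* i) refl (# n) ι θ) (cong (_* ι) nθ)))

      τθ : τ * θ ≡ ι
      τθ = trans (cong (τ *_) θ≡) (trans (solve 3 (λ u t i → u :* (t :* i) := t :* u :* i) refl τ t ι) (trans (cong (_* ι) tτ) (Rq.*-identityˡ ι)))

      q≤1 : q ≤ # 1
      q≤1 = ≤-trans (*-monoʳ _ (0≤inv (<⇒≤ 0<m)) (#-mono (ℕₚ.m∸n≤m m j))) (≤-reflexive (inv-pos-r 0<m))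

      θ≤d : θ ≤ # d
      θ≤d = ≤-trans (*-monoʳ (# d) 0≤d q≤1) (≤-reflexive (Rq.*-identityˡ _))

      μ≡ : μ ≡ (# d + # 1) * θ
      μ≡ = solve 2 (λ d q → d :* (d :+ κ 1) :* q := (d :+ κ 1) :* (q :* d)) refl (# d) q

      0≤μ : # 0 ≤ μ
      0≤μ = 0≤* (0≤* 0≤d (0≤+ 0≤d 0≤1)) 0≤q

      deg⁺≤m : deg⁺ ≤ # m
      deg⁺≤m = *-cancelˡ (# 2) (0<#suc 1) (≤-trans (*-monoˡ (# 2) (0≤# 2) deg⁺≤) (≤-trans (≤-by ((# n - # 80 * dd) * # d + # 4 * (dd * (# d - # 1)) + # 76 * (dd * # d)) (0≤+ (0≤+ (0≤* (≤⇒0≤- n≥) 0≤d) (0≤* (0≤# 4) (0≤* 0≤dd (≤⇒0≤- 1≤d')))) (0≤* (0≤# 76) (0≤* 0≤dd 0≤d)))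
          (solve 2 (λ n d → n :* d :- κ 2 :* (κ 2 :* (d :* d)) := (n :- κ 80 :* (d :* d)) :* d :+ κ 4 :* (d :* d :* (d :- κ 1)) :+ κ 76 :* (d :* d :* d)) refl (# n) (# d))) (≤-reflexive (sym vol-m))))

      d≤m : # d ≤ # m
      d≤m = ≤-trans (≤-trans (≤-reflexive (sym (Rq.*-identityʳ (# d)))) (*-monoˡ (# d) 0≤d (≤-by (# d) 0≤d (solve 1 (λ d → d :+ κ 1 :- κ 1 := d) refl (# d))))) deg⁺≤m

      VC VD : Graph → ℚ
      VC E = ∑ Vs (λ i → D E i * ((C E G i - μ) * (C E G i - μ)))
      VD E = ∑ Vs (λ i → D E i * ((D E i - θ) * (D E i - θ)))

      varC : ex j VC ≤ t * (# 8 * μ + # 8)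
      varC = ≤-trans (≤-reflexive (ex-cong j j≤m (λ E e h → ∑-cong Vs (λ i → cong (λ y → D E i * ((y - μ) * (y - μ))) (sym (lin-aw e i)))))) (≤-trans (variance j j<m (aw G) deg⁺ (0≤aw G) (aw≤2 G) (λ i → trans (lin-aw e∅ i) (C∅ (reg e∅) i)) deg⁺≤m)
        (≤-reflexive (trans (solve 3 (λ m A q → κ 2 :* m :* (κ 8 :* (A :* (q :* q)) :+ κ 8 :* q) := κ 2 :* m :* q :* (κ 8 :* (A :* q) :+ κ 8)) refl (# m) deg⁺ q) (cong (_* (# 8 * μ + # 8)) 2mq))))

      varD : ex j VD ≤ t * (# 8 * θ + # 8)
      varD = ≤-trans (≤-reflexive (ex-cong j j≤m (λ E e h → ∑-cong Vs (λ i → cong₂ (λ y z → D E i * ((y - z) * (y - z))) (sym (lin-inc e i)) (Rq.*-comm q (# d)))))) (≤-trans (variance j j<m (λ i q → inc q i) (# d) (λ i q → 0≤inc q i) inc≤2 (λ i → trans (lin-inc e∅ i) (D∅ i)) d≤m)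
        (≤-reflexive (trans (solve 3 (λ m A q → κ 2 :* m :* (κ 8 :* (A :* (q :* q)) :+ κ 8 :* q) := κ 2 :* m :* q :* (κ 8 :* (q :* A) :+ κ 8)) refl (# m) (# d) q) (cong (_* (# 8 * θ + # 8)) 2mq))))

      exDC² : ex j (λ E → DC² E G) ≤ t * (# 16 * μ + # 16 + # 2 * (μ * μ))
      exDC² = ≤-trans (ex-mono j j≤m (λ E e h → ≤-trans (∑-mono Vs (λ i → *-monoˡ _ (0≤D e i) (sq-shift (C E G i) μ))) (≤-reflexive (trans (∑-cong Vs (λ i → solve 3 (λ d y m → d :* (κ 2 :* y :+ κ 2 :* m) := κ 2 :* (d :* y) :+ κ 2 :* m :* d) refl (D E i) ((C E G i - μ) * (C E G i - μ)) (μ * μ))) (trans (∑-+ Vs _ _) (cong₂ _+_ (∑-*ˡ (# 2) Vs _) (trans (∑-*ˡ _ Vs _) (cong (# 2 * (μ * μ) *_) h))))))))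
        (≤-trans (≤-reflexive (trans (ex-+ j _ _) (cong₂ _+_ (ex-* j (# 2) VC) (ex-const j _ j≤m)))) (≤-trans (+-monoˡ _ (*-monoˡ (# 2) (0≤# 2) varC)) (≤-reflexive (solve 2 (λ t m → κ 2 :* (t :* (κ 8 :* m :+ κ 8)) :+ κ 2 :* (m :* m) :* t := t :* (κ 16 :* m :+ κ 16 :+ κ 2 :* (m :* m))) refl t μ))))

      exψ₀ : ex j (λ E → t * exc E G) ≤ t * (t * μ)
      exψ₀ = ≤-trans (≤-reflexive (ex-* j t _)) (*-monoˡ t (<⇒≤ 0<t) (≤-trans (excess j j≤m) (≤-reflexive (trans (solve 3 (λ m q A → κ 2 :* m :* (q :* q :* A) := κ 2 :* m :* q :* (A :* q)) refl (# m) q deg⁺) (cong (_* μ) 2mq)))))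

      ∑-Vs-const : ∀ c → ∑ Vs (λ _ → c) ≡ # n * c
      ∑-Vs-const c = trans (∑-const Vs c) (cong (λ k → # k * c) (Lₚ.length-tabulate id))

      exD⁸ : ex j (λ E → D⁸ E G) ≤ c₇ * t + # n * (# 256 * θ ^ 8)
      exD⁸ = ≤-trans (≤-reflexive (trans (ex-cong j j≤m (λ E e h → trans (∑-+ Vs _ _) (cong₂ _+_ (trans (∑-*ˡ c₇ Vs _) (cong (c₇ *_) h)) (∑-*ˡ (# 256) Vs _)))) (trans (ex-+ j _ _) (cong₂ _+_ (ex-const j _ j≤m) (trans (ex-* j (# 256) _) (cong (# 256 *_) (ex-∑ j Vs _)))))))
        (≤-trans (+-monoʳ _ (*-monoˡ (# 256) (0≤# 256) (∑-mono Vs (λ i → ex-Db j j≤m i 8)))) (≤-reflexive (cong (c₇ * t +_) (trans (cong (# 256 *_) (∑-Vs-const (θ ^ 8))) (solve 2 (λ n x → κ 256 :* (n :* x) := n :* (κ 256 :* x)) refl (# n) (θ ^ 8))))))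

      exbad : ex j (λ E → bad τ E G) ≤ # n * ((# 160 * τ) ^ 8 * μ ^ 8 + # 256 * (# 40 * τ) ^ 4 * θ ^ 8)
      exbad = ≤-trans (≤-reflexive (trans (ex-∑ j Vs _) (∑-cong Vs (λ i → trans (ex-+ j _ _) (cong₂ _+_ (ex-* j _ _) (ex-* j _ _)))))) (≤-trans (∑-mono Vs (λ i → +-mono (*-monoˡ _ (0≤^ 8 (0≤* (0≤# 160) 0≤τ)) (≤-trans (ex-Rb j j≤m i 8) (≤-reflexive (cong (_^ 8) (Rq.*-comm q deg⁺))))) (*-monoˡ _ (0≤* (0≤# 256) (0≤^ 4 (0≤* (0≤# 40) 0≤τ))) (ex-Db j j≤m i 8)))) (≤-reflexive (∑-Vs-const _)))

      μτ : μ * τ ≡ (# d + # 1) * ι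
      μτ = trans (cong (_* τ) μ≡) (trans (solve 3 (λ a x u → a :* x :* u := a :* (u :* x)) refl (# d + # 1) θ τ) (cong ((# d + # 1) *_) τθ))

      -- With at most n edges left the mean residual degree is at most 2, so its powers become
      -- constants, and ι ≤ 2 τ exchanges spare factors 1/n for 1/t.
      module Middle (lv<n : lv ℕ.≤ n) where

        t≤2n : t ≤ # 2 * # n
        t≤2n = *-monoˡ (# 2) (0≤# 2) (#-mono lv<n)

        ι≤2τ : ι ≤ # 2 * τ
        ι≤2τ = *-cancelˡ t 0<t (≤-trans (*-monoʳ ι 0≤ι t≤2n) (≤-reflexive (trans (trans (Rq.*-assoc _ _ _) (cong (# 2 *_) nι)) (sym (trans (solve 2 (λ t u → t :* (κ 2 :* u) := κ 2 :* (t :* u)) refl t τ) (cong (# 2 *_) tτ))))))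

        θ≤2 : θ ≤ # 2
        θ≤2 = *-cancelˡ (# n) 0<n (≤-trans (≤-reflexive nθ) (≤-trans t≤2n (≤-reflexive (Rq.*-comm _ _))))

        exψA : ex j (λ E → ψA t E G) ≤ k₂ * (τ * τ) + k₄ * (dd * ι * τ)
        exψA = ≤-trans (≤-reflexive (trans (ex-+ j _ _) (cong₂ _+_ (trans (ex-* j _ _) (cong (# 24 * (τ * τ * τ) *_) (trans (ex-+ j _ _) (cong₂ _+_ (ex-* j (# 189) _) (ex-* j (# 32) _))))) (ex-* j t _))))
            (≤-trans (+-mono (*-monoˡ _ (0≤* (0≤# 24) (0≤* (0≤* 0≤τ 0≤τ) 0≤τ)) (+-mono (*-monoˡ (# 189) (0≤# 189) exDC²) (*-monoˡ (# 32) (0≤# 32) D⁸b))) (*-monoˡ t (<⇒≤ 0<t) badb)) arith)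
          where
          D⁸b : ex j (λ E → D⁸ E G) ≤ t * (c₇ + # 256 * # 2 ^ 7)
          D⁸b = ≤-trans exD⁸ (≤-trans (≤-reflexive (trans (solve 5 (λ c t n x y → c :* t :+ n :* (κ 256 :* (x :* y)) := c :* t :+ n :* x :* (κ 256 :* y)) refl c₇ t (# n) θ (θ ^ 7)) (cong (λ z → c₇ * t + z * (# 256 * θ ^ 7)) nθ))) (≤-trans (≤-reflexive (solve 3 (λ c t y → c :* t :+ t :* (κ 256 :* y) := t :* (c :+ κ 256 :* y)) refl c₇ t (θ ^ 7))) (*-monoˡ t (<⇒≤ 0<t) (+-monoʳ c₇ (*-monoˡ (# 256) (0≤# 256) (^-mono-≤ 7 0≤θ θ≤2))))))
          ι⁴ : ℚ
          ι⁴ = ι ^ 4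
          0≤ι⁴ = 0≤^ 4 0≤ι
          -- Here 160 τ μ ≤ 320 d/n, and (d/n)^8 is (d²/n)^4 times n^(-4). Since d² ≤ n, the eighth
          -- moment leaves n^(-4), more than the factors t and n in front consume.
          first : (# 160 * τ) ^ 8 * μ ^ 8 ≤ # 320 ^ 8 * ι⁴
          first = ≤-trans (≤-reflexive (trans (sym (*-^ (# 160 * τ) μ 8)) (cong (_^ 8) (trans (solve 2 (λ u m → κ 160 :* u :* m := κ 160 :* (m :* u)) refl τ μ) (cong (# 160 *_) μτ))))) (≤-trans (^-mono-≤ 8 (0≤* (0≤# 160) (0≤* (0≤+ 0≤d 0≤1) 0≤ι)) (≤-trans (*-monoˡ (# 160) (0≤# 160) (*-monoʳ ι 0≤ι d+1≤)) (≤-reflexive (solve 2 (λ d i → κ 160 :* (κ 2 :* d :* i) := κ 320 :* (d :* i)) refl (# d) ι))))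
            (≤-trans (≤-reflexive (trans (*-^ (# 320) (# d * ι) 8) (cong (# 320 ^ 8 *_) (solve 2 (λ d i → let x = d :* i in x :* (x :* (x :* (x :* (x :* (x :* (x :* (x :* κ 1))))))) := (d :* d :* i :* (d :* d :* i :* (d :* d :* i :* (d :* d :* i :* κ 1)))) :* (i :* (i :* (i :* (i :* κ 1))))) refl (# d) ι)))) (*-monoˡ _ (0≤^ 8 (0≤# 320)) (≤-trans (*-monoʳ ι⁴ 0≤ι⁴ (≤-trans (^-mono-≤ 4 {dd * ι} {# 1} (0≤* 0≤dd 0≤ι) ddι≤1) (≤-reflexive (solve 0 (κ 1 :* (κ 1 :* (κ 1 :* (κ 1 :* κ 1))) := κ 1) refl)))) (≤-reflexive (Rq.*-identityˡ _))))))
            where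
            ddι≤1 : dd * ι ≤ # 1
            ddι≤1 = ≤-trans (≤-by (# 79 * (dd * ι)) (0≤* (0≤# 79) (0≤* 0≤dd 0≤ι)) (solve 1 (λ x → κ 80 :* x :- x := κ 79 :* x) refl (dd * ι))) 80ddι
          second : # 256 * (# 40 * τ) ^ 4 * θ ^ 8 ≤ # 256 * # 40 ^ 4 * # 2 ^ 4 * ι⁴
          second = ≤-trans (≤-reflexive (trans (solve 2 (λ u x → κ 256 :* (κ 40 :* u :* (κ 40 :* u :* (κ 40 :* u :* (κ 40 :* u :* κ 1)))) :* (x :* (x :* (x :* (x :* (x :* (x :* (x :* (x :* κ 1)))))))) := κ 256 :* (κ 40 :* (κ 40 :* (κ 40 :* (κ 40 :* κ 1)))) :* (x :* (x :* (x :* (x :* κ 1)))) :* (u :* x :* (u :* x :* (u :* x :* (u :* x :* κ 1))))) refl τ θ) (cong (λ y → # 256 * # 40 ^ 4 * θ ^ 4 * y ^ 4) τθ))) (*-monoʳ ι⁴ 0≤ι⁴ (*-monoˡ _ (0≤* (0≤# 256) (0≤^ 4 (0≤# 40))) (^-mono-≤ 4 0≤θ θ≤2)))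
          badb : ex j (λ E → bad τ E G) ≤ # n * (k₅ * ι⁴)
          badb = ≤-trans exbad (*-monoˡ (# n) (0≤# n) (≤-trans (+-mono first second) (≤-reflexive (sym (Rq.distribʳ ι⁴ _ _)))))
          -- t n ι⁴ ≤ 2 n² ι⁴ = 2 ι² ≤ 4 ι τ
          tail : t * (# n * (k₅ * ι⁴)) ≤ # 4 * k₅ * (dd * ι * τ)
          tail = ≤-trans (*-monoʳ _ (0≤* (0≤# n) (0≤* 0≤k₅ 0≤ι⁴)) t≤2n) (≤-trans (≤-reflexive (trans (solve 3 (λ n c i → κ 2 :* n :* (n :* (c :* (i :* (i :* (i :* (i :* κ 1)))))) := κ 2 :* c :* ((n :* i) :* (n :* i)) :* (i :* i)) refl (# n) k₅ ι) (trans (cong (λ y → # 2 * k₅ * (y * y) * (ι * ι)) nι) (solve 2 (λ c i → κ 2 :* c :* (κ 1 :* κ 1) :* (i :* i) := κ 2 :* c :* (i :* i)) refl k₅ ι))))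
            (≤-by (# 2 * k₅ * (ι * (# 2 * τ - ι)) + # 4 * k₅ * ((dd - # 1) * (ι * τ))) (0≤+ (0≤* (0≤* (0≤# 2) 0≤k₅) (0≤* 0≤ι (≤⇒0≤- ι≤2τ))) (0≤* (0≤* (0≤# 4) 0≤k₅) (0≤* (≤⇒0≤- 1≤dd) (0≤* 0≤ι 0≤τ)))) (solve 4 (λ c i u e → κ 4 :* c :* (e :* i :* u) :- κ 2 :* c :* (i :* i) := κ 2 :* c :* (i :* (κ 2 :* u :- i)) :+ κ 4 :* c :* ((e :- κ 1) :* (i :* u))) refl k₅ ι τ dd)))
          μτ≤ : μ * τ ≤ # 2 * (dd * ι)
          μτ≤ = ≤-trans (≤-reflexive μτ) (≤-trans (*-monoʳ ι 0≤ι (≤-trans d+1≤ (*-monoˡ (# 2) (0≤# 2) d≤dd))) (≤-reflexive (Rq.*-assoc _ _ _)))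
          μτ² : μ * τ * (μ * τ) ≤ # 8 * (dd * ι * τ)
          μτ² = ≤-trans (≤-reflexive (cong₂ _*_ μτ μτ)) (≤-trans (*-mono (0≤* (0≤+ 0≤d 0≤1) 0≤ι) (0≤* (0≤* (0≤# 2) 0≤d) 0≤ι) (*-monoʳ ι 0≤ι d+1≤) (*-monoʳ ι 0≤ι d+1≤)) (≤-by (# 4 * (dd * ι * (# 2 * τ - ι))) (0≤* (0≤# 4) (0≤* (0≤* 0≤dd 0≤ι) (≤⇒0≤- ι≤2τ))) (solve 3 (λ d i u → κ 8 :* (d :* d :* i :* u) :- κ 2 :* d :* i :* (κ 2 :* d :* i) := κ 4 :* (d :* d :* i :* (κ 2 :* u :- i))) refl (# d) ι τ)))
          z = c₇ + # 256 * # 2 ^ 7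
          arith : # 24 * (τ * τ * τ) * (# 189 * (t * (# 16 * μ + # 16 + # 2 * (μ * μ))) + # 32 * (t * z)) + t * (# n * (k₅ * ι⁴)) ≤ k₂ * (τ * τ) + k₄ * (dd * ι * τ)
          arith = ≤-trans (≤-reflexive (cong (_+ t * (# n * (k₅ * ι⁴))) (trans (solve 4 (λ u t m z → κ 24 :* (u :* u :* u) :* (κ 189 :* (t :* (κ 16 :* m :+ κ 16 :+ κ 2 :* (m :* m))) :+ κ 32 :* (t :* z)) := (t :* u) :* (κ 72576 :* (m :* u :* u) :+ κ 9072 :* (m :* u :* (m :* u)) :+ κ 24 :* (κ 3024 :+ κ 32 :* z) :* (u :* u))) refl τ t μ z) (trans (cong (_* (# 72576 * (μ * τ * τ) + # 9072 * (μ * τ * (μ * τ)) + k₂ * (τ * τ))) tτ) (Rq.*-identityˡ _)))))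
            (≤-by (# 72576 * (τ * (# 2 * (dd * ι) - μ * τ)) + # 9072 * (# 8 * (dd * ι * τ) - μ * τ * (μ * τ)) + (# 4 * k₅ * (dd * ι * τ) - t * (# n * (k₅ * ι⁴))) + # 194688 * (dd * ι * τ))
              (0≤+ (0≤+ (0≤+ (0≤* (0≤# 72576) (0≤* 0≤τ (≤⇒0≤- μτ≤))) (0≤* (0≤# 9072) (≤⇒0≤- μτ²))) (≤⇒0≤- tail)) (0≤* (0≤# 194688) (0≤* (0≤* 0≤dd 0≤ι) 0≤τ)))
              (solve 8 (λ c u e i m y w c5 → c :* (u :* u) :+ (κ 217728 :+ κ 4 :* c5 :+ κ 194688) :* (e :* i :* u) :- (κ 72576 :* (m :* u :* u) :+ κ 9072 :* (m :* u :* (m :* u)) :+ c :* (u :* u) :+ w) := κ 72576 :* (u :* (κ 2 :* (e :* i) :- m :* u)) :+ κ 9072 :* (κ 8 :* (e :* i :* u) :- m :* u :* (m :* u)) :+ (κ 4 :* c5 :* (e :* i :* u) :- w) :+ κ 194688 :* (e :* i :* u)) refl k₂ τ dd ι μ (# 0) (t * (# n * (k₅ * ι⁴))) k₅))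

      -- With at least n edges left, C is always at most t/20, so variances suffice, and τ ≤ ι.
      module Upper (n≤lv : n ℕ.≤ lv) where

        η ν : ℚ
        η = # 20 * deg⁺ * τ
        ν = θ * θ

        2n≤t : # 2 * # n ≤ t
        2n≤t = *-monoˡ (# 2) (0≤# 2) (#-mono n≤lv)

        τ≤ι : τ ≤ ι
        τ≤ι = *-cancelˡ t 0<t (≤-trans (≤-reflexive (trans tτ (sym nι))) (*-monoʳ ι 0≤ι (≤-trans (≤-by (# n) (0≤# n) (solve 1 (λ n → κ 2 :* n :- n := n) refl (# n))) 2n≤t)))

        20deg⁺≤t : # 20 * deg⁺ ≤ t
        20deg⁺≤t = ≤-trans (*-monoˡ (# 20) (0≤# 20) deg⁺≤) (≤-trans (≤-by ((# n - # 80 * dd) + # n + # 40 * dd) (0≤+ (0≤+ (≤⇒0≤- n≥) (0≤# n)) (0≤* (0≤# 40) 0≤dd)) (solve 2 (λ n e → κ 2 :* n :- κ 20 :* (κ 2 :* e) := (n :- κ 80 :* e) :+ n :+ κ 40 :* e) refl (# n) dd)) 2n≤t)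

        0≤deg⁺ : # 0 ≤ deg⁺
        0≤deg⁺ = 0≤* 0≤d (0≤+ 0≤d 0≤1)

        0≤η : # 0 ≤ η
        0≤η = 0≤* (0≤* (0≤# 20) 0≤deg⁺) 0≤τ

        η≤1 : η ≤ # 1
        η≤1 = ≤-trans (*-monoʳ τ 0≤τ 20deg⁺≤t) (≤-reflexive tτ)

        0≤ν : # 0 ≤ ν
        0≤ν = 0≤sq θ

        ημ≤d : η * μ ≤ # d
        ημ≤d = ≤-trans (≤-reflexive (trans (solve 3 (λ A u m → κ 20 :* A :* u :* m := κ 20 :* A :* (m :* u)) refl deg⁺ τ μ) (cong (# 20 * deg⁺ *_) μτ))) (≤-trans (*-mono (0≤* (0≤# 20) 0≤deg⁺) (0≤* (0≤* (0≤# 2) 0≤d) 0≤ι) (*-monoˡ (# 20) (0≤# 20) deg⁺≤) (*-monoʳ ι 0≤ι d+1≤)) (≤-trans (≤-reflexive (solve 2 (λ d i → κ 20 :* (κ 2 :* (d :* d)) :* (κ 2 :* d :* i) := κ 80 :* (d :* d :* i) :* d) refl (# d) ι)) (≤-trans (*-monoʳ (# d) 0≤d 80ddι) (≤-reflexive (Rq.*-identityˡ _)))))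

        ην≤θ : η * ν ≤ θ
        ην≤θ = ≤-trans (≤-reflexive (trans (solve 3 (λ A u x → κ 20 :* A :* u :* (x :* x) := κ 20 :* A :* (u :* x) :* x) refl deg⁺ τ θ) (cong (λ y → # 20 * deg⁺ * y * θ) τθ))) (≤-trans (*-monoʳ θ 0≤θ (≤-trans (*-monoʳ ι 0≤ι (*-monoˡ (# 20) (0≤# 20) deg⁺≤)) (≤-trans (≤-by (# 40 * (dd * ι)) (0≤* (0≤# 40) (0≤* 0≤dd 0≤ι)) (solve 2 (λ e i → κ 80 :* (e :* i) :- κ 20 :* (κ 2 :* e) :* i := κ 40 :* (e :* i)) refl dd ι)) 80ddι))) (≤-reflexive (Rq.*-identityˡ θ)))

        Γ : Graph → ℚ
        Γ E = ∑∑ (λ a b → X E G a b * ((D E a * D E b - ν) * (D E a * D E b - ν)))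

        exΓ : ex j Γ ≤ # 4 * dd * (t * (# 8 * θ + # 8))
        exΓ = ≤-trans (ex-mono j j≤m (λ E e h → ≤-trans (∑∑-mono (λ a b → *-monoˡ _ (0≤X (sub e) a b) (pt e a b))) (≤-reflexive (sums e)))) (≤-trans (≤-reflexive (ex-* j (# 4 * dd) VD)) (*-monoˡ _ (0≤* (0≤# 4) 0≤dd) varD))
          where
          sqD : Graph → Fin n → ℚ
          sqD E a = (D E a - θ) * (D E a - θ)
          pt : ∀ {E} → Ext E G → ∀ a b → (D E a * D E b - ν) * (D E a * D E b - ν) ≤ # 2 * dd * (sqD E b + sqD E a)
          -- The deviation of D_a D_b from θ² is D_a (D_b - θ) + θ (D_a - θ), where D_a and θ are at
          -- most d.
          pt {E} e a b = ≤-trans (≤-reflexive (cong (λ y → y * y) (solve 3 (λ a b x → a :* b :- x :* x := a :* (b :- x) :+ x :* (a :- x)) refl (D E a) (D E b) θ))) (≤-trans (sq-+₂ (D E a * (D E b - θ)) (θ * (D E a - θ)))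
            (≤-by (# 2 * ((dd - D E a * D E a) * sqD E b + (dd - θ * θ) * sqD E a)) (0≤* (0≤# 2) (0≤+ (0≤* (≤⇒0≤- (*-mono (0≤D e a) 0≤d (D≤d e a) (D≤d e a))) (0≤sq _)) (0≤* (≤⇒0≤- (*-mono 0≤θ 0≤d θ≤d θ≤d)) (0≤sq _))))
              (solve 5 (λ e a x y z → κ 2 :* e :* (y :* y :+ z :* z) :- κ 2 :* (a :* y :* (a :* y) :+ x :* z :* (x :* z)) := κ 2 :* ((e :- a :* a) :* (y :* y) :+ (e :- x :* x) :* (z :* z))) refl dd (D E a) θ (D E b - θ) (D E a - θ))))
          sums : ∀ {E} → Ext E G → ∑∑ (λ a b → X E G a b * (# 2 * dd * (sqD E b + sqD E a))) ≡ # 4 * dd * VD E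
          sums {E} e = trans (∑∑-cong (λ a b → solve 4 (λ x e y z → x :* (κ 2 :* e :* (y :+ z)) := κ 2 :* e :* (x :* y :+ x :* z)) refl (X E G a b) dd (sqD E b) (sqD E a))) (trans (∑∑-*ˡ _ _) (trans (cong (# 2 * dd *_) (trans (∑∑-+ _ _) (cong₂ _+_ (trans (∑∑-swap _) (∑-cong Vs (λ b → trans (∑-*ʳ _ Vs _) (cong (_* sqD E b) (X-col e b))))) (∑-cong Vs (λ a → trans (∑-*ʳ _ Vs _) (cong (_* sqD E a) (X-row e a))))))) (solve 2 (λ e v → κ 2 :* e :* (v :+ v) := κ 4 :* e :* v) refl dd (VD E))))

        exψB : ex j (λ E → ψB t μ ν E G) ≤ k₂ * (τ * τ) + k₄ * (dd * ι * τ)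
        exψB = ≤-trans (ex-mono j j≤m (λ E e h → *-monoˡ _ 0≤τ³ (+-monoˡ _ (+-monoˡ _ (*-monoˡ (# 21) (0≤# 21) (pt E e h))))))
            (≤-trans (≤-reflexive (trans (ex-* j _ _) (cong (# 24 * (τ * τ * τ) *_) (trans (ex-+ j _ _) (cong₂ _+_ (trans (ex-+ j _ _) (cong₂ _+_ (trans (ex-* j (# 21) _) (cong (# 21 *_) (trans (ex-* j (# 3) _) (cong (# 3 *_) (trans (ex-+ j _ _) (cong₂ _+_ (trans (ex-+ j _ _) (cong (ex j VC +_) (ex-* j (η * η) _))) (ex-const j _ j≤m))))))) (ex-* j (# 32) _))) (ex-const j _ j≤m))))))
            (≤-trans (*-monoˡ _ 0≤τ³ (+-monoˡ _ (+-mono (*-monoˡ (# 21) (0≤# 21) (*-monoˡ (# 3) (0≤# 3) (+-monoˡ _ (+-mono varC (*-monoˡ _ (0≤sq η) exDC²))))) (*-monoˡ (# 32) (0≤# 32) exΓ)))) arith))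
          where
          0≤τ³ : # 0 ≤ # 24 * (τ * τ * τ)
          0≤τ³ = 0≤* (0≤# 24) (0≤* (0≤* 0≤τ 0≤τ) 0≤τ)
          pt : ∀ E → Ext E G → Sized lv E → ∑ Vs (λ i → D E i * (# 3 * ((C E G i - μ) * (C E G i - μ) + η * C E G i * (η * C E G i) + # 2 * D E i * (# 2 * D E i)))) ≤ # 3 * (VC E + η * η * DC² E G + # 4 * dd * t)
          pt E e h = ≤-trans (∑-mono Vs (λ i → ≤-by (# 12 * (D E i * (dd - D E i * D E i))) (0≤* (0≤# 12) (0≤* (0≤D e i) (≤⇒0≤- (*-mono (0≤D e i) 0≤d (D≤d e i) (D≤d e i)))))
                (solve 5 (λ d x h c e → κ 3 :* (d :* x :+ h :* h :* (d :* (c :* c)) :+ κ 4 :* e :* d) :- d :* (κ 3 :* (x :+ h :* c :* (h :* c) :+ κ 2 :* d :* (κ 2 :* d))) := κ 12 :* (d :* (e :- d :* d))) refl (D E i) ((C E G i - μ) * (C E G i - μ)) η (C E G i) dd)))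
              (≤-reflexive (trans (∑-*ˡ (# 3) Vs _) (cong (# 3 *_) (trans (∑-+ Vs _ _) (cong₂ _+_ (trans (∑-+ Vs _ _) (cong (VC E +_) (∑-*ˡ (η * η) Vs _))) (trans (∑-*ˡ (# 4 * dd) Vs _) (cong (# 4 * dd *_) h)))))))
          μ≤ : μ ≤ # 2 * (dd * θ)
          μ≤ = ≤-trans (≤-reflexive μ≡) (≤-trans (*-monoʳ θ 0≤θ (≤-trans d+1≤ (*-monoˡ (# 2) (0≤# 2) d≤dd))) (≤-reflexive (Rq.*-assoc _ _ _)))
          η²≤1 : η * η ≤ # 1
          η²≤1 = ≤-trans (*-mono 0≤η 0≤1 η≤1 η≤1) (≤-reflexive (Rq.*-identityˡ _))
          ημ² : η * μ * (η * μ) ≤ dd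
          ημ² = *-mono (0≤* 0≤η 0≤μ) 0≤d ημ≤d ημ≤d
          ην² : η * ν * (η * ν) ≤ dd * θ
          ην² = ≤-trans (*-mono (0≤* 0≤η 0≤ν) 0≤θ ην≤θ ην≤θ) (*-monoʳ θ 0≤θ (≤-trans θ≤d d≤dd))
          -- The coefficient of d² θ is 4056 = 63 · 48 + 1024 + 8: from the terms in μ, with μ ≤ 2
          -- d² θ and η ≤ 1, from the residual degree products, and from η ν. The remaining terms
          -- are bounded by the same multiple of d².
          inner : # 21 * (# 3 * (# 8 * μ + # 8 + η * η * (# 16 * μ + # 16 + # 2 * (μ * μ)) + # 4 * dd)) + # 32 * (# 4 * dd * (# 8 * θ + # 8)) + # 8 * (η * ν * (η * ν)) ≤ # 4056 * (dd * (θ + # 1))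
          inner = ≤-by (# 63 * (# 24 * (# 2 * (dd * θ) - μ) + # 16 * ((# 1 - η * η) * μ) + # 16 * (# 1 - η * η) + # 2 * (dd - η * μ * (η * μ)) + # 24 * (dd - # 1)) + # 8 * (dd * θ - η * ν * (η * ν)) + # 1142 * dd)
              (0≤+ (0≤+ (0≤* (0≤# 63) (0≤+ (0≤+ (0≤+ (0≤+ (0≤* (0≤# 24) (≤⇒0≤- μ≤)) (0≤* (0≤# 16) (0≤* (≤⇒0≤- η²≤1) 0≤μ))) (0≤* (0≤# 16) (≤⇒0≤- η²≤1))) (0≤* (0≤# 2) (≤⇒0≤- ημ²))) (0≤* (0≤# 24) (≤⇒0≤- 1≤dd)))) (0≤* (0≤# 8) (≤⇒0≤- ην²))) (0≤* (0≤# 1142) 0≤dd))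
              (solve 5 (λ m h e x v → κ 4056 :* (e :* (x :+ κ 1)) :- (κ 21 :* (κ 3 :* (κ 8 :* m :+ κ 8 :+ h :* h :* (κ 16 :* m :+ κ 16 :+ κ 2 :* (m :* m)) :+ κ 4 :* e)) :+ κ 32 :* (κ 4 :* e :* (κ 8 :* x :+ κ 8)) :+ κ 8 :* (h :* v :* (h :* v)))
                 := κ 63 :* (κ 24 :* (κ 2 :* (e :* x) :- m) :+ κ 16 :* ((κ 1 :- h :* h) :* m) :+ κ 16 :* (κ 1 :- h :* h) :+ κ 2 :* (e :- h :* m :* (h :* m)) :+ κ 24 :* (e :- κ 1)) :+ κ 8 :* (e :* x :- h :* v :* (h :* v)) :+ κ 1142 :* e) refl μ η dd θ ν)
          arith : # 24 * (τ * τ * τ) * (# 21 * (# 3 * (t * (# 8 * μ + # 8) + η * η * (t * (# 16 * μ + # 16 + # 2 * (μ * μ))) + # 4 * dd * t)) + # 32 * (# 4 * dd * (t * (# 8 * θ + # 8))) + # 8 * (η * ν * (η * ν)) * t) ≤ k₂ * (τ * τ) + k₄ * (dd * ι * τ)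
          arith = ≤-trans (≤-reflexive (trans (solve 7 (λ u t m h e x v → κ 24 :* (u :* u :* u) :* (κ 21 :* (κ 3 :* (t :* (κ 8 :* m :+ κ 8) :+ h :* h :* (t :* (κ 16 :* m :+ κ 16 :+ κ 2 :* (m :* m))) :+ κ 4 :* e :* t)) :+ κ 32 :* (κ 4 :* e :* (t :* (κ 8 :* x :+ κ 8))) :+ κ 8 :* (h :* v :* (h :* v)) :* t)
                   := (t :* u) :* (κ 24 :* (u :* u) :* (κ 21 :* (κ 3 :* (κ 8 :* m :+ κ 8 :+ h :* h :* (κ 16 :* m :+ κ 16 :+ κ 2 :* (m :* m)) :+ κ 4 :* e)) :+ κ 32 :* (κ 4 :* e :* (κ 8 :* x :+ κ 8)) :+ κ 8 :* (h :* v :* (h :* v))))) refl τ t μ η dd θ ν) (trans (cong (_* (# 24 * (τ * τ) * (# 21 * (# 3 * (# 8 * μ + # 8 + η * η * (# 16 * μ + # 16 + # 2 * (μ * μ)) + # 4 * dd)) + # 32 * (# 4 * dd * (# 8 * θ + # 8)) + # 8 * (η * ν * (η * ν))))) tτ) (Rq.*-identityˡ _))))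
              (≤-trans (*-monoˡ _ (0≤* (0≤# 24) (0≤sq τ)) inner) (≤-trans (≤-reflexive (trans (solve 3 (λ u e x → κ 24 :* (u :* u) :* (κ 4056 :* (e :* (x :+ κ 1))) := κ 97344 :* (e :* (u :* x) :* u) :+ κ 97344 :* (e :* u :* u)) refl τ dd θ) (cong (λ y → # 97344 * (dd * y * τ) + # 97344 * (dd * τ * τ)) τθ)))
                (≤-by (# 97344 * (dd * (ι - τ) * τ) + k₂ * (τ * τ) + (# 217728 + # 4 * k₅) * (dd * ι * τ)) (0≤+ (0≤+ (0≤* (0≤# 97344) (0≤* (0≤* 0≤dd (≤⇒0≤- τ≤ι)) 0≤τ)) (0≤* 0≤k₂ (0≤sq τ))) (0≤* (0≤+ (0≤# 217728) (0≤* (0≤# 4) 0≤k₅)) (0≤* (0≤* 0≤dd 0≤ι) 0≤τ)))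
                  (solve 5 (λ c u e i c5 → c :* (u :* u) :+ (κ 217728 :+ κ 4 :* c5 :+ κ 194688) :* (e :* i :* u) :- (κ 97344 :* (e :* i :* u) :+ κ 97344 :* (e :* u :* u)) := κ 97344 :* (e :* (i :- u) :* u) :+ c :* (u :* u) :+ (κ 217728 :+ κ 4 :* c5) :* (e :* i :* u)) refl k₂ τ dd ι k₅))))

    -- Summation of the errors over all steps

    module Assembly (m S : ℕ) where

      module _ (h∅ : Sized m ∅) (1≤d : 1 ℕ.≤ d) (n≥ : # 80 * dd ≤ # n) (S≥ : 5119 ℕ.≤ S) where
        open Sparse 1≤d n≥

        t p' θ' μ ν : ℕ → ℚ
        t r = # 2 * # r
        p' r = # r * inv (# m)
        θ' r = p' r * # d
        μ r = deg⁺ * p' r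
        ν r = θ' r * θ' r

        -- The decisions are arguments so that a case split in `key` or `exψ` reduces the error term
        -- together with its bound.
        regime : ∀ r → Dec (r ℕ.≤ S) → Dec (r ℕ.≤ n) → Graph → Graph → ℚ
        regime r (yes _) _ G E = t r * exc E G
        regime r (no _) (yes _) G E = ψA (t r) E G
        regime r (no _) (no _) G E = ψB (t r) (μ r) (ν r) E G

        ψ : ℕ → Graph → Graph → ℚ
        ψ r = regime r (r ℕ.≤? S) (r ℕ.≤? n)

        level-bound : ∀ r → Dec (r ℕ.≤ S) → ℚ
        level-bound r (yes _) = t r * (t r * μ r)
        level-bound r (no _) = k₂ * (inv (t r) * inv (t r)) + k₄ * (ω * inv (t r))

        bnd : ℕ → ℚ
        bnd r = level-bound r (r ℕ.≤? S)

        vol-m : # 2 * # m ≡ # n * # d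
        vol-m = trans (sym h∅) vol∅

        0<m : # 0 < # m
        0<m = mkPos (0≤# m) (λ z → pos⇒≢0 (0<* 0<n (<-≤-trans 0<1 1≤d')) (trans (sym vol-m) (trans (cong (# 2 *_) z) (Rq.zeroʳ (# 2)))))

        1≤deg⁺ : # 1 ≤ deg⁺
        1≤deg⁺ = ≤-trans 1≤dd (≤-by (# d) (0≤# d) (solve 1 (λ d → d :* (d :+ κ 1) :- d :* d := d) refl (# d)))

        d/m : # d * inv (# m) ≡ # 2 * ι
        d/m = trans (sym (Rq.*-identityˡ _)) (trans (cong (_* (# d * inv (# m))) (sym (inv-pos-r 0<n))) (trans (solve 4 (λ n i d j → n :* i :* (d :* j) := n :* d :* (i :* j)) refl (# n) ι (# d) (inv (# m)))
          (trans (cong (_* (ι * inv (# m))) (sym vol-m)) (trans (solve 3 (λ m i j → κ 2 :* m :* (i :* j) := κ 2 :* i :* (m :* j)) refl (# m) ι (inv (# m))) (trans (cong (# 2 * ι *_) (inv-pos-r 0<m)) (Rq.*-identityʳ _))))))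

        2deg⁺≤m : # 2 * deg⁺ ≤ # m
        2deg⁺≤m = *-cancelˡ (# 2) (0<#suc 1) (≤-trans (*-monoˡ (# 2) (0≤# 2) (*-monoˡ (# 2) (0≤# 2) deg⁺≤)) (≤-trans (≤-by ((# n - # 80 * dd) * # d + # 80 * (dd * (# d - # 1)) + # 72 * dd) (0≤+ (0≤+ (0≤* (≤⇒0≤- n≥) (0≤# d)) (0≤* (0≤# 80) (0≤* 0≤dd (≤⇒0≤- 1≤d')))) (0≤* (0≤# 72) 0≤dd))
          (solve 2 (λ n d → n :* d :- κ 2 :* (κ 2 :* (κ 2 :* (d :* d))) := (n :- κ 80 :* (d :* d)) :* d :+ κ 80 :* (d :* d :* (d :- κ 1)) :+ κ 72 :* (d :* d)) refl (# n) (# d))) (≤-reflexive (sym vol-m))))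

        4μ≤t : ∀ r → # 4 * μ r ≤ t r
        4μ≤t r = ≤-trans (≤-reflexive (solve 3 (λ g r j → κ 4 :* (g :* (r :* j)) := κ 2 :* r :* (κ 2 :* g :* j)) refl deg⁺ (# r) (inv (# m)))) (≤-trans (*-monoˡ (t r) (0≤* (0≤# 2) (0≤# r)) (≤-trans (*-monoʳ (inv (# m)) (0≤inv (0≤# m)) 2deg⁺≤m) (≤-reflexive (inv-pos-r 0<m)))) (≤-reflexive (Rq.*-identityʳ _)))

        20deg⁺≤ : ∀ {r} → n ℕ.≤ r → # 20 * deg⁺ ≤ t r
        20deg⁺≤ {r} p = ≤-trans (*-monoˡ (# 20) (0≤# 20) deg⁺≤) (≤-trans (≤-by ((# n - # 80 * dd) + # n + # 40 * dd) (0≤+ (0≤+ (≤⇒0≤- n≥) (0≤# n)) (0≤* (0≤# 40) 0≤dd)) (solve 2 (λ n e → κ 2 :* n :- κ 20 :* (κ 2 :* e) := (n :- κ 80 :* e) :+ n :+ κ 40 :* e) refl (# n) dd)) (*-monoˡ (# 2) (0≤# 2) (#-mono p)))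

        0≤p' : ∀ r → # 0 ≤ p' r
        0≤p' r = 0≤* (0≤# r) (0≤inv (0≤# m))

        key : ∀ s {E G₀} → Ext E G₀ → Sized (suc s) E → Bound-by E (λ G → ψ (suc s) G E)
        key s {E} e₀ h = go (suc s ℕ.≤? S) (suc s ℕ.≤? n)
          where
          r₀ = suc s
          go : (x : Dec (suc s ℕ.≤ S)) (y : Dec (suc s ℕ.≤ n)) → Bound-by E (λ G → regime (suc s) x y G E)
          go (yes _) _ = subst (λ v → Bound-by E (λ G → v * exc E G)) h (key₀ e₀ (≤-trans (≤-trans (≤-reflexive (sym (Rq.*-identityʳ (# 2)))) (*-monoˡ (# 2) (0≤# 2) (#-mono (s≤s z≤n)))) (≤-reflexive (sym h))))
          go (no p) (yes _) = subst (λ v → Bound-by E (λ G → ψA v E G)) h (SmallState.keyA e₀ (≤-trans (≤-trans (≤-reflexive (#-* 2 5120)) (*-monoˡ (# 2) (0≤# 2) (#-mono (ℕₚ.≤-trans (s≤s S≥) (ℕₚ.≰⇒> p))))) (≤-reflexive (sym h))))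
          go (no _) (no q) = subst (λ v → Bound-by E (λ G → ψB v (μ r₀) (ν r₀) E G)) h (keyB e₀ 1≤deg⁺ (≤-trans (20deg⁺≤ (ℕₚ.<⇒≤ (ℕₚ.≰⇒> q))) (≤-reflexive (sym h))) (μ r₀) (ν r₀)
             (0≤* (≤-trans 0≤1 1≤deg⁺) (0≤p' r₀)) (0≤sq (θ' r₀)) (≤-trans (4μ≤t r₀) (≤-reflexive (sym h))))

        exψ : ∀ {G} (e : Ext ∅ G) j → suc j ℕ.≤ m → Walk.ex m e h∅ j (ψ (m ℕ.∸ j) G) ≤ bnd (m ℕ.∸ j)
        exψ {G} e j j<m = go (m ℕ.∸ j ℕ.≤? S) (m ℕ.∸ j ℕ.≤? n)
          where
          open AtLevel m e h∅ 1≤d n≥ j j<m using (exψ₀; module Middle; module Upper)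
          go : (x : Dec (m ℕ.∸ j ℕ.≤ S)) (y : Dec (m ℕ.∸ j ℕ.≤ n)) → Walk.ex m e h∅ j (regime (m ℕ.∸ j) x y G) ≤ level-bound (m ℕ.∸ j) x
          go (yes _) _ = exψ₀
          go (no _) (yes q) = Middle.exψA q
          go (no _) (no q) = Upper.exψB (ℕₚ.<⇒≤ (ℕₚ.≰⇒> q))

        open Averaged ψ key public using (PS; XG≤PS)

        -- The average in the recursion of `PS` is one step of the walk, so unfolding it moves from
        -- j to j + 1 inserted edges and releases the expected error of the level with r edges left.
        PS-bound : ∀ {G} (e : Ext ∅ G) r j → j ℕ.+ r ≡ m → Walk.ex m e h∅ j (PS r G) ≤ # r + ∑↓ r bnd
        PS-bound {G} e zero j eq = ≤-reflexive (trans (Walk.ex-const m e h∅ j (# 0) (ℕₚ.≤-trans (ℕₚ.m≤m+n j 0) (ℕₚ.≤-reflexive eq))) (sym (Rq.+-identityʳ (# 0))))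
        PS-bound {G} e (suc r) j eq = ≤-trans (≤-reflexive (trans (ex-+ j _ _) (cong₂ _+_ (trans (ex-+ j _ _) (cong (_+ ex j (ψ (suc r) G)) (ex-const j (# 1) (ℕₚ.<⇒≤ j<m)))) (cong (λ k → ex j (avg G k (PS r G))) (sym lv)))))
            (≤-trans (+-mono (+-monoʳ (# 1) (subst (λ k → ex j (ψ k G) ≤ bnd k) lv (exψ e j j<m))) (PS-bound e r (suc j) (trans (sym (ℕₚ.+-suc j r)) eq)))
              (≤-reflexive (trans (solve 3 (λ b r s → κ 1 :+ b :+ (r :+ s) := κ 1 :+ r :+ (b :+ s)) refl (bnd (suc r)) (# r) (∑↓ r bnd)) (cong (_+ ∑↓ (suc r) bnd) (sym (#-suc r))))))
          where
          open Walk m e h∅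
          j<m : suc j ℕ.≤ m
          j<m = ℕₚ.≤-trans (ℕₚ.m≤m+n (suc j) r) (ℕₚ.≤-reflexive (trans (sym (ℕₚ.+-suc j r)) eq))
          lv : m ℕ.∸ j ≡ suc r
          lv = trans (cong (ℕ._∸ j) (sym eq)) (ℕₚ.m+n∸m≡n j (suc r))

        ∑XG≤ : ∑ (𝓗 ∅) (λ G → XG m G ∅) ≤ (# m + ∑↓ m bnd) * N ∅
        ∑XG≤ = ≤-trans (XG≤PS m ∅ h∅) (≤-trans (∑𝓗-mono ∅ (λ G e → PS-bound e m 0 refl)) (≤-reflexive (N-* ∅ (# m + ∑↓ m bnd))))

        0≤ω : # 0 ≤ ω
        0≤ω = 0≤* 0≤dd 0≤ι

        -- At r ≤ S the bound t² μ equals 4 r³ (d + 1) d/m, where d/m = 2/n and d + 1 ≤ 2 d²; thus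
        -- 16 = 4 · 2 · 2.
        low : ℚ
        low = # 16 * (# S * # S * # S) * ω

        0≤low : # 0 ≤ low
        0≤low = 0≤* (0≤* (0≤# 16) (0≤* (0≤* (0≤# S) (0≤# S)) (0≤# S))) 0≤ω

        low≤ : ∀ r → r ℕ.≤ S → t r * (t r * μ r) ≤ low
        low≤ r p = ≤-trans (≤-reflexive (trans (solve 3 (λ d r j → κ 2 :* r :* (κ 2 :* r :* (d :* (d :+ κ 1) :* (r :* j))) := κ 4 :* (r :* r :* r) :* ((d :+ κ 1) :* (d :* j))) refl (# d) (# r) (inv (# m))) (cong (λ y → # 4 * (# r * # r * # r) * ((# d + # 1) * y)) d/m)))
          (≤-trans (*-mono (0≤* (0≤# 4) 0≤r³) (0≤* (0≤# 4) 0≤ω) (*-monoˡ (# 4) (0≤# 4) r³≤) (≤-by (# 2 * ((dd - # 1 + (dd - # d)) * ι)) (0≤* (0≤# 2) (0≤* (0≤+ (≤⇒0≤- 1≤dd) (≤⇒0≤- d≤dd)) 0≤ι)) (solve 2 (λ d i → κ 4 :* (d :* d :* i) :- (d :+ κ 1) :* (κ 2 :* i) := κ 2 :* ((d :* d :- κ 1 :+ (d :* d :- d)) :* i)) refl (# d) ι)))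
            (≤-reflexive (solve 2 (λ s w → κ 4 :* s :* (κ 4 :* w) := κ 16 :* s :* w) refl (# S * # S * # S) ω)))
          where
          0≤r³ : # 0 ≤ # r * # r * # r
          0≤r³ = 0≤* (0≤* (0≤# r) (0≤# r)) (0≤# r)
          r≤ = #-mono p
          r³≤ : # r * # r * # r ≤ # S * # S * # S
          r³≤ = *-mono (0≤sq (# r)) (0≤# S) (*-mono (0≤# r) (0≤# S) r≤ r≤) r≤

        low-sum : ∀ r → r ℕ.≤ S → ∑↓ r bnd ≤ # r * low
        low-sum zero _ = ≤-reflexive (sym (Rq.zeroˡ low))
        low-sum (suc r) p = ≤-trans (+-mono (go (suc r ℕ.≤? S)) (low-sum r (ℕₚ.<⇒≤ p))) (≤-reflexive (trans (solve 2 (λ r l → l :+ r :* l := (κ 1 :+ r) :* l) refl (# r) low) (cong (_* low) (sym (#-suc r)))))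
          where
          go : ∀ x → level-bound (suc r) x ≤ low
          go (yes q) = low≤ (suc r) q
          go (no q) = ⊥-elim (q p)

        0<S : # 0 < # S
        0<S = <-≤-trans (0<#suc 5118) (#-mono S≥)

        0≤k₄ : # 0 ≤ k₄
        0≤k₄ = 0≤+ (0≤+ (0≤# 217728) (0≤* (0≤# 4) 0≤k₅)) (0≤# 194688)

        -- 1/r² ≤ 1/(r - 1) - 1/r telescopes.
        high-sum : ∀ k → ∑↓ (k ℕ.+ S) bnd ≤ # S * low + k₂ * (inv (# S) - inv (# (k ℕ.+ S))) + k₄ * (ω * harmonic (k ℕ.+ S))
        high-sum zero = ≤-trans (low-sum S ℕₚ.≤-refl) (≤-by (k₄ * (ω * harmonic S)) (0≤* 0≤k₄ (0≤* 0≤ω (harmonic-mono {0} {S} z≤n))) (solve 4 (λ a c i h → a :+ c :* (i :- i) :+ h :- a := h) refl (# S * low) k₂ (inv (# S)) (k₄ * (ω * harmonic S))))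
        high-sum (suc k) = ≤-trans (+-mono (go (suc (k ℕ.+ S) ℕ.≤? S)) (high-sum k)) (≤-reflexive (solve 8 (λ a c i y x e w h → c :* (y :- x) :+ e :* (w :* x) :+ (a :+ c :* (i :- y) :+ e :* (w :* h)) := a :+ c :* (i :- x) :+ e :* (w :* (x :+ h))) refl (# S * low) k₂ (inv (# S)) y x k₄ ω (harmonic (k ℕ.+ S))))
          where
          r₀ = k ℕ.+ S
          x = inv (# (suc r₀))
          y = inv (# r₀)
          τ = inv (t (suc r₀))
          0<r₀ : # 0 < # r₀
          0<r₀ = <-≤-trans 0<S (#-mono (ℕₚ.m≤n+m S k))
          0≤x : # 0 ≤ x
          0≤x = 0≤inv (0≤# (suc r₀))
          0≤τ : # 0 ≤ τ
          0≤τ = 0≤inv (0≤* (0≤# 2) (0≤# (suc r₀)))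
          x≡ : x ≡ # 2 * τ
          x≡ = trans (sym (Rq.*-identityʳ x)) (trans (cong (x *_) (sym (inv-pos-r (0<* (0<#suc 1) (0<#suc r₀))))) (trans (solve 3 (λ x r u → x :* (κ 2 :* r :* u) := r :* x :* (κ 2 :* u)) refl x (# (suc r₀)) τ) (trans (cong (_* (# 2 * τ)) (inv-pos-r (0<#suc r₀))) (Rq.*-identityˡ _))))
          τ≤x : τ ≤ x
          τ≤x = ≤-trans (≤-by τ 0≤τ (solve 1 (λ u → κ 2 :* u :- u := u) refl τ)) (≤-reflexive (sym x≡))
          x≤y : x ≤ y
          x≤y = inv-antimono 0<r₀ (#-mono (ℕₚ.n≤1+n r₀))
          y-x : y - x ≡ x * y
          y-x = trans (trans (solve 2 (λ y x → y :- x := κ 1 :* y :- x :* κ 1) refl y x) (trans (cong₂ (λ u v → u * y - x * v) (sym (trans (cong (_* x) (sym (#-suc r₀))) (inv-pos-r (0<#suc r₀)))) (sym (inv-pos-r 0<r₀))) (solve 3 (λ r x y → (κ 1 :+ r) :* x :* y :- x :* (r :* y) := x :* y) refl (# r₀) x y))) refl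
          go : ∀ z → level-bound (suc r₀) z ≤ k₂ * (y - x) + k₄ * (ω * x)
          go (yes q) = ⊥-elim (ℕₚ.<⇒≱ (s≤s (ℕₚ.m≤n+m S k)) q)
          go (no _) = +-mono (*-monoˡ k₂ 0≤k₂ (≤-trans (*-mono 0≤τ 0≤x τ≤x τ≤x) (≤-trans (*-monoˡ x 0≤x x≤y) (≤-reflexive (sym y-x))))) (*-monoˡ k₄ 0≤k₄ (*-monoˡ ω 0≤ω τ≤x))

        total : ∑↓ m bnd ≤ # S * low + k₂ * inv (# S) + k₄ * (ω * harmonic m)
        total = go (m ℕ.≤? S)
          where
          0≤tail = 0≤* 0≤k₄ (0≤* 0≤ω (harmonic-mono {0} {m} z≤n))
          go : Dec (m ℕ.≤ S) → ∑↓ m bnd ≤ # S * low + k₂ * inv (# S) + k₄ * (ω * harmonic m)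
          go (yes p) = ≤-trans (low-sum m p) (≤-trans (*-monoʳ low 0≤low (#-mono p)) (≤-by (k₂ * inv (# S) + k₄ * (ω * harmonic m)) (0≤+ (0≤* 0≤k₂ (0≤inv (0≤# S))) 0≤tail) (solve 3 (λ a b c → a :+ b :+ c :- a := b :+ c) refl (# S * low) (k₂ * inv (# S)) (k₄ * (ω * harmonic m)))))
          go (no p) = subst (λ k → ∑↓ k bnd ≤ # S * low + k₂ * inv (# S) + k₄ * (ω * harmonic k)) (ℕₚ.m∸n+n≡m (ℕₚ.<⇒≤ (ℕₚ.≰⇒> p))) (≤-trans (high-sum k) (+-monoˡ _ (+-monoʳ _ (*-monoˡ k₂ 0≤k₂ (≤-by (inv (# (k ℕ.+ S))) (0≤inv (0≤# (k ℕ.+ S))) (solve 2 (λ a b → a :- (a :- b) := b) refl (inv (# S)) (inv (# (k ℕ.+ S)))))))))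
            where k = m ℕ.∸ S

    -- From the averaged bound to the number of bad graphs

    module Counting (m : ℕ) where

      module _ (h∅ : Sized m ∅) where

        Lnd≡𝓗 : Lnd n d ≡ 𝓗 ∅
        Lnd≡𝓗 = filterᵇ-cong (λ G → sym (trans (cong (isRegular {n} d G ∧_) (⊆⇒subᵇ ∅ G (∅⊆ G))) (Bₚ.∧-identityʳ _))) (allVecs (NP n))

        #Lnd : # (length (Lnd n d)) ≡ N ∅
        #Lnd = trans (cong (λ l → # (length l)) Lnd≡𝓗) (#-length (𝓗 ∅))

        R : Graph → ℚ
        R G = N ∅ * reach n d G (NP n) ∅

        ∑R≤ : ∑ (𝓗 ∅) R ≤ N ∅
        ∑R≤ = ≤-trans (≤-reflexive (∑-*ˡ (N ∅) (𝓗 ∅) _)) (≤-trans (*-monoˡ (N ∅) (0≤N ∅) (≤-trans (≤-reflexive (∑-𝓗 ∅ _)) (≤-trans (∑-mono (allVecs (NP n)) (λ G → drop (inᵇ ∅ G) (0≤reach G (NP n) ∅))) (∑reach≤1 (NP n) ∅)))) (≤-reflexive (Rq.*-identityʳ _)))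
          where
          drop : ∀ b {x} → # 0 ≤ x → 𝟙 b * x ≤ x
          drop true p = ≤-reflexive (Rq.*-identityˡ _)
          drop false p = ≤-trans (≤-reflexive (Rq.zeroˡ _)) p

        -- This ensures that the fuel in `probA` covers all m steps.
        m≤NP : ∀ {G} → Ext ∅ G → m ℕ.≤ NP n
        m≤NP {G} e = #-cancel-≤ (≤-trans (≤-reflexive (sym (∑Xq-sized h∅ e))) (≤-trans (∑-mono Ps (λ q → le (Xq-cases e q))) (≤-reflexive (trans (∑-const Ps (# 1)) (trans (Rq.*-identityʳ _) (cong # (Lₚ.length-tabulate {n = NP n} id)))))))
          where
          le : ∀ {x} {Z : Set} → x ≡ # 0 ⊎ (x ≡ # 1 × Z) → x ≤ # 1
          le (inj₁ z) = ≤-trans (≤-reflexive z) 0≤1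
          le (inj₂ (z , _)) = ≤-reflexive z

        excess-G : Graph → ℚ
        excess-G G = R G + XG m G ∅ - # (suc m)

        base : ∀ {G} → Ext ∅ G → # (suc m) ≤ R G + XG m G ∅
        base {G} e = ≤-trans (≤-reflexive (sym (Rq.+-identityʳ _))) (≤-trans (path-am-gm m e h∅ (NP n) (m≤NP e) (# 1) [] 0<1 [] (≤-reflexive (sym (Rq.*-identityˡ (# 1))))) (≤-reflexive (solve 2 (λ r x → κ 1 :* r :+ x :+ κ 0 := r :+ x) refl (R G) (XG m G ∅))))

        -- The path inequality is started with the list consisting of `c` and the multiplier
        -- `inv c`, whose product is 1; `base` starts it with an empty list. The parameter is
        -- adjusted to R in `deviation`.
        family : ∀ {G} → Ext ∅ G → ∀ c → # 0 < c → # (suc m) + # 1 ≤ inv c * R G + XG m G ∅ + c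
        family {G} e c p = ≤-trans (path-am-gm m e h∅ (NP n) (m≤NP e) (inv c) (c ∷ []) (0<inv p) (p ∷ []) (≤-reflexive (sym (trans (cong (inv c *_) (Rq.*-identityʳ c)) (trans (Rq.*-comm _ _) (inv-pos-r p)))))) (≤-reflexive (cong (inv c * R G + XG m G ∅ +_) (Rq.+-identityʳ c)))

        module _ (e : ℕ) (Δ : ℚ) (∑X≤ : ∑ (𝓗 ∅) (λ G → XG m G ∅) ≤ (# m + Δ) * N ∅) (small : # 8 * (# (suc e) * # (suc e) * # (suc e)) * Δ ≤ # 1) where

          -- `h` is half of the tolerance 1/(e + 1): `deviation` turns a distance of at least 2 h
          -- between R and 1 into an excess of at least h²/2.
          E₀ h : ℚ
          E₀ = # (suc e)
          h = inv (# 2 * E₀)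

          1≤E₀ : # 1 ≤ E₀
          1≤E₀ = #-mono (s≤s z≤n)

          0<2E : # 0 < # 2 * E₀
          0<2E = 0<* (0<#suc 1) (0<#suc e)

          hE : # 2 * E₀ * h ≡ # 1
          hE = inv-pos-r 0<2E

          0≤h : # 0 ≤ h
          0≤h = 0≤inv (<⇒≤ 0<2E)

          2h≡ : # 2 * h ≡ inv E₀
          2h≡ = inv-unique (trans (solve 2 (λ e h → e :* (κ 2 :* h) := κ 2 :* e :* h) refl E₀ h) hE)

          2h≤1 : # 2 * h ≤ # 1
          2h≤1 = ≤-trans (≤-by ((E₀ - # 1) * (# 2 * h)) (0≤* (≤⇒0≤- 1≤E₀) (0≤* (0≤# 2) 0≤h)) (solve 2 (λ e h → κ 2 :* e :* h :- κ 2 :* h := (e :- κ 1) :* (κ 2 :* h)) refl E₀ h)) (≤-reflexive hE)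

          ε : ℚ
          ε = (ℤ.+ 1) ℚ./ suc e

          ε≡ : ε ≡ # 2 * h
          ε≡ = trans (frac-# 1 e) (trans (Rq.*-identityˡ _) (sym 2h≡))

          test : Graph → Bool
          test G = ℚ.∣ (probA n d G ℚ.* ((ℤ.+ length (Lnd n d)) ℚ./ 1)) ℚ.- 1ℚ ∣ ℚ.≤ᵇ ε

          R-1≡ : ∀ G → (probA n d G ℚ.* ((ℤ.+ length (Lnd n d)) ℚ./ 1)) ℚ.- 1ℚ ≡ R G - # 1
          R-1≡ G = trans (sym (+≡ _ _)) (cong₂ _+_ (trans (sym (*≡ _ _)) (trans (cong (reach n d G (NP n) ∅ *_) (trans (/1-# (length (Lnd n d))) #Lnd)) (Rq.*-comm _ _))) (trans (sym (-≡ _)) (cong -_ (sym #1))))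

          far : ∀ G → test G ≡ false → # 2 * h ≤ ∣ R G - # 1 ∣
          far G z = by (≤-total (∣ R G - # 1 ∣) (# 2 * h))
            where
            by : ∣ R G - # 1 ∣ ≤ # 2 * h ⊎ # 2 * h ≤ ∣ R G - # 1 ∣ → # 2 * h ≤ ∣ R G - # 1 ∣
            by (inj₂ p) = p
            by (inj₁ p) = ⊥-elim (subst T z (ℚₚ.≤⇒≤ᵇ (subst₂ _≤_ (cong ℚ.∣_∣ (sym (R-1≡ G))) (sym ε≡) p)))

          pointwise : ∀ G → Ext ∅ G → 𝟙 (not (test G)) * (h * h) ≤ # 2 * excess-G G
          pointwise G x = by (test G) refl
            where
            by : ∀ b → test G ≡ b → 𝟙 (not b) * (h * h) ≤ # 2 * excess-G G
            by true _ = ≤-trans (≤-reflexive (Rq.zeroˡ _)) (0≤* (0≤# 2) (≤⇒0≤- (base x)))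
            by false z = ≤-trans (≤-reflexive (Rq.*-identityˡ _)) (deviation (base x) (family x) 0≤h 2h≤1 (far G z))

          b : ℕ
          b = badCount n d ε

          #b : # b ≡ ∑ (𝓗 ∅) (λ G → 𝟙 (not (test G)))
          #b = trans (#-length (filterᵇ (λ G → not (test G)) (Lnd n d))) (trans (∑-filter _ (Lnd n d) _) (trans (∑-cong (Lnd n d) (λ G → Rq.*-identityʳ _)) (cong (λ l → ∑ l (λ G → 𝟙 (not (test G)))) Lnd≡𝓗)))

          ∑excess : ∑ (𝓗 ∅) excess-G ≤ Δ * N ∅
          ∑excess = ≤-trans (≤-reflexive (trans (∑-- (𝓗 ∅) _ _) (cong₂ _-_ (∑-+ (𝓗 ∅) _ _) (N-* ∅ (# (suc m)))))) (≤-trans (+-monoˡ _ (+-mono ∑R≤ ∑X≤)) (≤-reflexive (trans (cong (λ k → N ∅ + (# m + Δ) * N ∅ - k * N ∅) (#-suc m)) (solve 3 (λ n m e → n :+ (m :+ e) :* n :- (κ 1 :+ m) :* n := e :* n) refl (N ∅) (# m) Δ))))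

          bhh : # b * (h * h) ≤ # 2 * (Δ * N ∅)
          bhh = ≤-trans (≤-reflexive (trans (cong (_* (h * h)) #b) (sym (∑-*ʳ (h * h) (𝓗 ∅) _)))) (≤-trans (∑𝓗-mono ∅ pointwise) (≤-trans (≤-reflexive (∑-*ˡ (# 2) (𝓗 ∅) _)) (*-monoˡ (# 2) (0≤# 2) ∑excess)))

          -- Markov's inequality for the nonnegative excess, whose average is at most Δ: the number
          -- b of bad graphs satisfies b h² ≤ 2 Δ N. As h = 1/(2 E₀), this is b E₀ ≤ 8 E₀³ Δ N, the
          -- origin of the 8 in `small`.
          few-bad : badCount n d ((ℤ.+ 1) ℚ./ suc e) ℕ.* suc e ℕ.≤ length (Lnd n d)
          few-bad = #-cancel-≤ (≤-trans (≤-reflexive (trans (#-* b (suc e)) scale)) (≤-trans (*-monoˡ (# 4 * (E₀ * E₀ * E₀)) (0≤* (0≤# 4) (0≤* (0≤sq E₀) (0≤# (suc e)))) bhh) (≤-trans (≤-reflexive (solve 3 (λ c x n → κ 4 :* c :* (κ 2 :* (x :* n)) := κ 8 :* c :* x :* n) refl (E₀ * E₀ * E₀) Δ (N ∅))) (≤-trans (*-monoʳ (N ∅) (0≤N ∅) small) (≤-reflexive (trans (Rq.*-identityˡ _) (sym #Lnd)))))))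
            where
            scale : # b * E₀ ≡ # 4 * (E₀ * E₀ * E₀) * (# b * (h * h))
            scale = sym (trans (solve 3 (λ e b h → κ 4 :* (e :* e :* e) :* (b :* (h :* h)) := (κ 2 :* e :* h) :* (κ 2 :* e :* h) :* (b :* e)) refl E₀ (# b) h) (trans (cong (λ z → z * z * (# b * E₀)) hE) (solve 1 (λ x → κ 1 :* κ 1 :* x := x) refl (# b * E₀))))

  -- Choice of the thresholds

  nat-+ : ∀ {x y} → IsNat x → IsNat y → IsNat (x + y)
  nat-+ (a , u) (b , v) = a ℕ.+ b , trans (cong₂ _+_ u v) (sym (#-+ a b))

  nat-^ : ∀ {x} k → IsNat x → IsNat (x ^ k)
  nat-^ zero p = 1 , refl
  nat-^ (suc k) p = nat-* p (nat-^ k p)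

  nat-# : ∀ k → IsNat (# k)
  nat-# k = k , refl

  -- The thresholds `S` and `M` are natural numbers built from these constants. The witnesses follow
  -- the structure of the constants, and `Eventually` receives them as variables, so its proofs
  -- treat the large numerals abstractly.
  nat-k₂ : IsNat k₂
  nat-k₂ = nat-* (nat-# 24) (nat-+ (nat-# 3024) (nat-* (nat-# 32) (nat-+ (nat-^ 7 (nat-# 16)) (nat-* (nat-# 256) (nat-^ 7 (nat-# 2))))))

  nat-k₄ : IsNat k₄
  nat-k₄ = nat-+ (nat-+ (nat-# 217728) (nat-* (nat-# 4) (nat-+ (nat-^ 8 (nat-# 320)) (nat-* (nat-* (nat-# 256) (nat-^ 4 (nat-# 40))) (nat-^ 4 (nat-# 2)))))) (nat-# 194688)

  module Eventually (K₂ K₄ : ℕ) (k₂≡ : k₂ ≡ # K₂) (k₄≡ : k₄ ≡ # K₄) (k C e : ℕ) where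

    E³ : ℕ
    E³ = suc e ℕ.* suc e ℕ.* suc e

    e₀ : ℚ
    e₀ = # (suc e) * # (suc e) * # (suc e)

    #E³ : # E³ ≡ e₀
    #E³ = trans (#-* (suc e ℕ.* suc e) (suc e)) (cong (_* # (suc e)) (#-* (suc e) (suc e)))

    opaque
      -- Levels above S have t ≥ 2 · 5120 = 10240, as `SmallState` requires. The other summand
      -- confines the contribution k₂/S to half of the admissible error.
      S : ℕ
      S = 5119 ℕ.+ 16 ℕ.* E³ ℕ.* K₂

      S≥ : 5119 ℕ.≤ S
      S≥ = ℕₚ.m≤m+n 5119 (16 ℕ.* E³ ℕ.* K₂)

      S-large : # 16 * e₀ * k₂ ≤ # S
      S-large = ≤-trans (≤-reflexive (trans (cong₂ (λ a b → # 16 * a * b) (sym #E³) k₂≡) (sym (trans (#-* (16 ℕ.* E³) K₂) (cong (_* # K₂) (#-* 16 E³)))))) (#-mono (ℕₚ.m≤n+m (16 ℕ.* E³ ℕ.* K₂) 5119))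

    S-pos : 1 ℕ.≤ S
    S-pos = ℕₚ.≤-trans (s≤s z≤n) S≥

    s : ℚ
    s = # S

    opaque
      -- With M x d² ≤ n, the contributions 16 S⁴ d²/n of the last steps and k₄ d²/n times the
      -- harmonic sum take at most the other half of the admissible error.
      M : ℕ
      M = 16 ℕ.* E³ ℕ.* (16 ℕ.* (S ℕ.* S ℕ.* S ℕ.* S) ℕ.+ K₄)

      80≤M : 80 ℕ.≤ M
      80≤M = ℕₚ.≤-trans (ℕₚ.m≤m+n 80 176) (ℕₚ.*-mono-≤ {16} {16 ℕ.* E³} {16} (ℕₚ.m≤m*n 16 E³) (ℕₚ.≤-trans (ℕₚ.m≤m*n 16 (S ℕ.* S ℕ.* S ℕ.* S) {{ℕ.>-nonZero S⁴}}) (ℕₚ.m≤m+n _ K₄)))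
        where
        S⁴ : 1 ℕ.≤ S ℕ.* S ℕ.* S ℕ.* S
        S⁴ = ℕₚ.*-mono-≤ {1} {S ℕ.* S ℕ.* S} {1} {S} (ℕₚ.*-mono-≤ {1} {S ℕ.* S} {1} {S} (ℕₚ.*-mono-≤ {1} {S} {1} {S} S-pos S-pos) S-pos) S-pos

      #M : # M ≡ # 16 * e₀ * (# 16 * (s * s * s * s) + k₄)
      #M = trans (#-* (16 ℕ.* E³) (16 ℕ.* (S ℕ.* S ℕ.* S ℕ.* S) ℕ.+ K₄)) (cong₂ _*_ (trans (#-* 16 E³) (cong (# 16 *_) #E³))
        (trans (#-+ (16 ℕ.* (S ℕ.* S ℕ.* S ℕ.* S)) K₄) (cong₂ _+_ (trans (#-* 16 (S ℕ.* S ℕ.* S ℕ.* S)) (cong (# 16 *_) (trans (#-* (S ℕ.* S ℕ.* S) S) (cong (_* s) (trans (#-* (S ℕ.* S) S) (cong (_* s) (#-* S S))))))) (sym k₄≡))))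

    N₀ : ℕ
    N₀ = suc (2 ℕ.* (Growth.Bᵏ k C M 0 0 0 ℕ.* Growth.Bᵏ k C M 0 0 0))

    Goal : ℕ → ℕ → Set
    Goal n d = badCount n d ((ℤ.+ 1) ℚ./ suc e) ℕ.* suc e ℕ.≤ length (Lnd n d)

    -- For d = 0 the procedure takes no step, so the counting argument applies with m = 0 and Δ = 0.
    empty : ∀ n → Goal n 0
    empty n = Regular-graphs.Counting.few-bad n 0 0 h∅ e (# 0) (≤-reflexive (trans (∑-0 (Regular-graphs.𝓗 n 0 ∅)) (solve 1 (λ n → κ 0 := (κ 0 :+ κ 0) :* n) refl (Regular-graphs.N n 0 ∅)))) (≤-trans (≤-reflexive (Rq.zeroʳ _)) 0≤1)
      where
      ∅ = Regular-graphs.∅ n 0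
      h∅ : Regular-graphs.Sized n 0 0 ∅
      h∅ = trans (Regular-graphs.vol∅ n 0) (trans (Rq.zeroʳ (# n)) (sym (Rq.zeroʳ (# 2))))

    module Positive (n d m l : ℕ) (1≤d : 1 ℕ.≤ d) (2m : n ℕ.* d ≡ m ℕ.* 2) (n≤ : n ℕ.≤ 2 ℕ.^ l) (grows : M ℕ.* suc (2 ℕ.* l) ℕ.* (d ℕ.* d) ℕ.≤ n) where
      open Regular-graphs n d
      open Assembly m S

      x : ℚ
      x = # (suc (2 ℕ.* l))

      1≤x : # 1 ≤ x
      1≤x = #-mono (s≤s z≤n)

      h∅ : Sized m ∅
      h∅ = trans vol∅ (trans (sym (#-* n d)) (trans (cong # 2m) (trans (#-* m 2) (Rq.*-comm (# m) (# 2)))))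

      80d²≤ : 80 ℕ.* (d ℕ.* d) ℕ.≤ n
      80d²≤ = ℕₚ.≤-trans (ℕₚ.*-monoˡ-≤ (d ℕ.* d) (ℕₚ.≤-trans 80≤M (ℕₚ.m≤m*n M (suc (2 ℕ.* l))))) grows

      n≥ : # 80 * dd ≤ # n
      n≥ = ≤-trans (≤-reflexive (sym (trans (#-* 80 (d ℕ.* d)) (cong (# 80 *_) (#-* d d))))) (#-mono 80d²≤)

      d≤n : d ℕ.≤ n
      d≤n = ℕₚ.≤-trans (ℕₚ.≤-trans (ℕₚ.m≤m*n d d {{ℕ.>-nonZero 1≤d}}) (ℕₚ.m≤n*m (d ℕ.* d) 80)) 80d²≤

      -- Bounding m crudely by n² only doubles the logarithm, which is why the factor is 2 l + 1.
      m≤ : m ℕ.≤ 2 ℕ.^ (2 ℕ.* l)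
      m≤ = ℕₚ.≤-trans (ℕₚ.m≤m*n m 2) (ℕₚ.≤-trans (ℕₚ.≤-reflexive (sym 2m)) (ℕₚ.≤-trans (ℕₚ.*-mono-≤ n≤ (ℕₚ.≤-trans d≤n n≤)) (ℕₚ.≤-reflexive (trans (sym (ℕₚ.^-distribˡ-+-* 2 l l)) (cong (λ y → 2 ℕ.^ (l ℕ.+ y)) (sym (ℕₚ.+-identityʳ l)))))))

      Hm≤x : harmonic m ≤ x
      Hm≤x = ≤-trans (harmonic-mono m≤) (harmonic-2^ (2 ℕ.* l))

      Δ : ℚ
      Δ = s * (# 16 * (s * s * s) * ω) + k₂ * inv s + k₄ * (ω * harmonic m)

      ∑X≤ : ∑ (𝓗 ∅) (λ G → XG m G ∅) ≤ (# m + Δ) * N ∅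
      ∑X≤ = ≤-trans (∑XG≤ h∅ 1≤d n≥ S≥) (*-monoʳ (N ∅) (0≤N ∅) (+-monoʳ (# m) (total h∅ 1≤d n≥ S≥)))

      0≤e₀ : # 0 ≤ e₀
      0≤e₀ = 0≤* (0≤sq (# (suc e))) (0≤# (suc e))

      0≤ω' : # 0 ≤ ω
      0≤ω' = 0≤* (0≤sq (# d)) (0≤inv (0≤# n))

      0≤k₄' : # 0 ≤ k₄
      0≤k₄' = ≤-trans (0≤# K₄) (≤-reflexive (sym k₄≡))

      part₁ : # 16 * e₀ * (k₂ * inv s) ≤ # 1
      part₁ = ≤-trans (≤-reflexive (sym (Rq.*-assoc _ _ _))) (≤-trans (*-monoʳ (inv s) (0≤inv (0≤# S)) S-large) (≤-reflexive (inv-pos-r (<-≤-trans 0<1 (#-mono S-pos)))))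

      Mxω : # M * x * ω ≤ # 1
      Mxω = ≤-trans (≤-reflexive (sym (Rq.*-assoc (# M * x) (# d * # d) (inv (# n))))) (≤-trans (*-monoʳ (inv (# n)) (0≤inv (0≤# n)) (≤-trans (≤-reflexive (sym (trans (#-* (M ℕ.* suc (2 ℕ.* l)) (d ℕ.* d)) (cong₂ _*_ (#-* M (suc (2 ℕ.* l))) (#-* d d))))) (#-mono grows)))
        (≤-reflexive (inv-pos-r (<-≤-trans 0<1 (#-mono (ℕₚ.≤-trans 1≤d d≤n))))))

      part₂ : # 16 * e₀ * (s * (# 16 * (s * s * s) * ω) + k₄ * (ω * harmonic m)) ≤ # 1
      part₂ = ≤-trans (≤-by (# 16 * e₀ * (# 16 * (s * s * s * s) * ω * (x - # 1) + k₄ * (ω * (x - harmonic m)))) (0≤* (0≤* (0≤# 16) 0≤e₀) (0≤+ (0≤* (0≤* (0≤* (0≤# 16) (0≤* (0≤* (0≤* (0≤# S) (0≤# S)) (0≤# S)) (0≤# S))) 0≤ω') (≤⇒0≤- 1≤x)) (0≤* 0≤k₄' (0≤* 0≤ω' (≤⇒0≤- Hm≤x)))))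
          (solve 6 (λ e s c w x h → κ 16 :* e :* (κ 16 :* (s :* s :* s :* s) :+ c) :* x :* w :- κ 16 :* e :* (s :* (κ 16 :* (s :* s :* s) :* w) :+ c :* (w :* h)) := κ 16 :* e :* (κ 16 :* (s :* s :* s :* s) :* w :* (x :- κ 1) :+ c :* (w :* (x :- h)))) refl e₀ s k₄ ω x (harmonic m)))
        (≤-trans (≤-reflexive (cong (λ y → y * x * ω) (sym #M))) Mxω)

      small : # 8 * e₀ * Δ ≤ # 1
      small = *-cancelˡ (# 2) (0<#suc 1) (≤-trans (≤-reflexive (solve 4 (λ e a b c → κ 2 :* (κ 8 :* e :* (a :+ b :+ c)) := κ 16 :* e :* (a :+ c) :+ κ 16 :* e :* b) refl e₀ (s * (# 16 * (s * s * s) * ω)) (k₂ * inv s) (k₄ * (ω * harmonic m)))) (≤-trans (+-mono part₂ part₁) (≤-reflexive (solve 0 (κ 1 :+ κ 1 := κ 2 :* κ 1) refl))))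

      goal : Goal n d
      goal = Counting.few-bad m h∅ e Δ ∑X≤ small

    eventually : ∀ n d → N₀ ℕ.≤ n → (n ℕ.* d) ℕ.% 2 ≡ 0 → d ℕ.^ (2 ℕ.* suc k) ℕ.* n ℕ.^ 2 ℕ.≤ C ℕ.^ (2 ℕ.* suc k) ℕ.* n ℕ.^ suc k → Goal n d
    eventually n zero _ _ _ = empty n
    eventually zero (suc d) () _ _
    eventually (suc n) (suc d) n≥ even hyp = go (binary-size n)
      where
      m = (suc n ℕ.* suc d) ℕ./ 2
      go : (Σ ℕ λ l → suc n ℕ.≤ 2 ℕ.^ l × 2 ℕ.^ l ℕ.≤ 2 ℕ.* suc n) → Goal (suc n) (suc d)
      go (l , n≤ , ≤2n) = Positive.goal (suc n) (suc d) m l (s≤s z≤n) (trans (m≡m%n+[m/n]*n (suc n ℕ.* suc d) 2) (cong (ℕ._+ m ℕ.* 2) even)) n≤ (Growth.growth k C M (suc n) (suc d) l n≥ ≤2n hyp)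

  theorem : ∀ k C e → Σ ℕ λ N → ∀ n d → N ℕ.≤ n → (n ℕ.* d) ℕ.% 2 ≡ 0 → d ℕ.^ (2 ℕ.* suc k) ℕ.* n ℕ.^ 2 ℕ.≤ C ℕ.^ (2 ℕ.* suc k) ℕ.* n ℕ.^ suc k →
    badCount n d ((ℤ.+ 1) ℚ./ suc e) ℕ.* suc e ℕ.≤ length (Lnd n d)
  theorem k C e = go nat-k₂ nat-k₄
    where
    go : IsNat k₂ → IsNat k₄ → _
    go (K₂ , p) (K₄ , q) = Eventually.N₀ K₂ K₄ p q k C e , Eventually.eventually K₂ K₄ p q k C e

open import Data.Nat using (ℕ; suc; _+_; _*_; _^_; _≤_; _%_)
open import Data.Integer using (+_)
open import Data.Rational using (_/_)
open import Data.List using (length)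
open import Relation.Binary.PropositionalEquality using (_≡_)
open import Data.Product using (Σ; _×_)

theorem2 : (k C e : ℕ) →
    Σ ℕ (λ N → (n d : ℕ) → N ≤ n → (n * d) % 2 ≡ 0 →
    d ^ (2 * suc k) * n ^ 2 ≤ C ^ (2 * suc k) * n ^ suc k →
    badCount n d ((+ 1) / suc e) * suc e ≤ length (Lnd n d))
theorem2 = Development.theorem
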